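{- There is an absolute constant $c>0$ such that for every integer $n\ge 2$, every skew-corner-free subset $A\subseteq [n]\times[n]$ satisfies \[ |A|\le \exp\left(-c\,\log^{1/12} n\right)\cdot n^2 . \]
   Context: $[n]=\{1,\dots,n\}$. A skew corner in a set $A\subseteq[n]\times[n]$ is a triple of points $(x,y),(x,y+h),(x+h,y')$ all lying in $A$, with $x,y,y',h$ integers; it is nontrivial if $h\neq 0$. A set is skew-corner-free if it contains no nontrivial skew corner. (The paper writes the bound as $\exp\{ -\Omega(\log^{1/12} n)\}\cdot n^2$, where $\Omega(\cdot)$ hides an absolute constant.) -}

module Defs where

open import Data.Nat using (ℕ)
open import Data.Integer using (ℤ; +_; _+_; _≤_; 1ℤ)
open import Data.Product using (_×_; _,_; ∃-syntax)
open import Data.List using (List)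
open import Data.List.Relation.Unary.All using (All)
open import Data.List.Relation.Unary.Unique.Propositional using (Unique)
open import Data.List.Membership.Propositional using (_∈_)
open import Relation.Binary.PropositionalEquality using (_≢_)
open import Relation.Nullary using (¬_)

InGrid : ℕ → ℤ × ℤ → Set
InGrid n (x , y) = (1ℤ ≤ x × x ≤ + n) × (1ℤ ≤ y × y ≤ + n)

-- A finite subset A ⊆ [n] × [n], represented as a duplicate-free list of
-- points (so its cardinality |A| is the length of the list).
record GridSet (n : ℕ) : Set where
  constructor gridSet
  field
    elems  : List (ℤ × ℤ)
    unique : Unique elems
    inGrid : All (InGrid n) elems
open GridSet public

HasSkewCorner : List (ℤ × ℤ) → Set
HasSkewCorner A =
  ∃[ x ] ∃[ y ] ∃[ y' ] ∃[ h ]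
    (h ≢ + 0 × (x , y) ∈ A × (x , y + h) ∈ A × (x + h , y') ∈ A)

SkewCornerFree : List (ℤ × ℤ) → Set
SkewCornerFree A = ¬ HasSkewCorner A

{-# OPTIONS --safe #-}
module Submission where

-- A density increment argument in the style of Kelley and Meka, carried out over ℚ and ℤ only.
-- If A is skew-corner-free and Y x denotes its column over x, then (Y x - Y x) meets the
-- difference of x with the set of nonempty columns in 0 alone. Hence the weighted
-- autocorrelation Φ of the columns, which has mean 1, is far from uniform: one of its high
-- moments exceeds 1, and by positivity of the odd moments of a Gram kernel Φ is at least 17/16
-- on most differences of a dense set. Sampling (Croot–Sisask) and a Riesz product over the large
-- spectrum smooth Φ along a multidimensional progression, which yields translates of a
-- smaller progression on which the columns, and hence A, have density larger by a constant
-- factor. After O(k) increments the density would exceed 1. Progressions are boxes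
-- of integer combinations of finitely many generators; dimensions drop by a polynomial in k
-- in each round and side lengths by a power of 2 linear in k, so log n = O(k^10) suffices.

import Data.Integer.Base as ℤ
import Data.Integer.Properties as ℤ
import Data.Integer.Tactic.RingSolver as ℤ
import Data.Nat.Base as ℕ
import Data.Nat.Coprimality as ℕ
import Data.Nat.Divisibility as ℕ
import Data.Nat.Properties as ℕ
import Data.Nat.Tactic.RingSolver as ℕ
import Data.Rational.Base as ℚ
import Data.Rational.Properties as ℚ

-- The obstacle is that everything must be finite and local. The integers have no finite dual to
-- average over, and boxes are not groups, so sums do not survive a shift. The dual is replaced by
-- the characters `x ↦ ω ^ (j x)`, `j < J`, of the rational point `ω = (3 + 4 i) / 5`: they are
-- nearly orthogonal on any bounded range once `J` is large, and `J` enters no later bound, so its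
-- size is free. Shifts are controlled by comparing a box with a slightly longer one, at a scale
-- where the longer one has hardly more mass. Corners are seen only by an asymmetric kernel, with
-- the columns on one side and the columns moved back by their own abscissas on the other;
-- Cauchy-Schwarz passes to the two symmetric kernels, where the offsets cancel. The denser
-- translates are found column by column, at unrelated heights. Nothing is lost by that: a skew
-- corner has two points in one column and a third at an arbitrary height in another, so sliding
-- every column by its own amount keeps the set skew-corner-free. Only the abscissas need a common
-- progression.

module Rationals where

  open import Data.Bool.Base using (Bool; true; false; T; _∧_; not; if_then_else_) public
  open import Data.Empty using (⊥; ⊥-elim) public
  open import Data.Unit.Base using (⊤; tt) public
  open import Data.Nat.Base using (ℕ; zero; suc) public
  open import Data.Integer.Base using (ℤ; +_; -[1+_]) public
  open import Data.Rational.Base public using (ℚ; _+_; _*_; _-_; -_; _≤_; _<_; 0ℚ; 1ℚ; ½; _/_; 1/_)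
  open import Data.Rational.Properties public using (≤-refl; ≤-trans; ≤-reflexive; <⇒≤; ≤-<-trans; <-≤-trans; +-comm; +-assoc; *-comm; *-assoc; +-identityˡ; +-identityʳ; *-identityˡ; *-identityʳ; *-zeroˡ; *-zeroʳ; *-distribˡ-+; *-distribʳ-+; +-mono-≤; ≤-total; ≰⇒>; ≮⇒≥; _≤?_; _<?_; _≟_; +-*-commutativeRing)
  import Data.Rational.Unnormalised.Base as ℚᵘ
  import Data.Rational.Unnormalised.Properties as ℚᵘ
  open import Data.Product.Base public using (_×_; _,_; proj₁; proj₂; ∃; Σ; ∃-syntax)
  open import Data.Sum.Base public using (_⊎_; inj₁; inj₂)
  open import Data.List.Base public using (List; []; _∷_; _++_; map; concatMap; filterᵇ; length; upTo)
  open import Data.List.Membership.Propositional public using (_∈_)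
  open import Data.List.Relation.Unary.Any public using (here; there)
  open import Relation.Nullary public using (¬_; Dec; yes; no; does)
  open import Relation.Binary.PropositionalEquality public using (_≡_; _≢_; refl; sym; trans; cong; cong₂; subst; module ≡-Reasoning)
  open import Function.Base public using (_∘_; _$_; id)
  open import Data.Maybe.Base using (Maybe; just; nothing)
  import Tactic.RingSolver.Core.AlmostCommutativeRing as ACR
  open import Tactic.RingSolver public using (solve-∀; solve)
  open import Level using (0ℓ)

  ℚ-ring : ACR.AlmostCommutativeRing 0ℓ 0ℓ
  ℚ-ring = ACR.fromCommutativeRing +-*-commutativeRing zero?
    where
    zero? : ∀ x → Maybe (0ℚ ≡ x)
    zero? x with 0ℚ ≟ x
    ... | yes e = just e
    ... | no _ = nothing

  2ℚ : ℚ
  2ℚ = + 2 / 1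

  -- Polynomial inequalities are proved by certificates: `d` is an explicit nonnegative expression,
  -- and the ring solver checks that it is the difference of the two sides.
  ≤-by : ∀ {a b} d → 0ℚ ≤ d → b ≡ a + d → a ≤ b
  ≤-by {a} d 0≤d eq = ≤-trans (≤-reflexive (sym (+-identityʳ a))) (≤-trans (+-mono-≤ (≤-refl {a}) 0≤d) (≤-reflexive (sym eq)))

  0≤- : ∀ {a b} → a ≤ b → 0ℚ ≤ b - a
  0≤- {a} {b} a≤b = ≤-trans (≤-reflexive (sym (ℚ.+-inverseʳ a))) (+-mono-≤ a≤b (≤-refl { - a}))

  0≤+ : ∀ {a b} → 0ℚ ≤ a → 0ℚ ≤ b → 0ℚ ≤ a + b
  0≤+ = +-mono-≤

  0≤* : ∀ {a b} → 0ℚ ≤ a → 0ℚ ≤ b → 0ℚ ≤ a * b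
  0≤* {a} {b} 0≤a 0≤b = ≤-trans (≤-reflexive (sym (*-zeroʳ a))) (ℚ.*-monoˡ-≤-nonNeg a {{ℚ.nonNegative 0≤a}} 0≤b)

  <⇒≱ : ∀ {a b} → a < b → ¬ (b ≤ a)
  <⇒≱ a<b b≤a = ℚ.<-irrefl refl (<-≤-trans a<b b≤a)

  ≤∧≢⇒< : ∀ {a b} → a ≤ b → a ≢ b → a < b
  ≤∧≢⇒< {a} {b} a≤b a≢b with a <? b
  ... | yes p = p
  ... | no h = ⊥-elim (a≢b (ℚ.≤-antisym a≤b (≮⇒≥ h)))

  0≤1 : 0ℚ ≤ 1ℚ
  0≤1 = ℚ.nonNegative⁻¹ 1ℚ

  0≤½ : 0ℚ ≤ ½
  0≤½ = ℚ.nonNegative⁻¹ ½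

  0≤2 : 0ℚ ≤ 2ℚ
  0≤2 = ℚ.nonNegative⁻¹ 2ℚ

  -- For closed rationals the instance argument evaluates to the unit type, so numerical
  -- inequalities are settled by computation.
  ≤! : ∀ {p q} {{_ : T (p ℚ.≤ᵇ q)}} → p ≤ q
  ≤! {{h}} = ℚ.≤ᵇ⇒≤ h

  *-monoˡ : ∀ {a b c} → 0ℚ ≤ c → a ≤ b → c * a ≤ c * b
  *-monoˡ {c = c} 0≤c = ℚ.*-monoˡ-≤-nonNeg c {{ℚ.nonNegative 0≤c}}

  *-monoʳ : ∀ {a b c} → 0ℚ ≤ c → a ≤ b → a * c ≤ b * c
  *-monoʳ {c = c} 0≤c = ℚ.*-monoʳ-≤-nonNeg c {{ℚ.nonNegative 0≤c}}

  *-mono : ∀ {a b c d} → 0ℚ ≤ a → 0ℚ ≤ d → a ≤ b → c ≤ d → a * c ≤ b * d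
  *-mono 0≤a 0≤d a≤b c≤d = ≤-trans (*-monoˡ 0≤a c≤d) (*-monoʳ 0≤d a≤b)

  0<* : ∀ {a b} → 0ℚ < a → 0ℚ < b → 0ℚ < a * b
  0<* {a} {b} 0<a 0<b = ℚ.≤-<-trans (≤-reflexive (sym (*-zeroʳ a))) (ℚ.*-monoʳ-<-pos a {{ℚ.positive 0<a}} 0<b)

  *-cancelˡ : ∀ {a b c} → 0ℚ < c → c * a ≤ c * b → a ≤ b
  *-cancelˡ {c = c} 0<c = ℚ.*-cancelˡ-≤-pos c {{ℚ.positive 0<c}}

  0≤sq : ∀ a → 0ℚ ≤ a * a
  0≤sq a with ≤-total 0ℚ a
  ... | inj₁ p = 0≤* p p
  ... | inj₂ p = ≤-trans (0≤* q q) (≤-reflexive (eq a))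
    where
    q : 0ℚ ≤ - a
    q = ℚ.neg-antimono-≤ p
    eq : ∀ x → (- x) * (- x) ≡ x * x
    eq = solve-∀ ℚ-ring

  -- This stands in for absolute values: a bound on `|a|` is derived from a bound on `a * a`, once
  -- for `a` and once for `- a`.
  sq-≤ : ∀ {a b} → 0ℚ ≤ b → a * a ≤ b * b → a ≤ b
  sq-≤ {a} {b} 0≤b h with ≤-total a b
  ... | inj₁ p = p
  ... | inj₂ b≤a with b ≟ a
  ...   | yes refl = ≤-refl
  ...   | no b≢a = ⊥-elim (<⇒≱ lt h)
    where
    b<a : b < a
    b<a = ≤∧≢⇒< b≤a b≢a
    0<d : 0ℚ < a - b
    0<d = ℚ.≤-<-trans (≤-reflexive (sym (ℚ.+-inverseʳ b))) (ℚ.+-monoˡ-< (- b) b<a)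
    eq : ∀ x y → x * x ≡ y * y + (x - y) * (x - y + (y + y))
    eq = solve-∀ ℚ-ring
    0<s : 0ℚ < a - b + (b + b)
    0<s = ℚ.<-≤-trans 0<d (≤-by (b + b) (0≤+ 0≤b 0≤b) refl)
    lt : b * b < a * a
    lt = ℚ.≤-<-trans (≤-reflexive (sym (+-identityʳ _))) (ℚ.<-≤-trans (ℚ.+-monoʳ-< (b * b) (0<* 0<d 0<s)) (≤-reflexive (sym (eq a b))))

  infixr 8 _^_
  _^_ : ℚ → ℕ → ℚ
  x ^ zero = 1ℚ
  x ^ suc n = x * x ^ n

  0≤^ : ∀ {x} n → 0ℚ ≤ x → 0ℚ ≤ x ^ n
  0≤^ zero h = 0≤1
  0≤^ (suc n) h = 0≤* h (0≤^ n h)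

  0<^ : ∀ {x} n → 0ℚ < x → 0ℚ < x ^ n
  0<^ zero h = ℚ.positive⁻¹ 1ℚ
  0<^ (suc n) h = 0<* h (0<^ n h)

  ^-mono : ∀ {x y} n → 0ℚ ≤ x → x ≤ y → x ^ n ≤ y ^ n
  ^-mono zero h p = ≤-refl
  ^-mono (suc n) h p = *-mono h (0≤^ n (≤-trans h p)) p (^-mono n h p)

  ^-+ : ∀ x m n → x ^ (m ℕ.+ n) ≡ x ^ m * x ^ n
  ^-+ x zero n = sym (*-identityˡ _)
  ^-+ x (suc m) n = trans (cong (x *_) (^-+ x m n)) (sym (*-assoc x (x ^ m) (x ^ n)))

  ^-distrib-* : ∀ x y n → (x * y) ^ n ≡ x ^ n * y ^ n
  ^-distrib-* x y zero = refl
  ^-distrib-* x y (suc n) = trans (cong (x * y *_) (^-distrib-* x y n)) (eq x y (x ^ n) (y ^ n))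
    where
    eq : ∀ a b c d → a * b * (c * d) ≡ a * c * (b * d)
    eq = solve-∀ ℚ-ring

  ^-* : ∀ x m n → x ^ (m ℕ.* n) ≡ (x ^ n) ^ m
  ^-* x zero n = refl
  ^-* x (suc m) n = trans (^-+ x n (m ℕ.* n)) (cong (x ^ n *_) (^-* x m n))

  1^ : ∀ n → 1ℚ ^ n ≡ 1ℚ
  1^ zero = refl
  1^ (suc n) = trans (*-identityˡ _) (1^ n)

  1≤^ : ∀ {x} n → 1ℚ ≤ x → 1ℚ ≤ x ^ n
  1≤^ n h = ≤-trans (≤-reflexive (sym (1^ n))) (^-mono n 0≤1 h)

  ≤1^ : ∀ {x} n → 0ℚ ≤ x → x ≤ 1ℚ → x ^ n ≤ 1ℚ
  ≤1^ n p h = ≤-trans (^-mono n p h) (≤-reflexive (1^ n))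

  -- Unary, so that inductions on `n` unfold by themselves; `ι≡` identifies it with the normalised
  -- fraction.
  ι : ℕ → ℚ
  ι zero = 0ℚ
  ι (suc n) = 1ℚ + ι n

  0≤ι : ∀ n → 0ℚ ≤ ι n
  0≤ι zero = ≤-refl
  0≤ι (suc n) = 0≤+ 0≤1 (0≤ι n)

  ι-+ : ∀ m n → ι (m ℕ.+ n) ≡ ι m + ι n
  ι-+ zero n = sym (+-identityˡ _)
  ι-+ (suc m) n = trans (cong (λ y → 1ℚ + y) (ι-+ m n)) (sym (+-assoc 1ℚ (ι m) (ι n)))

  ι-* : ∀ m n → ι (m ℕ.* n) ≡ ι m * ι n
  ι-* zero n = sym (*-zeroˡ (ι n))
  ι-* (suc m) n = trans (ι-+ n (m ℕ.* n)) (trans (cong (λ x → ι n + x) (ι-* m n)) (eq (ι m) (ι n)))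
    where
    eq : ∀ a b → b + a * b ≡ (1ℚ + a) * b
    eq = solve-∀ ℚ-ring

  ι-^ : ∀ m n → ι (m ℕ.^ n) ≡ ι m ^ n
  ι-^ m zero = +-identityʳ 1ℚ
  ι-^ m (suc n) = trans (ι-* m (m ℕ.^ n)) (cong (ι m *_) (ι-^ m n))

  ι-mono : ∀ {m n} → m ℕ.≤ n → ι m ≤ ι n
  ι-mono {n = n} ℕ.z≤n = 0≤ι n
  ι-mono (ℕ.s≤s h) = +-mono-≤ (≤-refl {1ℚ}) (ι-mono h)

  0<ι : ∀ n → 0ℚ < ι (suc n)
  0<ι n = ℚ.<-≤-trans (ℚ.positive⁻¹ 1ℚ) (≤-by (ι n) (0≤ι n) refl)

  ι-cancel-≤ : ∀ {m n} → ι m ≤ ι n → m ℕ.≤ n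
  ι-cancel-≤ {zero} h = ℕ.z≤n
  ι-cancel-≤ {suc m} {zero} h = ⊥-elim (<⇒≱ (0<ι m) h)
  ι-cancel-≤ {suc m} {suc n} h = ℕ.s≤s (ι-cancel-≤ (≤-trans (≤-reflexive (eq (ι m))) (≤-trans (+-mono-≤ h (≤-refl { - 1ℚ})) (≤-reflexive (sym (eq (ι n)))))))
    where
    eq : ∀ a → a ≡ 1ℚ + a + - 1ℚ
    eq = solve-∀ ℚ-ring

  bernoulli : ∀ {x} n → 0ℚ ≤ x → x ≤ 1ℚ → 1ℚ - ι n * x ≤ (1ℚ - x) ^ n
  bernoulli {x} zero p q = ≤-reflexive (eq x)
    where
    eq : ∀ x → 1ℚ - 0ℚ * x ≡ 1ℚ
    eq = solve-∀ ℚ-ring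
  bernoulli {x} (suc n) p q = ≤-trans (≤-by (ι n * x * x) (0≤* (0≤* (0≤ι n) p) p) (eq x (ι n))) (*-monoˡ (0≤- q) (bernoulli n p q))
    where
    eq : ∀ x m → (1ℚ - x) * (1ℚ - m * x) ≡ 1ℚ - (1ℚ + m) * x + m * x * x
    eq = solve-∀ ℚ-ring

  pos≢0 : ∀ {q} → 0ℚ < q → q ≢ 0ℚ
  pos≢0 p refl = ℚ.<-irrefl refl p

  abstract
    -- Total reciprocal, with junk value inv 0 = 0.
    inv : ℚ → ℚ
    inv q with q ≟ 0ℚ
    ... | yes _ = 0ℚ
    ... | no q≢0 = (1/ q) {{ℚ.≢-nonZero q≢0}}

    inv-*ʳ : ∀ {q} → q ≢ 0ℚ → q * inv q ≡ 1ℚ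
    inv-*ʳ {q} q≢0 with q ≟ 0ℚ
    ... | yes e = ⊥-elim (q≢0 e)
    ... | no h = ℚ.*-inverseʳ q {{ℚ.≢-nonZero h}}

    0<inv : ∀ {q} → 0ℚ < q → 0ℚ < inv q
    0<inv {q} p with q ≟ 0ℚ
    ... | yes e = ⊥-elim (pos≢0 p e)
    ... | no h = ℚ.positive⁻¹ ((1/ q) {{ℚ.≢-nonZero h}}) {{ℚ.1/pos⇒pos q {{ℚ.positive p}}}}

    0≤inv : ∀ {q} → 0ℚ ≤ q → 0ℚ ≤ inv q
    0≤inv {q} p with 0ℚ ≟ q
    ... | yes refl = ≤-refl
    ... | no h = <⇒≤ (0<inv (≤∧≢⇒< p h))

    infix 4 _≤ᵇ_
    _≤ᵇ_ : ℚ → ℚ → Bool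
    p ≤ᵇ q = does (p ≤? q)

    ≤ᵇ-elim : ∀ (Q : Bool → Set) a b → (a ≤ b → Q true) → (b < a → Q false) → Q (a ≤ᵇ b)
    ≤ᵇ-elim Q a b t f = go (a ≤? b)
      where
      go : (d : Dec (a ≤ b)) → Q (does d)
      go (yes p) = t p
      go (no p) = f (≰⇒> p)

  inv-pos : ∀ {q} → 0ℚ < q → q * inv q ≡ 1ℚ
  inv-pos p = inv-*ʳ (pos≢0 p)

  ≤ᵇ-false : ∀ {a b} → (a ≤ᵇ b) ≡ false → b < a
  ≤ᵇ-false {a} {b} = ≤ᵇ-elim (λ c → c ≡ false → b < a) a b (λ _ ()) (λ h _ → h)

  ≤ᵇ-T : ∀ {a b} → T (a ≤ᵇ b) → a ≤ b
  ≤ᵇ-T {a} {b} = ≤ᵇ-elim (λ c → T c → a ≤ b) a b (λ h _ → h) (λ _ ())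

  ≰ᵇ-false : ∀ {a b} → not (a ≤ᵇ b) ≡ false → a ≤ b
  ≰ᵇ-false {a} {b} = ≤ᵇ-elim (λ c → not c ≡ false → a ≤ b) a b (λ h _ → h) (λ _ ())

  ι≡ : ∀ n → ι n ≡ ℚ.mkℚ (+ n) 0 (ℕ.sym (ℕ.1-coprimeTo n))
  ι≡ zero = refl
  ι≡ (suc n) = trans (cong (λ y → 1ℚ + y) (ι≡ n)) (ℚ.toℚᵘ-injective (ℚᵘ.≃-trans (ℚ.toℚᵘ-homo-+ 1ℚ (ℚ.mkℚ (+ n) 0 (ℕ.sym (ℕ.1-coprimeTo n)))) (ℚᵘ.*≡* (cong (λ x → (+ 1 ℤ.+ x) ℤ.* + 1) (ℤ.*-identityʳ (+ n))))))

  archimedean : ∀ q → ∃ λ n → q ≤ ι n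
  archimedean q@(ℚ.mkℚ (+ n) d c) = n , ≤-trans (ℚ.*≤* h) (≤-reflexive (sym (ι≡ n)))
    where
    h : (+ n) ℤ.* (+ 1) ℤ.≤ (+ n) ℤ.* (+ suc d)
    h = ℤ.*-monoˡ-≤-nonNeg (+ n) (ℤ.+≤+ (ℕ.s≤s ℕ.z≤n))
  archimedean q@(ℚ.mkℚ (-[1+ n ]) d c) = 0 , ℚ.nonPositive⁻¹ q

-- Finite sums, counting and averaging over lists

module Sums where

  open Rationals

  -- Lists serve as multisets. That one is contained in another is expressed throughout by comparing
  -- their sums of an arbitrary nonnegative function.
  ∑ : {A : Set} → List A → (A → ℚ) → ℚ
  ∑ [] f = 0ℚ
  ∑ (x ∷ xs) f = f x + ∑ xs f

  # : {A : Set} → List A → ℚ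
  # xs = ∑ xs (λ _ → 1ℚ)

  𝟙 : Bool → ℚ
  𝟙 true = 1ℚ
  𝟙 false = 0ℚ

  0≤𝟙 : ∀ b → 0ℚ ≤ 𝟙 b
  0≤𝟙 true = 0≤1
  0≤𝟙 false = ≤-refl

  𝟙≤1 : ∀ b → 𝟙 b ≤ 1ℚ
  𝟙≤1 true = ≤-refl
  𝟙≤1 false = 0≤1

  𝟙-∧ : ∀ a b → 𝟙 (a ∧ b) ≡ 𝟙 a * 𝟙 b
  𝟙-∧ true b = sym (*-identityˡ (𝟙 b))
  𝟙-∧ false b = sym (*-zeroˡ (𝟙 b))

  module _ {A : Set} where

    ∑-cong : ∀ (xs : List A) {f g} → (∀ x → f x ≡ g x) → ∑ xs f ≡ ∑ xs g
    ∑-cong [] h = refl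
    ∑-cong (x ∷ xs) h = cong₂ _+_ (h x) (∑-cong xs h)

    ∑-cong∈ : ∀ (xs : List A) {f g} → (∀ x → x ∈ xs → f x ≡ g x) → ∑ xs f ≡ ∑ xs g
    ∑-cong∈ [] h = refl
    ∑-cong∈ (x ∷ xs) h = cong₂ _+_ (h x (here refl)) (∑-cong∈ xs (λ y m → h y (there m)))

    ∑-mono∈ : ∀ (xs : List A) {f g} → (∀ x → x ∈ xs → f x ≤ g x) → ∑ xs f ≤ ∑ xs g
    ∑-mono∈ [] h = ≤-refl
    ∑-mono∈ (x ∷ xs) h = +-mono-≤ (h x (here refl)) (∑-mono∈ xs (λ y m → h y (there m)))

    ∑-mono : ∀ (xs : List A) {f g} → (∀ x → f x ≤ g x) → ∑ xs f ≤ ∑ xs g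
    ∑-mono xs h = ∑-mono∈ xs (λ x _ → h x)

    ∑-0 : ∀ (xs : List A) → ∑ xs (λ _ → 0ℚ) ≡ 0ℚ
    ∑-0 [] = refl
    ∑-0 (x ∷ xs) = trans (+-identityˡ _) (∑-0 xs)

    0≤∑ : ∀ (xs : List A) {f} → (∀ x → 0ℚ ≤ f x) → 0ℚ ≤ ∑ xs f
    0≤∑ xs h = ≤-trans (≤-reflexive (sym (∑-0 xs))) (∑-mono xs h)

    0≤∑∈ : ∀ (xs : List A) {f} → (∀ x → x ∈ xs → 0ℚ ≤ f x) → 0ℚ ≤ ∑ xs f
    0≤∑∈ xs h = ≤-trans (≤-reflexive (sym (∑-0 xs))) (∑-mono∈ xs h)

    ∑-+ : ∀ (xs : List A) (f g : A → ℚ) → ∑ xs (λ x → f x + g x) ≡ ∑ xs f + ∑ xs g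
    ∑-+ [] f g = refl
    ∑-+ (x ∷ xs) f g = trans (cong (λ s → f x + g x + s) (∑-+ xs f g)) (eq (f x) (g x) (∑ xs f) (∑ xs g))
      where
      eq : ∀ a b c d → a + b + (c + d) ≡ a + c + (b + d)
      eq = solve-∀ ℚ-ring

    ∑-- : ∀ (xs : List A) (f g : A → ℚ) → ∑ xs (λ x → f x - g x) ≡ ∑ xs f - ∑ xs g
    ∑-- [] f g = refl
    ∑-- (x ∷ xs) f g = trans (cong (λ s → f x - g x + s) (∑-- xs f g)) (eq (f x) (g x) (∑ xs f) (∑ xs g))
      where
      eq : ∀ a b c d → a - b + (c - d) ≡ a + c - (b + d)
      eq = solve-∀ ℚ-ring

    ∑-*ˡ : ∀ (xs : List A) c (f : A → ℚ) → ∑ xs (λ x → c * f x) ≡ c * ∑ xs f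
    ∑-*ˡ [] c f = sym (*-zeroʳ c)
    ∑-*ˡ (x ∷ xs) c f = trans (cong (λ s → c * f x + s) (∑-*ˡ xs c f)) (sym (*-distribˡ-+ c (f x) (∑ xs f)))

    ∑-*ʳ : ∀ (xs : List A) c (f : A → ℚ) → ∑ xs (λ x → f x * c) ≡ ∑ xs f * c
    ∑-*ʳ xs c f = trans (∑-cong xs (λ x → *-comm (f x) c)) (trans (∑-*ˡ xs c f) (*-comm c (∑ xs f)))

    ∑-const : ∀ (xs : List A) c → ∑ xs (λ _ → c) ≡ # xs * c
    ∑-const xs c = trans (∑-cong xs (λ _ → sym (*-identityˡ c))) (∑-*ʳ xs c (λ _ → 1ℚ))

    ∑-++ : ∀ (xs ys : List A) f → ∑ (xs ++ ys) f ≡ ∑ xs f + ∑ ys f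
    ∑-++ [] ys f = sym (+-identityˡ _)
    ∑-++ (x ∷ xs) ys f = trans (cong (λ s → f x + s) (∑-++ xs ys f)) (sym (+-assoc (f x) (∑ xs f) (∑ ys f)))

    ∑-filter : ∀ (p : A → Bool) xs f → ∑ (filterᵇ p xs) f ≡ ∑ xs (λ x → 𝟙 (p x) * f x)
    ∑-filter p [] f = refl
    ∑-filter p (x ∷ xs) f with p x
    ... | true = cong₂ _+_ (sym (*-identityˡ (f x))) (∑-filter p xs f)
    ... | false = trans (sym (+-identityˡ _)) (cong₂ _+_ (sym (*-zeroˡ (f x))) (∑-filter p xs f))

    #-filter : ∀ (p : A → Bool) xs → # (filterᵇ p xs) ≡ ∑ xs (λ x → 𝟙 (p x))
    #-filter p xs = trans (∑-filter p xs _) (∑-cong xs (λ x → *-identityʳ _))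

    ∑-filter-≤ : ∀ (p : A → Bool) xs {f} → (∀ x → 0ℚ ≤ f x) → ∑ (filterᵇ p xs) f ≤ ∑ xs f
    ∑-filter-≤ p xs {f} h = ≤-trans (≤-reflexive (∑-filter p xs f)) (∑-mono xs (λ x → ≤-trans (*-monoʳ (h x) (𝟙≤1 (p x))) (≤-reflexive (*-identityˡ _))))

    0≤# : ∀ (xs : List A) → 0ℚ ≤ # xs
    0≤# xs = 0≤∑ xs (λ _ → 0≤1)

    ∑≤# : ∀ (xs : List A) {f} → (∀ x → f x ≤ 1ℚ) → ∑ xs f ≤ # xs
    ∑≤# xs h = ∑-mono xs h

    #≡length : ∀ (xs : List A) → # xs ≡ ι (length xs)
    #≡length [] = refl
    #≡length (x ∷ xs) = cong (λ y → 1ℚ + y) (#≡length xs)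

    term≤∑ : ∀ {xs : List A} {f x} → (∀ y → 0ℚ ≤ f y) → x ∈ xs → f x ≤ ∑ xs f
    term≤∑ {x ∷ xs} {f} h (here refl) = ≤-by (∑ xs f) (0≤∑ xs h) refl
    term≤∑ {y ∷ xs} {f} h (there m) = ≤-trans (term≤∑ h m) (≤-by (f y) (h y) (+-comm (f y) (∑ xs f)))

    ∑-pos-∃ : ∀ (xs : List A) {f} → 0ℚ < ∑ xs f → ∃ λ x → x ∈ xs × 0ℚ < f x
    ∑-pos-∃ [] h = ⊥-elim (ℚ.<-irrefl refl h)
    ∑-pos-∃ (x ∷ xs) {f} h with 0ℚ <? f x
    ... | yes p = x , here refl , p
    ... | no np with ∑-pos-∃ xs {f} (ℚ.<-≤-trans h (≤-trans (+-mono-≤ (≮⇒≥ np) (≤-refl {∑ xs f})) (≤-reflexive (+-identityˡ _))))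
    ...   | y , m , p = y , there m , p

    #-pos-∃ : ∀ (xs : List A) → 0ℚ < # xs → ∃ (_∈ xs)
    #-pos-∃ [] h = ⊥-elim (ℚ.<-irrefl refl h)
    #-pos-∃ (x ∷ xs) h = x , here refl

    argmax : ∀ (x₀ : A) xs (f : A → ℚ) → ∃ λ x → ∀ y → y ∈ xs → f y ≤ f x
    argmax x₀ [] f = x₀ , λ y ()
    argmax x₀ (x ∷ xs) f with argmax x₀ xs f
    ... | y , h with ≤-total (f x) (f y)
    ...   | inj₁ p = y , λ { z (here refl) → p ; z (there m) → h z m }
    ...   | inj₂ p = x , λ { z (here refl) → ≤-refl ; z (there m) → ≤-trans (h z m) p }

    ≤-avg-∃ : ∀ (xs : List A) {f c} → 0ℚ < # xs → # xs * c ≤ ∑ xs f → ∃ λ x → x ∈ xs × c ≤ f x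
    ≤-avg-∃ [] pos h = ⊥-elim (ℚ.<-irrefl refl pos)
    ≤-avg-∃ (x ∷ xs) {f} {c} pos h with argmax′ x xs
      where
      argmax′ : ∀ x xs → ∃ λ y → y ∈ (x ∷ xs) × (∀ z → z ∈ (x ∷ xs) → f z ≤ f y)
      argmax′ x [] = x , here refl , λ { z (here refl) → ≤-refl }
      argmax′ x (x′ ∷ xs) with argmax′ x′ xs
      ... | y , m , h with ≤-total (f x) (f y)
      ...   | inj₁ p = y , there m , λ { z (here refl) → p ; z (there m) → h z m }
      ...   | inj₂ p = x , here refl , λ { z (here refl) → ≤-refl ; z (there m) → ≤-trans (h z m) p }
    ... | y , m , ub = y , m , *-cancelˡ pos (≤-trans h (≤-trans (∑-mono∈ (x ∷ xs) ub) (≤-reflexive (∑-const (x ∷ xs) (f y)))))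

  module _ {A B : Set} where

    ∑-map : ∀ (g : A → B) xs f → ∑ (map g xs) f ≡ ∑ xs (λ x → f (g x))
    ∑-map g [] f = refl
    ∑-map g (x ∷ xs) f = cong (λ s → f (g x) + s) (∑-map g xs f)

    ∑-concatMap : ∀ (g : A → List B) xs f → ∑ (concatMap g xs) f ≡ ∑ xs (λ x → ∑ (g x) f)
    ∑-concatMap g [] f = refl
    ∑-concatMap g (x ∷ xs) f = trans (∑-++ (g x) (concatMap g xs) f) (cong (λ s → ∑ (g x) f + s) (∑-concatMap g xs f))

    ∑-swap : ∀ (xs : List A) (ys : List B) (f : A → B → ℚ) → ∑ xs (λ x → ∑ ys (f x)) ≡ ∑ ys (λ y → ∑ xs (λ x → f x y))
    ∑-swap [] ys f = sym (∑-0 ys)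
    ∑-swap (x ∷ xs) ys f = trans (cong (λ s → ∑ ys (f x) + s) (∑-swap xs ys f)) (sym (∑-+ ys (f x) (λ y → ∑ xs (λ x → f x y))))

    ∑-∑-* : ∀ (xs : List A) (ys : List B) f g → ∑ xs (λ x → ∑ ys (λ y → f x * g y)) ≡ ∑ xs f * ∑ ys g
    ∑-∑-* xs ys f g = trans (∑-cong xs (λ x → ∑-*ˡ ys (f x) g)) (∑-*ʳ xs (∑ ys g) f)

  module _ {A B : Set} where

    pairs : List A → List B → List (A × B)
    pairs xs ys = concatMap (λ x → map (x ,_) ys) xs

    ∑-pairs : ∀ xs ys (f : A × B → ℚ) → ∑ (pairs xs ys) f ≡ ∑ xs (λ x → ∑ ys (λ y → f (x , y)))
    ∑-pairs xs ys f = trans (∑-concatMap _ xs f) (∑-cong xs (λ x → ∑-map (x ,_) ys f))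

-- Moments of Gram kernels and sifting

module Moments where

  open Rationals
  open Sums
  open import Data.List.Membership.Propositional.Properties using (∈-concatMap⁻; ∈-map⁻)
  import Data.List.Membership.Propositional as L

  -- A rank one term `wt * fl z * fr z′` of a kernel. Two factors are kept so that the mixed kernel
  -- can be compared with the two symmetric ones.
  record Entry (Z : Set) : Set where
    constructor entry
    field
      wt : ℚ
      fl fr : Z → ℚ
  open Entry public

  *-pos-cancel : ∀ {a b} → 0ℚ ≤ a → 0ℚ < a * b → 0ℚ < b
  *-pos-cancel {a} {b} 0≤a h with 0ℚ <? b
  ... | yes p = p
  ... | no np = ⊥-elim (<⇒≱ h (≤-trans (*-monoˡ 0≤a (≮⇒≥ np)) (≤-reflexive (*-zeroʳ a))))

  -- At most half of `M` is lost to `x`, and at most a quarter to the density term, since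
  -- `d * s ≤ n * (d * k) ≤ n / 4` and `n * n ≤ M`.
  sifting-mass : ∀ {M x d n s k} → 0ℚ ≤ d → 0ℚ ≤ n → 2ℚ * x ≤ M → n * n ≤ M → 2ℚ * 2ℚ * (d * k) ≤ 1ℚ → s ≤ n * k →
    ½ * ½ * M ≤ M - x - d * n * s
  sifting-mass {M} {x} {d} {n} {s} {k} 0≤d 0≤n h₁ h₂ h₃ h₄ = ≤-by _
    (0≤+ (0≤+ (0≤+ (0≤* 0≤½ (0≤- h₁)) (0≤* {½ * ½} ≤! (0≤- h₂))) (0≤* {½ * ½} ≤! (0≤* (0≤* 0≤n 0≤n) (0≤- h₃)))) (0≤* (0≤* 0≤d 0≤n) (0≤- h₄)))
    (eq M x d n s k)
    where
    eq : ∀ M x d n s k → M - x - d * n * s ≡ ½ * ½ * M + (½ * (M - 2ℚ * x) + ½ * ½ * (M - n * n) + ½ * ½ * (n * n * (1ℚ - 2ℚ * 2ℚ * (d * k))) + d * n * (n * k - s))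
    eq = solve-∀ ℚ-ring

  module _ {Z : Set} where

    infixl 7 _⊙_
    _⊙_ : Entry Z → Entry Z → Entry Z
    e ⊙ e′ = entry (wt e * wt e′) (λ z → fl e z * fl e′ z) (λ z → fr e z * fr e′ z)

    unit : Entry Z
    unit = entry 1ℚ (λ _ → 1ℚ) (λ _ → 1ℚ)

    -- Tensor power: the words of length `r` in the entries are the terms of the expanded `r`-th
    -- power of the kernel.
    pow : List (Entry Z) → ℕ → List (Entry Z)
    pow es zero = unit ∷ []
    pow es (suc r) = concatMap (λ e → map (e ⊙_) (pow es r)) es

    record Multiplicative (p : Entry Z → Z → ℚ) : Set where
      field
        at-⊙ : ∀ e e′ z → p (e ⊙ e′) z ≡ p e z * p e′ z
        at-unit : ∀ z → p unit z ≡ 1ℚ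
    open Multiplicative

    fl-mult : Multiplicative fl
    fl-mult = record { at-⊙ = λ _ _ _ → refl ; at-unit = λ _ → refl }

    fr-mult : Multiplicative fr
    fr-mult = record { at-⊙ = λ _ _ _ → refl ; at-unit = λ _ → refl }

    one : Entry Z → Z → ℚ
    one _ _ = 1ℚ

    one-mult : Multiplicative one
    one-mult = record { at-⊙ = λ _ _ _ → refl ; at-unit = λ _ → refl }

    ker : (p q : Entry Z → Z → ℚ) → List (Entry Z) → Z → Z → ℚ
    ker p q es z z′ = ∑ es (λ e → wt e * (p e z * q e z′))

    ker-pow : ∀ {p q} → Multiplicative p → Multiplicative q → ∀ es r z z′ → ker p q (pow es r) z z′ ≡ ker p q es z z′ ^ r
    ker-pow mp mq es zero z z′ = trans (cong₂ (λ a b → 1ℚ * (a * b) + 0ℚ) (at-unit mp z) (at-unit mq z′)) refl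
    ker-pow {p} {q} mp mq es (suc r) z z′ = trans (∑-concatMap _ es _) (trans (∑-cong es step) (∑-*ʳ es (ker p q es z z′ ^ r) (λ e → wt e * (p e z * q e z′))))
      where
      eq : ∀ a b c d e f → a * b * (c * d * (e * f)) ≡ a * (c * e) * (b * (d * f))
      eq = solve-∀ ℚ-ring
      term : ∀ e e′ → wt (e ⊙ e′) * (p (e ⊙ e′) z * q (e ⊙ e′) z′) ≡ wt e * (p e z * q e z′) * (wt e′ * (p e′ z * q e′ z′))
      term e e′ = trans (cong₂ (λ a b → wt e * wt e′ * (a * b)) (at-⊙ mp e e′ z) (at-⊙ mq e e′ z′)) (eq (wt e) (wt e′) (p e z) (p e′ z) (q e z′) (q e′ z′))
      step : ∀ e → ∑ (map (e ⊙_) (pow es r)) (λ e → wt e * (p e z * q e z′)) ≡ wt e * (p e z * q e z′) * ker p q es z z′ ^ r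
      step e = trans (∑-map (e ⊙_) (pow es r) _) (trans (∑-cong (pow es r) (term e)) (trans (∑-*ˡ (pow es r) (wt e * (p e z * q e z′)) _) (cong (wt e * (p e z * q e z′) *_) (ker-pow mp mq es r z z′))))

    pow-closed : ∀ {Q : Entry Z → Set} → Q unit → (∀ {e e′} → Q e → Q e′ → Q (e ⊙ e′)) → ∀ es → (∀ e → e ∈ es → Q e) → ∀ r e → e ∈ pow es r → Q e
    pow-closed u m es h zero e (here refl) = u
    pow-closed u m es h (suc r) e e∈ with L.find (∈-concatMap⁻ (λ e → map (e ⊙_) (pow es r)) {xs = es} e∈)
    ... | e₁ , e₁∈ , e∈′ with ∈-map⁻ (e₁ ⊙_) e∈′
    ...   | e₂ , e₂∈ , refl = m (h e₁ e₁∈) (pow-closed u m es h r e₂ e₂∈)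

    ∑∑-ker : ∀ P p q es → ∑ P (λ z → ∑ P (λ z′ → ker p q es z z′)) ≡ ∑ es (λ e → wt e * (∑ P (p e) * ∑ P (q e)))
    ∑∑-ker P p q es = begin
      ∑ P (λ z → ∑ P (λ z′ → ker p q es z z′))
        ≡⟨ ∑-cong P (λ z → ∑-swap P es _) ⟩
      ∑ P (λ z → ∑ es (λ e → ∑ P (λ z′ → wt e * (p e z * q e z′))))
        ≡⟨ ∑-swap P es _ ⟩
      ∑ es (λ e → ∑ P (λ z → ∑ P (λ z′ → wt e * (p e z * q e z′))))
        ≡⟨ ∑-cong es (λ e → trans (∑-cong P (λ z → ∑-*ˡ P (wt e) _)) (trans (∑-*ˡ P (wt e) _) (cong (wt e *_) (∑-∑-* P P (p e) (q e))))) ⟩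
      ∑ es (λ e → wt e * (∑ P (p e) * ∑ P (q e))) ∎
      where open ≡-Reasoning

    moment : List Z → (p q : Entry Z → Z → ℚ) → List (Entry Z) → ℕ → ℚ
    moment P p q es r = ∑ P (λ z → ∑ P (λ z′ → ker p q es z z′ ^ r))

    moment-pow : ∀ {p q} → Multiplicative p → Multiplicative q → ∀ P es r → moment P p q es r ≡ ∑ (pow es r) (λ e → wt e * (∑ P (p e) * ∑ P (q e)))
    moment-pow {p} {q} mp mq P es r = trans (∑-cong P (λ z → ∑-cong P (λ z′ → sym (ker-pow mp mq es r z z′)))) (∑∑-ker P p q (pow es r))

    0≤wt-pow : ∀ es → (∀ e → e ∈ es → 0ℚ ≤ wt e) → ∀ r e → e ∈ pow es r → 0ℚ ≤ wt e
    0≤wt-pow = pow-closed 0≤1 0≤*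

    -- Expanded over words, the moment is a sum of weighted squares, for odd `r` as well. This
    -- limits how much mass the kernel can have at negative values.
    moment-psd : ∀ P es → (∀ e → e ∈ es → 0ℚ ≤ wt e) → ∀ r → 0ℚ ≤ moment P fl fl es r
    moment-psd P es h r = ≤-trans (0≤∑∈ (pow es r) (λ e m → 0≤* (0≤wt-pow es h r e m) (0≤sq (∑ P (fl e))))) (≤-reflexive (sym (moment-pow fl-mult fl-mult P es r)))

    -- Termwise `2 a b ≤ a² + b²` in the expansion over words, whose weights are products of
    -- nonnegative weights.
    moment-cs : ∀ P es → (∀ e → e ∈ es → 0ℚ ≤ wt e) → ∀ r → moment P fl fr es r + moment P fl fr es r ≤ moment P fl fl es r + moment P fr fr es r
    moment-cs P es h r = ≤-trans (≤-reflexive lhs) (≤-trans (∑-mono∈ (pow es r) amgm) (≤-reflexive (sym rhs)))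
      where
      eq : ∀ w a b → w * (a * a) + w * (b * b) ≡ w * (a * b) + w * (a * b) + w * ((a - b) * (a - b))
      eq = solve-∀ ℚ-ring
      amgm : ∀ e → e ∈ pow es r → wt e * (∑ P (fl e) * ∑ P (fr e)) + wt e * (∑ P (fl e) * ∑ P (fr e)) ≤ wt e * (∑ P (fl e) * ∑ P (fl e)) + wt e * (∑ P (fr e) * ∑ P (fr e))
      amgm e m = ≤-by _ (0≤* (0≤wt-pow es h r e m) (0≤sq (∑ P (fl e) - ∑ P (fr e)))) (eq (wt e) (∑ P (fl e)) (∑ P (fr e)))
      lhs : moment P fl fr es r + moment P fl fr es r ≡ ∑ (pow es r) (λ e → wt e * (∑ P (fl e) * ∑ P (fr e)) + wt e * (∑ P (fl e) * ∑ P (fr e)))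
      lhs = trans (cong₂ _+_ mm mm) (sym (∑-+ (pow es r) _ _))
        where mm = moment-pow fl-mult fr-mult P es r
      rhs : moment P fl fl es r + moment P fr fr es r ≡ ∑ (pow es r) (λ e → wt e * (∑ P (fl e) * ∑ P (fl e)) + wt e * (∑ P (fr e) * ∑ P (fr e)))
      rhs = trans (cong₂ _+_ (moment-pow fl-mult fl-mult P es r) (moment-pow fr-mult fr-mult P es r)) (sym (∑-+ (pow es r) _ _))

    Indicator : Entry Z → Set
    Indicator e = 0ℚ ≤ wt e × ∃ λ (b : Z → Bool) → ∀ z → fl e z ≡ 𝟙 (b z)

    indicator-⊙ : ∀ {e e′} → Indicator e → Indicator e′ → Indicator (e ⊙ e′)
    indicator-⊙ (w , b , h) (w′ , b′ , h′) = 0≤* w w′ , (λ z → b z ∧ b′ z) , λ z → trans (cong₂ _*_ (h z) (h′ z)) (sym (𝟙-∧ (b z) (b′ z)))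

    -- One positive bracket gives everything: with `a = # A` and `D` the number of bad pairs,
    -- `a² - c D - δ N a > 0` forces `a > 0`, `a ≥ δ N` and `c D ≤ a²` at once.
    select : ∀ P (bad : Z → Z → Bool) c δ (e : Entry Z) → Indicator e → 0ℚ ≤ c → 0ℚ ≤ δ → 0ℚ < # P →
      0ℚ < wt e * (∑ P (fl e) * ∑ P (fl e) - c * ∑ P (λ z → ∑ P (λ z′ → fl e z * fl e z′ * 𝟙 (bad z z′))) - δ * # P * ∑ P (fl e)) →
      ∃ λ (b : Z → Bool) → let A = filterᵇ b P in
        0ℚ < # A × δ * # P ≤ # A × c * ∑ A (λ z → ∑ A (λ z′ → 𝟙 (bad z z′))) ≤ # A * # A
    select P bad c δ e (0≤w , b , fl≡) 0≤c 0≤δ 0<P h = b , 0<A , A-large , A-good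
      where
      G B : ℚ
      G = ∑ P (fl e)
      B = ∑ P (λ z → ∑ P (λ z′ → fl e z * fl e z′ * 𝟙 (bad z z′)))
      A = filterᵇ b P
      N = # P
      A≡ : # A ≡ G
      A≡ = trans (#-filter b P) (∑-cong P (λ z → sym (fl≡ z)))
      B≡ : ∑ A (λ z → ∑ A (λ z′ → 𝟙 (bad z z′))) ≡ B
      B≡ = trans (∑-filter b P _) (∑-cong P (λ z → trans (cong₂ _*_ (sym (fl≡ z)) (trans (∑-filter b P _) (∑-cong P (λ z′ → cong (_* 𝟙 (bad z z′)) (sym (fl≡ z′)))))) (trans (sym (∑-*ˡ P (fl e z) _)) (∑-cong P (λ z′ → sym (*-assoc (fl e z) _ _))))))

      0<br : 0ℚ < # A * # A - c * ∑ A (λ z → ∑ A (λ z′ → 𝟙 (bad z z′))) - δ * N * # A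
      0<br = subst (0ℚ <_) (cong₂ (λ x y → x * x - c * y - δ * N * x) (sym A≡) (sym B≡)) (*-pos-cancel 0≤w h)

      D = ∑ A (λ z → ∑ A (λ z′ → 𝟙 (bad z z′)))
      0≤D : 0ℚ ≤ D
      0≤D = 0≤∑ A (λ z → 0≤∑ A (λ z′ → 0≤𝟙 (bad z z′)))

      0<A : 0ℚ < # A
      0<A with 0ℚ <? # A
      ... | yes p = p
      ... | no np = ⊥-elim (<⇒≱ 0<br (≤-trans (≤-reflexive (trans (cong (λ x → x * x - c * D - δ * N * x) A≡0) (eq c D (δ * N)))) (ℚ.neg-antimono-≤ (0≤* 0≤c 0≤D))))
        where
        A≡0 : # A ≡ 0ℚ
        A≡0 = ℚ.≤-antisym (≮⇒≥ np) (0≤# A)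
        eq : ∀ c d m → 0ℚ * 0ℚ - c * d - m * 0ℚ ≡ - (c * d)
        eq = solve-∀ ℚ-ring

      A-large : δ * N ≤ # A
      A-large = *-cancelˡ 0<A (≤-by (# A * # A - c * D - δ * N * # A + c * D) (0≤+ (<⇒≤ 0<br) (0≤* 0≤c 0≤D)) (eq (# A) (c * D) (δ * N)))
        where
        eq : ∀ a x d → a * a ≡ a * d + (a * a - x - d * a + x)
        eq = solve-∀ ℚ-ring

      A-good : c * D ≤ # A * # A
      A-good = ≤-by (# A * # A - c * D - δ * N * # A + δ * N * # A) (0≤+ (<⇒≤ 0<br) (0≤* (0≤* 0≤δ (<⇒≤ 0<P)) (<⇒≤ 0<A))) (eq (# A) (c * D) (δ * N))
        where
        eq : ∀ a x d → a * a ≡ x + (a * a - x - d * a + d * a)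
        eq = solve-∀ ℚ-ring

    -- Expand the r-th power of the kernel into rank one indicators 1_A(z) 1_A(z′) and
    -- select, on average, an A which is large and mostly avoids the bad pairs.
    sifting : ∀ P es r (bad : Z → Z → Bool) c δ κ → (∀ e → e ∈ es → Indicator e) → 0ℚ ≤ c → 0ℚ ≤ δ →
      (∀ z → ∑ es (λ e → wt e * fl e z) ≤ κ) → 0ℚ ≤ κ → 0ℚ < # P → 2ℚ * 2ℚ * (δ * κ ^ r) ≤ 1ℚ →
      # P * # P ≤ moment P fl fl es r →
      2ℚ * (c * ∑ P (λ z → ∑ P (λ z′ → ker fl fl es z z′ ^ r * 𝟙 (bad z z′)))) ≤ moment P fl fl es r →
      ∃ λ (b : Z → Bool) → let A = filterᵇ b P in
        0ℚ < # A × δ * # P ≤ # A × c * ∑ A (λ z → ∑ A (λ z′ → 𝟙 (bad z z′))) ≤ # A * # A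
    sifting P es r bad c δ κ ind 0≤c 0≤δ hκ 0≤κ 0<P hδ hM hB = finish (∑-pos-∃ (pow es r) positive)
      where
      N = # P
      M = moment P fl fl es r
      Pow = pow es r
      indP : ∀ e → e ∈ Pow → Indicator e
      indP = pow-closed (0≤1 , (λ _ → true) , (λ _ → refl)) (λ {e} {e′} → indicator-⊙ {e} {e′}) es ind r
      G B : Entry Z → ℚ
      G e = ∑ P (fl e)
      B e = ∑ P (λ z → ∑ P (λ z′ → fl e z * fl e z′ * 𝟙 (bad z z′)))
      MB = ∑ P (λ z → ∑ P (λ z′ → ker fl fl es z z′ ^ r * 𝟙 (bad z z′)))

      M≡ : M ≡ ∑ Pow (λ e → wt e * (G e * G e))
      M≡ = moment-pow fl-mult fl-mult P es r

      MB≡ : MB ≡ ∑ Pow (λ e → wt e * B e)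
      MB≡ = begin
        MB ≡⟨ ∑-cong P (λ z → ∑-cong P (λ z′ → trans (cong (_* 𝟙 (bad z z′)) (sym (ker-pow fl-mult fl-mult es r z z′))) (trans (sym (∑-*ʳ Pow (𝟙 (bad z z′)) _)) (∑-cong Pow (λ e → *-assoc (wt e) _ _))))) ⟩
        ∑ P (λ z → ∑ P (λ z′ → ∑ Pow (λ e → wt e * (fl e z * fl e z′ * 𝟙 (bad z z′))))) ≡⟨ ∑-cong P (λ z → ∑-swap P Pow _) ⟩
        ∑ P (λ z → ∑ Pow (λ e → ∑ P (λ z′ → wt e * (fl e z * fl e z′ * 𝟙 (bad z z′))))) ≡⟨ ∑-swap P Pow _ ⟩
        ∑ Pow (λ e → ∑ P (λ z → ∑ P (λ z′ → wt e * (fl e z * fl e z′ * 𝟙 (bad z z′))))) ≡⟨ ∑-cong Pow (λ e → trans (∑-cong P (λ z → ∑-*ˡ P (wt e) _)) (∑-*ˡ P (wt e) _)) ⟩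
        ∑ Pow (λ e → wt e * B e) ∎
        where open ≡-Reasoning

      -- With the trivial second factor the power of the kernel is the total weight of the words
      -- containing `z`, hence the `r`-th power of that weight for single entries.
      κ-pow : ∀ z → ∑ Pow (λ e → wt e * fl e z) ≤ κ ^ r
      κ-pow z = ≤-trans (≤-reflexive (trans (trans (∑-cong Pow (λ e → cong (wt e *_) (sym (*-identityʳ _)))) (ker-pow fl-mult one-mult es r z z)) (cong (_^ r) (∑-cong es (λ e → cong (wt e *_) (*-identityʳ (fl e z)))))))
        (^-mono r (0≤∑∈ es (λ e m → 0≤* (proj₁ (ind e m)) (≤-trans (0≤𝟙 (proj₁ (proj₂ (ind e m)) z)) (≤-reflexive (sym (proj₂ (proj₂ (ind e m)) z)))))) (hκ z))

      MG : ∑ Pow (λ e → wt e * G e) ≤ N * κ ^ r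
      MG = ≤-trans (≤-reflexive (trans (∑-cong Pow (λ e → sym (∑-*ˡ P (wt e) (fl e)))) (∑-swap Pow P _))) (≤-trans (∑-mono P κ-pow) (≤-reflexive (∑-const P (κ ^ r))))

      score : Entry Z → ℚ
      score e = wt e * (G e * G e - c * B e - δ * N * G e)

      total : ∑ Pow score ≡ M - c * MB - δ * N * ∑ Pow (λ e → wt e * G e)
      total = begin
        ∑ Pow score ≡⟨ ∑-cong Pow (λ e → eq (wt e) (G e * G e) c (B e) (δ * N) (G e)) ⟩
        ∑ Pow (λ e → wt e * (G e * G e) - c * (wt e * B e) - δ * N * (wt e * G e)) ≡⟨ ∑-- Pow _ _ ⟩
        ∑ Pow (λ e → wt e * (G e * G e) - c * (wt e * B e)) - ∑ Pow (λ e → δ * N * (wt e * G e)) ≡⟨ cong₂ _-_ (∑-- Pow _ _) (∑-*ˡ Pow (δ * N) _) ⟩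
        ∑ Pow (λ e → wt e * (G e * G e)) - ∑ Pow (λ e → c * (wt e * B e)) - δ * N * ∑ Pow (λ e → wt e * G e)
          ≡⟨ cong (_- δ * N * ∑ Pow (λ e → wt e * G e)) (cong₂ _-_ (sym M≡) (trans (∑-*ˡ Pow c _) (cong (c *_) (sym MB≡)))) ⟩
        M - c * MB - δ * N * ∑ Pow (λ e → wt e * G e) ∎
        where
        open ≡-Reasoning
        eq : ∀ w gg c b d g → w * (gg - c * b - d * g) ≡ w * gg - c * (w * b) - d * (w * g)
        eq = solve-∀ ℚ-ring

      positive : 0ℚ < ∑ Pow score
      positive = ℚ.<-≤-trans (0<* (ℚ.positive⁻¹ (½ * ½)) (ℚ.<-≤-trans (0<* 0<P 0<P) hM)) (≤-trans low (≤-reflexive (sym total)))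
        where
        low : ½ * ½ * M ≤ M - c * MB - δ * N * ∑ Pow (λ e → wt e * G e)
        low = sifting-mass {M} {c * MB} {δ} {N} 0≤δ (<⇒≤ 0<P) hB hM hδ MG

      finish : ∃ (λ e → e ∈ Pow × 0ℚ < score e) → _
      finish (e , m , h) = select P bad c δ e (indP e m) 0≤c 0≤δ 0<P h

-- From a large even moment of a deviation to upward deviations

module Unbalancing where

  open Rationals
  open Sums

  1/4 1/16 5/4 17/16 16ℚ : ℚ
  1/4 = + 1 / 4
  1/16 = + 1 / 16
  5/4 = + 5 / 4
  17/16 = + 17 / 16
  16ℚ = + 16 / 1

  -- K^16 grows so fast that it absorbs (4(K-1))^2 as soon as K ≥ 5/4.
  shift-by-power : ∀ {K} → 5/4 ≤ K → (K - 1ℚ) * (K - 1ℚ) ≤ 1/16 * K ^ 16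
  shift-by-power {K} h = ≤-trans (*-mono 0≤f 0≤g f≤ f≤) (≤-reflexive (trans (eq (K ^ 8)) (cong (1/16 *_) (sym (^-+ K 8 8)))))
    where
    0≤K : 0ℚ ≤ K
    0≤K = ≤-trans (≤! {0ℚ} {5/4}) h
    0≤f : 0ℚ ≤ K - 1ℚ
    0≤f = 0≤- (≤-trans (≤! {1ℚ} {5/4}) h)
    0≤g : 0ℚ ≤ 1/4 * K ^ 8
    0≤g = 0≤* (≤! {0ℚ} {1/4}) (0≤^ 8 0≤K)
    eq : ∀ a → 1/4 * a * (1/4 * a) ≡ 1/16 * (a * a)
    eq = solve-∀ ℚ-ring
    eq′ : ∀ K x → 1/4 * (K * x) ≡ K - 1ℚ + (1ℚ + 1/4 * (K * (x - (1ℚ + 1ℚ + 1ℚ + 1ℚ))))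
    eq′ = solve-∀ ℚ-ring
    7th : 1ℚ + 1ℚ + 1ℚ + 1ℚ ≤ K ^ 7
    7th = ≤-trans (≤! {1ℚ + 1ℚ + 1ℚ + 1ℚ} {5/4 ^ 7}) (^-mono 7 (≤! {0ℚ} {5/4}) h)
    f≤ : K - 1ℚ ≤ 1/4 * K ^ 8
    f≤ = ≤-by _ (0≤+ 0≤1 (0≤* (≤! {0ℚ} {1/4}) (0≤* 0≤K (0≤- 7th)))) (eq′ K (K ^ 7))

  -- Weighting an even power of `f = K - 1` by `1 + 2 f` only helps on average, because the odd
  -- moment is nonnegative, and it makes the term nonpositive where `K ≤ ½`. Other values below
  -- `5/4` contribute at most `1/4 ^ suc q`, so a large moment must come from `K ≥ 5/4`.
  unbalance-pointwise : ∀ K q → 0ℚ ≤ K →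
    (K - 1ℚ) ^ (suc q ℕ.* 2) + 2ℚ * (K - 1ℚ) ^ suc (suc q ℕ.* 2) ≤ 1/4 ^ suc q + 2ℚ * 1/16 ^ suc q * (K ^ suc (suc q ℕ.* 16) * 𝟙 (5/4 ≤ᵇ K))
  unbalance-pointwise K q 0≤K = ≤-trans (≤-reflexive (trans (eq (f ^ (suc q ℕ.* 2)) f) (cong (_* (1ℚ + 2ℚ * f)) (trans (^-* f (suc q) 2) (cong (_^ suc q) (cong (f *_) (*-identityʳ f))))))) (≤ᵇ-elim (λ c → s ^ suc q * (1ℚ + 2ℚ * f) ≤ 1/4 ^ suc q + 2ℚ * 1/16 ^ suc q * (K ^ suc (suc q ℕ.* 16) * 𝟙 c)) 5/4 K large small′)
    where
    f = K - 1ℚ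
    s = f * f
    eq : ∀ x f → x + 2ℚ * (f * x) ≡ x * (1ℚ + 2ℚ * f)
    eq = solve-∀ ℚ-ring
    -- Each factor `f²` costs sixteen powers of `K` by `shift-by-power`, and the weight
    -- `2 K - 1 ≤ 2 K` costs one more. This is the origin of the exponent of `K`.
    large : 5/4 ≤ K → s ^ suc q * (1ℚ + 2ℚ * f) ≤ 1/4 ^ suc q + 2ℚ * 1/16 ^ suc q * (K ^ suc (suc q ℕ.* 16) * 1ℚ)
    large h = ≤-trans (*-mono (0≤^ (suc q) (0≤sq f)) (0≤* 0≤2 0≤K) s≤ (≤-by 1ℚ 0≤1 (eq₂ K)))
        (≤-by (1/4 ^ suc q) (0≤^ (suc q) (≤! {0ℚ} {1/4}))
          (trans (cong (λ x → 1/4 ^ suc q + 2ℚ * 1/16 ^ suc q * (K * x * 1ℚ)) (^-* K (suc q) 16)) (eq₁ (1/4 ^ suc q) (1/16 ^ suc q) K ((K ^ 16) ^ suc q))))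
      where
      s≤ : s ^ suc q ≤ 1/16 ^ suc q * (K ^ 16) ^ suc q
      s≤ = ≤-trans (^-mono (suc q) (0≤sq f) (shift-by-power h)) (≤-reflexive (^-distrib-* 1/16 (K ^ 16) (suc q)))
      eq₂ : ∀ K → 2ℚ * K ≡ 1ℚ + 2ℚ * (K - 1ℚ) + 1ℚ
      eq₂ = solve-∀ ℚ-ring
      eq₁ : ∀ a b K x → a + 2ℚ * b * (K * x * 1ℚ) ≡ b * x * (2ℚ * K) + a
      eq₁ = solve-∀ ℚ-ring
    small′ : K < 5/4 → s ^ suc q * (1ℚ + 2ℚ * f) ≤ 1/4 ^ suc q + 2ℚ * 1/16 ^ suc q * (K ^ suc (suc q ℕ.* 16) * 0ℚ)
    small′ h = ≤-trans (small (≤-total 1ℚ K)) (≤-reflexive (sym (trans (cong (λ y → 1/4 ^ suc q + y) (trans (cong (2ℚ * 1/16 ^ suc q *_) (*-zeroʳ (K ^ suc (suc q ℕ.* 16)))) (*-zeroʳ (2ℚ * 1/16 ^ suc q)))) (+-identityʳ _))))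
      where
      K≤ : K ≤ 5/4
      K≤ = <⇒≤ h
      small : 1ℚ ≤ K ⊎ K ≤ 1ℚ → s ^ suc q * (1ℚ + 2ℚ * f) ≤ 1/4 ^ suc q
      -- Here `f² ≤ 1/16` and the weight is at most `2`; a single factor `1/16 * 2 ≤ 1/4` absorbs
      -- it.
      small (inj₁ 1≤K) = ≤-trans (*-mono {d = 2ℚ} (0≤^ (suc q) (0≤sq f)) 0≤2 (^-mono (suc q) (0≤sq f) (≤-trans (*-mono (0≤- 1≤K) (≤! {0ℚ} {1/4}) f≤ f≤) (≤-refl {1/16})))
          (≤-by (2ℚ * (5/4 - K) + ½) (0≤+ (0≤* 0≤2 (0≤- K≤)) 0≤½) (eq₁ K)))
          (≤-trans (≤-reflexive (eq₂ (1/16 ^ q))) (≤-trans (*-monoʳ {c = 1/16 ^ q} (0≤^ q (≤! {0ℚ} {1/16})) (≤! {1/16 * 2ℚ} {1/4})) (*-monoˡ (≤! {0ℚ} {1/4}) (^-mono q (≤! {0ℚ} {1/16}) (≤! {1/16} {1/4})))))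
        where
        eq₁ : ∀ K → 2ℚ ≡ 1ℚ + 2ℚ * (K - 1ℚ) + (2ℚ * (5/4 - K) + ½)
        eq₁ = solve-∀ ℚ-ring
        eq₂ : ∀ x → 1/16 * x * 2ℚ ≡ 1/16 * 2ℚ * x
        eq₂ = solve-∀ ℚ-ring
        eq₃ : ∀ K → 1/4 ≡ K - 1ℚ + (5/4 - K)
        eq₃ = solve-∀ ℚ-ring
        f≤ : K - 1ℚ ≤ 1/4
        f≤ = ≤-by (5/4 - K) (0≤- K≤) (eq₃ K)
      small (inj₂ K≤1) with ≤-total ½ K
      ... | inj₁ ½≤K = ≤-trans (*-mono {d = 1ℚ} (0≤^ (suc q) (0≤sq f)) 0≤1 (^-mono (suc q) (0≤sq f) s≤¼) (≤-by (2ℚ * (1ℚ - K)) (0≤* 0≤2 (0≤- K≤1)) (eq₁ K))) (≤-reflexive (*-identityʳ _))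
        where
        eq₁ : ∀ K → 1ℚ ≡ 1ℚ + 2ℚ * (K - 1ℚ) + 2ℚ * (1ℚ - K)
        eq₁ = solve-∀ ℚ-ring
        eq₂ : ∀ K → 1/4 ≡ (K - 1ℚ) * (K - 1ℚ) + (K - ½) * (1ℚ - K + ½)
        eq₂ = solve-∀ ℚ-ring
        s≤¼ : s ≤ 1/4
        s≤¼ = ≤-by _ (0≤* (0≤- ½≤K) (0≤+ (0≤- K≤1) 0≤½)) (eq₂ K)
      ... | inj₂ K≤½ = ≤-trans (≤-by (s ^ suc q * (2ℚ * (½ - K))) (0≤* (0≤^ (suc q) (0≤sq f)) (0≤* 0≤2 (0≤- K≤½))) (eq₁ (s ^ suc q) K)) (0≤^ (suc q) (≤! {0ℚ} {1/4}))
        where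
        eq₁ : ∀ x K → 0ℚ ≡ x * (1ℚ + 2ℚ * (K - 1ℚ)) + x * (2ℚ * (½ - K))
        eq₁ = solve-∀ ℚ-ring

  module _ {Z : Set} where

    ∑∑ : List Z → (Z → Z → ℚ) → ℚ
    ∑∑ P f = ∑ P (λ z → ∑ P (f z))

    ∑∑-mono : ∀ P {f g : Z → Z → ℚ} → (∀ z z′ → f z z′ ≤ g z z′) → ∑∑ P f ≤ ∑∑ P g
    ∑∑-mono P h = ∑-mono P (λ z → ∑-mono P (h z))

    ∑∑-cong : ∀ P {f g : Z → Z → ℚ} → (∀ z z′ → f z z′ ≡ g z z′) → ∑∑ P f ≡ ∑∑ P g
    ∑∑-cong P h = ∑-cong P (λ z → ∑-cong P (h z))

    ∑∑-+ : ∀ P f g → ∑∑ P (λ z z′ → f z z′ + g z z′) ≡ ∑∑ P f + ∑∑ P g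
    ∑∑-+ P f g = trans (∑-cong P (λ z → ∑-+ P (f z) (g z))) (∑-+ P _ _)

    ∑∑-*ˡ : ∀ P c f → ∑∑ P (λ z z′ → c * f z z′) ≡ c * ∑∑ P f
    ∑∑-*ˡ P c f = trans (∑-cong P (λ z → ∑-*ˡ P c (f z))) (∑-*ˡ P c _)

    ∑∑-const : ∀ P c → ∑∑ P (λ _ _ → c) ≡ # P * # P * c
    ∑∑-const P c = trans (∑-cong P (λ _ → ∑-const P c)) (trans (∑-const P (# P * c)) (sym (*-assoc (# P) (# P) c)))

  -- A Gram kernel deviating from its mean 1 in a high even moment has, by positivity of
  -- its odd moments, most of its r-th moment on the set where it exceeds 17/16.
  unbalance-arith : ∀ {n β a b c t x y m₁ m₂ m} → 0ℚ ≤ n → 1ℚ ≤ c → 0ℚ ≤ b → 1ℚ ≤ t →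
    β * n ≤ x → 0ℚ ≤ y → x + 2ℚ * y ≤ n * a + 2ℚ * b * m₁ → (d : ℚ) → 0ℚ ≤ d → d * b ≡ 1ℚ →
    2ℚ * 2ℚ * (c * t) ≤ d * (β - a) → m₂ ≤ n * t → m₁ ≤ m →
    n ≤ m × 2ℚ * (c * m₂) ≤ m
  unbalance-arith {n} {β} {a} {b} {c} {t} {x} {y} {m₁} {m₂} {m} 0≤n 1≤c 0≤b 1≤t h₁ h₂ h₃ d 0≤d db≡1 h₄ h₅ h₆ =
    ≤-trans (≤-by (n * (2ℚ * c * (t - 1ℚ) + 2ℚ * (c - 1ℚ) + 1ℚ)) (0≤* 0≤n (0≤+ (0≤+ (0≤* (0≤* 0≤2 0≤c) (0≤- 1≤t)) (0≤* 0≤2 (0≤- 1≤c))) 0≤1)) (eq₁ n c t)) main ,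
    ≤-trans (≤-by (2ℚ * c * (n * t - m₂)) (0≤* (0≤* 0≤2 0≤c) (0≤- h₅)) (eq₂ n c t m₂)) main
    where
    0≤c : 0ℚ ≤ c
    0≤c = ≤-trans 0≤1 1≤c
    eq₁ : ∀ n c t → 2ℚ * c * t * n ≡ n + n * (2ℚ * c * (t - 1ℚ) + 2ℚ * (c - 1ℚ) + 1ℚ)
    eq₁ = solve-∀ ℚ-ring
    eq₂ : ∀ n c t m₂ → 2ℚ * c * t * n ≡ 2ℚ * (c * m₂) + 2ℚ * c * (n * t - m₂)
    eq₂ = solve-∀ ℚ-ring
    step : d * (β - a) * n ≤ 2ℚ * m₁
    step = ≤-trans (≤-by _ (0≤* 0≤d (0≤+ (0≤+ (0≤- h₁) (0≤* 0≤2 h₂)) (0≤- h₃))) (eq₃ n β a b x y m₁ d)) (≤-reflexive (trans (cong (λ z → 2ℚ * z * m₁) db≡1) (cong (_* m₁) (*-identityʳ 2ℚ))))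
      where
      eq₃ : ∀ n β a b x y m₁ d → 2ℚ * (d * b) * m₁ ≡ d * (β - a) * n + d * (x - β * n + 2ℚ * y + (n * a + 2ℚ * b * m₁ - (x + 2ℚ * y)))
      eq₃ = solve-∀ ℚ-ring
    main : 2ℚ * c * t * n ≤ m
    main = ≤-by (½ * (n * (d * (β - a) - 2ℚ * 2ℚ * (c * t)) + (2ℚ * m₁ - d * (β - a) * n)) + (m - m₁))
      (0≤+ (0≤* 0≤½ (0≤+ (0≤* 0≤n (0≤- h₄)) (0≤- step))) (0≤- h₆)) (eq₄ n c t d (β - a) m₁ m)
      where
      eq₄ : ∀ n c t d e m₁ m → m ≡ 2ℚ * c * t * n + (½ * (n * (d * e - 2ℚ * 2ℚ * (c * t)) + (2ℚ * m₁ - d * e * n)) + (m - m₁))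
      eq₄ = solve-∀ ℚ-ring

  module _ {Z : Set} where

    unbalance : ∀ (P : List Z) (K : Z → Z → ℚ) q c β → (∀ z z′ → 0ℚ ≤ K z z′) → 1ℚ ≤ c →
      β * (# P * # P) ≤ ∑∑ P (λ z z′ → (K z z′ - 1ℚ) ^ (suc q ℕ.* 2)) →
      0ℚ ≤ ∑∑ P (λ z z′ → (K z z′ - 1ℚ) ^ suc (suc q ℕ.* 2)) →
      2ℚ * 2ℚ * (c * 17/16 ^ suc (suc q ℕ.* 16)) ≤ 16ℚ ^ suc q * (β - 1/4 ^ suc q) →
      # P * # P ≤ ∑∑ P (λ z z′ → K z z′ ^ suc (suc q ℕ.* 16)) ×
      2ℚ * (c * ∑∑ P (λ z z′ → K z z′ ^ suc (suc q ℕ.* 16) * 𝟙 (not (17/16 ≤ᵇ K z z′)))) ≤ ∑∑ P (λ z z′ → K z z′ ^ suc (suc q ℕ.* 16))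
    unbalance P K q c β 0≤K 1≤c hβ hodd hpar =
      unbalance-arith {β = β} (0≤* (0≤# P) (0≤# P)) 1≤c (0≤^ (suc q) (≤! {0ℚ} {1/16})) (1≤^ r (≤! {1ℚ} {17/16})) hβ hodd split (16ℚ ^ suc q) (0≤^ (suc q) (≤! {0ℚ} {16ℚ}))
        (trans (sym (^-distrib-* 16ℚ 1/16 (suc q))) (1^ (suc q))) hpar bad≤ good≤
      where
      r = suc (suc q ℕ.* 16)
      split = ≤-trans (≤-reflexive (sym (trans (∑∑-+ P _ _) (cong (λ y → ∑∑ P (λ z z′ → (K z z′ - 1ℚ) ^ (suc q ℕ.* 2)) + y) (∑∑-*ˡ P 2ℚ _)))))
        (≤-trans (∑∑-mono P (λ z z′ → unbalance-pointwise (K z z′) q (0≤K z z′)))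
          (≤-reflexive (trans (∑∑-+ P _ _) (cong₂ _+_ (∑∑-const P (1/4 ^ suc q)) (∑∑-*ˡ P (2ℚ * 1/16 ^ suc q) _)))))
      bad≤ : ∑∑ P (λ z z′ → K z z′ ^ r * 𝟙 (not (17/16 ≤ᵇ K z z′))) ≤ # P * # P * 17/16 ^ r
      bad≤ = ≤-trans (∑∑-mono P (λ z z′ → pointwise (K z z′) (0≤K z z′))) (≤-reflexive (∑∑-const P (17/16 ^ r)))
        where
        pointwise : ∀ k → 0ℚ ≤ k → k ^ r * 𝟙 (not (17/16 ≤ᵇ k)) ≤ 17/16 ^ r
        pointwise k p = ≤ᵇ-elim (λ c → k ^ r * 𝟙 (not c) ≤ 17/16 ^ r) 17/16 k
          (λ _ → ≤-trans (≤-reflexive (*-zeroʳ (k ^ r))) (0≤^ r (≤! {0ℚ} {17/16})))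
          (λ h → ≤-trans (≤-reflexive (*-identityʳ (k ^ r))) (^-mono r p (<⇒≤ h)))
      good≤ : ∑∑ P (λ z z′ → K z z′ ^ r * 𝟙 (5/4 ≤ᵇ K z z′)) ≤ ∑∑ P (λ z z′ → K z z′ ^ r)
      good≤ = ∑∑-mono P (λ z z′ → ≤-trans (*-monoˡ (0≤^ r (0≤K z z′)) (𝟙≤1 (5/4 ≤ᵇ K z z′))) (≤-reflexive (*-identityʳ _)))

-- Random samples: second moments and amplification

module Tuples where

  open Rationals
  open Sums
  open Unbalancing using (16ℚ)
  open import Data.List.Membership.Propositional.Properties using (∈-concatMap⁻; ∈-map⁻)
  import Data.List.Membership.Propositional as L

  tuples : {A : Set} → List A → ℕ → List (List A)
  tuples xs zero = [] ∷ []
  tuples xs (suc m) = concatMap (λ x → map (x ∷_) (tuples xs m)) xs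

  module _ {A : Set} where

    ∑-tuples : ∀ (xs : List A) m F → ∑ (tuples xs (suc m)) F ≡ ∑ xs (λ x → ∑ (tuples xs m) (λ t → F (x ∷ t)))
    ∑-tuples xs m F = trans (∑-concatMap _ xs F) (∑-cong xs (λ x → ∑-map (x ∷_) (tuples xs m) F))

    #-tuples : ∀ (xs : List A) m → # (tuples xs m) ≡ # xs ^ m
    #-tuples xs zero = +-identityʳ 1ℚ
    #-tuples xs (suc m) = trans (∑-tuples xs m _) (trans (∑-const xs _) (cong (# xs *_) (#-tuples xs m)))

    ∑-tuples-≤ : ∀ (s : A → A) xs ys → (∀ (F : A → ℚ) → (∀ x → 0ℚ ≤ F x) → ∑ xs F ≤ ∑ ys (λ y → F (s y))) →
      ∀ m (F : List A → ℚ) → (∀ t → 0ℚ ≤ F t) → ∑ (tuples xs m) F ≤ ∑ (tuples ys m) (λ t → F (map s t))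
    ∑-tuples-≤ s xs ys h zero F 0≤F = ≤-refl
    ∑-tuples-≤ s xs ys h (suc m) F 0≤F = ≤-trans (≤-reflexive (∑-tuples xs m F))
      (≤-trans (h _ (λ x → 0≤∑ (tuples xs m) (λ t → 0≤F (x ∷ t))))
        (≤-trans (∑-mono ys (λ y → ∑-tuples-≤ s xs ys h m (λ t → F (s y ∷ t)) (λ t → 0≤F (s y ∷ t))))
          (≤-reflexive (sym (∑-tuples ys m (λ t → F (map s t)))))))

    length-tuples : ∀ (xs : List A) m t → t ∈ tuples xs m → length t ≡ m
    length-tuples xs zero t (here refl) = refl
    length-tuples xs (suc m) t t∈ with L.find (∈-concatMap⁻ (λ x → map (x ∷_) (tuples xs m)) {xs = xs} t∈)
    ... | x , _ , t∈′ with ∈-map⁻ (x ∷_) t∈′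
    ...   | u , u∈ , refl = cong suc (length-tuples xs m u u∈)

    module _ (xs : List A) (d : A → ℚ) (mean-zero : ∑ xs d ≡ 0ℚ) (d² : ∀ x → d x * d x ≤ 1ℚ) where

      -- Independent draws of mean zero: the cross terms sum to zero over the first coordinate, so
      -- variances add up.
      second-moment : ∀ m → ∑ (tuples xs m) (λ t → ∑ t d * ∑ t d) ≤ ι m * # xs ^ m
      second-moment zero = ≤-refl
      second-moment (suc m) = ≤-trans (≤-reflexive expand)
        (≤-trans (+-mono-≤ (≤-trans (*-monoˡ (0≤^ m (0≤# xs)) (∑-mono xs d²)) (≤-refl {# xs ^ m * # xs})) (*-monoˡ (0≤# xs) (second-moment m)))
          (≤-reflexive (eq (# xs ^ m) (# xs) (ι m))))
        where
        Tm = tuples xs m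
        V = ∑ Tm (λ t → ∑ t d * ∑ t d)
        S = ∑ Tm (λ t → ∑ t d)
        eq : ∀ a n i → a * n + n * (i * a) ≡ (1ℚ + i) * (n * a)
        eq = solve-∀ ℚ-ring
        sq : ∀ a b → (a + b) * (a + b) ≡ a * a + 2ℚ * a * b + b * b
        sq = solve-∀ ℚ-ring
        inner : ∀ x → ∑ Tm (λ t → (d x + ∑ t d) * (d x + ∑ t d)) ≡ # xs ^ m * (d x * d x) + d x * (2ℚ * S) + V
        inner x = trans (∑-cong Tm (λ t → sq (d x) (∑ t d))) (trans (∑-+ Tm _ _)
          (cong (_+ V) (trans (∑-+ Tm _ _) (cong₂ _+_ (trans (∑-const Tm (d x * d x)) (cong (_* (d x * d x)) (#-tuples xs m)))
            (trans (∑-*ˡ Tm (2ℚ * d x) _) (c (d x) S))))))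
          where
          c : ∀ a s → 2ℚ * a * s ≡ a * (2ℚ * s)
          c = solve-∀ ℚ-ring
        expand : ∑ (tuples xs (suc m)) (λ t → ∑ t d * ∑ t d) ≡ # xs ^ m * ∑ xs (λ x → d x * d x) + # xs * V
        expand = trans (∑-tuples xs m _) (trans (∑-cong xs inner) (trans (∑-+ xs _ _) (cong₂ _+_ (trans (∑-+ xs _ _)
          (trans (cong₂ _+_ (∑-*ˡ xs (# xs ^ m) _) (trans (∑-*ʳ xs (2ℚ * S) d) (trans (cong (_* (2ℚ * S)) mean-zero) (*-zeroˡ (2ℚ * S))))) (+-identityʳ (# xs ^ m * ∑ xs (λ x → d x * d x))))) (∑-const xs V))))

      -- With `θ` at least sixteen times the variance, a block fails with probability at most
      -- `1/16`, which is what `penalty` is calibrated to.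
      chebyshev : ∀ m θ → 16ℚ * ι m ≤ θ → 0ℚ < θ → 16ℚ * ∑ (tuples xs m) (λ t → 𝟙 (not (∑ t d * ∑ t d ≤ᵇ θ))) ≤ # (tuples xs m)
      chebyshev m θ hθ 0<θ = *-cancelˡ 0<θ (≤-trans (≤-reflexive (eq θ F)) (≤-trans (*-monoˡ (≤! {0ℚ} {16ℚ}) (≤-trans markov (second-moment m)))
        (≤-trans (≤-reflexive (sym (*-assoc 16ℚ (ι m) _))) (≤-trans (*-monoʳ (0≤^ m (0≤# xs)) hθ) (≤-reflexive (cong (θ *_) (sym (#-tuples xs m))))))))
        where
        F = ∑ (tuples xs m) (λ t → 𝟙 (not (∑ t d * ∑ t d ≤ᵇ θ)))
        eq : ∀ a b → a * (16ℚ * b) ≡ 16ℚ * (a * b)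
        eq = solve-∀ ℚ-ring
        pt : ∀ x → 0ℚ ≤ x → θ * 𝟙 (not (x ≤ᵇ θ)) ≤ x
        pt x p = ≤ᵇ-elim (λ c → θ * 𝟙 (not c) ≤ x) x θ (λ _ → ≤-trans (≤-reflexive (*-zeroʳ θ)) p) (λ h → ≤-trans (≤-reflexive (*-identityʳ θ)) (<⇒≤ h))
        markov : θ * F ≤ ∑ (tuples xs m) (λ t → ∑ t d * ∑ t d)
        markov = ≤-trans (≤-reflexive (sym (∑-*ˡ (tuples xs m) θ _))) (∑-mono (tuples xs m) (λ t → pt _ (0≤sq (∑ t d))))

    -- An exponential moment: a factor `16` for each failing block. If a block fails with
    -- probability at most `1/16`, the mean factor is at most `2`, so by Markov the penalty of `b`
    -- blocks reaches `4 ^ b` with probability at most `½ ^ b`. This amplifies Chebyshev without any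
    -- large deviation estimate.
    penalty : (A → Bool) → List A → ℚ
    penalty p [] = 1ℚ
    penalty p (x ∷ t) = (1ℚ + (16ℚ - 1ℚ) * 𝟙 (p x)) * penalty p t

    factor≥1 : ∀ b → 1ℚ ≤ 1ℚ + (16ℚ - 1ℚ) * 𝟙 b
    factor≥1 true = ≤!
    factor≥1 false = ≤!

    0≤factor : ∀ b → 0ℚ ≤ 1ℚ + (16ℚ - 1ℚ) * 𝟙 b
    0≤factor b = ≤-trans 0≤1 (factor≥1 b)

    0≤penalty : ∀ p t → 0ℚ ≤ penalty p t
    0≤penalty p [] = 0≤1
    0≤penalty p (x ∷ t) = 0≤* (0≤factor (p x)) (0≤penalty p t)

    penalty-total : ∀ p xs b → 16ℚ * ∑ xs (λ x → 𝟙 (p x)) ≤ # xs → ∑ (tuples xs b) (penalty p) ≤ (2ℚ * # xs) ^ b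
    penalty-total p xs zero h = ≤!
    penalty-total p xs (suc b) h = ≤-trans (≤-reflexive (trans (∑-tuples xs b (penalty p)) (∑-∑-* xs (tuples xs b) _ (penalty p))))
      (*-mono (0≤∑ xs (λ x → 0≤factor (p x))) (0≤^ b (0≤* 0≤2 (0≤# xs))) factor (penalty-total p xs b h))
      where
      F = ∑ xs (λ x → 𝟙 (p x))
      eq : ∀ n f → 2ℚ * n ≡ n + (16ℚ - 1ℚ) * f + (n - 16ℚ * f + f)
      eq = solve-∀ ℚ-ring
      factor : ∑ xs (λ x → 1ℚ + (16ℚ - 1ℚ) * 𝟙 (p x)) ≤ 2ℚ * # xs
      factor = ≤-trans (≤-reflexive (trans (∑-+ xs _ _) (cong (λ y → # xs + y) (∑-*ˡ xs (16ℚ - 1ℚ) _)))) (≤-by _ (0≤+ (0≤- h) (0≤∑ xs (λ x → 0≤𝟙 (p x)))) (eq (# xs) F))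

    -- If every block failed one of the two tests, each would contribute a factor at least `16` to
    -- the product of penalties.
    common : ∀ (p q : A → Bool) t → penalty p t * penalty q t < 16ℚ ^ length t → ∃ λ x → x ∈ t × p x ≡ false × q x ≡ false
    common p q [] h = ⊥-elim (<⇒≱ h (≤-reflexive (sym (*-identityʳ 1ℚ))))
    common p q (x ∷ t) h with p x in px | q x in qx
    ... | false | false = x , here refl , px , qx
    ... | true | b = rec (*-cancel-< (ℚ.≤-<-trans (≤-trans (*-monoʳ (0≤* (0≤penalty p t) (0≤penalty q t)) (≤-trans (≤-reflexive (sym (*-identityʳ 16ℚ))) (*-monoˡ (≤! {0ℚ} {16ℚ}) (factor≥1 b)))) (≤-reflexive (sh 16ℚ (1ℚ + (16ℚ - 1ℚ) * 𝟙 b) (penalty p t) (penalty q t)))) h))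
      where
      sh : ∀ a b c d → a * b * (c * d) ≡ a * c * (b * d)
      sh = solve-∀ ℚ-ring
      *-cancel-< : ∀ {a b} → 16ℚ * a < 16ℚ * b → a < b
      *-cancel-< = ℚ.*-cancelˡ-<-nonNeg 16ℚ
      rec : penalty p t * penalty q t < 16ℚ ^ length t → _
      rec h′ with common p q t h′
      ... | y , m , r = y , there m , r
    ... | false | true = rec (*-cancel-< (ℚ.≤-<-trans (≤-reflexive (sh 16ℚ (penalty p t) (penalty q t))) h))
      where
      sh : ∀ a c d → a * (c * d) ≡ (1ℚ + (16ℚ - 1ℚ) * 0ℚ) * c * (a * d)
      sh = solve-∀ ℚ-ring
      *-cancel-< : ∀ {a b} → 16ℚ * a < 16ℚ * b → a < b
      *-cancel-< = ℚ.*-cancelˡ-<-nonNeg 16ℚ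
      rec : penalty p t * penalty q t < 16ℚ ^ length t → _
      rec h′ with common p q t h′
      ... | y , m , r = y , there m , r

-- Almost periods by sampling

module AlmostPeriods where

  open Rationals
  open Sums
  open Unbalancing using (16ℚ)
  open Tuples
  open import Data.List.Membership.Propositional.Properties using (∈-filter⁻)

  data Reach (T : List ℤ) : ℕ → ℤ → Set where
    reach-0 : Reach T 0 ℤ.0ℤ
    reach-+ : ∀ {j v t t′} → Reach T j v → t ∈ T → t′ ∈ T → Reach T (suc j) (v ℤ.+ (t ℤ.- t′))

  4ℚ : ℚ
  4ℚ = + 4 / 1

  -- `f y` is the share of `A` that `S` hits from `y`, to be estimated from `b` blocks of `m` points
  -- of `A`. `Pm` has room for all sets `A - t` with `t` in `P₂`, and `Pp` for the positions to
  -- which a walk with steps in `P₂ - P₂` moves `A`.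
  module Sampling (A Pm Pp P₂ : List ℤ) (S : ℤ → Bool) (ε : ℚ) (m b : ℕ) (0<A : 0ℚ < # A) (0≤ε : 0ℚ < ε)
    (hm : 16ℚ * ι m ≤ (ε * ι m) * (ε * ι m)) (0<m : 0ℚ < ι m) (0<Pp : 0ℚ < # Pp)
    (A⊂Pm : ∀ t → t ∈ P₂ → ∀ (F : ℤ → ℚ) → (∀ x → 0ℚ ≤ F x) → ∑ A F ≤ ∑ Pm (λ y → F (y ℤ.+ t)))
    where

    N = # A

    f : ℤ → ℚ
    f y = inv N * ∑ A (λ z → 𝟙 (S (y ℤ.- z)))

    N*f : ∀ y → N * f y ≡ ∑ A (λ z → 𝟙 (S (y ℤ.- z)))
    N*f y = trans (sym (*-assoc N (inv N) _)) (trans (cong (_* ∑ A (λ z → 𝟙 (S (y ℤ.- z)))) (inv-pos 0<A)) (*-identityˡ _))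

    0≤f : ∀ y → 0ℚ ≤ f y
    0≤f y = 0≤* (0≤inv (<⇒≤ 0<A)) (0≤∑ A (λ z → 0≤𝟙 (S (y ℤ.- z))))

    f≤1 : ∀ y → f y ≤ 1ℚ
    f≤1 y = *-cancelˡ 0<A (≤-trans (≤-reflexive (N*f y)) (≤-trans (∑-mono A (λ z → 𝟙≤1 (S (y ℤ.- z)))) (≤-reflexive (sym (*-identityʳ N)))))

    θ : ℚ
    θ = (ε * ι m) * (ε * ι m)

    dev : ℤ → ℚ → List ℤ → ℚ
    dev y φ β = ∑ β (λ z → 𝟙 (S (y ℤ.- z)) - φ)

    fails : ℤ → ℚ → List ℤ → Bool
    fails y φ β = not (dev y φ β * dev y φ β ≤ᵇ θ)

    bad : List (List ℤ) → ℤ → Bool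
    bad τ y = 4ℚ ^ b ≤ᵇ penalty (fails y (f y)) τ

    samples : List (List ℤ)
    samples = tuples A m

    fails-rare : ∀ y → 16ℚ * ∑ samples (λ β → 𝟙 (fails y (f y) β)) ≤ # samples
    fails-rare y = chebyshev A (λ z → 𝟙 (S (y ℤ.- z)) - f y) mean-zero (λ z → bound (S (y ℤ.- z))) m θ hm (0<* (0<* 0≤ε 0<m) (0<* 0≤ε 0<m))
      where
      mean-zero : ∑ A (λ z → 𝟙 (S (y ℤ.- z)) - f y) ≡ 0ℚ
      mean-zero = trans (∑-- A _ _) (trans (cong₂ _-_ (sym (N*f y)) (∑-const A (f y))) (ℚ.+-inverseʳ (N * f y)))
      eq₁ : ∀ x → 1ℚ ≡ (1ℚ - x) * (1ℚ - x) + x * (1ℚ + (1ℚ - x))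
      eq₁ = solve-∀ ℚ-ring
      eq₀ : ∀ x → 1ℚ ≡ (0ℚ - x) * (0ℚ - x) + (1ℚ - x) * (1ℚ + x)
      eq₀ = solve-∀ ℚ-ring
      bound : ∀ c → (𝟙 c - f y) * (𝟙 c - f y) ≤ 1ℚ
      bound true = ≤-by _ (0≤* (0≤f y) (0≤+ 0≤1 (0≤- (f≤1 y)))) (eq₁ (f y))
      bound false = ≤-by _ (0≤* (0≤- (f≤1 y)) (0≤+ 0≤1 (0≤f y))) (eq₀ (f y))

    G : List (List (List ℤ))
    G = tuples samples b

    bad-rare : ∀ y → 2ℚ ^ b * ∑ G (λ τ → 𝟙 (bad τ y)) ≤ # G
    bad-rare y = *-cancelˡ (0<^ b (ℚ.positive⁻¹ 2ℚ)) (≤-trans (≤-reflexive (trans (sym (*-assoc (2ℚ ^ b) (2ℚ ^ b) _)) (cong (_* ∑ G (λ τ → 𝟙 (bad τ y))) (sym (^-distrib-* 2ℚ 2ℚ b)))))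
      (≤-trans (≤-reflexive (sym (∑-*ˡ G (4ℚ ^ b) _)))
        (≤-trans (∑-mono G (λ τ → pt (penalty (fails y (f y)) τ) (0≤penalty (fails y (f y)) τ)))
          (≤-trans (penalty-total (fails y (f y)) samples b (fails-rare y)) (≤-reflexive (trans (^-distrib-* 2ℚ (# samples) b) (cong (2ℚ ^ b *_) (sym (#-tuples samples b)))))))))
      where
      pt : ∀ x → 0ℚ ≤ x → 4ℚ ^ b * 𝟙 (4ℚ ^ b ≤ᵇ x) ≤ x
      pt x p = ≤ᵇ-elim (λ c → 4ℚ ^ b * 𝟙 c ≤ x) (4ℚ ^ b) x (λ h → ≤-trans (≤-reflexive (*-identityʳ (4ℚ ^ b))) h) (λ _ → ≤-trans (≤-reflexive (*-zeroʳ (4ℚ ^ b))) p)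

    good : List (List ℤ) → Bool
    good τ = 2ℚ ^ b * ∑ Pp (λ y → 𝟙 (bad τ y)) ≤ᵇ 2ℚ * # Pp

    -- Markov over the samples: on average at most a share `½ ^ b` of `Pp` is bad, so at least half
    -- of the samples stay below twice that share.
    good-common : # G ≤ 2ℚ * ∑ G (λ τ → 𝟙 (good τ))
    good-common = *-cancelˡ 0<Pp (≤-by _ (0≤+ (0≤- X≤) (0≤- ≤X)) (eq (# Pp) (# G) (∑ G (λ τ → 𝟙 (good τ))) X))
      where
      X = ∑ G (λ τ → 2ℚ ^ b * ∑ Pp (λ y → 𝟙 (bad τ y)))
      eq : ∀ p n g x → p * (2ℚ * g) ≡ p * n + (p * n - x + (x - 2ℚ * p * (n - g)))
      eq = solve-∀ ℚ-ring
      X≤ : X ≤ # Pp * # G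
      X≤ = ≤-trans (≤-reflexive (trans (∑-cong G (λ τ → sym (∑-*ˡ Pp (2ℚ ^ b) _))) (∑-swap G Pp _)))
        (≤-trans (∑-mono Pp (λ y → ≤-trans (≤-reflexive (∑-*ˡ G (2ℚ ^ b) _)) (bad-rare y))) (≤-reflexive (∑-const Pp (# G))))
      pt : ∀ x → 0ℚ ≤ x → 2ℚ * # Pp * (1ℚ - 𝟙 (x ≤ᵇ 2ℚ * # Pp)) ≤ x
      pt x p = ≤ᵇ-elim (λ c → 2ℚ * # Pp * (1ℚ - 𝟙 c) ≤ x) x (2ℚ * # Pp) (λ _ → ≤-trans (≤-reflexive (*-zeroʳ (2ℚ * # Pp))) p)
        (λ h → ≤-trans (≤-reflexive (*-identityʳ (2ℚ * # Pp))) (<⇒≤ h))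
      ≤X : 2ℚ * # Pp * (# G - ∑ G (λ τ → 𝟙 (good τ))) ≤ X
      ≤X = ≤-trans (≤-reflexive (trans (cong (2ℚ * # Pp *_) (sym (∑-- G _ _))) (sym (∑-*ˡ G (2ℚ * # Pp) _))))
        (∑-mono G (λ τ → pt (2ℚ ^ b * ∑ Pp (λ y → 𝟙 (bad τ y))) (0≤* (0≤^ b 0≤2) (0≤∑ Pp (λ y → 0≤𝟙 (bad τ y))))))

    translate : ℤ → List (List ℤ) → List (List ℤ)
    translate t = map (map (λ z → z ℤ.+ t))

    bases : List (List (List ℤ))
    bases = tuples (tuples Pm m) b

    -- Every base tuple collects the translates t for which it becomes a good sample.
    periods : List (List ℤ) → List ℤ
    periods τ = filterᵇ (λ t → good (translate t τ)) P₂

    -- For each `t` every sample is the translate by `t` of a base in `Pm`, so `t` is a period of at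
    -- least half as many bases as there are samples. Averaging over bases then yields one with many
    -- periods.
    many-periods : 0ℚ < # bases → ∃ λ τ → τ ∈ bases × # P₂ * # G ≤ 2ℚ * # bases * # (periods τ)
    many-periods 0<bases = ≤-avg-∃ bases {λ τ → 2ℚ * # bases * # (periods τ)} 0<bases avg
      where
      per-t : ∀ t → t ∈ P₂ → # G ≤ 2ℚ * ∑ bases (λ τ → 𝟙 (good (translate t τ)))
      per-t t t∈ = ≤-trans good-common (*-monoˡ 0≤2 (∑-tuples-≤ (map (λ z → z ℤ.+ t)) samples (tuples Pm m)
        (λ F 0≤F → ∑-tuples-≤ (λ z → z ℤ.+ t) A Pm (A⊂Pm t t∈) m F 0≤F) b (λ τ → 𝟙 (good τ)) (λ τ → 0≤𝟙 (good τ))))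
      eq : ∀ n x → n * (2ℚ * x) ≡ 2ℚ * n * x
      eq = solve-∀ ℚ-ring
      sum : # P₂ * # G ≤ 2ℚ * ∑ bases (λ τ → # (periods τ))
      sum = ≤-trans (≤-reflexive (sym (∑-const P₂ (# G)))) (≤-trans (∑-mono∈ P₂ per-t) (≤-reflexive (trans (∑-*ˡ P₂ 2ℚ _)
        (cong (2ℚ *_) (trans (∑-swap P₂ bases _) (∑-cong bases (λ τ → sym (#-filter (λ t → good (translate t τ)) P₂))))))))
      avg : # bases * (# P₂ * # G) ≤ ∑ bases (λ τ → 2ℚ * # bases * # (periods τ))
      avg = ≤-trans (*-monoˡ (<⇒≤ 0<bases) sum) (≤-reflexive (trans (eq (# bases) (∑ bases (λ τ → # (periods τ)))) (sym (∑-*ˡ bases (2ℚ * # bases) _))))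

    module _ (τ : List (List ℤ)) (τ-len : length τ ≡ b) (τ-blocks : ∀ β → β ∈ τ → length β ≡ m) where

      dev-translate : ∀ t y φ β → dev (y ℤ.+ t) φ (map (λ z → z ℤ.+ t) β) ≡ dev y φ β
      dev-translate t y φ β = trans (∑-map (λ z → z ℤ.+ t) β _) (∑-cong β (λ z → cong (λ w → 𝟙 (S w) - φ) (eq y t z)))
        where
        eq : ∀ y t z → y ℤ.+ t ℤ.- (z ℤ.+ t) ≡ y ℤ.- z
        eq = ℤ.solve-∀

      penalty-translate : ∀ t y φ τ′ → penalty (fails (y ℤ.+ t) φ) (translate t τ′) ≡ penalty (fails y φ) τ′
      penalty-translate t y φ [] = refl
      penalty-translate t y φ (β ∷ τ′) = cong₂ (λ u v → (1ℚ + (16ℚ - 1ℚ) * 𝟙 (not (u * u ≤ᵇ θ))) * v) (dev-translate t y φ β) (penalty-translate t y φ τ′)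

      dev-difference : ∀ y φ φ′ β → dev y φ β - dev y φ′ β ≡ # β * (φ′ - φ)
      dev-difference y φ φ′ β = trans (sym (∑-- β _ _)) (trans (∑-cong β (λ z → eq (𝟙 (S (y ℤ.- z))) φ φ′)) (∑-const β (φ′ - φ)))
        where
        eq : ∀ a b c → a - b - (a - c) ≡ c - b
        eq = solve-∀ ℚ-ring

      -- Both values are close to the empirical mean of a common block, which does not move
      -- when the sample and the point are translated together.
      close : ∀ y t t′ → bad (translate t τ) (y ℤ.+ t) ≡ false → bad (translate t′ τ) (y ℤ.+ t′) ≡ false → f (y ℤ.+ t′) ≤ f (y ℤ.+ t) + 2ℚ * ε
      close y t t′ h h′ = conclude (common (fails y φ) (fails y φ′) τ (<-≤-trans
          (ℚ.≤-<-trans (*-monoʳ (0≤penalty (fails y φ′) τ) (<⇒≤ pen)) (ℚ.*-monoʳ-<-pos (4ℚ ^ b) {{ℚ.positive (0<^ b (ℚ.positive⁻¹ 4ℚ))}} pen′))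
          (≤-reflexive (trans (sym (^-distrib-* 4ℚ 4ℚ b)) (cong (16ℚ ^_) (sym τ-len))))))
        where
        φ = f (y ℤ.+ t)
        φ′ = f (y ℤ.+ t′)
        pen : penalty (fails y φ) τ < 4ℚ ^ b
        pen = subst (_< 4ℚ ^ b) (penalty-translate t y φ τ) (≤ᵇ-false h)
        pen′ : penalty (fails y φ′) τ < 4ℚ ^ b
        pen′ = subst (_< 4ℚ ^ b) (penalty-translate t′ y φ′ τ) (≤ᵇ-false h′)
        conclude : ∃ (λ β → β ∈ τ × fails y φ β ≡ false × fails y φ′ β ≡ false) → φ′ ≤ φ + 2ℚ * ε
        conclude (β , β∈ , p , p′) = *-cancelˡ 0<m (≤-by (ε * ι m - D + (ε * ι m - - D′)) (0≤+ (0≤- (sq-≤ 0≤εm (≰ᵇ-false p))) (0≤- (sq-≤ 0≤εm (≤-trans (≤-reflexive (neg D′)) (≰ᵇ-false p′)))))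
            (trans (eq (ι m) ε φ φ′) (trans (cong (λ x → ι m * φ′ + (ε * ι m + ε * ι m - x)) (sym diff)) (eq₂ (ι m * φ′) (ε * ι m) D D′))))
          where
          D = dev y φ β
          D′ = dev y φ′ β
          0≤εm : 0ℚ ≤ ε * ι m
          0≤εm = <⇒≤ (0<* 0≤ε 0<m)
          diff : D - D′ ≡ ι m * (φ′ - φ)
          diff = trans (dev-difference y φ φ′ β) (cong (_* (φ′ - φ)) (trans (#≡length β) (cong ι (τ-blocks β β∈))))
          neg : ∀ x → - x * - x ≡ x * x
          neg = solve-∀ ℚ-ring
          eq : ∀ m e a b → m * (a + 2ℚ * e) ≡ m * b + (e * m + e * m - m * (b - a))
          eq = solve-∀ ℚ-ring
          eq₂ : ∀ a e d d′ → a + (e + e - (d - d′)) ≡ a + (e - d + (e - - d′))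
          eq₂ = solve-∀ ℚ-ring

      close′ : ∀ y t t′ → f (y ℤ.+ t′) ≤ f (y ℤ.+ t) + 2ℚ * ε + 𝟙 (bad (translate t τ) (y ℤ.+ t)) + 𝟙 (bad (translate t′ τ) (y ℤ.+ t′))
      close′ y t t′ = go (bad (translate t τ) (y ℤ.+ t)) (bad (translate t′ τ) (y ℤ.+ t′)) refl refl
       where
       go : ∀ c c′ → bad (translate t τ) (y ℤ.+ t) ≡ c → bad (translate t′ τ) (y ℤ.+ t′) ≡ c′ → f (y ℤ.+ t′) ≤ f (y ℤ.+ t) + 2ℚ * ε + 𝟙 c + 𝟙 c′
       go false false h h′ = ≤-trans (close y t t′ h h′) (≤-by 0ℚ ≤-refl (eq (f (y ℤ.+ t)) ε))
        where
        eq : ∀ a e → a + 2ℚ * e + 0ℚ + 0ℚ ≡ a + 2ℚ * e + 0ℚ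
        eq = solve-∀ ℚ-ring
       go true c _ _ = ≤-trans (f≤1 (y ℤ.+ t′)) (≤-by _ (0≤+ (0≤+ (0≤f (y ℤ.+ t)) (0≤* 0≤2 (<⇒≤ 0≤ε))) (0≤𝟙 c)) (eq (f (y ℤ.+ t)) ε (𝟙 c)))
        where
        eq : ∀ a e c → a + 2ℚ * e + 1ℚ + c ≡ 1ℚ + (a + 2ℚ * e + c)
        eq = solve-∀ ℚ-ring
       go false true _ _ = ≤-trans (f≤1 (y ℤ.+ t′)) (≤-by _ (0≤+ (0≤f (y ℤ.+ t)) (0≤* 0≤2 (<⇒≤ 0≤ε))) (eq (f (y ℤ.+ t)) ε))
        where
        eq : ∀ a e → a + 2ℚ * e + 0ℚ + 1ℚ ≡ 1ℚ + (a + 2ℚ * e)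
        eq = solve-∀ ℚ-ring

      module _ (ℓ : ℕ) (A⊂Pp : ∀ j v → j ℕ.≤ ℓ → Reach P₂ j v → ∀ (F : ℤ → ℚ) → (∀ x → 0ℚ ≤ F x) → ∑ A (λ y → F (y ℤ.+ v)) ≤ ∑ Pp F) where

        loss : ℚ
        loss = 2ℚ * ε * N + 4ℚ * # Pp * inv (2ℚ ^ b)

        good-bad : ∀ t → t ∈ periods τ → ∑ Pp (λ y → 𝟙 (bad (translate t τ) y)) ≤ 2ℚ * # Pp * inv (2ℚ ^ b)
        good-bad t t∈ = *-cancelˡ 0<2^b (≤-trans (≤ᵇ-T (proj₂ (∈-filter⁻ _ {xs = P₂} t∈))) (≤-reflexive (trans (sym (*-identityʳ _)) (trans (cong (2ℚ * # Pp *_) (sym (inv-pos 0<2^b))) (eq (2ℚ * # Pp) (2ℚ ^ b) _)))))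
          where
          0<2^b = 0<^ b (ℚ.positive⁻¹ 2ℚ)
          eq : ∀ a b c → a * (b * c) ≡ b * (a * c)
          eq = solve-∀ ℚ-ring

        Reach-mono : ∀ {j v} → Reach (periods τ) j v → Reach P₂ j v
        Reach-mono reach-0 = reach-0
        Reach-mono (reach-+ r m m′) = reach-+ (Reach-mono r) (proj₁ (∈-filter⁻ _ {xs = P₂} m)) (proj₁ (∈-filter⁻ _ {xs = P₂} m′))

        -- The point `y + v - t′` is carried to `y + v` by `t′` and to the next position of the walk
        -- by `t`, so `close′` compares consecutive positions. Both lie in `Pp`, where bad points
        -- are rare.
        almost-period : ∀ j v → j ℕ.≤ ℓ → Reach (periods τ) j v → ∑ A f ≤ ∑ A (λ y → f (y ℤ.+ v)) + ι j * loss
        almost-period zero _ _ reach-0 = ≤-by 0ℚ ≤-refl (trans (cong (_+ 0ℚ * loss) (∑-cong A (λ y → cong f (ℤ.+-identityʳ y)))) (eq (∑ A f) loss))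
          where
          eq : ∀ a l → a + 0ℚ * l ≡ a + 0ℚ
          eq = solve-∀ ℚ-ring
        almost-period (suc j) _ j≤ r@(reach-+ {v = v} {t} {t′} r′ t∈ t′∈) = ≤-trans (almost-period j v j≤′ r′)
          (≤-trans (+-mono-≤ step (≤-refl {ι j * loss})) (≤-reflexive (eq (∑ A (λ y → f (y ℤ.+ (v ℤ.+ (t ℤ.- t′))))) loss (ι j))))
          where
          j≤′ = ℕ.≤-trans (ℕ.n≤1+n j) j≤
          eq : ∀ a l i → a + l + i * l ≡ a + (1ℚ + i) * l
          eq = solve-∀ ℚ-ring
          shift : ∀ y v t t′ → y ℤ.+ v ℤ.- t′ ℤ.+ t ≡ y ℤ.+ (v ℤ.+ (t ℤ.- t′))
          shift = ℤ.solve-∀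
          shift′ : ∀ y v t′ → y ℤ.+ v ℤ.- t′ ℤ.+ t′ ≡ y ℤ.+ v
          shift′ = ℤ.solve-∀
          w = v ℤ.+ (t ℤ.- t′)
          b₁ b₂ : ℤ → ℚ
          b₁ y = 𝟙 (bad (translate t τ) y)
          b₂ y = 𝟙 (bad (translate t′ τ) y)
          pointwise : ∀ y → f (y ℤ.+ v) ≤ f (y ℤ.+ w) + 2ℚ * ε + b₁ (y ℤ.+ w) + b₂ (y ℤ.+ v)
          pointwise y = subst (λ x → f x ≤ f (y ℤ.+ w) + 2ℚ * ε + b₁ (y ℤ.+ w) + b₂ x) (shift′ y v t′)
            (subst (λ x → f (y ℤ.+ v ℤ.- t′ ℤ.+ t′) ≤ f x + 2ℚ * ε + b₁ x + b₂ (y ℤ.+ v ℤ.- t′ ℤ.+ t′)) (shift y v t t′) (close′ (y ℤ.+ v ℤ.- t′) t t′))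
          sum : ∑ A (λ y → f (y ℤ.+ w) + 2ℚ * ε + b₁ (y ℤ.+ w) + b₂ (y ℤ.+ v)) ≡ ∑ A (λ y → f (y ℤ.+ w)) + N * (2ℚ * ε) + ∑ A (λ y → b₁ (y ℤ.+ w)) + ∑ A (λ y → b₂ (y ℤ.+ v))
          sum = trans (∑-+ A _ _) (cong (_+ ∑ A (λ y → b₂ (y ℤ.+ v))) (trans (∑-+ A _ _) (cong (_+ ∑ A (λ y → b₁ (y ℤ.+ w))) (trans (∑-+ A _ _) (cong (λ x → ∑ A (λ y → f (y ℤ.+ w)) + x) (∑-const A (2ℚ * ε)))))))
          c = 2ℚ * # Pp * inv (2ℚ ^ b)
          step : ∑ A (λ y → f (y ℤ.+ v)) ≤ ∑ A (λ y → f (y ℤ.+ w)) + loss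
          step = ≤-trans (∑-mono A pointwise) (≤-trans (≤-reflexive sum)
            (≤-trans (+-mono-≤ (+-mono-≤ (≤-refl {∑ A (λ y → f (y ℤ.+ w)) + N * (2ℚ * ε)})
                (≤-trans (A⊂Pp (suc j) w j≤ (Reach-mono r) b₁ (λ y → 0≤𝟙 (bad (translate t τ) y))) (good-bad t t∈)))
                (≤-trans (A⊂Pp j v j≤′ (Reach-mono r′) b₂ (λ y → 0≤𝟙 (bad (translate t′ τ) y))) (good-bad t′ t′∈)))
              (≤-reflexive (eq′ (∑ A (λ y → f (y ℤ.+ w))) N ε (# Pp) (inv (2ℚ ^ b))))))
            where
            eq′ : ∀ s n e p i → s + n * (2ℚ * e) + 2ℚ * p * i + 2ℚ * p * i ≡ s + (2ℚ * e * n + 4ℚ * p * i)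
            eq′ = solve-∀ ℚ-ring

-- A rational rotation of infinite order

module Circle where

  open Rationals
  open Sums

  3/5 4/5 : ℚ
  3/5 = + 3 / 5
  4/5 = + 4 / 5

  -- cosℕ n + i sinℕ n = ((3 + 4i) / 5)^n: a rational point of infinite order on the unit circle.
  cosℕ sinℕ : ℕ → ℚ
  cosℕ zero = 1ℚ
  cosℕ (suc n) = 3/5 * cosℕ n - 4/5 * sinℕ n
  sinℕ zero = 0ℚ
  sinℕ (suc n) = 4/5 * cosℕ n + 3/5 * sinℕ n

  cosᶻ sinᶻ : ℤ → ℚ
  cosᶻ (+ n) = cosℕ n
  cosᶻ -[1+ n ] = cosℕ (suc n)
  sinᶻ (+ n) = sinℕ n
  sinᶻ -[1+ n ] = - sinℕ (suc n)

  unitℕ : ∀ n → cosℕ n * cosℕ n + sinℕ n * sinℕ n ≡ 1ℚ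
  unitℕ zero = refl
  unitℕ (suc n) = trans (eq (cosℕ n) (sinℕ n)) (unitℕ n)
    where
    eq : ∀ c s → (3/5 * c - 4/5 * s) * (3/5 * c - 4/5 * s) + (4/5 * c + 3/5 * s) * (4/5 * c + 3/5 * s) ≡ c * c + s * s
    eq = solve-∀ ℚ-ring

  unit-circleᶻ : ∀ x → cosᶻ x * cosᶻ x + sinᶻ x * sinᶻ x ≡ 1ℚ
  unit-circleᶻ (+ n) = unitℕ n
  unit-circleᶻ -[1+ n ] = trans (eq (cosℕ (suc n)) (sinℕ (suc n))) (unitℕ (suc n))
    where
    eq : ∀ c s → c * c + (- s) * (- s) ≡ c * c + s * s
    eq = solve-∀ ℚ-ring

  cos-negᶻ : ∀ x → cosᶻ (ℤ.- x) ≡ cosᶻ x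
  cos-negᶻ (+ zero) = refl
  cos-negᶻ (+ suc n) = refl
  cos-negᶻ -[1+ n ] = refl

  sin-negᶻ : ∀ x → sinᶻ (ℤ.- x) ≡ - sinᶻ x
  sin-negᶻ (+ zero) = refl
  sin-negᶻ (+ suc n) = refl
  sin-negᶻ -[1+ n ] = eq (sinℕ (suc n))
    where
    eq : ∀ a → a ≡ - - a
    eq = solve-∀ ℚ-ring

  Rotates : (x y z : ℤ) → Set
  Rotates x y z = cosᶻ z ≡ cosᶻ x * cosᶻ y - sinᶻ x * sinᶻ y × sinᶻ z ≡ sinᶻ x * cosᶻ y + cosᶻ x * sinᶻ y

  rot-suc : ∀ y → Rotates (+ 1) y (ℤ.suc y)
  rot-suc (+ n) = cong₂ (λ a b → a * cosℕ n - b * sinℕ n) e₁ e₂ , cong₂ (λ a b → b * cosℕ n + a * sinℕ n) e₁ e₂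
    where
    e₁ : 3/5 ≡ cosℕ 1
    e₁ = refl
    e₂ : 4/5 ≡ sinℕ 1
    e₂ = refl
  rot-suc -[1+ zero ] = refl , refl
  rot-suc -[1+ suc n ] = eq₁ (cosℕ (suc n)) (sinℕ (suc n)) , eq₂ (cosℕ (suc n)) (sinℕ (suc n))
    where
    eq₁ : ∀ c s → c ≡ 3/5 * (3/5 * c - 4/5 * s) - 4/5 * (- (4/5 * c + 3/5 * s))
    eq₁ = solve-∀ ℚ-ring
    eq₂ : ∀ c s → - s ≡ 4/5 * (3/5 * c - 4/5 * s) + 3/5 * (- (4/5 * c + 3/5 * s))
    eq₂ = solve-∀ ℚ-ring

  rot-+ : ∀ n y → Rotates (+ n) y (+ n ℤ.+ y)
  rot-+ zero y = trans (cong cosᶻ (ℤ.+-identityˡ y)) (eq₁ (cosᶻ y) (sinᶻ y)) , trans (cong sinᶻ (ℤ.+-identityˡ y)) (eq₂ (cosᶻ y) (sinᶻ y))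
    where
    eq₁ : ∀ c s → c ≡ 1ℚ * c - 0ℚ * s
    eq₁ = solve-∀ ℚ-ring
    eq₂ : ∀ c s → s ≡ 0ℚ * c + 1ℚ * s
    eq₂ = solve-∀ ℚ-ring
  rot-+ (suc n) y with rot-+ n y | rot-suc (+ n ℤ.+ y)
  ... | hc , hs | gc , gs =
    trans (cong cosᶻ (ℤ.+-assoc (+ 1) (+ n) y)) (trans gc (trans (cong₂ (λ a b → 3/5 * a - 4/5 * b) hc hs) (eq₁ (cosℕ n) (sinℕ n) (cosᶻ y) (sinᶻ y)))) ,
    trans (cong sinᶻ (ℤ.+-assoc (+ 1) (+ n) y)) (trans gs (trans (cong₂ (λ a b → 4/5 * a + 3/5 * b) hc hs) (eq₂ (cosℕ n) (sinℕ n) (cosᶻ y) (sinᶻ y))))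
    where
    eq₁ : ∀ a b c s → 3/5 * (a * c - b * s) - 4/5 * (b * c + a * s) ≡ (3/5 * a - 4/5 * b) * c - (4/5 * a + 3/5 * b) * s
    eq₁ = solve-∀ ℚ-ring
    eq₂ : ∀ a b c s → 4/5 * (a * c - b * s) + 3/5 * (b * c + a * s) ≡ (4/5 * a + 3/5 * b) * c + (3/5 * a - 4/5 * b) * s
    eq₂ = solve-∀ ℚ-ring

  rotate-back : ∀ {c s a b A B} → c * c + s * s ≡ 1ℚ → A ≡ c * a - s * b → B ≡ s * a + c * b → a ≡ c * A - - s * B × b ≡ - s * A + c * B
  rotate-back {c} {s} {a} {b} h refl refl = trans (sym (*-identityˡ a)) (trans (cong (_* a) (sym h)) (eq₁ c s a b)) , trans (sym (*-identityˡ b)) (trans (cong (_* b) (sym h)) (eq₂ c s a b))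
    where
    eq₁ : ∀ c s a b → (c * c + s * s) * a ≡ c * (c * a - s * b) - - s * (s * a + c * b)
    eq₁ = solve-∀ ℚ-ring
    eq₂ : ∀ c s a b → (c * c + s * s) * b ≡ - s * (c * a - s * b) + c * (s * a + c * b)
    eq₂ = solve-∀ ℚ-ring

  rot : ∀ x y → Rotates x y (x ℤ.+ y)
  rot (+ n) y = rot-+ n y
  rot -[1+ n ] y = back
    where
    z = -[1+ n ] ℤ.+ y
    y≡ : + suc n ℤ.+ (-[1+ n ] ℤ.+ y) ≡ y
    y≡ = trans (sym (ℤ.+-assoc (+ suc n) -[1+ n ] y)) (trans (cong (ℤ._+ y) (ℤ.+-inverseʳ (+ suc n))) (ℤ.+-identityˡ y))
    back = rotate-back {cosℕ (suc n)} {sinℕ (suc n)} (unitℕ (suc n)) (trans (cong cosᶻ (sym y≡)) (proj₁ (rot-+ (suc n) z))) (trans (cong sinᶻ (sym y≡)) (proj₂ (rot-+ (suc n) z)))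

  cos-+ᶻ : ∀ x y → cosᶻ (x ℤ.+ y) ≡ cosᶻ x * cosᶻ y - sinᶻ x * sinᶻ y
  cos-+ᶻ x y = proj₁ (rot x y)

  sin-+ᶻ : ∀ x y → sinᶻ (x ℤ.+ y) ≡ sinᶻ x * cosᶻ y + cosᶻ x * sinᶻ y
  sin-+ᶻ x y = proj₂ (rot x y)

  sq≤1 : ∀ {a b} → a * a + b * b ≡ 1ℚ → a ≤ 1ℚ × - 1ℚ ≤ a
  sq≤1 {a} {b} h = sq-≤ 0≤1 le , ≤-trans (ℚ.neg-antimono-≤ (sq-≤ {a = - a} 0≤1 (≤-trans (≤-reflexive (neg a)) le))) (≤-reflexive (nn a))
    where
    neg : ∀ a → - a * - a ≡ a * a
    neg = solve-∀ ℚ-ring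
    nn : ∀ a → - - a ≡ a
    nn = solve-∀ ℚ-ring
    le : a * a ≤ 1ℚ * 1ℚ
    le = ≤-by (b * b) (0≤sq b) (trans (*-identityˡ 1ℚ) (sym h))

  cos≤1ᶻ : ∀ x → cosᶻ x ≤ 1ℚ
  cos≤1ᶻ x = proj₁ (sq≤1 {cosᶻ x} {sinᶻ x} (unit-circleᶻ x))

  5ℚ : ℚ
  5ℚ = ι 5

  -- E (C + iS) ≡ 3 + 4i modulo 5, written without subtraction.
  Residue : ℚ → ℚ → ℚ → Set
  Residue E C S = ∃ λ p → ∃ λ r → ∃ λ p′ → ∃ λ r′ → (E * C + 5ℚ * ι r ≡ ι 3 + 5ℚ * ι p) × (E * S + 5ℚ * ι r′ ≡ ι 4 + 5ℚ * ι p′)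

  -- `(3 + 4 i)² = -7 + 24 i` is congruent to `3 + 4 i` modulo `5`, so all positive powers of
  -- `3 + 4 i` have this residue.
  residue-suc : ∀ {E C S} → Residue E C S → Residue (5ℚ * E) (3/5 * C - 4/5 * S) (4/5 * C + 3/5 * S)
  residue-suc {E} {C} {S} (p , r , p′ , r′ , hc , hs) = 3 ℕ.* p ℕ.+ 4 ℕ.* r′ , 3 ℕ.* r ℕ.+ 4 ℕ.* p′ ℕ.+ 2 , 4 ℕ.+ 4 ℕ.* p ℕ.+ 3 ℕ.* p′ , 4 ℕ.* r ℕ.+ 3 ℕ.* r′ ,
    trans (cong (λ x → 5ℚ * E * (3/5 * C - 4/5 * S) + 5ℚ * x) (hom₁ r p′)) (trans (eq₁ E C S (ι r) (ι r′) (ι p′)) (trans (cong₂ (λ a b → ι 3 * a - ι 4 * b + rest₁) hc hs) (trans (eq₁′ (ι p) (ι r) (ι p′) (ι r′)) (cong (λ x → ι 3 + 5ℚ * x) (sym (hom₂ p r′)))))) ,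
    trans (cong (λ x → 5ℚ * E * (4/5 * C + 3/5 * S) + 5ℚ * x) (hom₃ r r′)) (trans (eq₂ E C S (ι r) (ι r′)) (trans (cong₂ (λ a b → ι 4 * a + ι 3 * b) hc hs) (trans (eq₂′ (ι p) (ι p′)) (cong (λ x → ι 4 + 5ℚ * x) (sym (hom₄ p p′))))))
    where
    rest₁ = 5ℚ * (ι 4 * ι p′ + ι 4 * ι r′ + ι 2)
    hom₂ : ∀ p r′ → ι (3 ℕ.* p ℕ.+ 4 ℕ.* r′) ≡ ι 3 * ι p + ι 4 * ι r′
    hom₂ p r′ = trans (ι-+ (3 ℕ.* p) (4 ℕ.* r′)) (cong₂ _+_ (ι-* 3 p) (ι-* 4 r′))
    hom₁ : ∀ r p′ → ι (3 ℕ.* r ℕ.+ 4 ℕ.* p′ ℕ.+ 2) ≡ ι 3 * ι r + ι 4 * ι p′ + ι 2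
    hom₁ r p′ = trans (ι-+ (3 ℕ.* r ℕ.+ 4 ℕ.* p′) 2) (cong (_+ ι 2) (hom₂ r p′))
    hom₃ : ∀ r r′ → ι (4 ℕ.* r ℕ.+ 3 ℕ.* r′) ≡ ι 4 * ι r + ι 3 * ι r′
    hom₃ r r′ = trans (ι-+ (4 ℕ.* r) (3 ℕ.* r′)) (cong₂ _+_ (ι-* 4 r) (ι-* 3 r′))
    hom₄ : ∀ p p′ → ι (4 ℕ.+ 4 ℕ.* p ℕ.+ 3 ℕ.* p′) ≡ ι 4 + ι 4 * ι p + ι 3 * ι p′
    hom₄ p p′ = trans (ι-+ (4 ℕ.+ 4 ℕ.* p) (3 ℕ.* p′)) (cong₂ _+_ (trans (ι-+ 4 (4 ℕ.* p)) (cong (λ x → ι 4 + x) (ι-* 4 p))) (ι-* 3 p′))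
    eq₁ : ∀ E C S r r′ p′ → 5ℚ * E * (3/5 * C - 4/5 * S) + 5ℚ * (ι 3 * r + ι 4 * p′ + ι 2) ≡ ι 3 * (E * C + 5ℚ * r) - ι 4 * (E * S + 5ℚ * r′) + 5ℚ * (ι 4 * p′ + ι 4 * r′ + ι 2)
    eq₁ = solve-∀ ℚ-ring
    eq₁′ : ∀ p r p′ r′ → ι 3 * (ι 3 + 5ℚ * p) - ι 4 * (ι 4 + 5ℚ * p′) + 5ℚ * (ι 4 * p′ + ι 4 * r′ + ι 2) ≡ ι 3 + 5ℚ * (ι 3 * p + ι 4 * r′)
    eq₁′ = solve-∀ ℚ-ring
    eq₂ : ∀ E C S r r′ → 5ℚ * E * (4/5 * C + 3/5 * S) + 5ℚ * (ι 4 * r + ι 3 * r′) ≡ ι 4 * (E * C + 5ℚ * r) + ι 3 * (E * S + 5ℚ * r′)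
    eq₂ = solve-∀ ℚ-ring
    eq₂′ : ∀ p p′ → ι 4 * (ι 3 + 5ℚ * p) + ι 3 * (ι 4 + 5ℚ * p′) ≡ ι 4 + 5ℚ * (ι 4 + ι 4 * p + ι 3 * p′)
    eq₂′ = solve-∀ ℚ-ring

  residue : ∀ n → Residue (5ℚ ^ suc n) (cosℕ (suc n)) (sinℕ (suc n))
  residue zero = 0 , 0 , 0 , 0 , refl , refl
  residue (suc n) = residue-suc {5ℚ ^ suc n} {cosℕ (suc n)} {sinℕ (suc n)} (residue n)

  ι-injective : ∀ {m n} → ι m ≡ ι n → m ≡ n
  ι-injective h = ℕ.≤-antisym (ι-cancel-≤ (≤-reflexive h)) (ι-cancel-≤ (≤-reflexive (sym h)))

  -- The value `1` would make a positive power of `5` congruent to `3` modulo `5`.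
  cosℕ≢1 : ∀ n → cosℕ (suc n) ≢ 1ℚ
  cosℕ≢1 n h = contradict (residue n)
    where
    5∤3 : ¬ (5 ℕ.∣ 3)
    5∤3 d = ℕ.<⇒≱ {3} {5} (ℕ.s≤s (ℕ.s≤s (ℕ.s≤s (ℕ.s≤s ℕ.z≤n)))) (ℕ.∣⇒≤ d)
    eq : ∀ e r → ι 5 * (e + r) ≡ 5ℚ * e * 1ℚ + 5ℚ * r
    eq = solve-∀ ℚ-ring
    nat : ∀ p r → 5ℚ ^ suc n * cosℕ (suc n) + 5ℚ * ι r ≡ ι 3 + 5ℚ * ι p → 5 ℕ.* (5 ℕ.^ n ℕ.+ r) ≡ 3 ℕ.+ 5 ℕ.* p
    nat p r hc = ι-injective (trans (ι-* 5 (5 ℕ.^ n ℕ.+ r)) (trans (cong (ι 5 *_) (trans (ι-+ (5 ℕ.^ n) r) (cong (_+ ι r) (ι-^ 5 n)))) (trans (eq (5ℚ ^ n) (ι r))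
      (trans (cong (λ x → 5ℚ ^ suc n * x + 5ℚ * ι r) (sym h)) (trans hc (sym (trans (ι-+ 3 (5 ℕ.* p)) (cong (λ x → ι 3 + x) (ι-* 5 p)))))))))
    contradict : Residue (5ℚ ^ suc n) (cosℕ (suc n)) (sinℕ (suc n)) → ⊥
    contradict (p , r , _ , _ , hc , _) = 5∤3 (ℕ.∣m+n∣m⇒∣n {m = 5 ℕ.* p} (subst (5 ℕ.∣_) (trans (nat p r hc) (ℕ.+-comm 3 (5 ℕ.* p))) (ℕ.m∣m*n (5 ℕ.^ n ℕ.+ r))) (ℕ.m∣m*n p))

  cos<1ᶻ : ∀ x → x ≢ ℤ.0ℤ → cosᶻ x < 1ℚ
  cos<1ᶻ (+ zero) h = ⊥-elim (h refl)
  cos<1ᶻ (+ suc n) h = ≤∧≢⇒< (cos≤1ᶻ (+ suc n)) (cosℕ≢1 n)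
  cos<1ᶻ -[1+ n ] h = ≤∧≢⇒< (cos≤1ᶻ -[1+ n ]) (cosℕ≢1 n)

  abstract

    cos sin : ℤ → ℚ
    cos = cosᶻ
    sin = sinᶻ

    unit-circle : ∀ x → cos x * cos x + sin x * sin x ≡ 1ℚ
    unit-circle = unit-circleᶻ

    cos-0 : cos ℤ.0ℤ ≡ 1ℚ
    cos-0 = refl

    sin-0 : sin ℤ.0ℤ ≡ 0ℚ
    sin-0 = refl

    cos-neg : ∀ x → cos (ℤ.- x) ≡ cos x
    cos-neg = cos-negᶻ

    sin-neg : ∀ x → sin (ℤ.- x) ≡ - sin x
    sin-neg = sin-negᶻ

    cos-+ : ∀ x y → cos (x ℤ.+ y) ≡ cos x * cos y - sin x * sin y
    cos-+ = cos-+ᶻ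

    sin-+ : ∀ x y → sin (x ℤ.+ y) ≡ sin x * cos y + cos x * sin y
    sin-+ = sin-+ᶻ

    cos<1 : ∀ x → x ≢ ℤ.0ℤ → cos x < 1ℚ
    cos<1 = cos<1ᶻ

  cos≤1 : ∀ x → cos x ≤ 1ℚ
  cos≤1 x = proj₁ (sq≤1 {cos x} {sin x} (unit-circle x))

  -1≤cos : ∀ x → - 1ℚ ≤ cos x
  -1≤cos x = proj₂ (sq≤1 {cos x} {sin x} (unit-circle x))

  sin≤1 : ∀ x → sin x ≤ 1ℚ
  sin≤1 x = proj₁ (sq≤1 {sin x} {cos x} (trans (+-comm (sin x * sin x) (cos x * cos x)) (unit-circle x)))

  -1≤sin : ∀ x → - 1ℚ ≤ sin x
  -1≤sin x = proj₂ (sq≤1 {sin x} {cos x} (trans (+-comm (sin x * sin x) (cos x * cos x)) (unit-circle x)))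

-- Characters of the integers and their near orthogonality

module Characters where

  open Rationals
  open Sums
  open Circle using (cos; sin; unit-circle; cos-0; sin-0; cos-neg; sin-neg; cos-+; sin-+; cos<1; cos≤1; -1≤cos)

  below : ℕ → List ℕ
  below zero = []
  below (suc n) = n ∷ below n

  #-below : ∀ n → # (below n) ≡ ι n
  #-below zero = refl
  #-below (suc n) = cong (λ y → 1ℚ + y) (#-below n)

  χr χi : ℕ → ℤ → ℚ
  χr j x = cos (+ j ℤ.* x)
  χi j x = sin (+ j ℤ.* x)

  χr-+ : ∀ j x y → χr j (x ℤ.+ y) ≡ χr j x * χr j y - χi j x * χi j y
  χr-+ j x y = trans (cong cos (ℤ.*-distribˡ-+ (+ j) x y)) (cos-+ (+ j ℤ.* x) (+ j ℤ.* y))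

  χi-+ : ∀ j x y → χi j (x ℤ.+ y) ≡ χi j x * χr j y + χr j x * χi j y
  χi-+ j x y = trans (cong sin (ℤ.*-distribˡ-+ (+ j) x y)) (sin-+ (+ j ℤ.* x) (+ j ℤ.* y))

  χr-neg : ∀ j x → χr j (ℤ.- x) ≡ χr j x
  χr-neg j x = trans (cong cos (sym (ℤ.neg-distribʳ-* (+ j) x))) (cos-neg (+ j ℤ.* x))

  χi-neg : ∀ j x → χi j (ℤ.- x) ≡ - χi j x
  χi-neg j x = trans (cong sin (sym (ℤ.neg-distribʳ-* (+ j) x))) (sin-neg (+ j ℤ.* x))

  χr-0 : ∀ j → χr j ℤ.0ℤ ≡ 1ℚ
  χr-0 j = trans (cong cos (ℤ.*-zeroʳ (+ j))) cos-0

  χ-unit : ∀ j x → χr j x * χr j x + χi j x * χi j x ≡ 1ℚ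
  χ-unit j x = unit-circle (+ j ℤ.* x)

  -- Real and imaginary part of `(1 - ω) * (1 + ω + ... + ω ^ (J - 1)) = 1 - ω ^ J`, where `ω = cos
  -- x + i sin x`.
  geometric : ∀ x J → let A = ∑ (below J) (λ j → χr j x) ; B = ∑ (below J) (λ j → χi j x) in
    A * (1ℚ - cos x) + B * sin x ≡ 1ℚ - χr J x × B * (1ℚ - cos x) - A * sin x ≡ 0ℚ - χi J x
  geometric x zero = trans (eq₀ (cos x) (sin x)) (cong (λ y → 1ℚ - y) (sym cos-0)) , trans (eq₀′ (cos x) (sin x)) (cong (λ y → 0ℚ - y) (sym sin-0))
    where
    eq₀ : ∀ c s → 0ℚ * (1ℚ - c) + 0ℚ * s ≡ 1ℚ - 1ℚ
    eq₀ = solve-∀ ℚ-ring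
    eq₀′ : ∀ c s → 0ℚ * (1ℚ - c) - 0ℚ * s ≡ 0ℚ - 0ℚ
    eq₀′ = solve-∀ ℚ-ring
  geometric x (suc J) = trans (eq₁ (χr J x) (χi J x) A B (cos x) (sin x)) (trans (cong (λ y → χr J x * (1ℚ - cos x) + χi J x * sin x + y) (proj₁ ih)) (trans (eq₁′ (χr J x) (χi J x) (cos x) (sin x)) (cong (λ y → 1ℚ - y) (sym (next-r J x))))) ,
    trans (eq₂ (χr J x) (χi J x) A B (cos x) (sin x)) (trans (cong (λ y → χi J x * (1ℚ - cos x) - χr J x * sin x + y) (proj₂ ih)) (trans (eq₂′ (χr J x) (χi J x) (cos x) (sin x)) (cong (λ y → 0ℚ - y) (sym (next-i J x)))))
    where
    A = ∑ (below J) (λ j → χr j x)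
    B = ∑ (below J) (λ j → χi j x)
    ih = geometric x J
    arg : ∀ J x → + suc J ℤ.* x ≡ + J ℤ.* x ℤ.+ x
    arg J x = trans (ℤ.suc-* (+ J) x) (ℤ.+-comm x (+ J ℤ.* x))
    next-r : ∀ J x → χr (suc J) x ≡ χr J x * cos x - χi J x * sin x
    next-r J x = trans (cong cos (arg J x)) (cos-+ (+ J ℤ.* x) x)
    next-i : ∀ J x → χi (suc J) x ≡ χi J x * cos x + χr J x * sin x
    next-i J x = trans (cong sin (arg J x)) (sin-+ (+ J ℤ.* x) x)
    eq₁ : ∀ r i a b c s → (r + a) * (1ℚ - c) + (i + b) * s ≡ r * (1ℚ - c) + i * s + (a * (1ℚ - c) + b * s)
    eq₁ = solve-∀ ℚ-ring
    eq₁′ : ∀ r i c s → r * (1ℚ - c) + i * s + (1ℚ - r) ≡ 1ℚ - (r * c - i * s)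
    eq₁′ = solve-∀ ℚ-ring
    eq₂ : ∀ r i a b c s → (i + b) * (1ℚ - c) - (r + a) * s ≡ i * (1ℚ - c) - r * s + (b * (1ℚ - c) - a * s)
    eq₂ = solve-∀ ℚ-ring
    eq₂′ : ∀ r i c s → i * (1ℚ - c) - r * s + (0ℚ - i) ≡ 0ℚ - (i * c + r * s)
    eq₂′ = solve-∀ ℚ-ring

  -- Taking squared moduli in the geometric sum, `(a² + b²) * 2 (1 - c) = 2 (1 - r) ≤ 4`.
  geometric-bound : ∀ {a b c s r i} → c * c + s * s ≡ 1ℚ → r * r + i * i ≡ 1ℚ → - 1ℚ ≤ r → a * (1ℚ - c) + b * s ≡ 1ℚ - r → b * (1ℚ - c) - a * s ≡ 0ℚ - i → c ≤ 1ℚ →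
    a * a * (1ℚ - c) ≤ 2ℚ
  geometric-bound {a} {b} {c} {s} {r} {i} cs ri r≥ h₁ h₂ c≤ = ≤-trans (≤-by (b * b * (1ℚ - c)) (0≤* (0≤sq b) (0≤- c≤)) (eq₀ a b c)) (*-cancelˡ {c = 2ℚ} (ℚ.positive⁻¹ 2ℚ) (≤-trans (≤-reflexive main) (≤-by (2ℚ * (r - - 1ℚ)) (0≤* 0≤2 (0≤- r≥)) (eq₃ r))))
    where
    eq₀ : ∀ a b c → (a * a + b * b) * (1ℚ - c) ≡ a * a * (1ℚ - c) + b * b * (1ℚ - c)
    eq₀ = solve-∀ ℚ-ring
    eq₃ : ∀ r → 2ℚ * 2ℚ ≡ 2ℚ * (1ℚ - r) + 2ℚ * (r - - 1ℚ)
    eq₃ = solve-∀ ℚ-ring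
    eq₁ : ∀ a b c s → 2ℚ * ((a * a + b * b) * (1ℚ - c)) + (a * a + b * b) * (c * c + s * s) ≡ (a * (1ℚ - c) + b * s) * (a * (1ℚ - c) + b * s) + (b * (1ℚ - c) - a * s) * (b * (1ℚ - c) - a * s) + (a * a + b * b) * 1ℚ
    eq₁ = solve-∀ ℚ-ring
    eq₂ : ∀ r i → (1ℚ - r) * (1ℚ - r) + (0ℚ - i) * (0ℚ - i) ≡ 1ℚ - 2ℚ * r + (r * r + i * i)
    eq₂ = solve-∀ ℚ-ring
    cancel : ∀ {x y z : ℚ} → x + z ≡ y + z → x ≡ y
    cancel {x} {y} {z} h = trans (e x z) (trans (cong (_- z) h) (sym (e y z)))
      where
      e : ∀ x z → x ≡ x + z - z
      e = solve-∀ ℚ-ring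
    main : 2ℚ * ((a * a + b * b) * (1ℚ - c)) ≡ 2ℚ * (1ℚ - r)
    main = trans (cancel {z = (a * a + b * b) * 1ℚ} (trans (cong (λ y → 2ℚ * ((a * a + b * b) * (1ℚ - c)) + (a * a + b * b) * y) (sym cs)) (trans (eq₁ a b c s) (cong₂ (λ x y → x * x + y * y + (a * a + b * b) * 1ℚ) h₁ h₂))))
      (trans (eq₂ r i) (trans (cong (λ y → 1ℚ - 2ℚ * r + y) ri) (eq₄ r)))
      where
      eq₄ : ∀ r → 1ℚ - 2ℚ * r + 1ℚ ≡ 2ℚ * (1ℚ - r)
      eq₄ = solve-∀ ℚ-ring

  -- Just what turns `geometric-bound` into the bound `κ J` for the modulus of the real part of the
  -- character sum at `x`.
  Large : ℕ → ℚ → ℤ → Set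
  Large J κ x = 2ℚ ≤ (1ℚ - cos x) * (κ * ι J * (κ * ι J))

  ∣∑χ∣ : ∀ J κ x → 0ℚ ≤ κ → x ≢ ℤ.0ℤ → Large J κ x → ∑ (below J) (λ j → χr j x) ≤ κ * ι J × - (∑ (below J) (λ j → χr j x)) ≤ κ * ι J
  ∣∑χ∣ J κ x 0≤κ x≢0 h = sq-≤ 0≤κJ sq , sq-≤ 0≤κJ (≤-trans (≤-reflexive (neg A)) sq)
    where
    A = ∑ (below J) (λ j → χr j x)
    0≤κJ : 0ℚ ≤ κ * ι J
    0≤κJ = 0≤* 0≤κ (0≤ι J)
    neg : ∀ a → - a * - a ≡ a * a
    neg = solve-∀ ℚ-ring
    0<1-c : 0ℚ < 1ℚ - cos x
    0<1-c = ≤∧≢⇒< (0≤- (cos≤1 x)) (λ e → ℚ.<-irrefl (trans (eq (cos x)) (trans (cong (λ y → 1ℚ - y) (sym e)) refl)) (cos<1 x x≢0))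
      where
      eq : ∀ c → c ≡ 1ℚ - (1ℚ - c)
      eq = solve-∀ ℚ-ring
    sq : A * A ≤ κ * ι J * (κ * ι J)
    sq = *-cancelˡ 0<1-c (≤-trans (≤-reflexive (*-comm (1ℚ - cos x) (A * A))) (≤-trans (geometric-bound {A} {∑ (below J) (λ j → χi j x)} {cos x} {sin x} {χr J x} {χi J x} (unit-circle x) (χ-unit J x) (-1≤cos (+ J ℤ.* x)) (proj₁ (geometric x J)) (proj₂ (geometric x J)) (cos≤1 x)) h))

  large-mono : ∀ {J J′ κ x} → 0ℚ ≤ κ → J ℕ.≤ J′ → Large J κ x → Large J′ κ x
  large-mono {J} {J′} {κ} {x} 0≤κ h p = ≤-trans p (*-monoˡ (0≤- (cos≤1 x)) (*-mono (0≤* 0≤κ (0≤ι J)) (0≤* 0≤κ (0≤ι J′)) (*-monoˡ 0≤κ (ι-mono h)) (*-monoˡ 0≤κ (ι-mono h))))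

  large-exists : ∀ κ x → 0ℚ < κ → x ≢ ℤ.0ℤ → ∃ λ J → Large J κ x
  large-exists κ x 0<κ x≢0 = suc n , ≤-trans (≤-trans (≤-reflexive (sym (trans (cong (_* 2ℚ) (inv-pos pos)) (*-identityˡ 2ℚ)))) (≤-trans (≤-reflexive (*-assoc D (inv D) 2ℚ)) (*-monoˡ (<⇒≤ pos) (≤-trans (proj₂ big) (≤-trans n≤ (≤-reflexive (*-identityʳ _))))))) (≤-trans (*-monoˡ (<⇒≤ pos) (*-monoˡ (0≤ι (suc n)) (≤-by (ι n) (0≤ι n) refl))) (≤-reflexive (eq (1ℚ - cos x) κ (ι (suc n)))))
    where
    eq′ : ∀ c → c ≡ 1ℚ - (1ℚ - c)
    eq′ = solve-∀ ℚ-ring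
    0<1-c : 0ℚ < 1ℚ - cos x
    0<1-c = ≤∧≢⇒< (0≤- (cos≤1 x)) (λ e → ℚ.<-irrefl (trans (eq′ (cos x)) (trans (cong (λ y → 1ℚ - y) (sym e)) refl)) (cos<1 x x≢0))
    D = (1ℚ - cos x) * (κ * κ)
    pos : 0ℚ < D
    pos = 0<* 0<1-c (0<* 0<κ 0<κ)
    big = archimedean (inv D * 2ℚ)
    n = proj₁ big
    n≤ : ι n ≤ ι (suc n) * 1ℚ * 1ℚ
    n≤ = ≤-by 1ℚ 0≤1 (e (ι n))
      where
      e : ∀ a → (1ℚ + a) * 1ℚ * 1ℚ ≡ a + 1ℚ
      e = solve-∀ ℚ-ring
    eq : ∀ c k i → c * (k * k) * (i * i) ≡ c * (k * i * (k * i))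
    eq = solve-∀ ℚ-ring

  -- As `cos x < 1` for `x ≠ 0`, each of the finitely many `x` has a threshold for `J`. The
  -- thresholds are simply added up, since the size of `J` is never charged for.
  orthogonality : ∀ κ → 0ℚ < κ → ∀ N → ∃ λ J → 0 ℕ.< J × (∀ x → ℤ.∣ x ∣ ℕ.≤ N → x ≢ ℤ.0ℤ → Large J κ x)
  orthogonality κ 0<κ zero = 1 , ℕ.s≤s ℕ.z≤n , λ x h x≢0 → ⊥-elim (x≢0 (ℤ.∣i∣≡0⇒i≡0 (ℕ.n≤0⇒n≡0 h)))
  orthogonality κ 0<κ (suc N) = J ℕ.+ J′ , ℕ.≤-trans (proj₁ (proj₂ ih)) (ℕ.m≤m+n J J′) , all
    where
    ih = orthogonality κ 0<κ N
    J = proj₁ ih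
    top = large-exists κ (+ suc N) 0<κ (λ ())
    J′ = proj₁ top
    cos-abs : ∀ x → cos x ≡ cos (+ ℤ.∣ x ∣)
    cos-abs (+ n) = refl
    cos-abs -[1+ n ] = cos-neg (+ suc n)
    all : ∀ x → ℤ.∣ x ∣ ℕ.≤ suc N → x ≢ ℤ.0ℤ → Large (J ℕ.+ J′) κ x
    all x h x≢0 with ℕ.m≤n⇒m<n∨m≡n h
    ... | inj₁ (ℕ.s≤s lt) = large-mono {κ = κ} {x} (<⇒≤ 0<κ) (ℕ.m≤m+n J J′) (proj₂ (proj₂ ih) x lt x≢0)
    ... | inj₂ e = large-mono {κ = κ} {x} (<⇒≤ 0<κ) (ℕ.m≤n+m J′ J) (subst (λ c → 2ℚ ≤ (1ℚ - c) * (κ * ι J′ * (κ * ι J′))) (sym (trans (cos-abs x) (cong (λ m → cos (+ m)) e))) (proj₂ top))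

-- Transferring correlations along a random walk by Fourier analysis

module Transfer where

  open Rationals
  open Sums
  open Unbalancing using (∑∑; ∑∑-mono; ∑∑-cong; ∑∑-+; ∑∑-*ˡ; ∑∑-const)
  open AlmostPeriods using (Reach; reach-0; reach-+)
  open Characters

  isZero : ℤ → Bool
  isZero (+ zero) = true
  isZero (+ suc _) = false
  isZero -[1+ _ ] = false

  isZero-0 : ∀ {x} → isZero x ≡ true → x ≡ ℤ.0ℤ
  isZero-0 {+ zero} _ = refl

  δ : ℤ → ℚ
  δ x = 𝟙 (isZero x)

  corr : List ℤ → ℤ → ℚ
  corr Y v = ∑∑ Y (λ s s′ → δ (v ℤ.+ (s ℤ.- s′)))

  module Energy (w : ℤ → ℚ) (T : List ℤ) where

    R I : ℕ → ℚ
    R j = ∑ T (λ t → w t * χr j t)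
    I j = ∑ T (λ t → w t * χi j t)

    energy : ℕ → ℚ
    energy j = R j * R j + I j * I j

    0≤energy : ∀ j → 0ℚ ≤ energy j
    0≤energy j = 0≤+ (0≤sq (R j)) (0≤sq (I j))

    -- Convolution with a weight on differences `t - t′` acts on a character by a real nonnegative
    -- scalar. This is why the steps of the walk are differences.
    energy-shift : ∀ j v → ∑∑ T (λ t t′ → w t * w t′ * χr j (v ℤ.+ (t ℤ.- t′))) ≡ energy j * χr j v
    energy-shift j v = begin
      ∑∑ T (λ t t′ → w t * w t′ * χr j (v ℤ.+ (t ℤ.- t′))) ≡⟨ ∑∑-cong T pointwise ⟩
      ∑∑ T (λ t t′ → p t * x t′ + q t * y t′) ≡⟨ ∑∑-+ T _ _ ⟩
      ∑∑ T (λ t t′ → p t * x t′) + ∑∑ T (λ t t′ → q t * y t′) ≡⟨ cong₂ _+_ (∑-∑-* T T p x) (∑-∑-* T T q y) ⟩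
      ∑ T p * R j + ∑ T q * I j ≡⟨ cong₂ (λ a b → a * R j + b * I j) ∑p ∑q ⟩
      (R j * cv - I j * sv) * R j + (I j * cv + R j * sv) * I j ≡⟨ eq (R j) (I j) cv sv ⟩
      energy j * cv ∎
      where
      open ≡-Reasoning
      cv = χr j v
      sv = χi j v
      p q x y : ℤ → ℚ
      p t = w t * χr j t * cv - w t * χi j t * sv
      q t = w t * χi j t * cv + w t * χr j t * sv
      x t = w t * χr j t
      y t = w t * χi j t
      eq : ∀ r i c s → (r * c - i * s) * r + (i * c + r * s) * i ≡ (r * r + i * i) * c
      eq = solve-∀ ℚ-ring
      ∑p : ∑ T p ≡ R j * cv - I j * sv
      ∑p = trans (∑-- T _ _) (cong₂ _-_ (∑-*ʳ T cv x) (∑-*ʳ T sv y))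
      ∑q : ∑ T q ≡ I j * cv + R j * sv
      ∑q = trans (∑-+ T _ _) (cong₂ _+_ (∑-*ʳ T cv y) (∑-*ʳ T sv x))
      dr : ∀ t t′ → χr j (t ℤ.- t′) ≡ χr j t * χr j t′ - χi j t * - χi j t′
      dr t t′ = trans (χr-+ j t (ℤ.- t′)) (cong₂ (λ a b → χr j t * a - χi j t * b) (χr-neg j t′) (χi-neg j t′))
      di : ∀ t t′ → χi j (t ℤ.- t′) ≡ χi j t * χr j t′ + χr j t * - χi j t′
      di t t′ = trans (χi-+ j t (ℤ.- t′)) (cong₂ (λ a b → χi j t * a + χr j t * b) (χr-neg j t′) (χi-neg j t′))
      alg : ∀ w w′ c s a b a′ b′ → w * w′ * (c * (a * a′ - b * - b′) - s * (b * a′ + a * - b′)) ≡ (w * a * c - w * b * s) * (w′ * a′) + (w * b * c + w * a * s) * (w′ * b′)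
      alg = solve-∀ ℚ-ring
      pointwise : ∀ t t′ → w t * w t′ * χr j (v ℤ.+ (t ℤ.- t′)) ≡ p t * x t′ + q t * y t′
      pointwise t t′ = trans (cong (w t * w t′ *_) (trans (χr-+ j v (t ℤ.- t′)) (cong₂ (λ a b → cv * a - sv * b) (dr t t′) (di t t′)))) (alg (w t) (w t′) cv sv (χr j t) (χi j t) (χr j t′) (χi j t′))

    χr≤1 : ∀ j x → χr j x ≤ 1ℚ
    χr≤1 j x = proj₁ (sq-bound {χr j x} {χi j x} (χ-unit j x))
      where open Circle using () renaming (sq≤1 to sq-bound)

    energy≤ : (∀ t → 0ℚ ≤ w t) → ∀ j → energy j ≤ ∑ T w * ∑ T w
    energy≤ 0≤w j = ≤-trans (≤-reflexive (trans (sym (*-identityʳ (energy j))) (trans (cong (energy j *_) (sym (χr-0 j))) (sym (energy-shift j ℤ.0ℤ)))))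
      (≤-trans (∑∑-mono T (λ t t′ → ≤-trans (*-monoˡ (0≤* (0≤w t) (0≤w t′)) (χr≤1 j (ℤ.0ℤ ℤ.+ (t ℤ.- t′)))) (≤-reflexive (*-identityʳ _)))) (≤-reflexive (∑-∑-* T T w w)))

    walk : ℕ → (ℤ → ℚ) → ℤ → ℚ
    walk zero F v = F v
    walk (suc ℓ) F v = ∑∑ T (λ t t′ → w t * w t′ * walk ℓ F (v ℤ.+ (t ℤ.- t′)))

    walk-lower : ∀ ℓ {j v} K F → (∀ t → 0ℚ ≤ w t) → Reach T j v → (∀ u → Reach T (ℓ ℕ.+ j) u → K ≤ F u) → (∑ T w * ∑ T w) ^ ℓ * K ≤ walk ℓ F v
    walk-lower zero {v = v} K F 0≤w r h = ≤-trans (≤-reflexive (*-identityˡ K)) (h v r)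
    walk-lower (suc ℓ) {j} {v} K F 0≤w r h = ≤-trans (≤-reflexive start) (∑-mono∈ T (λ t t∈ → ∑-mono∈ T (λ t′ t′∈ → *-monoˡ (0≤* (0≤w t) (0≤w t′))
        (walk-lower ℓ K F 0≤w (reach-+ r t∈ t′∈) (λ u r′ → h u (subst (λ m → Reach T m u) (ℕ.+-suc ℓ j) r′))))))
      where
      W² = ∑ T w * ∑ T w
      start : W² ^ suc ℓ * K ≡ ∑∑ T (λ t t′ → w t * w t′ * (W² ^ ℓ * K))
      start = trans (*-assoc W² (W² ^ ℓ) K) (trans (cong (_* (W² ^ ℓ * K)) (sym (∑-∑-* T T w w))) (trans (sym (∑-*ʳ T (W² ^ ℓ * K) _)) (∑-cong T (λ t → sym (∑-*ʳ T (W² ^ ℓ * K) _)))))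

    walk-χ : ∀ ℓ (js : List ℕ) (a : ℕ → ℚ) v → walk ℓ (λ u → ∑ js (λ j → a j * χr j u)) v ≡ ∑ js (λ j → a j * energy j ^ ℓ * χr j v)
    walk-χ zero js a v = ∑-cong js (λ j → cong (_* χr j v) (sym (*-identityʳ (a j))))
    walk-χ (suc ℓ) js a v = begin
      ∑∑ T (λ t t′ → w t * w t′ * walk ℓ (λ u → ∑ js (λ j → a j * χr j u)) (v ℤ.+ (t ℤ.- t′)))
        ≡⟨ ∑∑-cong T (λ t t′ → trans (cong (w t * w t′ *_) (walk-χ ℓ js a (v ℤ.+ (t ℤ.- t′)))) (trans (sym (∑-*ˡ js (w t * w t′) _)) (∑-cong js (λ j → eq (w t * w t′) (a j * energy j ^ ℓ) (χr j (v ℤ.+ (t ℤ.- t′))))))) ⟩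
      ∑∑ T (λ t t′ → ∑ js (λ j → a j * energy j ^ ℓ * (w t * w t′ * χr j (v ℤ.+ (t ℤ.- t′)))))
        ≡⟨ trans (∑-cong T (λ t → ∑-swap T js _)) (∑-swap T js _) ⟩
      ∑ js (λ j → ∑∑ T (λ t t′ → a j * energy j ^ ℓ * (w t * w t′ * χr j (v ℤ.+ (t ℤ.- t′)))))
        ≡⟨ ∑-cong js (λ j → trans (∑∑-*ˡ T (a j * energy j ^ ℓ) _) (trans (cong (a j * energy j ^ ℓ *_) (energy-shift j v)) (eq′ (a j) (energy j ^ ℓ) (energy j) (χr j v)))) ⟩
      ∑ js (λ j → a j * energy j ^ suc ℓ * χr j v) ∎
      where
      open ≡-Reasoning
      eq : ∀ x y z → x * (y * z) ≡ y * (x * z)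
      eq = solve-∀ ℚ-ring
      eq′ : ∀ a b e c → a * b * (e * c) ≡ a * (e * b) * c
      eq′ = solve-∀ ℚ-ring

  open Energy public using (energy; 0≤energy; energy-shift; energy≤; walk; walk-lower; walk-χ)

  one′ : ℤ → ℚ
  one′ _ = 1ℚ

  energy-shift-1 : ∀ Y j v → ∑∑ Y (λ s s′ → χr j (v ℤ.+ (s ℤ.- s′))) ≡ energy one′ Y j * χr j v
  energy-shift-1 Y j v = trans (∑∑-cong Y (λ s s′ → sym (trans (cong (_* χr j (v ℤ.+ (s ℤ.- s′))) (*-identityˡ 1ℚ)) (*-identityˡ _)))) (energy-shift one′ Y j v)

  module Spectral (Ξ : List ℤ) (c : ℤ → ℚ) (0≤c : ∀ ξ → 0ℚ ≤ c ξ) (Y : ℤ → List ℤ) (κ : ℚ) (0≤κ : 0ℚ ≤ κ) (N J : ℕ) (0<J : 0 ℕ.< J)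
    (large : ∀ x → ℤ.∣ x ∣ ℕ.≤ N → x ≢ ℤ.0ℤ → Large J κ x) where

    Φ : ℤ → ℚ
    Φ v = ∑ Ξ (λ ξ → c ξ * corr (Y ξ) v)

    a : ℕ → ℚ
    a j = ∑ Ξ (λ ξ → c ξ * energy one′ (Y ξ) j)

    0≤a : ∀ j → 0ℚ ≤ a j
    0≤a j = 0≤∑ Ξ (λ ξ → 0≤* (0≤c ξ) (0≤energy one′ (Y ξ) j))

    -- Up to the factor `J` this is the Fourier expansion of `Φ`. Its coefficients `a j` are
    -- nonnegative because `Φ` is a combination of autocorrelations; hence `transfer` may compare
    -- frequency by frequency.
    Ŝ : ℤ → ℚ
    Ŝ v = ∑ (below J) (λ j → a j * χr j v)

    E : ℚ
    E = ∑ Ξ (λ ξ → c ξ * (# (Y ξ) * # (Y ξ)))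

    Within : ℤ → Set
    Within v = ∀ ξ → ξ ∈ Ξ → ∀ s → s ∈ Y ξ → ∀ s′ → s′ ∈ Y ξ → ℤ.∣ v ℤ.+ (s ℤ.- s′) ∣ ℕ.≤ N

    D : ℤ → ℚ
    D x = ∑ (below J) (λ j → χr j x)

    expand : ∀ v → Ŝ v ≡ ∑ Ξ (λ ξ → c ξ * ∑∑ (Y ξ) (λ s s′ → D (v ℤ.+ (s ℤ.- s′))))
    expand v = begin
      ∑ (below J) (λ j → a j * χr j v)
        ≡⟨ ∑-cong (below J) (λ j → trans (sym (∑-*ʳ Ξ (χr j v) _)) (∑-cong Ξ (λ ξ → trans (*-assoc (c ξ) _ _) (cong (c ξ *_) (sym (energy-shift-1 (Y ξ) j v)))))) ⟩
      ∑ (below J) (λ j → ∑ Ξ (λ ξ → c ξ * ∑∑ (Y ξ) (λ s s′ → χr j (v ℤ.+ (s ℤ.- s′)))))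
        ≡⟨ ∑-swap (below J) Ξ _ ⟩
      ∑ Ξ (λ ξ → ∑ (below J) (λ j → c ξ * ∑∑ (Y ξ) (λ s s′ → χr j (v ℤ.+ (s ℤ.- s′)))))
        ≡⟨ ∑-cong Ξ (λ ξ → trans (∑-*ˡ (below J) (c ξ) _) (cong (c ξ *_) (trans (∑-swap (below J) (Y ξ) _) (∑-cong (Y ξ) (λ s → ∑-swap (below J) (Y ξ) _))))) ⟩
      ∑ Ξ (λ ξ → c ξ * ∑∑ (Y ξ) (λ s s′ → D (v ℤ.+ (s ℤ.- s′)))) ∎
      where open ≡-Reasoning

    D-bound : ∀ x → ℤ.∣ x ∣ ℕ.≤ N → D x ≤ ι J * (δ x + κ) × ι J * δ x ≤ D x + ι J * κ
    D-bound x h = go (isZero x) refl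
      where
      eq₀ : ∀ i k → i * (0ℚ + k) ≡ k * i
      eq₀ = solve-∀ ℚ-ring
      eq₁ : ∀ i d k → d + i * k ≡ i * 0ℚ + (k * i - - d)
      eq₁ = solve-∀ ℚ-ring
      D0 : ∀ {x} → x ≡ ℤ.0ℤ → D x ≡ ι J
      D0 refl = trans (∑-cong (below J) χr-0) (#-below J)
      go : ∀ b → isZero x ≡ b → D x ≤ ι J * (𝟙 b + κ) × ι J * 𝟙 b ≤ D x + ι J * κ
      go true e = ≤-trans (≤-reflexive (trans (D0 (isZero-0 e)) (sym (*-identityʳ (ι J))))) (*-monoˡ (0≤ι J) (≤-by κ 0≤κ refl)) ,
        ≤-by (ι J * κ) (0≤* (0≤ι J) 0≤κ) (cong (_+ ι J * κ) (trans (D0 (isZero-0 e)) (sym (*-identityʳ (ι J)))))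
      go false e = ≤-trans (proj₁ b) (≤-reflexive (sym (eq₀ (ι J) κ))) , ≤-by _ (0≤- (proj₂ b)) (eq₁ (ι J) (D x) κ)
        where
        x≢0 : x ≢ ℤ.0ℤ
        x≢0 eq = true≢false (trans (sym (cong isZero eq)) e)
          where
          true≢false : true ≢ false
          true≢false ()
        b = ∣∑χ∣ J κ x 0≤κ x≢0 (large x h x≢0)

    -- `Φ v` counts the zeros of `v + (s - s′)`, while the character sum `D` is `J` at zero and at
    -- most `κ J` in modulus elsewhere on the range secured by `Within`.
    approx : ∀ v → Within v → Ŝ v ≤ ι J * (Φ v + κ * E) × ι J * Φ v ≤ Ŝ v + ι J * (κ * E)
    approx v h = ≤-trans (≤-reflexive (expand v)) (≤-trans (∑-mono∈ Ξ up) (≤-reflexive total)) ,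
      ≤-trans (≤-reflexive (sym (∑-*ˡ Ξ (ι J) _))) (≤-trans (∑-mono∈ Ξ down) (≤-reflexive total′))
      where
      n : ℤ → ℚ
      n ξ = # (Y ξ) * # (Y ξ)
      split : ∀ ξ → ∑∑ (Y ξ) (λ s s′ → ι J * (δ (v ℤ.+ (s ℤ.- s′)) + κ)) ≡ ι J * (corr (Y ξ) v + n ξ * κ)
      split ξ = trans (∑∑-*ˡ (Y ξ) (ι J) _) (cong (ι J *_) (trans (∑∑-+ (Y ξ) _ _) (cong (λ y → corr (Y ξ) v + y) (∑∑-const (Y ξ) κ))))
      up : ∀ ξ → ξ ∈ Ξ → c ξ * ∑∑ (Y ξ) (λ s s′ → D (v ℤ.+ (s ℤ.- s′))) ≤ c ξ * (ι J * (corr (Y ξ) v + n ξ * κ))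
      up ξ ξ∈ = *-monoˡ (0≤c ξ) (≤-trans (∑-mono∈ (Y ξ) (λ s s∈ → ∑-mono∈ (Y ξ) (λ s′ s′∈ → proj₁ (D-bound _ (h ξ ξ∈ s s∈ s′ s′∈))))) (≤-reflexive (split ξ)))
      eqt : ∀ c i x n k → c * (i * (x + n * k)) ≡ i * (c * x) + i * k * (c * n)
      eqt = solve-∀ ℚ-ring
      eqt′ : ∀ i p k e → i * p + i * k * e ≡ i * (p + k * e)
      eqt′ = solve-∀ ℚ-ring
      total : ∑ Ξ (λ ξ → c ξ * (ι J * (corr (Y ξ) v + n ξ * κ))) ≡ ι J * (Φ v + κ * E)
      total = trans (∑-cong Ξ (λ ξ → eqt (c ξ) (ι J) (corr (Y ξ) v) (n ξ) κ)) (trans (∑-+ Ξ _ _) (trans (cong₂ _+_ (∑-*ˡ Ξ (ι J) _) (∑-*ˡ Ξ (ι J * κ) _)) (eqt′ (ι J) (Φ v) κ E)))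
      eqd : ∀ i c x n k → c * (x + n * (i * k)) ≡ c * x + i * k * (c * n)
      eqd = solve-∀ ℚ-ring
      down : ∀ ξ → ξ ∈ Ξ → ι J * (c ξ * corr (Y ξ) v) ≤ c ξ * (∑∑ (Y ξ) (λ s s′ → D (v ℤ.+ (s ℤ.- s′))) + n ξ * (ι J * κ))
      down ξ ξ∈ = ≤-trans (≤-reflexive (trans (e (ι J) (c ξ) (corr (Y ξ) v)) (cong (c ξ *_) (sym (∑∑-*ˡ (Y ξ) (ι J) _)))))
        (*-monoˡ (0≤c ξ) (≤-trans (∑-mono∈ (Y ξ) (λ s s∈ → ∑-mono∈ (Y ξ) (λ s′ s′∈ → proj₂ (D-bound _ (h ξ ξ∈ s s∈ s′ s′∈)))))
          (≤-reflexive (trans (∑∑-+ (Y ξ) _ _) (cong (λ y → ∑∑ (Y ξ) (λ s s′ → D (v ℤ.+ (s ℤ.- s′))) + y) (∑∑-const (Y ξ) (ι J * κ)))))))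
        where
        e : ∀ i c x → i * (c * x) ≡ c * (i * x)
        e = solve-∀ ℚ-ring
      total′ : ∑ Ξ (λ ξ → c ξ * (∑∑ (Y ξ) (λ s s′ → D (v ℤ.+ (s ℤ.- s′))) + n ξ * (ι J * κ))) ≡ Ŝ v + ι J * (κ * E)
      total′ = trans (∑-cong Ξ (λ ξ → eqd (ι J) (c ξ) _ (n ξ) κ)) (trans (∑-+ Ξ _ _) (cong₂ _+_ (sym (expand v)) (trans (∑-*ˡ Ξ (ι J * κ) _) (*-assoc (ι J) κ E))))

    Ŝ-energy : ∀ B v → ∑∑ B (λ z z′ → Ŝ (v ℤ.+ (z ℤ.- z′))) ≡ ∑ (below J) (λ j → a j * energy one′ B j * χr j v)
    Ŝ-energy B v = trans (∑-cong B (λ z → ∑-swap B (below J) _)) (trans (∑-swap B (below J) _)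
      (∑-cong (below J) (λ j → trans (∑∑-*ˡ B (a j) _) (trans (cong (a j *_) (energy-shift-1 B j v)) (sym (*-assoc (a j) _ _))))))

    -- On each frequency either the walk contracts by `½` per step, or the character is nearly
    -- constant on `B`. So the average that the walk sees from `A` is also seen from `B`, up to the
    -- factor `1 - γ` and to the total coefficient mass, essentially `Φ 0`, damped by `½ ^ ℓ`.
    transfer : ∀ A T w B ℓ g γ → (∀ t → 0ℚ ≤ w t) → 0ℚ < ∑ T w → 0ℚ < # A → 0ℚ ≤ γ → γ ≤ 1ℚ →
      (∀ v → Reach T ℓ v → ∀ z → z ∈ A → ∀ z′ → z′ ∈ A → Within (v ℤ.+ (z ℤ.- z′))) →
      (∀ z → z ∈ B → ∀ z′ → z′ ∈ B → Within (ℤ.0ℤ ℤ.+ (z ℤ.- z′))) → Within ℤ.0ℤ →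
      (∀ v → Reach T ℓ v → g * (# A * # A) ≤ ∑∑ A (λ z z′ → Φ (v ℤ.+ (z ℤ.- z′)))) →
      (∀ j → j ∈ below J → energy w T j ≤ ½ * (∑ T w * ∑ T w) ⊎ (1ℚ - γ) * (# B * # B) ≤ energy one′ B j) →
      (1ℚ - γ) * (g - κ * E) * (# B * # B) ≤ ∑∑ B (λ z z′ → Φ (ℤ.0ℤ ℤ.+ (z ℤ.- z′))) + κ * E * (# B * # B) + ½ ^ ℓ * (# B * # B) * (Φ ℤ.0ℤ + κ * E)
    transfer A T w B ℓ g γ 0≤w 0<W 0<A 0≤γ γ≤1 inA inB in0 lower dich =
      finish (0<* (0<^ ℓ 0<W²) 0<ιJ) chain
      where
      W² = ∑ T w * ∑ T w
      0<W² : 0ℚ < W²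
      0<W² = 0<* 0<W 0<W
      0<ιJ : 0ℚ < ι J
      0<ιJ = ιpos 0<J
        where
        ιpos : ∀ {n} → 0 ℕ.< n → 0ℚ < ι n
        ιpos {suc n} _ = 0<ι n
      A² = # A * # A
      B² = # B * # B
      0≤B² : 0ℚ ≤ B²
      0≤B² = 0≤* (0≤# B) (0≤# B)
      K = ι J * ((g - κ * E) * A²)
      F : ℤ → ℚ
      F v = ∑∑ A (λ z z′ → Ŝ (v ℤ.+ (z ℤ.- z′)))
      F≥ : ∀ v → Reach T ℓ v → K ≤ F v
      F≥ v r = ≤-trans (≤-by (ι J * (∑∑ A (λ z z′ → Φ (v ℤ.+ (z ℤ.- z′))) - g * A²)) (0≤* (0≤ι J) (0≤- (lower v r))) (eq (ι J) g (κ * E) A² (∑∑ A (λ z z′ → Φ (v ℤ.+ (z ℤ.- z′)))) ))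
        (≤-by _ (0≤- sum) (eq′ (F v) (ι J * ∑∑ A (λ z z′ → Φ (v ℤ.+ (z ℤ.- z′)))) (A² * (ι J * (κ * E)))))
        where
        eq : ∀ i g k a p → i * p - a * (i * k) ≡ i * ((g - k) * a) + i * (p - g * a)
        eq = solve-∀ ℚ-ring
        eq′ : ∀ f p k → f ≡ p - k + (f + k - p)
        eq′ = solve-∀ ℚ-ring
        sum : ι J * ∑∑ A (λ z z′ → Φ (v ℤ.+ (z ℤ.- z′))) ≤ F v + A² * (ι J * (κ * E))
        sum = ≤-trans (≤-reflexive (sym (∑∑-*ˡ A (ι J) _))) (≤-trans (∑-mono∈ A (λ z z∈ → ∑-mono∈ A (λ z′ z′∈ → proj₂ (approx _ (inA v r z z∈ z′ z′∈)))))
          (≤-reflexive (trans (∑∑-+ A _ _) (cong (λ y → F v + y) (∑∑-const A (ι J * (κ * E)))))))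
      spectral-lower : W² ^ ℓ * K ≤ ∑ (below J) (λ j → a j * energy one′ A j * energy w T j ^ ℓ * χr j ℤ.0ℤ)
      spectral-lower = ≤-trans (walk-lower w T ℓ K (λ u → ∑ (below J) (λ j → a j * energy one′ A j * χr j u)) 0≤w reach-0
          (λ u r → ≤-trans (F≥ u (subst (λ m → Reach T m u) (ℕ.+-identityʳ ℓ) r)) (≤-reflexive (Ŝ-energy A u))))
        (≤-reflexive (walk-χ w T ℓ (below J) (λ j → a j * energy one′ A j) ℤ.0ℤ))
      term : ∀ j → a j * energy one′ A j * energy w T j ^ ℓ * χr j ℤ.0ℤ ≤ A² * (a j * energy w T j ^ ℓ)
      term j = ≤-trans (≤-reflexive (trans (cong (a j * energy one′ A j * energy w T j ^ ℓ *_) (χr-0 j)) (e (a j) (energy one′ A j) (energy w T j ^ ℓ)))) (*-monoʳ (0≤* (0≤a j) (0≤^ ℓ (0≤energy w T j))) (energy≤ one′ A (λ _ → 0≤1) j))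
        where
        e : ∀ a b c → a * b * c * 1ℚ ≡ b * (a * c)
        e = solve-∀ ℚ-ring
      dichotomy : ∀ j → j ∈ below J → (1ℚ - γ) * B² * energy w T j ^ ℓ ≤ W² ^ ℓ * (energy one′ B j + ½ ^ ℓ * B²)
      dichotomy j j∈ with dich j j∈
      ... | inj₁ small = ≤-trans (*-mono (0≤* (0≤- γ≤1) 0≤B²) (0≤^ ℓ (0≤* 0≤½ (<⇒≤ 0<W²))) (≤-by (γ * B²) (0≤* 0≤γ 0≤B²) (e γ B²)) (^-mono ℓ (0≤energy w T j) small))
          (≤-trans (≤-reflexive (trans (cong (B² *_) (^-distrib-* ½ W² ℓ)) (e′ B² (½ ^ ℓ) (W² ^ ℓ)))) (*-monoˡ (0≤^ ℓ (<⇒≤ 0<W²)) (≤-by (energy one′ B j) (0≤energy one′ B j) (+-comm (energy one′ B j) (½ ^ ℓ * B²)))))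
        where
        e : ∀ g b → b ≡ (1ℚ - g) * b + g * b
        e = solve-∀ ℚ-ring
        e′ : ∀ b h w → b * (h * w) ≡ w * (h * b)
        e′ = solve-∀ ℚ-ring
      ... | inj₂ big = ≤-trans (*-mono (0≤* (0≤- γ≤1) 0≤B²) (0≤^ ℓ (<⇒≤ 0<W²)) big (^-mono ℓ (0≤energy w T j) (energy≤ w T 0≤w j)))
          (≤-trans (≤-reflexive (*-comm (energy one′ B j) (W² ^ ℓ))) (*-monoˡ (0≤^ ℓ (<⇒≤ 0<W²)) (≤-by (½ ^ ℓ * B²) (0≤* (0≤^ ℓ 0≤½) 0≤B²) refl)))
      SB = ∑ (below J) (λ j → a j * energy one′ B j)
      Sa = ∑ (below J) a
      ΦB = ∑∑ B (λ z z′ → Φ (ℤ.0ℤ ℤ.+ (z ℤ.- z′)))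
      summed : (1ℚ - γ) * B² * ∑ (below J) (λ j → a j * energy w T j ^ ℓ) ≤ W² ^ ℓ * (SB + ½ ^ ℓ * B² * Sa)
      summed = ≤-trans (≤-reflexive (trans (sym (∑-*ˡ (below J) ((1ℚ - γ) * B²) _)) (∑-cong (below J) (λ j → e ((1ℚ - γ) * B²) (a j) (energy w T j ^ ℓ)))))
        (≤-trans (∑-mono∈ (below J) (λ j j∈ → *-monoˡ (0≤a j) (dichotomy j j∈)))
          (≤-reflexive (trans (∑-cong (below J) (λ j → e₂ (a j) (W² ^ ℓ) (energy one′ B j) (½ ^ ℓ * B²))) (trans (∑-*ˡ (below J) (W² ^ ℓ) _) (cong (W² ^ ℓ *_) (trans (∑-+ (below J) _ _) (cong (λ y → SB + y) (∑-*ˡ (below J) (½ ^ ℓ * B²) a))))))))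
        where
        e : ∀ k a x → k * (a * x) ≡ a * (k * x)
        e = solve-∀ ℚ-ring
        e₂ : ∀ a w b h → a * (w * (b + h)) ≡ w * (a * b + h * a)
        e₂ = solve-∀ ℚ-ring
      SB≤ : SB ≤ ι J * (ΦB + B² * (κ * E))
      SB≤ = ≤-trans (≤-reflexive (trans (∑-cong (below J) (λ j → trans (sym (*-identityʳ _)) (cong (a j * energy one′ B j *_) (sym (χr-0 j))))) (sym (Ŝ-energy B ℤ.0ℤ))))
        (≤-trans (∑-mono∈ B (λ z z∈ → ∑-mono∈ B (λ z′ z′∈ → proj₁ (approx _ (inB z z∈ z′ z′∈))))) (≤-reflexive (trans (∑∑-*ˡ B (ι J) _) (cong (ι J *_) (trans (∑∑-+ B _ _) (cong (λ y → ΦB + y) (∑∑-const B (κ * E))))))))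
      Sa≤ : Sa ≤ ι J * (Φ ℤ.0ℤ + κ * E)
      Sa≤ = ≤-trans (≤-reflexive (∑-cong (below J) (λ j → trans (sym (*-identityʳ (a j))) (cong (a j *_) (sym (χr-0 j)))))) (proj₁ (approx ℤ.0ℤ in0))
      X = ∑ (below J) (λ j → a j * energy w T j ^ ℓ)
      lowX : W² ^ ℓ * (ι J * (g - κ * E)) ≤ X
      lowX = *-cancelˡ (0<* 0<A 0<A) (≤-trans (≤-reflexive (e A² (W² ^ ℓ) (ι J) (g - κ * E))) (≤-trans spectral-lower (≤-trans (∑-mono (below J) term) (≤-reflexive (∑-*ˡ (below J) A² _)))))
        where
        e : ∀ a w i x → a * (w * (i * x)) ≡ w * (i * (x * a))
        e = solve-∀ ℚ-ring
      RHS = ΦB + κ * E * B² + ½ ^ ℓ * B² * (Φ ℤ.0ℤ + κ * E)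
      chain : W² ^ ℓ * ι J * ((1ℚ - γ) * (g - κ * E) * B²) ≤ W² ^ ℓ * ι J * RHS
      chain = ≤-trans (≤-reflexive (e (W² ^ ℓ) (ι J) (1ℚ - γ) (g - κ * E) B²)) (≤-trans (*-monoˡ (0≤* (0≤- γ≤1) 0≤B²) lowX) (≤-trans summed
        (≤-trans (*-monoˡ (0≤^ ℓ (<⇒≤ 0<W²)) (+-mono-≤ SB≤ (*-monoˡ (0≤* (0≤^ ℓ 0≤½) 0≤B²) Sa≤))) (≤-reflexive (e₂ (W² ^ ℓ) (ι J) ΦB B² (κ * E) (½ ^ ℓ) (Φ ℤ.0ℤ))))))
        where
        e : ∀ w i g x b → w * i * (g * x * b) ≡ g * b * (w * (i * x))
        e = solve-∀ ℚ-ring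
        e₂ : ∀ w i p b k h f → w * (i * (p + b * k) + h * b * (i * (f + k))) ≡ w * i * (p + k * b + h * b * (f + k))
        e₂ = solve-∀ ℚ-ring
      finish : ∀ {x y} → 0ℚ < W² ^ ℓ * ι J → W² ^ ℓ * ι J * x ≤ W² ^ ℓ * ι J * y → x ≤ y
      finish = *-cancelˡ

-- Riesz products and the large spectrum

module RieszProducts where

  open Rationals
  open Sums
  open Characters
  open Transfer using (energy; module Energy)

  record Factor : Set where
    constructor factor
    field
      α β : ℚ
      freq : ℕ
      unital : α * α + β * β ≤ 1ℚ
  open Factor public

  5/4 9/8 10/9 1/16 1/4 : ℚ
  5/4 = + 5 / 4
  9/8 = + 9 / 8
  10/9 = + 10 / 9
  1/16 = + 1 / 16
  1/4 = + 1 / 4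

  -- 1 + ½ Re(ω χ(x)) with ω = α + iβ
  fac : Factor → ℤ → ℚ
  fac f x = 1ℚ + ½ * (α f * χr (freq f) x - β f * χi (freq f) x)

  riesz : List Factor → ℤ → ℚ
  riesz [] x = 1ℚ
  riesz (f ∷ Λ) x = fac f x * riesz Λ x

  -- Cauchy-Schwarz for the real part of a product of complex numbers, from the two-square identity.
  plane-cs : ∀ {a b x y A X} → a * a + b * b ≤ A → x * x + y * y ≤ X → 0ℚ ≤ A → (a * x - b * y) * (a * x - b * y) ≤ A * X
  plane-cs {a} {b} {x} {y} h₁ h₂ 0≤A = ≤-trans (≤-by _ (0≤sq (a * y + b * x)) (eq a b x y)) (*-mono (0≤+ (0≤sq a) (0≤sq b)) (≤-trans (0≤+ (0≤sq x) (0≤sq y)) h₂) h₁ h₂)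
    where
    eq : ∀ a b x y → (a * a + b * b) * (x * x + y * y) ≡ (a * x - b * y) * (a * x - b * y) + (a * y + b * x) * (a * y + b * x)
    eq = solve-∀ ℚ-ring

  neg-sq : ∀ x → - x * - x ≡ x * x
  neg-sq = solve-∀ ℚ-ring

  abs-≤ : ∀ {x b} → 0ℚ ≤ b → x * x ≤ b * b → x ≤ b × - x ≤ b
  abs-≤ {x} p h = sq-≤ p h , sq-≤ p (≤-trans (≤-reflexive (neg-sq x)) h)

  real-part : Factor → ℤ → ℚ
  real-part f x = α f * χr (freq f) x - β f * χi (freq f) x

  real-part-bound : ∀ f x → real-part f x ≤ 1ℚ × - real-part f x ≤ 1ℚ
  real-part-bound f x = abs-≤ 0≤1 (plane-cs {α f} {β f} {χr (freq f) x} {χi (freq f) x} (unital f) (≤-reflexive (χ-unit (freq f) x)) 0≤1)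

  ½≤fac : ∀ f x → ½ ≤ fac f x
  ½≤fac f x = ≤-by (½ * (1ℚ - - real-part f x)) (0≤* 0≤½ (0≤- (proj₂ (real-part-bound f x)))) (eq (real-part f x))
    where
    eq : ∀ a → 1ℚ + ½ * a ≡ ½ + ½ * (1ℚ - - a)
    eq = solve-∀ ℚ-ring

  0<fac : ∀ f x → 0ℚ < fac f x
  0<fac f x = ℚ.<-≤-trans (ℚ.positive⁻¹ ½) (½≤fac f x)

  0<riesz : ∀ Λ x → 0ℚ < riesz Λ x
  0<riesz [] x = ℚ.positive⁻¹ 1ℚ
  0<riesz (f ∷ Λ) x = 0<* (0<fac f x) (0<riesz Λ x)

  0≤riesz : ∀ Λ x → 0ℚ ≤ riesz Λ x
  0≤riesz Λ x = <⇒≤ (0<riesz Λ x)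

  -- As `2 (1 - Re χ(w)) = |χ(w) - 1|²`, this puts `w` into the Bohr set of radius `η` for the
  -- frequency of the factor.
  Near : ℚ → ℤ → Factor → Set
  Near η w f = 2ℚ * (1ℚ - χr (freq f) w) ≤ η * η

  rp-shift : ∀ {η w} f → 0ℚ ≤ η → Near η w f → ∀ x → real-part f (x ℤ.+ w) - real-part f x ≤ η × - (real-part f (x ℤ.+ w) - real-part f x) ≤ η
  rp-shift {η} {w} f 0≤η h x = abs-≤ 0≤η (≤-trans (≤-reflexive (cong₂ _*_ shift shift)) (≤-trans (plane-cs {a} {b} {rw - 1ℚ} {iw} ab≤ (≤-trans (≤-reflexive wd) h) 0≤1) (≤-reflexive (*-identityˡ (η * η)))))
    where
    j = freq f
    r = χr j x
    i = χi j x
    rw = χr j w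
    iw = χi j w
    a = real-part f x
    b = α f * i + β f * r
    eq : ∀ α β r i rw iw → α * (r * rw - i * iw) - β * (i * rw + r * iw) - (α * r - β * i) ≡ (α * r - β * i) * (rw - 1ℚ) - (α * i + β * r) * iw
    eq = solve-∀ ℚ-ring
    shift : real-part f (x ℤ.+ w) - real-part f x ≡ a * (rw - 1ℚ) - b * iw
    shift = trans (cong₂ (λ u v → α f * u - β f * v - real-part f x) (χr-+ j x w) (χi-+ j x w)) (eq (α f) (β f) r i rw iw)
    eq₂ : ∀ α β r i → (α * r - β * i) * (α * r - β * i) + (α * i + β * r) * (α * i + β * r) ≡ (α * α + β * β) * (r * r + i * i)
    eq₂ = solve-∀ ℚ-ring
    ab≤ : a * a + b * b ≤ 1ℚ
    ab≤ = ≤-trans (≤-reflexive (trans (eq₂ (α f) (β f) r i) (trans (cong ((α f * α f + β f * β f) *_) (χ-unit j x)) (*-identityʳ _)))) (unital f)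
    eq₃ : ∀ r i → (r - 1ℚ) * (r - 1ℚ) + i * i ≡ r * r + i * i + (1ℚ - 2ℚ * r)
    eq₃ = solve-∀ ℚ-ring
    eq₄ : ∀ r → 1ℚ + (1ℚ - 2ℚ * r) ≡ 2ℚ * (1ℚ - r)
    eq₄ = solve-∀ ℚ-ring
    wd : (rw - 1ℚ) * (rw - 1ℚ) + iw * iw ≡ 2ℚ * (1ℚ - rw)
    wd = trans (eq₃ rw iw) (trans (cong (_+ (1ℚ - 2ℚ * rw)) (χ-unit j w)) (eq₄ rw))

  fac-shift : ∀ {η w} f → 0ℚ ≤ η → Near η w f → ∀ x → (1ℚ - η) * fac f x ≤ fac f (x ℤ.+ w) × (1ℚ - η) * fac f (x ℤ.+ w) ≤ fac f x
  fac-shift {η} {w} f 0≤η h x =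
    ≤-by _ (0≤+ (0≤* 0≤½ (0≤- (proj₂ d))) (0≤* 0≤η (0≤- (½≤fac f x)))) (eq η (real-part f x) (real-part f (x ℤ.+ w))) ,
    ≤-by _ (0≤+ (0≤* 0≤½ (0≤- (proj₁ d))) (0≤* 0≤η (0≤- (½≤fac f (x ℤ.+ w))))) (eq′ η (real-part f x) (real-part f (x ℤ.+ w)))
    where
    d = rp-shift {η} {w} f 0≤η h x
    eq : ∀ e a b → 1ℚ + ½ * b ≡ (1ℚ - e) * (1ℚ + ½ * a) + (½ * (e - - (b - a)) + e * (1ℚ + ½ * a - ½))
    eq = solve-∀ ℚ-ring
    eq′ : ∀ e a b → 1ℚ + ½ * a ≡ (1ℚ - e) * (1ℚ + ½ * b) + (½ * (e - (b - a)) + e * (1ℚ + ½ * b - ½))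
    eq′ = solve-∀ ℚ-ring

  riesz-shift : ∀ {η w} Λ → 0ℚ ≤ η → η ≤ 1ℚ → (∀ f → f ∈ Λ → Near η w f) → ∀ x →
    (1ℚ - η) ^ length Λ * riesz Λ x ≤ riesz Λ (x ℤ.+ w) × (1ℚ - η) ^ length Λ * riesz Λ (x ℤ.+ w) ≤ riesz Λ x
  riesz-shift [] p q h x = ≤-reflexive (*-identityˡ 1ℚ) , ≤-reflexive (*-identityˡ 1ℚ)
  riesz-shift {η} {w} (f ∷ Λ) p q h x =
    ≤-trans (≤-reflexive (eq (1ℚ - η) ((1ℚ - η) ^ length Λ) (fac f x) (riesz Λ x))) (*-mono (0≤* (0≤- q) (<⇒≤ (0<fac f x))) (0≤riesz Λ (x ℤ.+ w)) (proj₁ head) (proj₁ tail)) ,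
    ≤-trans (≤-reflexive (eq (1ℚ - η) ((1ℚ - η) ^ length Λ) (fac f (x ℤ.+ w)) (riesz Λ (x ℤ.+ w)))) (*-mono (0≤* (0≤- q) (<⇒≤ (0<fac f (x ℤ.+ w)))) (0≤riesz Λ x) (proj₂ head) (proj₂ tail))
    where
    head = fac-shift {η} {w} f p (h f (here refl)) x
    tail = riesz-shift {η} {w} Λ p q (λ g m → h g (there m)) x
    eq : ∀ e E a b → e * E * (a * b) ≡ e * a * (E * b)
    eq = solve-∀ ℚ-ring

  squeeze : ∀ {e p s} → 0ℚ < s → 2ℚ ≤ e → e * p ≤ s → s ≤ p → ⊥
  squeeze {e} {p} {s} 0<s h₁ h₂ h₃ = <⇒≱ 0<s (≤-by _ (0≤+ (0≤+ (0≤* (≤-trans (<⇒≤ 0<s) h₃) (0≤- h₁)) (0≤- h₂)) (0≤* 0≤2 (0≤- h₃))) (eq e p s))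
    where
    eq : ∀ e p s → 0ℚ ≡ s + (p * (e - 2ℚ) + (s - e * p) + 2ℚ * (p - s))
    eq = solve-∀ ℚ-ring

  -- The job of Chang's lemma, relative to a chain of scales: a frequency large on `T` but small on
  -- the current scale joins the product. The weighted mass of `T` then grows by `5/4`, that of the
  -- scale by at most `9/8`. As the scale contains `T`, this stops before `M` frequencies, and the
  -- others are settled.
  module Greedy (T : List ℤ) (P : ℕ → List ℤ) (J : ℕ)
    (T⊂P : ∀ (F : ℤ → ℚ) → (∀ x → 0ℚ ≤ F x) → ∑ T F ≤ ∑ (P 0) F)
    (P-mono : ∀ r (F : ℤ → ℚ) → (∀ x → 0ℚ ≤ F x) → ∑ (P r) F ≤ ∑ (P (suc r)) F)
    (τ c : ℚ) (K M : ℕ) (0<T : 0ℚ < # T) (0<τ : 0ℚ < τ) (τ≤1 : τ ≤ 1ℚ) (0≤c : 0ℚ ≤ c)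
    (hK : 2ℚ ≤ (1ℚ + c) ^ K * τ) (hM : 2ℚ ≤ 10/9 ^ M * τ) where

    ST : List Factor → ℚ
    ST Λ = ∑ T (riesz Λ)

    SP : ℕ → List Factor → ℚ
    SP r Λ = ∑ (P r) (riesz Λ)

    0<ST : ∀ Λ → 0ℚ < ST Λ
    0<ST Λ with #-pos-∃ T 0<T
    ... | t , t∈ = ℚ.<-≤-trans (0<riesz Λ t) (term≤∑ (0≤riesz Λ) t∈)

    SP-mono : ∀ r n Λ → SP r Λ ≤ SP (n ℕ.+ r) Λ
    SP-mono r zero Λ = ≤-refl
    SP-mono r (suc n) Λ = ≤-trans (SP-mono r n Λ) (P-mono (n ℕ.+ r) (riesz Λ) (0≤riesz Λ))

    ST≤SP : ∀ r Λ → ST Λ ≤ SP r Λ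
    ST≤SP r Λ = ≤-trans (T⊂P (riesz Λ) (0≤riesz Λ)) (subst (λ m → SP 0 Λ ≤ SP m Λ) (ℕ.+-identityʳ r) (SP-mono 0 r Λ))

    -- A scale at which one more shift hardly adds mass. Any `K` consecutive scales contain one:
    -- otherwise their mass would grow by `(1 + c) ^ K ≥ 2 / τ`, although `T` already has a share
    -- `τ` of the largest.
    Regular : ℕ → List Factor → Set
    Regular r Λ = SP (suc r) Λ ≤ (1ℚ + c) * SP r Λ

    find-regular : ∀ n base Λ → (∃ λ i → base ℕ.≤ i × i ℕ.< n ℕ.+ base × Regular i Λ) ⊎ (1ℚ + c) ^ n * SP base Λ ≤ SP (n ℕ.+ base) Λ
    find-regular zero base Λ = inj₂ (≤-reflexive (*-identityˡ _))
    find-regular (suc n) base Λ = go (find-regular n base Λ) (≤-total (SP (suc (n ℕ.+ base)) Λ) ((1ℚ + c) * SP (n ℕ.+ base) Λ))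
      where
      Goal = (∃ λ i → base ℕ.≤ i × i ℕ.< suc n ℕ.+ base × Regular i Λ) ⊎ (1ℚ + c) ^ suc n * SP base Λ ≤ SP (suc n ℕ.+ base) Λ
      go : (∃ λ i → base ℕ.≤ i × i ℕ.< n ℕ.+ base × Regular i Λ) ⊎ (1ℚ + c) ^ n * SP base Λ ≤ SP (n ℕ.+ base) Λ →
        SP (suc (n ℕ.+ base)) Λ ≤ (1ℚ + c) * SP (n ℕ.+ base) Λ ⊎ (1ℚ + c) * SP (n ℕ.+ base) Λ ≤ SP (suc (n ℕ.+ base)) Λ → Goal
      go (inj₁ (i , p , q , r)) _ = inj₁ (i , p , ℕ.m≤n⇒m≤1+n q , r)
      go (inj₂ _) (inj₁ r) = inj₁ (n ℕ.+ base , ℕ.m≤n+m base n , ℕ.≤-refl , r)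
      go (inj₂ h) (inj₂ h′) = inj₂ (≤-trans (≤-reflexive (*-assoc (1ℚ + c) _ _)) (≤-trans (*-monoˡ (0≤+ 0≤1 0≤c) h) h′))

    Settled : ℕ → List Factor → ℕ → Set
    Settled r Λ j = energy (riesz Λ) T j ≤ ½ * (ST Λ * ST Λ) ⊎ 1/16 * (SP r Λ * SP r Λ) ≤ energy (riesz Λ) (P r) j

    Violates : ℕ → List Factor → ℕ → Set
    Violates r Λ j = ½ * (ST Λ * ST Λ) ≤ energy (riesz Λ) T j × energy (riesz Λ) (P r) j ≤ 1/16 * (SP r Λ * SP r Λ)

    search : ∀ r Λ js → (∃ λ j → Violates r Λ j) ⊎ (∀ j → j ∈ js → Settled r Λ j)
    search r Λ [] = inj₂ (λ j ())
    search r Λ (j ∷ js) = go (≤-total (energy (riesz Λ) T j) (½ * (ST Λ * ST Λ))) (≤-total (1/16 * (SP r Λ * SP r Λ)) (energy (riesz Λ) (P r) j)) (search r Λ js)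
      where
      Goal = (∃ λ j → Violates r Λ j) ⊎ (∀ j′ → j′ ∈ j ∷ js → Settled r Λ j′)
      add : Settled r Λ j → (∃ λ j → Violates r Λ j) ⊎ (∀ j → j ∈ js → Settled r Λ j) → Goal
      add s (inj₁ v) = inj₁ v
      add s (inj₂ h) = inj₂ λ { j (here refl) → s ; j (there m) → h j m }
      go : energy (riesz Λ) T j ≤ ½ * (ST Λ * ST Λ) ⊎ ½ * (ST Λ * ST Λ) ≤ energy (riesz Λ) T j →
        1/16 * (SP r Λ * SP r Λ) ≤ energy (riesz Λ) (P r) j ⊎ energy (riesz Λ) (P r) j ≤ 1/16 * (SP r Λ * SP r Λ) →
        (∃ λ j → Violates r Λ j) ⊎ (∀ j → j ∈ js → Settled r Λ j) → Goal
      go (inj₁ s) _ rest = add (inj₁ s) rest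
      go (inj₂ _) (inj₁ s) rest = add (inj₂ s) rest
      go (inj₂ v) (inj₂ v′) rest = inj₁ (j , v , v′)

    ∑-extend : ∀ xs f Λ → ∑ xs (riesz (f ∷ Λ)) ≡ ∑ xs (riesz Λ) + ½ * (α f * Energy.R (riesz Λ) xs (freq f) - β f * Energy.I (riesz Λ) xs (freq f))
    ∑-extend xs f Λ = trans (∑-cong xs (λ x → eq (riesz Λ x) (α f) (β f) (χr (freq f) x) (χi (freq f) x)))
      (trans (∑-+ xs _ _) (cong (λ y → ∑ xs (riesz Λ) + y) (trans (∑-*ˡ xs ½ _) (cong (½ *_) (trans (∑-- xs _ _) (cong₂ _-_ (∑-*ˡ xs (α f) _) (∑-*ˡ xs (β f) _)))))))
      where
      eq : ∀ C a b r i → (1ℚ + ½ * (a * r - b * i)) * C ≡ C + ½ * (a * (C * r) - b * (C * i))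
      eq = solve-∀ ℚ-ring

    -- The new coefficient is the conjugate of the Fourier coefficient `F` of `T` divided by the
    -- mass `s` of `T`. So `T` gains `½ |F|² / s ≥ s / 4`. On the scale the Fourier coefficient is
    -- at most `1/4` of the mass, as `1/16 = (1/4)²`, so the gain is at most `1/8`.
    extension : ∀ r Λ j → Violates r Λ j → ∃ λ f → 5/4 * ST Λ ≤ ST (f ∷ Λ) × SP r (f ∷ Λ) ≤ 9/8 * SP r Λ
    extension r Λ j (big , small) = f , ST≥ , SP≤
      where
      s = ST Λ
      is = inv s
      p = SP r Λ
      R = Energy.R (riesz Λ) T j
      I = Energy.I (riesz Λ) T j
      RP = Energy.R (riesz Λ) (P r) j
      IP = Energy.I (riesz Λ) (P r) j
      s*is : s * is ≡ 1ℚ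
      s*is = inv-pos (0<ST Λ)
      0≤is : 0ℚ ≤ is
      0≤is = 0≤inv (<⇒≤ (0<ST Λ))
      eqω : ∀ R I i → R * i * (R * i) + - (I * i) * - (I * i) ≡ (R * R + I * I) * (i * i)
      eqω = solve-∀ ℚ-ring
      eqs : ∀ s i → s * s * (i * i) ≡ s * i * (s * i)
      eqs = solve-∀ ℚ-ring
      u : R * is * (R * is) + - (I * is) * - (I * is) ≤ 1ℚ
      u = ≤-trans (≤-reflexive (eqω R I is)) (≤-trans (*-monoʳ (0≤* 0≤is 0≤is) (Energy.energy≤ (riesz Λ) T (0≤riesz Λ) j)) (≤-reflexive (trans (eqs s is) (cong₂ _*_ s*is s*is))))
      f : Factor
      f = factor (R * is) (- (I * is)) j u
      ST≥ : 5/4 * s ≤ ST (f ∷ Λ)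
      ST≥ = ≤-trans (≤-by (½ * is * (R * R + I * I - ½ * (s * s))) (0≤* (0≤* 0≤½ 0≤is) (0≤- big)) (trans (eq s is R I) (trans (cong (λ y → s + ½ * ½ * (y * s) + ½ * is * (R * R + I * I - ½ * (s * s))) s*is) (eq′ s (½ * is * (R * R + I * I - ½ * (s * s))))))) (≤-reflexive (sym (∑-extend T f Λ)))
        where
        eq : ∀ s i R I → s + ½ * (R * i * R - - (I * i) * I) ≡ s + ½ * ½ * (s * i * s) + ½ * i * (R * R + I * I - ½ * (s * s))
        eq = solve-∀ ℚ-ring
        eq′ : ∀ s x → s + ½ * ½ * (1ℚ * s) + x ≡ 5/4 * s + x
        eq′ = solve-∀ ℚ-ring
      cross : R * is * RP - - (I * is) * IP ≤ 1/4 * p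
      cross = sq-≤ (0≤* {1/4} ≤! (0≤∑ (P r) (0≤riesz Λ))) (≤-trans (plane-cs {R * is} { - (I * is)} {RP} {IP} u small 0≤1) (≤-reflexive (eq p)))
        where
        eq : ∀ p → 1ℚ * (1/16 * (p * p)) ≡ 1/4 * p * (1/4 * p)
        eq = solve-∀ ℚ-ring
      SP≤ : SP r (f ∷ Λ) ≤ 9/8 * p
      SP≤ = ≤-trans (≤-reflexive (∑-extend (P r) f Λ)) (≤-by (½ * (1/4 * p - (R * is * RP - - (I * is) * IP))) (0≤* 0≤½ (0≤- cross)) (eq p (R * is * RP - - (I * is) * IP)))
        where
        eq : ∀ p x → 9/8 * p ≡ p + ½ * x + ½ * (1/4 * p - x)
        eq = solve-∀ ℚ-ring

    -- Windows of `K` scales are used from the top down, one for each factor. Smaller scales have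
    -- smaller mass, so the density bound survives the passage to the next window.
    greedy : ∀ rem Λ → length Λ ℕ.+ rem ≡ M → 10/9 ^ length Λ * τ * SP (rem ℕ.* K) Λ ≤ ST Λ →
      ∃ λ Λ′ → length Λ′ ℕ.≤ M × ∃ λ r → r ℕ.< M ℕ.* K × Regular r Λ′ × (∀ j → j ∈ below J → Settled r Λ′ j)
    -- With `M` factors the density bound and `hM` would give `T` twice the mass of the scale `P 0`
    -- that contains it.
    greedy zero Λ len h = ⊥-elim (squeeze {e = 10/9 ^ length Λ * τ} (0<ST Λ) (subst (λ m → 2ℚ ≤ 10/9 ^ m * τ) (trans (sym len) (ℕ.+-identityʳ (length Λ))) hM) h (ST≤SP 0 Λ))
    greedy (suc rem) Λ len h = go (find-regular K base Λ)
      where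
      base = rem ℕ.* K
      Goal = ∃ λ Λ′ → length Λ′ ℕ.≤ M × ∃ λ r → r ℕ.< M ℕ.* K × Regular r Λ′ × (∀ j → j ∈ below J → Settled r Λ′ j)
      e = 10/9 ^ length Λ
      SP-mono-≤ : ∀ {r r′} Λ → r ℕ.≤ r′ → SP r Λ ≤ SP r′ Λ
      SP-mono-≤ {r} {r′} Λ q = subst (λ m → SP r Λ ≤ SP m Λ) (ℕ.m∸n+n≡m q) (SP-mono r (r′ ℕ.∸ r) Λ)
      h′ : τ * SP (K ℕ.+ base) Λ ≤ ST Λ
      h′ = ≤-trans (≤-trans (≤-reflexive (sym (*-identityˡ _))) (≤-trans (*-monoʳ (0≤* (<⇒≤ 0<τ) (0≤∑ (P (K ℕ.+ base)) (0≤riesz Λ))) (1≤^ (length Λ) (≤! {1ℚ} {10/9}))) (≤-reflexive (sym (*-assoc e τ _))))) h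
      go : (∃ λ i → base ℕ.≤ i × i ℕ.< K ℕ.+ base × Regular i Λ) ⊎ (1ℚ + c) ^ K * SP base Λ ≤ SP (K ℕ.+ base) Λ → Goal
      go (inj₂ big) = ⊥-elim (squeeze {e = (1ℚ + c) ^ K * τ} (0<ST Λ) hK
        (≤-trans (≤-reflexive (eq ((1ℚ + c) ^ K) τ (SP base Λ))) (≤-trans (*-monoˡ (<⇒≤ 0<τ) big) h′)) (ST≤SP base Λ))
        where
        eq : ∀ a t p → a * t * p ≡ t * (a * p)
        eq = solve-∀ ℚ-ring
      go (inj₁ (i , base≤i , i< , reg)) = go′ (search i Λ (below J))
        where
        len≤ : suc rem ℕ.≤ M
        len≤ = subst (suc rem ℕ.≤_) len (ℕ.m≤n+m (suc rem) (length Λ))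
        go′ : (∃ λ j → Violates i Λ j) ⊎ (∀ j → j ∈ below J → Settled i Λ j) → Goal
        go′ (inj₂ settled) = Λ , subst (length Λ ℕ.≤_) len (ℕ.m≤m+n (length Λ) (suc rem)) , i , ℕ.<-≤-trans i< (ℕ.*-monoˡ-≤ K len≤) , reg , settled
        go′ (inj₁ (j , v)) = extend (extension i Λ j v)
          where
          extend : (∃ λ f → 5/4 * ST Λ ≤ ST (f ∷ Λ) × SP i (f ∷ Λ) ≤ 9/8 * SP i Λ) → Goal
          extend (f , st , sp) = greedy rem (f ∷ Λ) (trans (sym (ℕ.+-suc (length Λ) rem)) len)
            (≤-trans (*-monoˡ (0≤* (0≤^ (suc (length Λ)) (≤! {0ℚ} {10/9})) (<⇒≤ 0<τ)) (≤-trans (SP-mono-≤ (f ∷ Λ) base≤i) (≤-trans sp (*-monoˡ (≤! {0ℚ} {9/8}) (SP-mono-≤ Λ (ℕ.<⇒≤ i<))))))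
              (≤-trans (≤-reflexive (eq e τ (SP (K ℕ.+ base) Λ))) (≤-trans (*-monoˡ (≤! {0ℚ} {5/4}) h) st)))
            where
            eq : ∀ e t p → 10/9 * e * t * (9/8 * p) ≡ 5/4 * (e * t * p)
            eq = solve-∀ ℚ-ring

    start : τ * SP (M ℕ.* K) [] ≤ ST [] → ∃ λ Λ′ → length Λ′ ℕ.≤ M × ∃ λ r → r ℕ.< M ℕ.* K × Regular r Λ′ × (∀ j → j ∈ below J → Settled r Λ′ j)
    start h = greedy M [] refl (≤-trans (≤-reflexive (cong (_* SP (M ℕ.* K) []) (*-identityˡ τ))) h)

    module _ (r : ℕ) (Λ : List Factor) (reg : Regular r Λ) (c≤1 : c ≤ 1ℚ) (w : ℤ)
      (shift : ∀ (F : ℤ → ℚ) → (∀ x → 0ℚ ≤ F x) → ∑ (P r) (λ x → F (x ℤ.+ w)) ≤ ∑ (P (suc r)) F)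
      (stable : ∀ x → (1ℚ - c) * riesz Λ x ≤ riesz Λ (x ℤ.+ w) × (1ℚ - c) * riesz Λ (x ℤ.+ w) ≤ riesz Λ x) where

      C : ℤ → ℚ
      C = riesz Λ
      Pr Pr′ : List ℤ
      Pr = P r
      Pr′ = P (suc r)
      S L₁ : ℚ
      S = SP r Λ
      L₁ = ∑ Pr (λ x → C (x ℤ.+ w))

      L₁≥ : (1ℚ - c) * S ≤ L₁
      L₁≥ = ≤-trans (≤-reflexive (sym (∑-*ˡ Pr (1ℚ - c) C))) (∑-mono Pr (λ x → proj₁ (stable x)))

      L₁≤ : L₁ ≤ (1ℚ + c) * S
      L₁≤ = ≤-trans (shift C (0≤riesz Λ)) reg

      0≤S : 0ℚ ≤ S
      0≤S = 0≤∑ Pr (0≤riesz Λ)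

      module _ (h : ℤ → ℚ) (h≤1 : ∀ x → h x ≤ 1ℚ) (-1≤h : ∀ x → - h x ≤ 1ℚ) where

        X₀ X₁ X₂ X₃ : ℚ
        X₀ = ∑ Pr (λ x → C x * h (x ℤ.+ w))
        X₁ = ∑ Pr (λ x → C (x ℤ.+ w) * h (x ℤ.+ w))
        X₂ = ∑ Pr′ (λ x → C x * h x)
        X₃ = ∑ Pr (λ x → C x * h x)

        step₁ : X₀ ≤ X₁ + c * (S + L₁)
        step₁ = ≤-trans (∑-mono Pr (λ x → pointwise (C x) (C (x ℤ.+ w)) (h (x ℤ.+ w)) (0≤riesz Λ x) (0≤riesz Λ (x ℤ.+ w)) (h≤1 (x ℤ.+ w)) (-1≤h (x ℤ.+ w)) (stable x)))
          (≤-reflexive (trans (∑-+ Pr _ _) (cong (λ y → X₁ + y) (trans (∑-*ˡ Pr c _) (cong (c *_) (∑-+ Pr _ _))))))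
          where
          eq : ∀ a b h c → b * h + c * (a + b) ≡ a * h + (½ * (1ℚ - - h) * (b - (1ℚ - c) * a + c * b) + ½ * (1ℚ - h) * (a - (1ℚ - c) * b + c * a))
          eq = solve-∀ ℚ-ring
          pointwise : ∀ a b h → 0ℚ ≤ a → 0ℚ ≤ b → h ≤ 1ℚ → - h ≤ 1ℚ → ((1ℚ - c) * a ≤ b × (1ℚ - c) * b ≤ a) → a * h ≤ b * h + c * (a + b)
          pointwise a b h 0≤a 0≤b p q (u , v) = ≤-by _ (0≤+ (0≤* (0≤* 0≤½ (0≤- q)) (0≤+ (0≤- u) (0≤* 0≤c 0≤b))) (0≤* (0≤* 0≤½ (0≤- p)) (0≤+ (0≤- v) (0≤* 0≤c 0≤a)))) (eq a b h c)

        step₂ : L₁ + X₁ ≤ SP (suc r) Λ + X₂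
        step₂ = ≤-trans (≤-reflexive (sym (trans (∑-cong Pr (λ x → eq (C (x ℤ.+ w)) (h (x ℤ.+ w)))) (∑-+ Pr _ _)))) (≤-trans (shift (λ x → C x * (1ℚ - - h x)) (λ x → 0≤* (0≤riesz Λ x) (0≤- (-1≤h x))))
          (≤-reflexive (trans (∑-cong Pr′ (λ x → eq (C x) (h x))) (∑-+ Pr′ _ _))))
          where
          eq : ∀ a h → a * (1ℚ - - h) ≡ a + a * h
          eq = solve-∀ ℚ-ring

        step₃ : S - X₃ ≤ SP (suc r) Λ - X₂
        step₃ = ≤-trans (≤-reflexive (sym (trans (∑-cong Pr (λ x → eq (C x) (h x))) (∑-- Pr _ _)))) (≤-trans (P-mono r (λ x → C x * (1ℚ - h x)) (λ x → 0≤* (0≤riesz Λ x) (0≤- (h≤1 x))))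
          (≤-reflexive (trans (∑-cong Pr′ (λ x → eq (C x) (h x))) (∑-- Pr′ _ _))))
          where
          eq : ∀ a h → a * (1ℚ - h) ≡ a - a * h
          eq = solve-∀ ℚ-ring

        -- Inclusions compare sums of nonnegative functions only, so the signed `h` enters as
        -- `1 + h` in `step₂` and as `1 - h` in `step₃`. The two inclusions cost `3 c S`, the
        -- stability of the product in `step₁` another `3 c S`.
        drift : X₀ ≤ X₃ + ι 6 * c * S
        drift = ≤-by _ (0≤+ (0≤+ (0≤+ (0≤+ (0≤- step₁) (0≤- step₂)) (0≤- step₃)) (0≤+ (0≤- L₁≥) (0≤* 0≤2 (0≤- reg)))) (0≤+ (0≤* 0≤c (0≤- L₁≤)) (0≤* (0≤* 0≤c (0≤- c≤1)) 0≤S)))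
          (eq X₀ X₁ X₂ X₃ S L₁ (SP (suc r) Λ) c)
          where
          eq : ∀ x₀ x₁ x₂ x₃ s l p c → x₃ + ι 6 * c * s ≡ x₀ + (x₁ + c * (s + l) - x₀ + (p + x₂ - (l + x₁)) + (p - x₂ - (s - x₃)) + (l - (1ℚ - c) * s + 2ℚ * ((1ℚ + c) * s - p)) + (c * ((1ℚ + c) * s - l) + c * (1ℚ - c) * s))
          eq = solve-∀ ℚ-ring

      drift-both : ∀ h → (∀ x → h x ≤ 1ℚ) → (∀ x → - h x ≤ 1ℚ) → let u = ∑ Pr (λ x → C x * h (x ℤ.+ w)) - ∑ Pr (λ x → C x * h x) in u * u ≤ ι 6 * c * S * (ι 6 * c * S)
      drift-both h p q = square {X₀′ - X₃′} {B} (≤-by _ (0≤- (drift h p q)) (eq X₀′ B X₃′)) (≤-by _ (0≤- lower) (eq′ X₀′ B X₃′))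
        where
        B = ι 6 * c * S
        X₀′ = ∑ Pr (λ x → C x * h (x ℤ.+ w))
        X₃′ = ∑ Pr (λ x → C x * h x)
        neg : ∀ a b → a * - b ≡ - 1ℚ * (a * b)
        neg = solve-∀ ℚ-ring
        nn : ∀ a → - - a ≡ a
        nn = solve-∀ ℚ-ring
        lower : - 1ℚ * X₀′ ≤ - 1ℚ * X₃′ + B
        lower = ≤-trans (≤-reflexive (sym (trans (∑-cong Pr (λ x → neg (C x) (h (x ℤ.+ w)))) (∑-*ˡ Pr (- 1ℚ) _)))) (≤-trans (drift (λ x → - h x) q (λ x → ≤-trans (≤-reflexive (nn (h x))) (p x)))
          (≤-reflexive (cong (_+ B) (trans (∑-cong Pr (λ x → neg (C x) (h x))) (∑-*ˡ Pr (- 1ℚ) _)))))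
        eq : ∀ a b c → b ≡ a - c + (c + b - a)
        eq = solve-∀ ℚ-ring
        eq′ : ∀ a b c → b ≡ - 1ℚ * (a - c) + (- 1ℚ * c + b - - 1ℚ * a)
        eq′ = solve-∀ ℚ-ring
        square : ∀ {u b} → u ≤ b → - 1ℚ * u ≤ b → u * u ≤ b * b
        square {u} {b} h₁ h₂ = ≤-by _ (0≤* (0≤- h₁) (0≤- h₂)) (e u b)
          where
          e : ∀ u b → b * b ≡ u * u + (b - u) * (b - - 1ℚ * u)
          e = solve-∀ ℚ-ring

      -- Shifting by `w` multiplies the weighted character sum by `χ_j(w)`, yet moves its real and
      -- imaginary part by at most `6 c S` each. So `1/16 * 2 (1 - Re χ_j(w)) ≤ 72 c²`, whence
      -- `576`.
      invariant : ∀ j → 1/16 * (S * S) ≤ energy C Pr j → 1ℚ - ι 576 * (c * c) ≤ χr j w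
      invariant j big = ≤-by _ (0≤- (*-cancelˡ {c = S * S} (0<* 0<S 0<S) bound)) (e₀ (χr j w) (ι 576 * (c * c)))
        where
        e₀ : ∀ x k → x ≡ 1ℚ - k + (k - (1ℚ - x))
        e₀ = solve-∀ ℚ-ring
        0<S : 0ℚ < S
        0<S = ℚ.<-≤-trans (0<ST Λ) (ST≤SP r Λ)
        R = Energy.R C Pr j
        I = Energy.I C Pr j
        rw = χr j w
        iw = χi j w
        Xr = ∑ Pr (λ x → C x * χr j (x ℤ.+ w))
        Xi = ∑ Pr (λ x → C x * χi j (x ℤ.+ w))
        Xr≡ : Xr ≡ R * rw - I * iw
        Xr≡ = trans (∑-cong Pr (λ x → trans (cong (C x *_) (χr-+ j x w)) (e (C x) (χr j x) (χi j x) rw iw))) (trans (∑-- Pr _ _) (cong₂ _-_ (∑-*ʳ Pr rw _) (∑-*ʳ Pr iw _)))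
          where
          e : ∀ c a b r i → c * (a * r - b * i) ≡ c * a * r - c * b * i
          e = solve-∀ ℚ-ring
        Xi≡ : Xi ≡ I * rw + R * iw
        Xi≡ = trans (∑-cong Pr (λ x → trans (cong (C x *_) (χi-+ j x w)) (e (C x) (χr j x) (χi j x) rw iw))) (trans (∑-+ Pr _ _) (cong₂ _+_ (∑-*ʳ Pr rw _) (∑-*ʳ Pr iw _)))
          where
          e : ∀ c a b r i → c * (b * r + a * i) ≡ c * b * r + c * a * i
          e = solve-∀ ℚ-ring
        χ-bounds : ∀ x → χr j x ≤ 1ℚ × - χr j x ≤ 1ℚ
        χ-bounds x = abs-≤ 0≤1 (≤-by _ (0≤sq (χi j x)) (trans (*-identityˡ 1ℚ) (sym (χ-unit j x))))
        χ-bounds′ : ∀ x → χi j x ≤ 1ℚ × - χi j x ≤ 1ℚ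
        χ-bounds′ x = abs-≤ 0≤1 (≤-by _ (0≤sq (χr j x)) (trans (*-identityˡ 1ℚ) (trans (sym (χ-unit j x)) (+-comm (χr j x * χr j x) (χi j x * χi j x)))))
        ur = drift-both (χr j) (λ x → proj₁ (χ-bounds x)) (λ x → proj₂ (χ-bounds x))
        ui = drift-both (χi j) (λ x → proj₁ (χ-bounds′ x)) (λ x → proj₂ (χ-bounds′ x))
        e₁ : ∀ R I r i → (R * r - I * i - R) * (R * r - I * i - R) + (I * r + R * i - I) * (I * r + R * i - I) ≡ (R * R + I * I) * (r * r + i * i + (1ℚ - 2ℚ * r))
        e₁ = solve-∀ ℚ-ring
        identity : (Xr - R) * (Xr - R) + (Xi - I) * (Xi - I) ≡ (R * R + I * I) * (1ℚ + (1ℚ - 2ℚ * rw))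
        identity = trans (cong₂ (λ a b → (a - R) * (a - R) + (b - I) * (b - I)) Xr≡ Xi≡) (trans (e₁ R I rw iw) (cong (λ y → (R * R + I * I) * (y + (1ℚ - 2ℚ * rw))) (χ-unit j w)))
        e₂ : ∀ s c r n → s * s * (ι 576 * (c * c)) ≡ s * s * (1ℚ - r) + ι 8 * ((ι 6 * c * s * (ι 6 * c * s) + ι 6 * c * s * (ι 6 * c * s) - n * (1ℚ + (1ℚ - 2ℚ * r))) + 2ℚ * (n - 1/16 * (s * s)) * (1ℚ - r))
        e₂ = solve-∀ ℚ-ring
        bound : S * S * (1ℚ - rw) ≤ S * S * (ι 576 * (c * c))
        bound = ≤-by _ (0≤* (0≤ι 8) (0≤+ (0≤- (≤-trans (≤-reflexive (sym identity)) (+-mono-≤ ur ui))) (0≤* (0≤* 0≤2 (0≤- big)) (0≤- (proj₁ (χ-bounds w)))))) (e₂ S c rw (R * R + I * I))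

-- Multidimensional progressions

module Boxes where

  open Rationals
  open Sums
  open Tuples using (tuples; ∑-tuples; #-tuples)
  open Transfer using (isZero; δ)
  open import Data.List.Membership.Propositional.Properties using (∈-concatMap⁻; ∈-concatMap⁺; ∈-map⁻; ∈-map⁺)
  import Data.List.Membership.Propositional as L

  range : ℤ → ℕ → List ℤ
  range lo zero = []
  range lo (suc n) = lo ∷ range (ℤ.suc lo) n

  #-range : ∀ lo n → # (range lo n) ≡ ι n
  #-range lo zero = refl
  #-range lo (suc n) = cong (λ y → 1ℚ + y) (#-range (ℤ.suc lo) n)

  range-++ : ∀ lo m n → range lo (m ℕ.+ n) ≡ range lo m ++ range (lo ℤ.+ + m) n
  range-++ lo zero n = cong (λ x → range x n) (sym (ℤ.+-identityʳ lo))
  range-++ lo (suc m) n = cong (lo ∷_) (trans (range-++ (ℤ.suc lo) m n) (cong (λ x → range (ℤ.suc lo) m ++ range x n) (eq lo (+ m))))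
    where
    eq : ∀ a b → + 1 ℤ.+ a ℤ.+ b ≡ a ℤ.+ (+ 1 ℤ.+ b)
    eq = ℤ.solve-∀

  ∑-range-shift : ∀ lo n a (F : ℤ → ℚ) → ∑ (range lo n) (λ i → F (i ℤ.+ a)) ≡ ∑ (range (lo ℤ.+ a) n) F
  ∑-range-shift lo zero a F = refl
  ∑-range-shift lo (suc n) a F = cong (λ y → F (lo ℤ.+ a) + y) (trans (∑-range-shift (ℤ.suc lo) n a F) (cong (λ x → ∑ (range x n) F) (eq lo a)))
    where
    eq : ∀ a b → + 1 ℤ.+ a ℤ.+ b ≡ + 1 ℤ.+ (a ℤ.+ b)
    eq = ℤ.solve-∀

  -- Containment of the shifted interval in the second one; `k` and `m` are the margins on its left
  -- and right.
  Covers : ℤ → ℕ → ℤ → ℕ → ℤ → Set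
  Covers lo n lo′ n′ a = ∃ λ k → ∃ λ m → lo ℤ.+ a ≡ lo′ ℤ.+ + k × n′ ≡ k ℕ.+ (n ℕ.+ m)

  ∑-range-⊂ : ∀ {lo n lo′ n′ a} → Covers lo n lo′ n′ a → ∀ (F : ℤ → ℚ) → (∀ x → 0ℚ ≤ F x) → ∑ (range lo n) (λ i → F (i ℤ.+ a)) ≤ ∑ (range lo′ n′) F
  ∑-range-⊂ {lo} {n} {lo′} {n′} {a} (k , m , e , refl) F 0≤F = ≤-trans (≤-reflexive (trans (∑-range-shift lo n a F) (cong (λ x → ∑ (range x n) F) e)))
    (≤-by _ (0≤+ (0≤∑ (range lo′ k) 0≤F) (0≤∑ (range (lo′ ℤ.+ + k ℤ.+ + n) m) 0≤F))
      (trans (cong (λ l → ∑ l F) (trans (range-++ lo′ k (n ℕ.+ m)) (cong (range lo′ k ++_) (range-++ (lo′ ℤ.+ + k) n m))))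
        (trans (∑-++ (range lo′ k) _ F) (trans (cong (λ y → ∑ (range lo′ k) F + y) (∑-++ (range (lo′ ℤ.+ + k) n) _ F)) (eq (∑ (range lo′ k) F) (∑ (range (lo′ ℤ.+ + k) n) F) (∑ (range (lo′ ℤ.+ + k ℤ.+ + n) m) F))))))
    where
    eq : ∀ a b c → a + (b + c) ≡ b + (a + c)
    eq = solve-∀ ℚ-ring

  In : ℤ → ℕ → ℤ → Set
  In lo n a = ∃ λ k → a ≡ lo ℤ.+ + k × k ℕ.< n

  ∈-range⁻ : ∀ {lo n a} → a ∈ range lo n → In lo n a
  ∈-range⁻ {lo} {suc n} (here refl) = 0 , sym (ℤ.+-identityʳ lo) , ℕ.s≤s ℕ.z≤n
  ∈-range⁻ {lo} {suc n} (there m) with ∈-range⁻ m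
  ... | k , refl , h = suc k , eq lo (+ k) , ℕ.s≤s h
    where
    eq : ∀ a b → + 1 ℤ.+ a ℤ.+ b ≡ a ℤ.+ (+ 1 ℤ.+ b)
    eq = ℤ.solve-∀

  ∈-range⁺ : ∀ {lo n a} → In lo n a → a ∈ range lo n
  ∈-range⁺ {lo} {suc n} (zero , refl , h) = here (ℤ.+-identityʳ lo)
  ∈-range⁺ {lo} {suc n} (suc k , refl , ℕ.s≤s h) = there (∈-range⁺ (k , sym (eq lo (+ k)) , h))
    where
    eq : ∀ a b → + 1 ℤ.+ a ℤ.+ b ≡ a ℤ.+ (+ 1 ℤ.+ b)
    eq = ℤ.solve-∀

  δ≤1 : ∀ x → δ x ≤ 1ℚ
  δ≤1 x = 𝟙≤1 (isZero x)

  0≤δ : ∀ x → 0ℚ ≤ δ x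
  0≤δ x = 0≤𝟙 (isZero x)

  isZero-nonzero : ∀ {x} → x ≢ ℤ.0ℤ → isZero x ≡ false
  isZero-nonzero {+ zero} h = ⊥-elim (h refl)
  isZero-nonzero {+ suc n} h = refl
  isZero-nonzero { -[1+ n ]} h = refl

  δ-nonzero : ∀ {x} → x ≢ ℤ.0ℤ → δ x ≡ 0ℚ
  δ-nonzero h = cong 𝟙 (isZero-nonzero h)

  δ-zero : ∀ {x} → x ≡ ℤ.0ℤ → δ x ≡ 1ℚ
  δ-zero refl = refl

  δ-pos : ∀ {x} → 0ℚ < δ x → x ≡ ℤ.0ℤ
  δ-pos {+ zero} h = refl
  δ-pos {+ suc n} h = ⊥-elim (ℚ.<-irrefl refl h)
  δ-pos { -[1+ n ]} h = ⊥-elim (ℚ.<-irrefl refl h)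

  -- A pointwise condition on coefficients that also forces one coefficient for each generator.
  data Fit (P : ℤ → Set) : List ℤ → List ℤ → Set where
    [] : Fit P [] []
    _∷_ : ∀ {g gs c cs} → P c → Fit P gs cs → Fit P (g ∷ gs) (c ∷ cs)

  dot : List ℤ → List ℤ → ℤ
  dot (g ∷ gs) (c ∷ cs) = c ℤ.* g ℤ.+ dot gs cs
  dot _ _ = ℤ.0ℤ

  -- The progression is listed with multiplicity, by coefficient vectors; it is free of repetitions
  -- when the generators are `Proper`.
  box : List ℤ → ℤ → ℕ → List ℤ
  box gs lo n = map (dot gs) (tuples (range lo n) (length gs))

  #-box : ∀ gs lo n → # (box gs lo n) ≡ ι n ^ length gs
  #-box gs lo n = trans (∑-map (dot gs) (tuples (range lo n) (length gs)) _) (trans (#-tuples (range lo n) (length gs)) (cong (_^ length gs) (#-range lo n)))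

  ∑-box-⊂ : ∀ {lo n lo′ n′} gs cs → Fit (Covers lo n lo′ n′) gs cs → ∀ (F : ℤ → ℚ) → (∀ x → 0ℚ ≤ F x) →
    ∑ (box gs lo n) (λ x → F (x ℤ.+ dot gs cs)) ≤ ∑ (box gs lo′ n′) F
  ∑-box-⊂ {lo} {n} {lo′} {n′} gs cs fit F 0≤F = ≤-trans (≤-reflexive (∑-map (dot gs) (tuples (range lo n) (length gs)) _)) (≤-trans (go gs cs fit F 0≤F) (≤-reflexive (sym (∑-map (dot gs) (tuples (range lo′ n′) (length gs)) F))))
    where
    eq : ∀ i g d c e → i ℤ.* g ℤ.+ d ℤ.+ (c ℤ.* g ℤ.+ e) ≡ (i ℤ.+ c) ℤ.* g ℤ.+ (d ℤ.+ e)
    eq = ℤ.solve-∀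
    go : ∀ gs cs → Fit (Covers lo n lo′ n′) gs cs → ∀ (F : ℤ → ℚ) → (∀ x → 0ℚ ≤ F x) →
      ∑ (tuples (range lo n) (length gs)) (λ t → F (dot gs t ℤ.+ dot gs cs)) ≤ ∑ (tuples (range lo′ n′) (length gs)) (λ t → F (dot gs t))
    go [] [] [] F 0≤F = ≤-refl
    go (g ∷ gs) (c ∷ cs) (h ∷ fit) F 0≤F = ≤-trans (≤-reflexive (trans (∑-tuples (range lo n) (length gs) _)
        (∑-cong (range lo n) (λ i → ∑-cong (tuples (range lo n) (length gs)) (λ t → cong F (eq i g (dot gs t) c (dot gs cs)))))))
      (≤-trans (∑-range-⊂ h (λ i → ∑ (tuples (range lo n) (length gs)) (λ t → F (i ℤ.* g ℤ.+ (dot gs t ℤ.+ dot gs cs)))) (λ i → 0≤∑ (tuples (range lo n) (length gs)) (λ t → 0≤F _)))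
        (≤-trans (∑-mono (range lo′ n′) (λ i → go gs cs fit (λ x → F (i ℤ.* g ℤ.+ x)) (λ x → 0≤F _)))
          (≤-reflexive (sym (∑-tuples (range lo′ n′) (length gs) _)))))

  ∈-tuples⁻ : ∀ {lo n} gs {t} → t ∈ tuples (range lo n) (length gs) → Fit (In lo n) gs t
  ∈-tuples⁻ [] (here refl) = []
  ∈-tuples⁻ {lo} {n} (g ∷ gs) t∈ with L.find (∈-concatMap⁻ (λ x → map (x ∷_) (tuples (range lo n) (length gs))) {xs = range lo n} t∈)
  ... | i , i∈ , t∈′ with ∈-map⁻ (i ∷_) t∈′
  ...   | u , u∈ , refl = ∈-range⁻ i∈ ∷ ∈-tuples⁻ gs u∈

  ∈-tuples⁺ : ∀ {lo n} gs {t} → Fit (In lo n) gs t → t ∈ tuples (range lo n) (length gs)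
  ∈-tuples⁺ [] [] = here refl
  ∈-tuples⁺ {lo} {n} (g ∷ gs) {c ∷ cs} (h ∷ fit) = ∈-concatMap⁺ (λ x → map (x ∷_) (tuples (range lo n) (length gs))) {xs = range lo n} (L.lose (∈-range⁺ h) (∈-map⁺ (c ∷_) (∈-tuples⁺ gs fit)))

  ∈-box⁻ : ∀ {gs lo n x} → x ∈ box gs lo n → ∃ λ cs → Fit (In lo n) gs cs × x ≡ dot gs cs
  ∈-box⁻ {gs} x∈ with ∈-map⁻ (dot gs) x∈
  ... | t , t∈ , e = t , ∈-tuples⁻ gs t∈ , e

  ∈-box⁺ : ∀ {gs lo n cs} → Fit (In lo n) gs cs → dot gs cs ∈ box gs lo n
  ∈-box⁺ {gs} fit = ∈-map⁺ (dot gs) (∈-tuples⁺ gs fit)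

  Fit-map : ∀ {P Q : ℤ → Set} {gs cs} → (∀ {a} → P a → Q a) → Fit P gs cs → Fit Q gs cs
  Fit-map f [] = []
  Fit-map f (p ∷ ps) = f p ∷ Fit-map f ps

  Bounded : ℕ → ℤ → Set
  Bounded B a = ℤ.∣ a ∣ ℕ.≤ B

  -- Applied to differences of coefficient vectors, this makes the parametrisation of a box of side
  -- at most `B` injective, wherever the box starts.
  Proper : ℕ → List ℤ → Set
  Proper B gs = ∀ cs → Fit (Bounded B) gs cs → dot gs cs ≡ ℤ.0ℤ → Fit (_≡ ℤ.0ℤ) gs cs

  In-diff : ∀ {lo n a b} → In lo n a → In lo n b → Bounded n (a ℤ.- b)
  In-diff {lo} {n} (k , refl , k<) (l , refl , l<) = subst (λ x → ℤ.∣ x ∣ ℕ.≤ n) (sym (eq lo (+ k) (+ l))) (bound k l k< l<)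
    where
    eq : ∀ a b c → a ℤ.+ b ℤ.- (a ℤ.+ c) ≡ b ℤ.- c
    eq = ℤ.solve-∀
    bound : ∀ k l → k ℕ.< n → l ℕ.< n → ℤ.∣ + k ℤ.- + l ∣ ℕ.≤ n
    bound k l p q = subst (ℕ._≤ n) (sym (trans (cong ℤ.∣_∣ (ℤ.m-n≡m⊖n k l)) (ℤ.∣m⊖n∣≡∣n⊖m∣ k l))) (ℕ.≤-trans (ℤ.∣m⊝n∣≤m⊔n l k) (ℕ.⊔-lub (ℕ.<⇒≤ q) (ℕ.<⇒≤ p)))

  fit-difference : ∀ {lo n gs as bs} → Fit (In lo n) gs as → Fit (In lo n) gs bs →
    ∃ λ es → Fit (Bounded n) gs es × dot gs es ≡ dot gs as ℤ.- dot gs bs × (Fit (_≡ ℤ.0ℤ) gs es → as ≡ bs)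
  fit-difference [] [] = [] , [] , refl , λ _ → refl
  fit-difference {lo} (_∷_ {g} {gs} {a} {as} p ps) (_∷_ {c = b} {cs = bs} q qs) with fit-difference {lo} ps qs
  ... | es , fit , e , same = a ℤ.- b ∷ es , In-diff {lo} p q ∷ fit , trans (cong (λ x → (a ℤ.- b) ℤ.* g ℤ.+ x) e) (eq a b g (dot gs as) (dot gs bs)) ,
    λ { (z ∷ zs) → cong₂ _∷_ (ℤ.i-j≡0⇒i≡j a b z) (same zs) }
    where
    eq : ∀ a b g x y → (a ℤ.- b) ℤ.* g ℤ.+ (x ℤ.- y) ≡ a ℤ.* g ℤ.+ x ℤ.- (b ℤ.* g ℤ.+ y)
    eq = ℤ.solve-∀

  injective : ∀ {gs lo n as bs} → Proper n gs → Fit (In lo n) gs as → Fit (In lo n) gs bs → dot gs as ≡ dot gs bs → as ≡ bs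
  injective {gs} {lo} {bs = bs} proper p q e with fit-difference {lo} p q
  ... | es , fit , d , same = same (proper es fit (trans d (trans (cong (ℤ._- dot gs bs) e) (ℤ.+-inverseʳ (dot gs bs)))))

  -- The indicator of equality of coefficient vectors, written as a product so that its sum over all
  -- vectors factorises.
  agree : List ℤ → List ℤ → ℚ
  agree [] [] = 1ℚ
  agree (a ∷ as) (b ∷ bs) = δ (a ℤ.- b) * agree as bs
  agree _ _ = 0ℚ

  agree-refl : ∀ as → agree as as ≡ 1ℚ
  agree-refl [] = refl
  agree-refl (a ∷ as) = trans (cong₂ _*_ (δ-zero (ℤ.+-inverseʳ a)) (agree-refl as)) (*-identityˡ 1ℚ)

  0≤agree : ∀ as bs → 0ℚ ≤ agree as bs
  0≤agree [] [] = 0≤1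
  0≤agree [] (_ ∷ _) = ≤-refl
  0≤agree (_ ∷ _) [] = ≤-refl
  0≤agree (a ∷ as) (b ∷ bs) = 0≤* (0≤δ (a ℤ.- b)) (0≤agree as bs)

  ∑-range-δ : ∀ lo n b → ∑ (range lo n) (λ i → δ (i ℤ.- b)) ≤ 1ℚ
  ∑-range-δ lo zero b = 0≤1
  ∑-range-δ lo (suc n) b with lo ℤ.≟ b
  ... | yes refl = ≤-trans (+-mono-≤ (δ≤1 (lo ℤ.- lo)) (≤-reflexive (above (ℤ.suc lo) n (0 , ℤ.+-identityʳ (ℤ.suc lo))))) (≤-reflexive (+-identityʳ 1ℚ))
    where
    above : ∀ l n → (∃ λ k → ℤ.suc lo ℤ.+ + k ≡ l) → ∑ (range l n) (λ i → δ (i ℤ.- lo)) ≡ 0ℚ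
    above l zero h = refl
    above l (suc n) (k , refl) = trans (cong₂ _+_ (trans (cong δ (eq lo (+ k))) refl) (above (ℤ.suc l) n (suc k , eq′ lo (+ k)))) refl
      where
      eq : ∀ a k → + 1 ℤ.+ a ℤ.+ k ℤ.- a ≡ + 1 ℤ.+ k
      eq = ℤ.solve-∀
      eq′ : ∀ a k → + 1 ℤ.+ a ℤ.+ (+ 1 ℤ.+ k) ≡ + 1 ℤ.+ (+ 1 ℤ.+ a ℤ.+ k)
      eq′ = ℤ.solve-∀
  ... | no lo≢b = ≤-trans (≤-reflexive (trans (cong (_+ ∑ (range (ℤ.suc lo) n) (λ i → δ (i ℤ.- b))) (δ-nonzero (λ e → lo≢b (ℤ.i-j≡0⇒i≡j lo b e)))) (+-identityˡ _))) (∑-range-δ (ℤ.suc lo) n b)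

  ∑-agree : ∀ lo n m bs → ∑ (tuples (range lo n) m) (λ as → agree as bs) ≤ 1ℚ
  ∑-agree lo n zero [] = ≤-reflexive (+-identityʳ 1ℚ)
  ∑-agree lo n zero (b ∷ bs) = ≤-trans (≤-reflexive (+-identityʳ 0ℚ)) 0≤1
  ∑-agree lo n (suc m) [] = ≤-trans (≤-reflexive (trans (∑-tuples (range lo n) m _) (trans (∑-cong (range lo n) (λ _ → ∑-0 (tuples (range lo n) m))) (∑-0 (range lo n))))) 0≤1
  ∑-agree lo n (suc m) (b ∷ bs) = ≤-trans (≤-reflexive (trans (∑-tuples (range lo n) m _) (∑-∑-* (range lo n) (tuples (range lo n) m) _ (λ as → agree as bs))))
    (≤-trans (*-mono (0≤∑ (range lo n) (λ i → 0≤δ (i ℤ.- b))) 0≤1 (∑-range-δ lo n b) (∑-agree lo n m bs)) (≤-reflexive (*-identityˡ 1ℚ)))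

  count≤1 : ∀ {gs n} lo → Proper n gs → ∀ c → ∑ (box gs lo n) (λ x → δ (x ℤ.- c)) ≤ 1ℚ
  count≤1 {gs} {n} lo proper c = ≤-trans (≤-reflexive (∑-map (dot gs) Tu _)) (go (0ℚ <? ∑ Tu (λ t → δ (dot gs t ℤ.- c))))
    where
    Tu = tuples (range lo n) (length gs)
    pt : ∀ bs → bs ∈ Tu → dot gs bs ≡ c → ∀ as → as ∈ Tu → δ (dot gs as ℤ.- c) ≤ agree as bs
    pt bs bs∈ e as as∈ with dot gs as ℤ.≟ c
    ... | no h = ≤-trans (≤-reflexive (δ-nonzero (λ z → h (ℤ.i-j≡0⇒i≡j (dot gs as) c z)))) (0≤agree as bs)
    ... | yes h = ≤-trans (δ≤1 (dot gs as ℤ.- c)) (≤-reflexive (sym (trans (cong (λ x → agree x bs) (injective {lo = lo} proper (∈-tuples⁻ gs as∈) (∈-tuples⁻ gs bs∈) (trans h (sym e)))) (agree-refl bs))))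
    use : ∃ (λ t → t ∈ Tu × 0ℚ < δ (dot gs t ℤ.- c)) → ∑ Tu (λ t → δ (dot gs t ℤ.- c)) ≤ 1ℚ
    use (bs , bs∈ , h) = ≤-trans (∑-mono∈ Tu (pt bs bs∈ (ℤ.i-j≡0⇒i≡j (dot gs bs) c (δ-pos h)))) (∑-agree lo n (length gs) bs)
    go : Dec (0ℚ < ∑ Tu (λ t → δ (dot gs t ℤ.- c))) → ∑ Tu (λ t → δ (dot gs t ℤ.- c)) ≤ 1ℚ
    go (yes p) = use (∑-pos-∃ Tu p)
    go (no np) = ≤-trans (≮⇒≥ np) 0≤1

-- Counting with multiplicity over a covering box

module Multiplicities where

  open Rationals
  open Sums
  open Unbalancing using (∑∑; ∑∑-cong)
  open Transfer using (isZero; δ; corr)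
  open Boxes

  _∨_ : Bool → Bool → Bool
  true ∨ b = true
  false ∨ b = b

  mem : List ℤ → ℤ → Bool
  mem [] t = false
  mem (s ∷ Y) t = isZero (t ℤ.- s) ∨ mem Y t

  multiplicity : List ℤ → ℤ → ℚ
  multiplicity Y t = ∑ Y (λ s → δ (t ℤ.- s))

  -- Sifting wants Boolean sets, the correlation identities want counts; where no point is repeated
  -- the two coincide.
  mem-multiplicity : ∀ Y t → multiplicity Y t ≤ 1ℚ → 𝟙 (mem Y t) ≡ multiplicity Y t
  mem-multiplicity Y t h = ℚ.≤-antisym (lower Y) (upper Y refl)
    where
    lower : ∀ Y → 𝟙 (mem Y t) ≤ multiplicity Y t
    lower [] = ≤-refl
    lower (s ∷ Y) = go (isZero (t ℤ.- s))
      where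
      go : ∀ b → 𝟙 (b ∨ mem Y t) ≤ 𝟙 b + multiplicity Y t
      go true = ≤-by (multiplicity Y t) (0≤∑ Y (λ s → 0≤δ (t ℤ.- s))) refl
      go false = ≤-trans (lower Y) (≤-reflexive (sym (+-identityˡ _)))
    none : ∀ Y → mem Y t ≡ false → multiplicity Y t ≡ 0ℚ
    none [] e = refl
    none (s ∷ Y) e = go (isZero (t ℤ.- s)) e
      where
      go : ∀ b → (b ∨ mem Y t) ≡ false → 𝟙 b + multiplicity Y t ≡ 0ℚ
      go false e = trans (+-identityˡ _) (none Y e)
    upper : ∀ Y′ → Y′ ≡ Y → multiplicity Y t ≤ 𝟙 (mem Y t)
    upper _ refl = go (mem Y t) refl
      where
      go : ∀ b → mem Y t ≡ b → multiplicity Y t ≤ 𝟙 b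
      go true e = h
      go false e = ≤-reflexive (none Y e)

  -- `U + c` meets each point of `Y` exactly once. This replaces the translation invariance of
  -- counting in a finite group.
  Complete : List ℤ → List ℤ → ℤ → Set
  Complete U Y c = ∀ s → s ∈ Y → ∑ U (λ u → δ (u ℤ.+ c ℤ.- s)) ≡ 1ℚ

  complete-box : ∀ {gs lo n s c} → Proper n gs → (∃ λ cs → Fit (In lo n) gs cs × dot gs cs ≡ s ℤ.- c) → ∑ (box gs lo n) (λ u → δ (u ℤ.+ c ℤ.- s)) ≡ 1ℚ
  complete-box {gs} {lo} {n} {s} {c} proper (cs , fit , e) = trans (∑-cong (box gs lo n) (λ u → cong δ (eq u c s)))
    (ℚ.≤-antisym (count≤1 lo proper (s ℤ.- c)) (≤-trans (≤-reflexive (sym (δ-zero (trans (cong (ℤ._- (s ℤ.- c)) e) (ℤ.+-inverseʳ (s ℤ.- c)))))) (term≤∑ (λ u → 0≤δ (u ℤ.- (s ℤ.- c))) (∈-box⁺ fit))))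
    where
    eq : ∀ u c s → u ℤ.+ c ℤ.- s ≡ u ℤ.- (s ℤ.- c)
    eq = ℤ.solve-∀

  module _ (U Y : List ℤ) where

    ∑-multiplicity : ∀ c → Complete U Y c → ∑ U (λ u → multiplicity Y (u ℤ.+ c)) ≡ # Y
    ∑-multiplicity c h = trans (∑-swap U Y _) (∑-cong∈ Y h)

    ∑-multiplicity² : ∀ c c′ → Complete U Y c → ∑ U (λ u → multiplicity Y (u ℤ.+ c) * multiplicity Y (u ℤ.+ c′)) ≡ corr Y (c′ ℤ.- c)
    ∑-multiplicity² c c′ h = begin
      ∑ U (λ u → multiplicity Y (u ℤ.+ c) * multiplicity Y (u ℤ.+ c′))
        ≡⟨ ∑-cong U (λ u → sym (∑-∑-* Y Y _ _)) ⟩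
      ∑ U (λ u → ∑∑ Y (λ s s′ → δ (u ℤ.+ c ℤ.- s) * δ (u ℤ.+ c′ ℤ.- s′)))
        ≡⟨ ∑-cong U (λ u → ∑∑-cong Y (λ s s′ → pointwise u s s′)) ⟩
      ∑ U (λ u → ∑∑ Y (λ s s′ → δ (c′ ℤ.- c ℤ.+ (s ℤ.- s′)) * δ (u ℤ.+ c ℤ.- s)))
        ≡⟨ trans (∑-swap U Y _) (∑-cong Y (λ s → ∑-swap U Y _)) ⟩
      ∑∑ Y (λ s s′ → ∑ U (λ u → δ (c′ ℤ.- c ℤ.+ (s ℤ.- s′)) * δ (u ℤ.+ c ℤ.- s)))
        ≡⟨ ∑-cong∈ Y (λ s s∈ → ∑-cong Y (λ s′ → trans (∑-*ˡ U (δ (c′ ℤ.- c ℤ.+ (s ℤ.- s′))) _) (trans (cong (δ (c′ ℤ.- c ℤ.+ (s ℤ.- s′)) *_) (h s s∈)) (*-identityʳ _)))) ⟩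
      corr Y (c′ ℤ.- c) ∎
      where
      open ≡-Reasoning
      pointwise : ∀ u s s′ → δ (u ℤ.+ c ℤ.- s) * δ (u ℤ.+ c′ ℤ.- s′) ≡ δ (c′ ℤ.- c ℤ.+ (s ℤ.- s′)) * δ (u ℤ.+ c ℤ.- s)
      pointwise u s s′ with u ℤ.+ c ℤ.- s ℤ.≟ ℤ.0ℤ
      ... | yes e = trans (cong₂ _*_ (δ-zero e) (cong δ (trans (eq u c c′ s s′) (trans (cong (λ x → x ℤ.+ (c′ ℤ.- c ℤ.+ (s ℤ.- s′))) e) (ℤ.+-identityˡ (c′ ℤ.- c ℤ.+ (s ℤ.- s′))))))) (trans (*-comm 1ℚ (δ (c′ ℤ.- c ℤ.+ (s ℤ.- s′)))) (cong (δ (c′ ℤ.- c ℤ.+ (s ℤ.- s′)) *_) (sym (δ-zero e))))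
        where
        eq : ∀ u c c′ s s′ → u ℤ.+ c′ ℤ.- s′ ≡ u ℤ.+ c ℤ.- s ℤ.+ (c′ ℤ.- c ℤ.+ (s ℤ.- s′))
        eq = ℤ.solve-∀
      ... | no ne = trans (cong (_* δ (u ℤ.+ c′ ℤ.- s′)) (δ-nonzero ne)) (trans (*-zeroˡ (δ (u ℤ.+ c′ ℤ.- s′))) (sym (trans (cong (δ (c′ ℤ.- c ℤ.+ (s ℤ.- s′)) *_) (δ-nonzero ne)) (*-zeroʳ (δ (c′ ℤ.- c ℤ.+ (s ℤ.- s′)))))))

-- Progressions inside Bohr sets by the pigeonhole principle

module NearRelations where

  open Rationals
  open Sums
  open Circle using (cos≤1; -1≤cos; sin≤1; -1≤sin)
  open Characters
  open RieszProducts using (Factor; freq; Near; plane-cs)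
  open Boxes
  open import Data.Fin.Base as Fin using (Fin)
  import Data.Fin.Properties as Fin
  open import Data.List.Properties using (∷-injective; take++drop≡id; length-take)
  open import Data.List.Base using (take; drop)

  near-mono : ∀ {a b w f} → 0ℚ ≤ a → a ≤ b → Near a w f → Near b w f
  near-mono p h n = ≤-trans n (*-mono p (≤-trans p h) h h)

  near-0 : ∀ {f} → Near 0ℚ ℤ.0ℤ f
  near-0 {f} = ≤-reflexive (cong (λ y → 2ℚ * (1ℚ - y)) (χr-0 (freq f)))

  near-neg : ∀ {a w f} → Near a w f → Near a (ℤ.- w) f
  near-neg {a} {w} {f} h = ≤-trans (≤-reflexive (cong (λ y → 2ℚ * (1ℚ - y)) (χr-neg (freq f) w))) h

  -- The triangle inequality `|χ(v) χ(w) - 1| ≤ |χ(v) - 1| + |χ(w) - 1|` in squared form; `plane-cs`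
  -- bounds the cross term.
  near-+ : ∀ {a b v w f} → 0ℚ ≤ a → 0ℚ ≤ b → Near a v f → Near b w f → Near (a + b) (v ℤ.+ w) f
  near-+ {a} {b} {v} {w} {f} 0≤a 0≤b hv hw = ≤-trans (≤-reflexive (cong (λ y → 2ℚ * (1ℚ - y)) R≡))
    (≤-by _ (0≤+ (0≤+ (0≤- hv) (0≤- hw)) (0≤* 0≤2 (0≤- dot≤))) (trans (eq₀ a b rv rw R) (cong (λ y → 2ℚ * (1ℚ - R) + (a * a - 2ℚ * (1ℚ - rv) + (b * b - 2ℚ * (1ℚ - rw)) + 2ℚ * (a * b - y))) (sym inner))))
    where
    j = freq f
    rv = χr j v
    iv = χi j v
    rw = χr j w
    iw = χi j w
    R = rv * rw - iv * iw
    I = iv * rw + rv * iw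
    R≡ = χr-+ j v w
    uv : rv * rv + iv * iv ≡ 1ℚ
    uv = χ-unit j v
    uw : rw * rw + iw * iw ≡ 1ℚ
    uw = χ-unit j w
    pq : ℚ
    pq = (rv - 1ℚ) * (R - rv) - (- iv) * (I - iv)
    eq₁ : ∀ r i x y → (r - 1ℚ) * (r * x - i * y - r) - (- i) * (i * x + r * y - i) ≡ (r * r + i * i) * (x - 1ℚ) - (r * x - i * y) + r
    eq₁ = solve-∀ ℚ-ring
    inner : pq ≡ rw - 1ℚ - R + rv
    inner = trans (eq₁ rv iv rw iw) (trans (cong (λ y → y * (rw - 1ℚ) - R + rv) uv) (cong (λ y → y - R + rv) (*-identityˡ (rw - 1ℚ))))
    eq₀ : ∀ a b r x R → (a + b) * (a + b) ≡ 2ℚ * (1ℚ - R) + (a * a - 2ℚ * (1ℚ - r) + (b * b - 2ℚ * (1ℚ - x)) + 2ℚ * (a * b - (x - 1ℚ - R + r)))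
    eq₀ = solve-∀ ℚ-ring
    eq₂ : ∀ r i → (r - 1ℚ) * (r - 1ℚ) + - i * - i ≡ r * r + i * i + 1ℚ - 2ℚ * r
    eq₂ = solve-∀ ℚ-ring
    eq₃ : ∀ r → 1ℚ + 1ℚ - 2ℚ * r ≡ 2ℚ * (1ℚ - r)
    eq₃ = solve-∀ ℚ-ring
    eq₄ : ∀ r i x y → (r * x - i * y - r) * (r * x - i * y - r) + (i * x + r * y - i) * (i * x + r * y - i) ≡ (r * r + i * i) * (x * x + y * y + 1ℚ - 2ℚ * x)
    eq₄ = solve-∀ ℚ-ring
    dot≤ : pq ≤ a * b
    dot≤ = sq-≤ (0≤* 0≤a 0≤b) (≤-trans (plane-cs {rv - 1ℚ} { - iv} {R - rv} {I - iv}
        (≤-trans (≤-reflexive (trans (eq₂ rv iv) (trans (cong (λ y → y + 1ℚ - 2ℚ * rv) uv) (eq₃ rv)))) hv)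
        (≤-trans (≤-reflexive (trans (eq₄ rv iv rw iw) (trans (cong₂ (λ x y → x * (y + 1ℚ - 2ℚ * rw)) uv uw) (trans (*-identityˡ _) (eq₃ rw))))) hw) (0≤* 0≤a 0≤a))
      (≤-reflexive (eq₅ a b)))
      where
      eq₅ : ∀ a b → a * a * (b * b) ≡ a * b * (a * b)
      eq₅ = solve-∀ ℚ-ring

  near-scale-ℕ : ∀ {a v f} n → 0ℚ ≤ a → Near a v f → Near (ι n * a) (+ n ℤ.* v) f
  near-scale-ℕ {a} {v} {f} zero 0≤a h = subst (λ x → Near x (+ 0 ℤ.* v) f) (sym (*-zeroˡ a)) (subst (λ x → Near 0ℚ x f) (sym (ℤ.*-zeroˡ v)) (near-0 {f}))
  near-scale-ℕ {a} {v} {f} (suc n) 0≤a h = subst (λ x → Near x (+ suc n ℤ.* v) f) (eq a (ι n)) (subst (λ x → Near (a + ι n * a) x f) (sym (ℤ.suc-* (+ n) v)) (near-+ {a} {ι n * a} {v} {+ n ℤ.* v} {f} 0≤a (0≤* (0≤ι n) 0≤a) h (near-scale-ℕ {a} {v} {f} n 0≤a h)))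
    where
    eq : ∀ a n → a + n * a ≡ (1ℚ + n) * a
    eq = solve-∀ ℚ-ring

  near-scale : ∀ {a v f} B b → Bounded B b → 0ℚ ≤ a → Near a v f → Near (ι B * a) (b ℤ.* v) f
  near-scale {a} {v} {f} B (+ n) h 0≤a p = near-mono {ι n * a} {ι B * a} {+ n ℤ.* v} {f} (0≤* (0≤ι n) 0≤a) (*-monoʳ 0≤a (ι-mono h)) (near-scale-ℕ {a} {v} {f} n 0≤a p)
  near-scale {a} {v} {f} B -[1+ n ] h 0≤a p = near-mono {ι (suc n) * a} {ι B * a} { -[1+ n ] ℤ.* v} {f} (0≤* (0≤ι (suc n)) 0≤a) (*-monoʳ 0≤a (ι-mono h))
    (subst (λ x → Near (ι (suc n) * a) x f) (ℤ.neg-distribˡ-* (+ suc n) v) (near-neg {ι (suc n) * a} {+ suc n ℤ.* v} {f} (near-scale-ℕ {a} {v} {f} (suc n) 0≤a p)))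

  near-dot : ∀ {a B f} gs bs → Fit (Bounded B) gs bs → 0ℚ ≤ a → (∀ g → g ∈ gs → Near a g f) → Near (ι (length gs) * (ι B * a)) (dot gs bs) f
  near-dot {a} {B} {f} [] [] [] 0≤a h = subst (λ x → Near x ℤ.0ℤ f) (sym (*-zeroˡ (ι B * a))) (near-0 {f})
  near-dot {a} {B} {f} (g ∷ gs) (b ∷ bs) (p ∷ ps) 0≤a h = subst (λ x → Near x (b ℤ.* g ℤ.+ dot gs bs) f) (eq (ι B * a) (ι (length gs)))
    (near-+ {ι B * a} {ι (length gs) * (ι B * a)} {b ℤ.* g} {dot gs bs} {f} (0≤* (0≤ι B) 0≤a) (0≤* (0≤ι (length gs)) (0≤* (0≤ι B) 0≤a)) (near-scale {a} {g} {f} B b p 0≤a (h g (here refl))) (near-dot {a} {B} {f} gs bs ps 0≤a (λ g′ m → h g′ (there m))))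
    where
    eq : ∀ x n → x + n * x ≡ (1ℚ + n) * x
    eq = solve-∀ ℚ-ring

  floor : ℕ → ℚ → ℕ
  floor zero x = 0
  floor (suc n) x = if ι (suc n) ≤ᵇ x then suc n else floor n x

  floor≤ : ∀ n x → floor n x ℕ.≤ n
  floor≤ zero x = ℕ.z≤n
  floor≤ (suc n) x = ≤ᵇ-elim (λ c → (if c then suc n else floor n x) ℕ.≤ suc n) (ι (suc n)) x (λ _ → ℕ.≤-refl) (λ _ → ℕ.m≤n⇒m≤1+n (floor≤ n x))

  floor-spec : ∀ n x → 0ℚ ≤ x → x ≤ 1ℚ + ι n → ι (floor n x) ≤ x × x ≤ 1ℚ + ι (floor n x)
  floor-spec zero x p q = p , q
  floor-spec (suc n) x p q = ≤ᵇ-elim (λ c → ι (if c then suc n else floor n x) ≤ x × x ≤ 1ℚ + ι (if c then suc n else floor n x)) (ι (suc n)) x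
    (λ h → h , q) (λ h → floor-spec n x p (<⇒≤ h))

  module Cells (K : ℕ) (0<K : 0ℚ < ι K) where

    -- For `x` in `[-1, 1]` the value `K (x + 1)` lies in `[0, 2 K]`, which has `2 K + 1` possible
    -- floors.
    side : ℕ
    side = suc (K ℕ.+ K)

    cell : ℚ → Fin side
    cell x = Fin.fromℕ< (ℕ.s≤s (floor≤ (K ℕ.+ K) (ι K * (x + 1ℚ))))

    same-cell : ∀ x y → (x ≤ 1ℚ × - 1ℚ ≤ x) → (y ≤ 1ℚ × - 1ℚ ≤ y) → cell x ≡ cell y → (x - y) * (x - y) ≤ inv (ι K) * inv (ι K)
    same-cell x y (x≤ , ≤x) (y≤ , ≤y) e = square (scale (≤-by _ (0≤+ (0≤- (proj₂ fx)) (0≤- (proj₁ fy′))) (eq₁ (ι K) x y (ι n)))) (scale (≤-by _ (0≤+ (0≤- (proj₂ fy′)) (0≤- (proj₁ fx))) (eq₁ (ι K) y x (ι n))))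
      where
      n = floor (K ℕ.+ K) (ι K * (x + 1ℚ))
      m = floor (K ℕ.+ K) (ι K * (y + 1ℚ))
      n≡m : n ≡ m
      n≡m = trans (sym (Fin.toℕ-fromℕ< (ℕ.s≤s (floor≤ (K ℕ.+ K) (ι K * (x + 1ℚ)))))) (trans (cong Fin.toℕ e) (Fin.toℕ-fromℕ< (ℕ.s≤s (floor≤ (K ℕ.+ K) (ι K * (y + 1ℚ))))))
      0≤K : 0ℚ ≤ ι K
      0≤K = 0≤ι K
      spec : ∀ x → x ≤ 1ℚ → - 1ℚ ≤ x → ι (floor (K ℕ.+ K) (ι K * (x + 1ℚ))) ≤ ι K * (x + 1ℚ) × ι K * (x + 1ℚ) ≤ 1ℚ + ι (floor (K ℕ.+ K) (ι K * (x + 1ℚ)))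
      spec x p q = floor-spec (K ℕ.+ K) (ι K * (x + 1ℚ)) (0≤* 0≤K (≤-trans (0≤- q) (≤-reflexive (e₁ x))))
        (≤-by _ (0≤+ (0≤* 0≤K (0≤- p)) 0≤1) (trans (cong (λ y → 1ℚ + y) (ι-+ K K)) (e₂ (ι K) x)))
        where
        e₁ : ∀ x → x - - 1ℚ ≡ x + 1ℚ
        e₁ = solve-∀ ℚ-ring
        e₂ : ∀ k x → 1ℚ + (k + k) ≡ k * (x + 1ℚ) + (k * (1ℚ - x) + 1ℚ)
        e₂ = solve-∀ ℚ-ring
      fx = spec x x≤ ≤x
      fy′ = subst (λ l → ι l ≤ ι K * (y + 1ℚ) × ι K * (y + 1ℚ) ≤ 1ℚ + ι l) (sym n≡m) (spec y y≤ ≤y)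
      eq₁ : ∀ k x y n → 1ℚ ≡ k * (x - y) + (1ℚ + n - k * (x + 1ℚ) + (k * (y + 1ℚ) - n))
      eq₁ = solve-∀ ℚ-ring
      scale : ∀ {z} → ι K * z ≤ 1ℚ → z ≤ inv (ι K)
      scale h = *-cancelˡ 0<K (≤-trans h (≤-reflexive (sym (inv-pos 0<K))))
      square : ∀ {b} → x - y ≤ b → y - x ≤ b → (x - y) * (x - y) ≤ b * b
      square {b} p q = ≤-by _ (0≤* (0≤- p) (0≤- q)) (e′ x y b)
        where
        e′ : ∀ x y b → b * b ≡ (x - y) * (x - y) + (b - (x - y)) * (b - (y - x))
        e′ = solve-∀ ℚ-ring

    cell² : Factor → ℤ → Fin (side ℕ.* side)
    cell² f x = Fin.combine (cell (χr (freq f) x)) (cell (χi (freq f) x))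

    cells : ∀ Λ → ℤ → Fin ((side ℕ.* side) ℕ.^ length Λ)
    cells [] x = Fin.zero
    cells (f ∷ Λ) x = Fin.combine (cell² f x) (cells Λ x)

    same-cells : ∀ Λ v w → cells Λ v ≡ cells Λ w → ∀ f → f ∈ Λ → Near (2ℚ * inv (ι K)) (v ℤ.- w) f
    same-cells (f ∷ Λ) v w e _ (there m) = same-cells Λ v w (proj₂ (Fin.combine-injective (cell² f v) (cells Λ v) (cell² f w) (cells Λ w) e)) _ m
    same-cells (f ∷ Λ) v w e _ (here refl) = ≤-trans (≤-reflexive (cong (λ y → 2ℚ * (1ℚ - y)) (trans (χr-+ j v (ℤ.- w)) (cong₂ (λ a b → r * a - i * b) (χr-neg j w) (χi-neg j w)))))
      (≤-trans (≤-reflexive dist) (≤-trans (+-mono-≤ c₁ c₂) (≤-by (2ℚ * (k * k)) (0≤* 0≤2 (0≤sq k)) (eq k))))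
      where
      j = freq f
      r = χr j v
      i = χi j v
      r′ = χr j w
      i′ = χi j w
      k = inv (ι K)
      eq : ∀ k → 2ℚ * k * (2ℚ * k) ≡ k * k + k * k + 2ℚ * (k * k)
      eq = solve-∀ ℚ-ring
      eq₁ : ∀ r i r′ i′ → (r - r′) * (r - r′) + (i - i′) * (i - i′) ≡ r * r + i * i + (r′ * r′ + i′ * i′) - 2ℚ * (r * r′ - i * - i′)
      eq₁ = solve-∀ ℚ-ring
      eq₂ : ∀ x → 2ℚ * (1ℚ - x) ≡ 1ℚ + 1ℚ - 2ℚ * x
      eq₂ = solve-∀ ℚ-ring
      dist : 2ℚ * (1ℚ - (r * r′ - i * - i′)) ≡ (r - r′) * (r - r′) + (i - i′) * (i - i′)
      dist = trans (eq₂ (r * r′ - i * - i′)) (sym (trans (eq₁ r i r′ i′) (cong₂ (λ a b → a + b - 2ℚ * (r * r′ - i * - i′)) (χ-unit j v) (χ-unit j w))))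
      χb : ∀ x → χr j x ≤ 1ℚ × - 1ℚ ≤ χr j x
      χb x = cos≤1 (+ j ℤ.* x) , -1≤cos (+ j ℤ.* x)
      χb′ : ∀ x → χi j x ≤ 1ℚ × - 1ℚ ≤ χi j x
      χb′ x = sin≤1 (+ j ℤ.* x) , -1≤sin (+ j ℤ.* x)
      heads = Fin.combine-injective (cell r) (cell i) (cell r′) (cell i′) (proj₁ (Fin.combine-injective (cell² f v) (cells Λ v) (cell² f w) (cells Λ w) e))
      c₁ : (r - r′) * (r - r′) ≤ k * k
      c₁ = same-cell r r′ (χb v) (χb w) (proj₁ heads)
      c₂ : (i - i′) * (i - i′) ≤ k * k
      c₂ = same-cell i i′ (χb′ v) (χb′ w) (proj₂ heads)

  digits : ∀ R s → Fin (R ℕ.^ s) → List ℤ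
  digits R zero _ = []
  digits R (suc s) i = + Fin.toℕ (proj₁ (Fin.remQuot {R} (R ℕ.^ s) i)) ∷ digits R s (proj₂ (Fin.remQuot {R} (R ℕ.^ s) i))

  digits-fit : ∀ R gs i → Fit (In ℤ.0ℤ R) gs (digits R (length gs) i)
  digits-fit R [] i = []
  digits-fit R (g ∷ gs) i = (_ , sym (ℤ.+-identityˡ _) , Fin.toℕ<n (proj₁ (Fin.remQuot {R} (R ℕ.^ length gs) i))) ∷ digits-fit R gs _

  digits-injective : ∀ R s i j → digits R s i ≡ digits R s j → i ≡ j
  digits-injective R zero Fin.zero Fin.zero _ = refl
  digits-injective R (suc s) i j e = trans (sym (Fin.combine-remQuot {R} (R ℕ.^ s) i)) (trans (cong₂ Fin.combine (Fin.toℕ-injective (ℤ.+-injective (proj₁ (∷-injective e)))) (digits-injective R s _ _ (proj₂ (∷-injective e)))) (Fin.combine-remQuot {R} (R ℕ.^ s) j))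

  AllZero : List ℤ → List ℤ → Set
  AllZero = Fit (_≡ ℤ.0ℤ)

  comb : ℤ → List ℤ → List ℤ → List ℤ
  comb b (c ∷ cs) (a ∷ as) = b ℤ.* c ℤ.+ a ∷ comb b cs as
  comb b _ _ = []

  comb-bound : ∀ {B R Q b c a} → Bounded B b → Bounded R c → Bounded Q a → Bounded (B ℕ.* R ℕ.+ Q) (b ℤ.* c ℤ.+ a)
  comb-bound {b = b} {c} {a} hb hc ha = ℕ.≤-trans (ℤ.∣i+j∣≤∣i∣+∣j∣ (b ℤ.* c) a) (ℕ.+-mono-≤ (ℕ.≤-trans (ℕ.≤-reflexive (ℤ.∣i*j∣≡∣i∣*∣j∣ b c)) (ℕ.*-mono-≤ hb hc)) ha)

  comb-fit : ∀ {B R Q b gs cs as} → Bounded B b → Fit (Bounded R) gs cs → Fit (Bounded Q) gs as → Fit (Bounded (B ℕ.* R ℕ.+ Q)) gs (comb b cs as)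
  comb-fit hb [] [] = []
  comb-fit {B} {R} {Q} {b} hb (p ∷ ps) (q ∷ qs) = comb-bound {B} {R} {Q} {b} hb p q ∷ comb-fit {B} {R} {Q} {b} hb ps qs

  comb-dot : ∀ {P P′ : ℤ → Set} b {gs cs as} → Fit P gs cs → Fit P′ gs as → dot gs (comb b cs as) ≡ b ℤ.* dot gs cs ℤ.+ dot gs as
  comb-dot b [] [] = sym (trans (ℤ.+-identityʳ _) (ℤ.*-zeroʳ b))
  comb-dot b (_∷_ {g} {gs} {c} {cs} p ps) (_∷_ {c = a} {cs = as} q qs) = trans (cong (λ x → (b ℤ.* c ℤ.+ a) ℤ.* g ℤ.+ x) (comb-dot b ps qs)) (eq b c a g (dot gs cs) (dot gs as))
    where
    eq : ∀ b c a g x y → (b ℤ.* c ℤ.+ a) ℤ.* g ℤ.+ (b ℤ.* x ℤ.+ y) ≡ b ℤ.* (c ℤ.* g ℤ.+ x) ℤ.+ (a ℤ.* g ℤ.+ y)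
    eq = ℤ.solve-∀

  comb-zero : ∀ {P P′ : ℤ → Set} {gs cs as} → Fit P gs cs → Fit P′ gs as → AllZero gs (comb ℤ.0ℤ cs as) → AllZero gs as
  comb-zero [] [] [] = []
  comb-zero (_∷_ {c = c} p ps) (_∷_ {c = a} q qs) (z ∷ zs) = trans (sym (trans (cong (ℤ._+ a) (ℤ.*-zeroˡ c)) (ℤ.+-identityˡ a))) z ∷ comb-zero ps qs zs

  data Insert (g c : ℤ) : List ℤ → List ℤ → List ℤ → List ℤ → Set where
    here : ∀ {gs cs} → Insert g c gs cs (g ∷ gs) (c ∷ cs)
    there : ∀ {h d gs cs gs′ cs′} → Insert g c gs cs gs′ cs′ → Insert g c (h ∷ gs) (d ∷ cs) (h ∷ gs′) (d ∷ cs′)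

  insert-length : ∀ {g c gs cs gs′ cs′} → Insert g c gs cs gs′ cs′ → length gs′ ≡ suc (length gs)
  insert-length here = refl
  insert-length (there i) = cong suc (insert-length i)

  pick : ∀ {P : ℤ → Set} {gs cs} → Fit P gs cs → ¬ AllZero gs cs → ∃ λ g → ∃ λ c → ∃ λ gs⁻ → ∃ λ cs⁻ → Insert g c gs⁻ cs⁻ gs cs × c ≢ ℤ.0ℤ
  pick [] h = ⊥-elim (h [])
  pick (_∷_ {g} {gs} {c} {cs} p ps) h with c ℤ.≟ ℤ.0ℤ
  ... | no c≢0 = g , c , gs , cs , here , c≢0
  ... | yes c≡0 with pick ps (λ z → h (c≡0 ∷ z))
  ...   | g′ , c′ , gs⁻ , cs⁻ , i , nz = g′ , c′ , g ∷ gs⁻ , c ∷ cs⁻ , there i , nz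

  -- The removed generator `g` does not take part in the vector `as` over `gs⁻`, so its coefficient
  -- in the sum is exactly `b * c`. With `c ≠ 0` a vanishing sum forces `b = 0`, and then the rest
  -- vanishes too.
  insert-combine : ∀ {B R Q g c gs⁻ cs⁻ gs cs as} b → Insert g c gs⁻ cs⁻ gs cs → Bounded B b → Fit (Bounded R) gs cs → Fit (Bounded Q) gs⁻ as →
    ∃ λ as′ → Fit (Bounded (B ℕ.* R ℕ.+ Q)) gs as′ × dot gs as′ ≡ b ℤ.* dot gs cs ℤ.+ dot gs⁻ as × (AllZero gs as′ → b ℤ.* c ≡ ℤ.0ℤ × (b ≡ ℤ.0ℤ → AllZero gs⁻ as))
  insert-combine {B} {R} {Q} {g} {c} {gs⁻} {cs⁻} {as = as} b here hb (p ∷ ps) qs = b ℤ.* c ∷ comb b cs⁻ as ,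
    subst (Bounded (B ℕ.* R ℕ.+ Q)) (ℤ.+-identityʳ (b ℤ.* c)) (comb-bound {B} {R} {Q} {b} {c} {ℤ.0ℤ} hb p ℕ.z≤n) ∷ comb-fit {B} {R} {Q} {b} hb ps qs ,
    trans (cong (λ x → b ℤ.* c ℤ.* g ℤ.+ x) (comb-dot b ps qs)) (eq b c g (dot gs⁻ cs⁻) (dot gs⁻ as)) ,
    λ { (z ∷ zs) → z , λ { refl → comb-zero ps qs zs } }
    where
    eq : ∀ b c g x y → b ℤ.* c ℤ.* g ℤ.+ (b ℤ.* x ℤ.+ y) ≡ b ℤ.* (c ℤ.* g ℤ.+ x) ℤ.+ y
    eq = ℤ.solve-∀
  insert-combine {B} {R} {Q} b (there {h} {d} {gs⁻} {cs⁻} {gs} {cs} i) hb (p ∷ ps) (_∷_ {c = a} {cs = as} q qs) with insert-combine {B} {R} {Q} b i hb ps qs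
  ... | as′ , fit , e , zero-out = b ℤ.* d ℤ.+ a ∷ as′ , comb-bound {B} {R} {Q} {b} hb p q ∷ fit ,
    trans (cong (λ x → (b ℤ.* d ℤ.+ a) ℤ.* h ℤ.+ x) e) (eq b d a h (dot gs cs) (dot gs⁻ as)) ,
    λ { (z ∷ zs) → proj₁ (zero-out zs) , λ { refl → trans (sym (trans (cong (ℤ._+ a) (ℤ.*-zeroˡ d)) (ℤ.+-identityˡ a))) z ∷ proj₂ (zero-out zs) refl } }
    where
    eq : ∀ b d a h x y → (b ℤ.* d ℤ.+ a) ℤ.* h ℤ.+ (b ℤ.* x ℤ.+ y) ≡ b ℤ.* (d ℤ.* h ℤ.+ x) ℤ.+ (a ℤ.* h ℤ.+ y)
    eq = ℤ.solve-∀

  zeros : List ℤ → List ℤ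
  zeros [] = []
  zeros (g ∷ gs) = ℤ.0ℤ ∷ zeros gs

  zeros-fit : ∀ {B} gs → Fit (Bounded B) gs (zeros gs)
  zeros-fit [] = []
  zeros-fit (g ∷ gs) = ℕ.z≤n ∷ zeros-fit gs

  zeros-dot : ∀ gs → dot gs (zeros gs) ≡ ℤ.0ℤ
  zeros-dot [] = refl
  zeros-dot (g ∷ gs) = trans (cong₂ ℤ._+_ (ℤ.*-zeroˡ g) (zeros-dot gs)) refl

  pad-fit : ∀ {B gs cs} hs → Fit (Bounded B) gs cs → Fit (Bounded B) (gs ++ hs) (cs ++ zeros hs)
  pad-fit hs [] = zeros-fit hs
  pad-fit hs (p ∷ ps) = p ∷ pad-fit hs ps

  pad-dot : ∀ {P : ℤ → Set} {gs cs} hs → Fit P gs cs → dot (gs ++ hs) (cs ++ zeros hs) ≡ dot gs cs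
  pad-dot hs [] = zeros-dot hs
  pad-dot hs (_∷_ {g} {c = c} p ps) = cong (λ x → c ℤ.* g ℤ.+ x) (pad-dot hs ps)

  pad-zero : ∀ {P : ℤ → Set} {gs cs} hs → Fit P gs cs → AllZero (gs ++ hs) (cs ++ zeros hs) → AllZero gs cs
  pad-zero hs [] _ = []
  pad-zero hs (p ∷ ps) (z ∷ zs) = z ∷ pad-zero hs ps zs

  module Relations (Λ : List Factor) (K : ℕ) (0<K : 0ℚ < ι K) (R s : ℕ) (crowded : (Cells.side K 0<K ℕ.* Cells.side K 0<K) ℕ.^ length Λ ℕ.< R ℕ.^ s) where

    open Cells K 0<K

    -- There are more coefficient vectors than cells, so two of them have values in one cell for all
    -- of `Λ`; their difference is the relation.
    relation : ∀ gs → length gs ≡ s → ∃ λ cs → Fit (Bounded R) gs cs × ¬ AllZero gs cs × (∀ f → f ∈ Λ → Near (2ℚ * inv (ι K)) (dot gs cs) f)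
    relation gs refl = use (Fin.pigeonhole crowded (λ i → cells Λ (dot gs (digits R (length gs) i))))
      where
      use : ∃ (λ i → ∃ λ j → i Fin.< j × cells Λ (dot gs (digits R (length gs) i)) ≡ cells Λ (dot gs (digits R (length gs) j))) → _
      use (i , j , i<j , e) = proj₁ d , proj₁ (proj₂ d) , nonzero , λ f m → subst (λ x → Near (2ℚ * inv (ι K)) x f) (sym (proj₁ (proj₂ (proj₂ d)))) (same-cells Λ _ _ e f m)
        where
        d = fit-difference {ℤ.0ℤ} (digits-fit R gs i) (digits-fit R gs j)
        nonzero : ¬ AllZero gs (proj₁ d)
        nonzero z = Fin.<-irrefl (digits-injective R (length gs) i j (proj₂ (proj₂ (proj₂ d)) z)) i<j

    -- Each near relation among the first `s` generators becomes a new generator, and one old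
    -- generator occurring in it is retired. The retired generators make the system triangular, so
    -- the new generators inherit independence, with coefficients enlarged by `n * R` only. The
    -- price is `s` dimensions.
    reduce : ∀ n gs → length gs ≡ s ℕ.+ n → ∃ λ gs′ → length gs′ ≡ n × (∀ g → g ∈ gs′ → ∀ f → f ∈ Λ → Near (2ℚ * inv (ι K)) g f) ×
      (∀ B bs → Fit (Bounded B) gs′ bs → ∃ λ as → Fit (Bounded (n ℕ.* (B ℕ.* R))) gs as × dot gs as ≡ dot gs′ bs × (AllZero gs as → AllZero gs′ bs))
    reduce zero gs len = [] , refl , (λ g ()) , λ { B [] [] → zeros gs , zeros-fit gs , zeros-dot gs , λ _ → [] }
    reduce (suc n) gs len = step (padded gs (ℕ.≤-trans (ℕ.m≤m+n s (suc n)) (ℕ.≤-reflexive (sym len))))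
      where
      padded : ∀ gs → s ℕ.≤ length gs → ∃ λ cs → Fit (Bounded R) gs cs × ¬ AllZero gs cs × (∀ f → f ∈ Λ → Near (2ℚ * inv (ι K)) (dot gs cs) f)
      padded gs s≤ with relation (take s gs) (trans (length-take s gs) (ℕ.m≤n⇒m⊓n≡m s≤))
      ... | cs , fit , nz , near = subst (λ gs → ∃ λ cs → Fit (Bounded R) gs cs × ¬ AllZero gs cs × (∀ f → f ∈ Λ → Near (2ℚ * inv (ι K)) (dot gs cs) f)) (take++drop≡id s gs)
        (cs ++ zeros (drop s gs) , pad-fit (drop s gs) fit , (λ z → nz (pad-zero (drop s gs) fit z)) , λ f m → subst (λ x → Near (2ℚ * inv (ι K)) x f) (sym (pad-dot (drop s gs) fit)) (near f m))
      step : (∃ λ cs → Fit (Bounded R) gs cs × ¬ AllZero gs cs × (∀ f → f ∈ Λ → Near (2ℚ * inv (ι K)) (dot gs cs) f)) → _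
      step (cs , fit , nz , near) with pick fit nz
      ... | g , c , gs⁻ , cs⁻ , ins , c≢0 with reduce n gs⁻ (ℕ.suc-injective (trans (sym (insert-length ins)) (trans len (ℕ.+-suc s n))))
      ...   | gs″ , len″ , near″ , lift = dot gs cs ∷ gs″ , cong suc len″ ,
        (λ { _ (here refl) f m → near f m ; g (there m′) f m → near″ g m′ f m }) ,
        λ { B (b ∷ bs) (hb ∷ hbs) → extend B b bs hb (lift B bs hbs) }
        where
        extend : ∀ B b bs → Bounded B b → (∃ λ as → Fit (Bounded (n ℕ.* (B ℕ.* R))) gs⁻ as × dot gs⁻ as ≡ dot gs″ bs × (AllZero gs⁻ as → AllZero gs″ bs)) →
          ∃ λ as → Fit (Bounded (suc n ℕ.* (B ℕ.* R))) gs as × dot gs as ≡ dot (dot gs cs ∷ gs″) (b ∷ bs) × (AllZero gs as → AllZero (dot gs cs ∷ gs″) (b ∷ bs))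
        extend B b bs hb (as , fa , da , za) with insert-combine {B} {R} {n ℕ.* (B ℕ.* R)} b ins hb fit fa
        ... | as′ , fa′ , da′ , za′ = as′ , fa′ , trans da′ (cong (λ x → b ℤ.* dot gs cs ℤ.+ x) da) , λ z → b≡0 (ℤ.i*j≡0⇒i≡0∨j≡0 b (proj₁ (za′ z))) ∷ za (proj₂ (za′ z) (b≡0 (ℤ.i*j≡0⇒i≡0∨j≡0 b (proj₁ (za′ z)))))
          where
          b≡0 : b ≡ ℤ.0ℤ ⊎ c ≡ ℤ.0ℤ → b ≡ ℤ.0ℤ
          b≡0 (inj₁ e) = e
          b≡0 (inj₂ e) = ⊥-elim (c≢0 e)

-- Enlarged boxes and their growth

module Extensions where

  open Rationals
  open Sums
  open Boxes

  bounded-split : ∀ {B c} → Bounded B c → ∃ λ p → ∃ λ q → c ≡ ℤ.- (+ B) ℤ.+ + p × B ℕ.+ B ≡ p ℕ.+ q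
  bounded-split {B} {+ n} h = B ℕ.+ n , B ℕ.∸ n , eq (+ B) (+ n) , trans (cong (B ℕ.+_) (sym (ℕ.m+[n∸m]≡n h))) (sym (ℕ.+-assoc B n (B ℕ.∸ n)))
    where
    eq : ∀ b n → n ≡ ℤ.- b ℤ.+ (b ℤ.+ n)
    eq = ℤ.solve-∀
  bounded-split {B} { -[1+ n ]} h = B ℕ.∸ suc n , B ℕ.+ suc n , trans (eq (+ suc n) (+ (B ℕ.∸ suc n))) (cong (λ x → ℤ.- x ℤ.+ + (B ℕ.∸ suc n)) (cong +_ (ℕ.m∸n+n≡m h))) ,
    trans (cong (ℕ._+ B) (sym (ℕ.m∸n+n≡m h))) (trans (ℕ.+-assoc (B ℕ.∸ suc n) (suc n) B) (cong ((B ℕ.∸ suc n) ℕ.+_) (ℕ.+-comm (suc n) B)))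
    where
    eq : ∀ m x → ℤ.- m ≡ ℤ.- (x ℤ.+ m) ℤ.+ x
    eq = ℤ.solve-∀

  ext : List ℤ → ℕ → ℕ → List ℤ
  ext gs B n = box gs (ℤ.- (+ B)) (n ℕ.+ (B ℕ.+ B))

  Span : List ℤ → ℕ → ℤ → Set
  Span gs B x = ∃ λ cs → Fit (Bounded B) gs cs × x ≡ dot gs cs

  covers-ext : ∀ {B₀ n B c} → Bounded B c → Covers (ℤ.- (+ B₀)) (n ℕ.+ (B₀ ℕ.+ B₀)) (ℤ.- (+ (B₀ ℕ.+ B))) (n ℕ.+ (B₀ ℕ.+ B ℕ.+ (B₀ ℕ.+ B))) c
  covers-ext {B₀} {n} {B} {c} h with bounded-split {B} {c} h
  ... | p , q , refl , e = p , q , eq (+ B₀) (+ B) (+ p) , trans (eq₂ n B₀ B) (trans (cong (λ x → n ℕ.+ (B₀ ℕ.+ B₀) ℕ.+ x) e) (eq₃ (n ℕ.+ (B₀ ℕ.+ B₀)) p q))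
    where
    eq : ∀ b₀ b p → ℤ.- b₀ ℤ.+ (ℤ.- b ℤ.+ p) ≡ ℤ.- (b₀ ℤ.+ b) ℤ.+ p
    eq = ℤ.solve-∀
    eq₂ : ∀ n b₀ b → n ℕ.+ (b₀ ℕ.+ b ℕ.+ (b₀ ℕ.+ b)) ≡ n ℕ.+ (b₀ ℕ.+ b₀) ℕ.+ (b ℕ.+ b)
    eq₂ = ℕ.solve-∀
    eq₃ : ∀ x p q → x ℕ.+ (p ℕ.+ q) ≡ p ℕ.+ (x ℕ.+ q)
    eq₃ = ℕ.solve-∀

  ∑-ext-shift : ∀ {gs} B₀ n B {c} → Span gs B c → ∀ (F : ℤ → ℚ) → (∀ x → 0ℚ ≤ F x) → ∑ (ext gs B₀ n) (λ x → F (x ℤ.+ c)) ≤ ∑ (ext gs (B₀ ℕ.+ B) n) F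
  ∑-ext-shift {gs} B₀ n B (cs , fit , refl) = ∑-box-⊂ gs cs (Fit-map (covers-ext {B₀} {n} {B}) fit)

  ext-0 : ∀ gs n → ext gs 0 n ≡ box gs ℤ.0ℤ n
  ext-0 gs n = cong (box gs ℤ.0ℤ) (ℕ.+-identityʳ n)

  ∑-box-shift : ∀ {gs} n B {c} → Span gs B c → ∀ (F : ℤ → ℚ) → (∀ x → 0ℚ ≤ F x) → ∑ (box gs ℤ.0ℤ n) (λ x → F (x ℤ.+ c)) ≤ ∑ (ext gs B n) F
  ∑-box-shift {gs} n B sp F 0≤F = ≤-trans (≤-reflexive (cong (λ l → ∑ l _) (sym (ext-0 gs n)))) (∑-ext-shift 0 n B sp F 0≤F)

  Bounded-+ : ∀ {B C a b} → Bounded B a → Bounded C b → Bounded (B ℕ.+ C) (a ℤ.+ b)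
  Bounded-+ {a = a} {b} p q = ℕ.≤-trans (ℤ.∣i+j∣≤∣i∣+∣j∣ a b) (ℕ.+-mono-≤ p q)

  Bounded-neg : ∀ {B a} → Bounded B a → Bounded B (ℤ.- a)
  Bounded-neg {B} {a} p = subst (ℕ._≤ B) (sym (ℤ.∣-i∣≡∣i∣ a)) p

  Span-+ : ∀ {gs B C x y} → Span gs B x → Span gs C y → Span gs (B ℕ.+ C) (x ℤ.+ y)
  Span-+ {B = B} {C} (_ , [] , refl) (_ , [] , refl) = [] , [] , refl
  Span-+ {B = B} {C} (c ∷ cs , _∷_ {g} {gs} p ps , refl) (d ∷ ds , q ∷ qs , refl) with Span-+ {gs} {B} {C} (cs , ps , refl) (ds , qs , refl)
  ... | es , fit , e = c ℤ.+ d ∷ es , Bounded-+ {B} {C} {c} {d} p q ∷ fit , trans (eq c d g (dot gs cs) (dot gs ds)) (cong (λ x → (c ℤ.+ d) ℤ.* g ℤ.+ x) e)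
    where
    eq : ∀ c d g x y → c ℤ.* g ℤ.+ x ℤ.+ (d ℤ.* g ℤ.+ y) ≡ (c ℤ.+ d) ℤ.* g ℤ.+ (x ℤ.+ y)
    eq = ℤ.solve-∀

  Span-neg : ∀ {gs B x} → Span gs B x → Span gs B (ℤ.- x)
  Span-neg (_ , [] , refl) = [] , [] , refl
  Span-neg {B = B} (c ∷ cs , _∷_ {g} {gs} p ps , refl) with Span-neg {gs} {B} (cs , ps , refl)
  ... | es , fit , e = ℤ.- c ∷ es , Bounded-neg {B} {c} p ∷ fit , trans (eq c g (dot gs cs)) (cong (λ x → (ℤ.- c) ℤ.* g ℤ.+ x) e)
    where
    eq : ∀ c g x → ℤ.- (c ℤ.* g ℤ.+ x) ≡ (ℤ.- c) ℤ.* g ℤ.+ (ℤ.- x)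
    eq = ℤ.solve-∀

  Span-- : ∀ {gs B C x y} → Span gs B x → Span gs C y → Span gs (B ℕ.+ C) (x ℤ.- y)
  Span-- {gs} {B} {C} p q = Span-+ {gs} {B} {C} p (Span-neg {gs} {C} q)

  Span-mono : ∀ {gs B C x} → B ℕ.≤ C → Span gs B x → Span gs C x
  Span-mono h (cs , fit , e) = cs , Fit-map (λ p → ℕ.≤-trans p h) fit , e

  In-bounded : ∀ {n a} → In ℤ.0ℤ n a → Bounded n a
  In-bounded {n} (k , refl , k<) = subst (ℕ._≤ n) (sym (cong ℤ.∣_∣ (ℤ.+-identityˡ (+ k)))) (ℕ.<⇒≤ k<)

  ∈-box-Span : ∀ {gs n x} → x ∈ box gs ℤ.0ℤ n → Span gs n x
  ∈-box-Span {gs} {n} x∈ with ∈-box⁻ {gs} x∈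
  ... | cs , fit , e = cs , Fit-map (In-bounded {n}) fit , e

  Proper-mono : ∀ {gs B C} → B ℕ.≤ C → Proper C gs → Proper B gs
  Proper-mono h p cs fit = p cs (Fit-map (λ q → ℕ.≤-trans q h) fit)

  box-minus-span : ∀ {gs n B s c} → s ∈ box gs ℤ.0ℤ n → Span gs B c → ∃ λ cs → Fit (In (ℤ.- (+ B)) (n ℕ.+ (B ℕ.+ B))) gs cs × dot gs cs ≡ s ℤ.- c
  box-minus-span {gs} {n} {B} s∈ sp with ∈-box⁻ {gs} s∈ | Span-neg {gs} {B} sp
  ... | as , fa , refl | ds , fd , e = proj₁ (go fa fd) , proj₁ (proj₂ (go fa fd)) , trans (proj₂ (proj₂ (go fa fd))) (cong (λ x → dot gs as ℤ.+ x) (sym e))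
    where
    add : ∀ {a d} → In ℤ.0ℤ n a → Bounded B d → In (ℤ.- (+ B)) (n ℕ.+ (B ℕ.+ B)) (a ℤ.+ d)
    add {d = d} (k , refl , k<) h with bounded-split {B} {d} h
    ... | p , q , refl , e = k ℕ.+ p , eq (+ k) (+ B) (+ p) , ℕ.+-mono-<-≤ k< (ℕ.≤-trans (ℕ.m≤m+n p q) (ℕ.≤-reflexive (sym e)))
      where
      eq : ∀ k b p → + 0 ℤ.+ k ℤ.+ (ℤ.- b ℤ.+ p) ≡ ℤ.- b ℤ.+ (k ℤ.+ p)
      eq = ℤ.solve-∀
    go : ∀ {gs as ds} → Fit (In ℤ.0ℤ n) gs as → Fit (Bounded B) gs ds → ∃ λ cs → Fit (In (ℤ.- (+ B)) (n ℕ.+ (B ℕ.+ B))) gs cs × dot gs cs ≡ dot gs as ℤ.+ dot gs ds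
    go [] [] = [] , [] , refl
    go (_∷_ {g} {gs} {a} {as} p ps) (_∷_ {c = d} {cs = ds} q qs) with go ps qs
    ... | es , fit , e′ = a ℤ.+ d ∷ es , add p q ∷ fit , trans (cong (λ x → (a ℤ.+ d) ℤ.* g ℤ.+ x) e′) (eq a d g (dot gs as) (dot gs ds))
      where
      eq : ∀ c d g x y → (c ℤ.+ d) ℤ.* g ℤ.+ (x ℤ.+ y) ≡ c ℤ.* g ℤ.+ x ℤ.+ (d ℤ.* g ℤ.+ y)
      eq = ℤ.solve-∀

  -- With `x = h / n` one has `(n + h) (1 - x) ≤ n` in every coordinate, and Bernoulli gives
  -- `(1 - x) ^ D ≥ 1 - D x ≥ 1 - η`.
  growth : ∀ {n h D η} → 0ℚ < ι n → 0ℚ ≤ η → ι D * ι h ≤ η * ι n → ι h ≤ ι n → ι (n ℕ.+ h) ^ D * (1ℚ - η) ≤ ι n ^ D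
  growth {n} {h} {D} {η} 0<n 0≤η le h≤n = ≤-trans (*-monoˡ (0≤^ D (0≤ι (n ℕ.+ h))) (≤-trans (≤-by (η - ι D * x) (0≤- Dx≤η) (e₁ η (ι D * x))) (bernoulli D 0≤x x≤1)))
    (≤-trans (≤-reflexive (sym (^-distrib-* (ι (n ℕ.+ h)) (1ℚ - x) D))) (^-mono D (0≤* (0≤ι (n ℕ.+ h)) (0≤- x≤1)) contract))
    where
    x = ι h * inv (ι n)
    i = inv (ι n)
    0≤i : 0ℚ ≤ i
    0≤i = 0≤inv (<⇒≤ 0<n)
    ni : ι n * i ≡ 1ℚ
    ni = inv-pos 0<n
    0≤x : 0ℚ ≤ x
    0≤x = 0≤* (0≤ι h) 0≤i
    e₁ : ∀ a b → 1ℚ - b ≡ 1ℚ - a + (a - b)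
    e₁ = solve-∀ ℚ-ring
    Dx≤η : ι D * x ≤ η
    Dx≤η = ≤-trans (≤-reflexive (sym (*-assoc (ι D) (ι h) i))) (≤-trans (*-monoʳ 0≤i le) (≤-reflexive (trans (*-assoc η (ι n) i) (trans (cong (η *_) ni) (*-identityʳ η)))))
    x≤1 : x ≤ 1ℚ
    x≤1 = ≤-trans (*-monoʳ 0≤i h≤n) (≤-reflexive ni)
    contract : ι (n ℕ.+ h) * (1ℚ - x) ≤ ι n
    contract = ≤-by (ι h * x) (0≤* (0≤ι h) 0≤x) (trans (e₄ (ι n) (ι h)) (trans (cong (λ y → ι n + ι h - ι h * y) (sym ni)) (trans (e₃ (ι n) (ι h) i) (cong (λ y → y * (1ℚ - x) + ι h * x) (sym (ι-+ n h))))))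
      where
      e₄ : ∀ n h → n ≡ n + h - h * 1ℚ
      e₄ = solve-∀ ℚ-ring
      e₃ : ∀ n h i → n + h - h * (n * i) ≡ (n + h) * (1ℚ - h * i) + h * (h * i)
      e₃ = solve-∀ ℚ-ring

-- Skew-corner-free columns and their autocorrelation

module Columns where

  open Rationals
  open Sums
  open Moments
  open Unbalancing
  open Transfer using (δ; corr)
  open Boxes
  open Multiplicities
  open Extensions
  open import Data.List.Membership.Propositional.Properties using (∈-filter⁻; ∈-concatMap⁻; ∈-map⁻)
  import Data.List.Membership.Propositional as L

  SkewFree : (ℤ → ℤ → Bool) → Set
  SkewFree A = ∀ x y y′ h → h ≢ ℤ.0ℤ → T (A x y) → T (A x (y ℤ.+ h)) → T (A (x ℤ.+ h) y′) → ⊥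

  δ-sym : ∀ a b → δ (a ℤ.- b) ≡ δ (b ℤ.- a)
  δ-sym a b with a ℤ.≟ b
  ... | yes refl = refl
  ... | no h = trans (δ-nonzero (λ e → h (ℤ.i-j≡0⇒i≡j a b e))) (sym (δ-nonzero (λ e → h (sym (ℤ.i-j≡0⇒i≡j b a e)))))

  49/64 1/8 : ℚ
  49/64 = + 49 / 64
  1/8 = + 1 / 8

  -- The junk value of `inv` makes this true at `y = 0`, which spares a case distinction for empty
  -- columns.
  inv-absorb : ∀ y → 0ℚ ≤ y → inv y * y * y ≡ y
  inv-absorb y p with y ≟ 0ℚ
  ... | yes refl = *-zeroʳ (inv 0ℚ * 0ℚ)
  ... | no h = trans (cong (_* y) (trans (*-comm (inv y) y) (inv-*ʳ h))) (*-identityˡ y)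

  inv-≤1 : ∀ y → 0ℚ ≤ y → inv y * y ≤ 1ℚ
  inv-≤1 y p with y ≟ 0ℚ
  ... | yes refl = ≤-trans (≤-reflexive (*-zeroʳ (inv 0ℚ))) 0≤1
  ... | no h = ≤-reflexive (trans (*-comm (inv y) y) (inv-*ʳ h))

  module Setup (A : ℤ → ℤ → Bool) (free : SkewFree A) (gs : List ℤ) (L L₁ : ℕ)
    (proper : Proper (L ℕ.+ (L₁ ℕ.+ (L₁ ℕ.+ L₁) ℕ.+ (L₁ ℕ.+ (L₁ ℕ.+ L₁)))) gs) (proper₁ : Proper L₁ gs) where

    -- Room for all shifts `z - off ξ` below, where `z` lies in `P` and `off ξ` in `P - P`.
    B : ℕ
    B = L₁ ℕ.+ (L₁ ℕ.+ L₁)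

    boxL P U : List ℤ
    boxL = box gs ℤ.0ℤ L
    P = box gs ℤ.0ℤ L₁
    U = ext gs B L

    properL : Proper L gs
    properL = Proper-mono (ℕ.m≤m+n L (B ℕ.+ B)) proper

    Y : ℤ → List ℤ
    Y x = filterᵇ (A x) boxL

    ∈-Y : ∀ {x s} → s ∈ Y x → s ∈ boxL × T (A x s)
    ∈-Y {x} s∈ = ∈-filter⁻ _ {xs = boxL} s∈

    multiplicity≤1 : ∀ x t → multiplicity (Y x) t ≤ 1ℚ
    multiplicity≤1 x t = ≤-trans (∑-filter-≤ (A x) boxL (λ s → 0≤δ (t ℤ.- s))) (≤-trans (≤-reflexive (∑-cong boxL (λ s → δ-sym t s))) (count≤1 ℤ.0ℤ properL t))

    complete : ∀ x {c} → Span gs B c → Complete U (Y x) c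
    complete x {c} sp s s∈ = complete-box {gs} {lo = ℤ.- (+ B)} proper (box-minus-span {gs} {L} {B} (proj₁ (∈-Y {x} s∈)) sp)

    -- For any pair `ζ`, `ζ′` the enlarged box, moved by `ζ′ - ζ`, still covers all columns.
    -- Averaging over `x₀` finds a position around which the columns over `x₀ + P - P` are dense on
    -- average.
    base-exists : ∀ Q → Q ≤ ∑ boxL (λ x → # (Y x)) → 0ℚ < # (ext gs (L₁ ℕ.+ L₁) L) →
      ∃ λ x₀ → # P * # P * Q ≤ # (ext gs (L₁ ℕ.+ L₁) L) * ∑∑ P (λ ζ ζ′ → # (Y (x₀ ℤ.+ (ζ′ ℤ.- ζ))))
    base-exists Q hQ 0<E = found (≤-avg-∃ E {λ x₀ → # E * S x₀} 0<E avg)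
      where
      E = ext gs (L₁ ℕ.+ L₁) L
      S : ℤ → ℚ
      S x₀ = ∑∑ P (λ ζ ζ′ → # (Y (x₀ ℤ.+ (ζ′ ℤ.- ζ))))
      found : ∃ (λ x → x ∈ E × # P * # P * Q ≤ # E * S x) → ∃ λ x₀ → # P * # P * Q ≤ # E * S x₀
      found (x , _ , h) = x , h
      eq : ∀ x a b → x ℤ.+ (a ℤ.- b) ℤ.+ (b ℤ.- a) ≡ x
      eq = ℤ.solve-∀
      one-pair : ∀ ζ → ζ ∈ P → ∀ ζ′ → ζ′ ∈ P → Q ≤ ∑ E (λ x₀ → # (Y (x₀ ℤ.+ (ζ′ ℤ.- ζ))))
      one-pair ζ ζ∈ ζ′ ζ′∈ = ≤-trans hQ (≤-trans (≤-reflexive (∑-cong boxL (λ x → cong (λ y → # (Y y)) (sym (eq x ζ ζ′)))))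
        (∑-box-shift {gs} L (L₁ ℕ.+ L₁) (Span-- {gs} {L₁} {L₁} (∈-box-Span {gs} {L₁} ζ∈) (∈-box-Span {gs} {L₁} ζ′∈)) (λ x → # (Y (x ℤ.+ (ζ′ ℤ.- ζ)))) (λ x → 0≤# (Y (x ℤ.+ (ζ′ ℤ.- ζ))))))
      total : # P * # P * Q ≤ ∑ E S
      total = ≤-trans (≤-reflexive (sym (∑∑-const P Q))) (≤-trans (∑-mono∈ P (λ ζ ζ∈ → ∑-mono∈ P (λ ζ′ ζ′∈ → one-pair ζ ζ∈ ζ′ ζ′∈)))
        (≤-reflexive (sym (trans (∑-swap E P _) (∑-cong P (λ ζ → ∑-swap E P _))))))
      avg : # E * (# P * # P * Q) ≤ ∑ E (λ x₀ → # E * S x₀)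
      avg = ≤-trans (*-monoˡ (<⇒≤ 0<E) total) (≤-reflexive (sym (∑-*ˡ E (# E) S)))

    module Base (x₀ : ℤ) where

      -- Abscissas are repeated as often as they are represented, which is the weight with which a
      -- kernel on `P × P` sees them.
      Ξ : List ℤ
      Ξ = concatMap (λ ζ → map (λ ζ′ → x₀ ℤ.+ (ζ′ ℤ.- ζ)) P) P

      ∑-Ξ : ∀ (F : ℤ → ℚ) → ∑ Ξ F ≡ ∑∑ P (λ ζ ζ′ → F (x₀ ℤ.+ (ζ′ ℤ.- ζ)))
      ∑-Ξ F = trans (∑-concatMap _ P F) (∑-cong P (λ ζ → ∑-map _ P F))

      off : ℤ → ℤ
      off ξ = ξ ℤ.- x₀

      off-Span : ∀ ξ → ξ ∈ Ξ → Span gs (L₁ ℕ.+ L₁) (off ξ)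
      off-Span ξ ξ∈ with L.find (∈-concatMap⁻ (λ ζ → map (λ ζ′ → x₀ ℤ.+ (ζ′ ℤ.- ζ)) P) {xs = P} ξ∈)
      ... | ζ , ζ∈ , m with ∈-map⁻ (λ ζ′ → x₀ ℤ.+ (ζ′ ℤ.- ζ)) m
      ...   | ζ′ , ζ′∈ , refl = subst (Span gs (L₁ ℕ.+ L₁)) (sym (eq x₀ (ζ′ ℤ.- ζ))) (Span-- {gs} {L₁} {L₁} (∈-box-Span {gs} {L₁} ζ′∈) (∈-box-Span {gs} {L₁} ζ∈))
        where
        eq : ∀ x d → x ℤ.+ d ℤ.- x ≡ d
        eq = ℤ.solve-∀

      nU Stot iU iS : ℚ
      nU = # U
      Stot = ∑ Ξ (λ ξ → # (Y ξ))
      iU = inv nU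
      iS = inv Stot

      -- Each column enters `Φ` with total mass proportional to its size, normalised to mean `1`.
      -- Then `c ξ * # (Y ξ)` is at most `nU / Stot` for all columns alike, so that sparse columns
      -- cause no excessive peak at `0`.
      c α : ℤ → ℚ
      c ξ = inv (# (Y ξ)) * (nU * iS)
      α ξ = # (Y ξ) * iU

      Φ : ℤ → ℚ
      Φ v = ∑ Ξ (λ ξ → c ξ * corr (Y ξ) v)

      module Analysis (0<nU : 0ℚ < nU) (0<Stot : 0ℚ < Stot) where

        nU*iU : nU * iU ≡ 1ℚ
        nU*iU = inv-pos 0<nU
        Stot*iS : Stot * iS ≡ 1ℚ
        Stot*iS = inv-pos 0<Stot
        0≤iU : 0ℚ ≤ iU
        0≤iU = 0≤inv (<⇒≤ 0<nU)
        0≤iS : 0ℚ ≤ iS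
        0≤iS = 0≤inv (<⇒≤ 0<Stot)

        0≤c : ∀ ξ → 0ℚ ≤ c ξ
        0≤c ξ = 0≤* (0≤inv (0≤# (Y ξ))) (0≤* (<⇒≤ 0<nU) 0≤iS)

        c*#≤ : ∀ ξ → c ξ * # (Y ξ) ≤ nU * iS
        c*#≤ ξ = ≤-trans (≤-reflexive (eq (inv (# (Y ξ))) (# (Y ξ)) (nU * iS))) (≤-trans (*-monoʳ (0≤* (<⇒≤ 0<nU) 0≤iS) (inv-≤1 (# (Y ξ)) (0≤# (Y ξ)))) (≤-reflexive (*-identityˡ (nU * iS))))
          where
          eq : ∀ i y x → i * x * y ≡ i * y * x
          eq = solve-∀ ℚ-ring

        m : ℤ → ℤ → ℚ
        m ξ = multiplicity (Y ξ)

        centred : ∀ ξ c₁ c₂ → Span gs B c₁ → Span gs B c₂ →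
          ∑ U (λ u → c ξ * ((m ξ (u ℤ.+ c₁) - α ξ) * (m ξ (u ℤ.+ c₂) - α ξ))) ≡ c ξ * corr (Y ξ) (c₂ ℤ.- c₁) - # (Y ξ) * iS
        centred ξ c₁ c₂ s₁ s₂ = begin
          ∑ U (λ u → c ξ * ((m ξ (u ℤ.+ c₁) - α ξ) * (m ξ (u ℤ.+ c₂) - α ξ)))
            ≡⟨ ∑-*ˡ U (c ξ) _ ⟩
          c ξ * ∑ U (λ u → (m ξ (u ℤ.+ c₁) - α ξ) * (m ξ (u ℤ.+ c₂) - α ξ))
            ≡⟨ cong (c ξ *_) (trans (∑-cong U (λ u → eq (m ξ (u ℤ.+ c₁)) (m ξ (u ℤ.+ c₂)) (α ξ))) (trans (∑-- U _ _) (cong₂ _-_ (∑-- U _ _) (∑-*ˡ U (α ξ) _)))) ⟩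
          c ξ * (∑ U (λ u → m ξ (u ℤ.+ c₁) * m ξ (u ℤ.+ c₂)) - ∑ U (λ u → α ξ * m ξ (u ℤ.+ c₁)) - α ξ * ∑ U (λ u → m ξ (u ℤ.+ c₂) - α ξ))
            ≡⟨ cong (c ξ *_) (cong₂ (λ a b → a - b - α ξ * ∑ U (λ u → m ξ (u ℤ.+ c₂) - α ξ)) (∑-multiplicity² U (Y ξ) c₁ c₂ (complete ξ s₁)) (trans (∑-*ˡ U (α ξ) _) (cong (α ξ *_) (∑-multiplicity U (Y ξ) c₁ (complete ξ s₁))))) ⟩
          c ξ * (corr (Y ξ) (c₂ ℤ.- c₁) - α ξ * y - α ξ * ∑ U (λ u → m ξ (u ℤ.+ c₂) - α ξ))
            ≡⟨ cong (λ a → c ξ * (corr (Y ξ) (c₂ ℤ.- c₁) - α ξ * y - α ξ * a)) (trans (∑-- U _ _) (trans (cong₂ _-_ (∑-multiplicity U (Y ξ) c₂ (complete ξ s₂)) (∑-const U (α ξ))) zero-mean)) ⟩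
          c ξ * (corr (Y ξ) (c₂ ℤ.- c₁) - α ξ * y - α ξ * 0ℚ)
            ≡⟨ eq₂ (inv y) nU iS iU y (corr (Y ξ) (c₂ ℤ.- c₁)) ⟩
          c ξ * corr (Y ξ) (c₂ ℤ.- c₁) - inv y * y * y * (nU * iU) * iS
            ≡⟨ cong (λ a → c ξ * corr (Y ξ) (c₂ ℤ.- c₁) - a) (trans (cong₂ (λ a b → a * b * iS) (inv-absorb y (0≤# (Y ξ))) nU*iU) (cong (_* iS) (*-identityʳ y))) ⟩
          c ξ * corr (Y ξ) (c₂ ℤ.- c₁) - # (Y ξ) * iS ∎
          where
          open ≡-Reasoning
          y = # (Y ξ)
          eq : ∀ a b x → (a - x) * (b - x) ≡ a * b - x * a - x * (b - x)
          eq = solve-∀ ℚ-ring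
          eq₂ : ∀ i n s j y k → i * (n * s) * (k - y * j * y - y * j * 0ℚ) ≡ i * (n * s) * k - i * y * y * (n * j) * s
          eq₂ = solve-∀ ℚ-ring
          eq₃ : ∀ n y i → y - n * (y * i) ≡ y - y * (n * i)
          eq₃ = solve-∀ ℚ-ring
          zero-mean : y - nU * α ξ ≡ 0ℚ
          zero-mean = trans (eq₃ nU y iU) (trans (cong (λ a → y - y * a) nU*iU) (trans (cong (λ a → y - a) (*-identityʳ y)) (ℚ.+-inverseʳ y)))

        over : (ℤ → ℤ → Entry ℤ) → List (Entry ℤ)
        over f = concatMap (λ ξ → map (f ξ) U) Ξ

        ker-over : ∀ p q f z z′ → ker p q (over f) z z′ ≡ ∑ Ξ (λ ξ → ∑ U (λ u → wt (f ξ u) * (p (f ξ u) z * q (f ξ u) z′)))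
        ker-over p q f z z′ = trans (∑-concatMap _ Ξ _) (∑-cong Ξ (λ ξ → ∑-map (f ξ) U _))

        over-∈ : ∀ {Q : Entry ℤ → Set} f → (∀ ξ u → Q (f ξ u)) → ∀ e → e ∈ over f → Q e
        over-∈ f h e e∈ with L.find (∈-concatMap⁻ (λ ξ → map (f ξ) U) {xs = Ξ} e∈)
        ... | ξ , _ , e∈′ with ∈-map⁻ (f ξ) e∈′
        ...   | u , _ , refl = h ξ u

        -- The right factor sees the column moved back by its own offset. In the mixed kernel the
        -- shift becomes `x₀ + z′ - z - ξ`, a difference between another abscissa and `ξ`, to which
        -- skew-corner-freeness applies; in both symmetric kernels the offset cancels.
        plain balanced : ℤ → ℤ → Entry ℤ
        plain ξ u = entry (c ξ) (λ z → m ξ (u ℤ.+ z)) (λ z → m ξ (u ℤ.+ z))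
        balanced ξ u = entry (c ξ) (λ z → m ξ (u ℤ.+ z) - α ξ) (λ z → m ξ (u ℤ.+ (z ℤ.- off ξ)) - α ξ)

        P-Span : ∀ {z} → z ∈ P → Span gs B z
        P-Span z∈ = Span-mono {gs} (ℕ.m≤m+n L₁ (L₁ ℕ.+ L₁)) (∈-box-Span {gs} {L₁} z∈)

        P-off-Span : ∀ {z} → z ∈ P → ∀ ξ → ξ ∈ Ξ → Span gs B (z ℤ.- off ξ)
        P-off-Span z∈ ξ ξ∈ = Span-- {gs} {L₁} {L₁ ℕ.+ L₁} (∈-box-Span {gs} {L₁} z∈) (off-Span ξ ξ∈)

        minus-one : ∀ (F : ℤ → ℚ) → ∑ Ξ (λ ξ → F ξ - # (Y ξ) * iS) ≡ ∑ Ξ F - 1ℚ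
        minus-one F = trans (∑-- Ξ _ _) (cong (λ a → ∑ Ξ F - a) (trans (∑-*ʳ Ξ iS _) Stot*iS))

        K : ℤ → ℤ → ℚ
        K = ker fl fl (over plain)

        K≡Φ : ∀ z → z ∈ P → ∀ z′ → K z z′ ≡ Φ (z′ ℤ.- z)
        K≡Φ z z∈ z′ = trans (ker-over fl fl plain z z′) (∑-cong Ξ (λ ξ → trans (∑-*ˡ U (c ξ) _) (cong (c ξ *_) (∑-multiplicity² U (Y ξ) z z′ (complete ξ (P-Span z∈))))))

        ker-ll : ∀ z → z ∈ P → ∀ z′ → z′ ∈ P → ker fl fl (over balanced) z z′ ≡ Φ (z′ ℤ.- z) - 1ℚ
        ker-ll z z∈ z′ z′∈ = trans (ker-over fl fl balanced z z′) (trans (∑-cong Ξ (λ ξ → centred ξ z z′ (P-Span z∈) (P-Span z′∈))) (minus-one _))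

        ker-rr : ∀ z → z ∈ P → ∀ z′ → z′ ∈ P → ker fr fr (over balanced) z z′ ≡ Φ (z′ ℤ.- z) - 1ℚ
        ker-rr z z∈ z′ z′∈ = trans (ker-over fr fr balanced z z′) (trans (∑-cong∈ Ξ (λ ξ ξ∈ → trans (centred ξ (z ℤ.- off ξ) (z′ ℤ.- off ξ) (P-off-Span z∈ ξ ξ∈) (P-off-Span z′∈ ξ ξ∈))
            (cong (λ v → c ξ * corr (Y ξ) v - # (Y ξ) * iS) (eq z z′ (off ξ))))) (minus-one _))
          where
          eq : ∀ a b d → b ℤ.- d ℤ.- (a ℤ.- d) ≡ b ℤ.- a
          eq = ℤ.solve-∀

        Ψ : ℤ → ℤ → ℚ
        Ψ z z′ = ∑ Ξ (λ ξ → c ξ * corr (Y ξ) (z′ ℤ.- off ξ ℤ.- z))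

        ker-lr : ∀ z → z ∈ P → ∀ z′ → z′ ∈ P → ker fl fr (over balanced) z z′ ≡ Ψ z z′ - 1ℚ
        ker-lr z z∈ z′ z′∈ = trans (ker-over fl fr balanced z z′) (trans (∑-cong∈ Ξ (λ ξ ξ∈ → centred ξ z (z′ ℤ.- off ξ) (P-Span z∈) (P-off-Span z′∈ ξ ξ∈))) (minus-one _))

        corr-0 : ∀ ξ → corr (Y ξ) ℤ.0ℤ ≤ # (Y ξ)
        corr-0 ξ = ∑-mono (Y ξ) (λ s → ≤-trans (≤-reflexive (∑-cong (Y ξ) (λ s′ → cong δ (ℤ.+-identityˡ (s ℤ.- s′))))) (multiplicity≤1 ξ s))

        -- A nonempty column at ξ + h excludes the difference h ≠ 0 from the column at ξ.
        corr-vanishes : ∀ ξ h → h ≢ ℤ.0ℤ → 0ℚ < # (Y (ξ ℤ.+ h)) → corr (Y ξ) h ≡ 0ℚ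
        corr-vanishes ξ h h≢0 col = trans (∑-cong∈ (Y ξ) (λ s s∈ → trans (∑-cong∈ (Y ξ) (λ s′ s′∈ → δ-nonzero (λ e → clash s s∈ s′ s′∈ e (#-pos-∃ (Y (ξ ℤ.+ h)) col)))) (∑-0 (Y ξ)))) (∑-0 (Y ξ))
          where
          eq : ∀ h s s′ → s ℤ.+ h ≡ h ℤ.+ (s ℤ.- s′) ℤ.+ s′
          eq = ℤ.solve-∀
          clash : ∀ s → s ∈ Y ξ → ∀ s′ → s′ ∈ Y ξ → h ℤ.+ (s ℤ.- s′) ≡ ℤ.0ℤ → ∃ (_∈ Y (ξ ℤ.+ h)) → ⊥
          clash s s∈ s′ s′∈ e (y′ , y′∈) = free ξ s y′ h h≢0 (proj₂ (∈-Y {ξ} s∈)) (subst (λ t → T (A ξ t)) (sym (trans (eq h s s′) (trans (cong (ℤ._+ s′) e) (ℤ.+-identityˡ s′)))) (proj₂ (∈-Y {ξ} s′∈))) (proj₂ (∈-Y {ξ ℤ.+ h} y′∈))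

        -- If the column over `x₀ + z′ - z` is nonempty, columns at other abscissas contribute
        -- nothing. There remain the `ξ` of zero shift, at most one for each `ζ`.
        Ψ-small : ∀ z z′ → 0ℚ < # (Y (x₀ ℤ.+ (z′ ℤ.- z))) → Ψ z z′ ≤ nU * iS * # P
        Ψ-small z z′ col = ≤-trans (∑-mono Ξ per-ξ) (≤-trans (≤-reflexive (∑-*ˡ Ξ (nU * iS) _)) (*-monoˡ (0≤* (<⇒≤ 0<nU) 0≤iS) count))
          where
          h : ℤ → ℤ
          h ξ = z′ ℤ.- off ξ ℤ.- z
          place : ∀ ξ x z z′ → x ℤ.+ (z′ ℤ.- z) ≡ ξ ℤ.+ (z′ ℤ.- (ξ ℤ.- x) ℤ.- z)
          place = ℤ.solve-∀
          per-ξ : ∀ ξ → c ξ * corr (Y ξ) (h ξ) ≤ nU * iS * δ (h ξ)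
          per-ξ ξ = go (h ξ ℤ.≟ ℤ.0ℤ)
            where
            go : Dec (h ξ ≡ ℤ.0ℤ) → c ξ * corr (Y ξ) (h ξ) ≤ nU * iS * δ (h ξ)
            go (yes e) = ≤-trans (*-monoˡ (0≤c ξ) (≤-trans (≤-reflexive (cong (corr (Y ξ)) e)) (corr-0 ξ))) (≤-trans (c*#≤ ξ) (≤-reflexive (sym (trans (cong (nU * iS *_) (δ-zero e)) (*-identityʳ (nU * iS))))))
            go (no ne) = ≤-reflexive (trans (cong (c ξ *_) (corr-vanishes ξ (h ξ) ne (subst (λ x → 0ℚ < # (Y x)) (place ξ x₀ z z′) col))) (trans (*-zeroʳ (c ξ)) (sym (trans (cong (nU * iS *_) (δ-nonzero ne)) (*-zeroʳ (nU * iS))))))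
          count : ∑ Ξ (λ ξ → δ (h ξ)) ≤ # P
          count = ≤-trans (≤-reflexive (∑-Ξ (λ ξ → δ (h ξ)))) (∑-mono P (λ ζ → ≤-trans (≤-reflexive (∑-cong P (λ ζ′ → trans (cong δ (eq z z′ x₀ ζ ζ′)) (δ-sym (z′ ℤ.+ ζ ℤ.- z) ζ′)))) (count≤1 ℤ.0ℤ proper₁ (z′ ℤ.+ ζ ℤ.- z))))
            where
            eq : ∀ z z′ x ζ ζ′ → z′ ℤ.- (x ℤ.+ (ζ′ ℤ.- ζ) ℤ.- x) ℤ.- z ≡ z′ ℤ.+ ζ ℤ.- z ℤ.- ζ′
            eq = ℤ.solve-∀

        boxL≤U : # boxL ≤ nU
        boxL≤U = ∑-box-shift {gs} L B {ℤ.0ℤ} (Span-mono {gs} {0} ℕ.z≤n (zero-span gs)) (λ _ → 1ℚ) (λ _ → 0≤1)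
          where
          zero-span : ∀ gs → Span gs 0 ℤ.0ℤ
          zero-span [] = [] , [] , refl
          zero-span (g ∷ gs) with zero-span gs
          ... | cs , fit , e = ℤ.0ℤ ∷ cs , ℕ.z≤n ∷ fit , trans e (sym (trans (cong (ℤ._+ dot gs cs) (ℤ.*-zeroˡ g)) (ℤ.+-identityˡ (dot gs cs))))

        #Y≤U : ∀ x → # (Y x) ≤ nU
        #Y≤U x = ≤-trans (∑-filter-≤ (A x) boxL (λ _ → 0≤1)) boxL≤U

        power-away : ∀ x n → x ≤ 1/8 → 49/64 ^ n ≤ (x - 1ℚ) ^ (n ℕ.* 2)
        power-away x n h = ≤-trans (^-mono n (≤! {0ℚ} {49/64}) (≤-by _ (0≤+ (0≤* (0≤- h) (0≤- h)) (0≤* (≤! {0ℚ} {+ 7 / 4}) (0≤- h))) (trans (cong ((x - 1ℚ) *_) (*-identityʳ (x - 1ℚ))) (eq x)))) (≤-reflexive (sym (^-* (x - 1ℚ) n 2)))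
          where
          eq : ∀ x → (x - 1ℚ) * (x - 1ℚ) ≡ 49/64 + ((1/8 - x) * (1/8 - x) + + 7 / 4 * (1/8 - x))
          eq = solve-∀ ℚ-ring

        0≤even : ∀ x n → 0ℚ ≤ x ^ (n ℕ.* 2)
        0≤even x n = ≤-trans (0≤^ n (0≤sq x)) (≤-reflexive (trans (cong (_^ n) (cong (x *_) (sym (*-identityʳ x)))) (sym (^-* x n 2))))

        module _ (θ : ℚ) (0<θ : 0ℚ < θ) (dense : θ * (# P * # P) ≤ Stot * iU) (big : + 8 / 1 ≤ θ * # P) (0<P : 0ℚ < # P) where

          -- By density `Stot ≥ θ |P|² nU`, so the left side is at most `1 / (θ |P|)`.
          Ψ≤1/8 : nU * iS * # P ≤ 1/8
          Ψ≤1/8 = *-cancelˡ 0<Stot (≤-trans (≤-reflexive (trans (eq Stot nU iS (# P)) (trans (cong (_* (nU * # P)) Stot*iS) (*-identityˡ (nU * # P)))))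
            (≤-by (1/8 * (nU * (# P * (θ * # P - + 8 / 1))) + 1/8 * (nU * (Stot * iU - θ * (# P * # P)))) (0≤+ (0≤* (≤! {0ℚ} {1/8}) (0≤* (<⇒≤ 0<nU) (0≤* (<⇒≤ 0<P) (0≤- big)))) (0≤* (≤! {0ℚ} {1/8}) (0≤* (<⇒≤ 0<nU) (0≤- dense))))
              (trans (trans (cong (_* 1/8) (sym (trans (cong (Stot *_) nU*iU) (*-identityʳ Stot)))) (eq₁ Stot nU iU θ (# P))) refl)))
            where
            eq : ∀ s n i p → s * (n * i * p) ≡ s * i * (n * p)
            eq = solve-∀ ℚ-ring
            eq₁ : ∀ s n i t p → s * (n * i) * 1/8 ≡ n * p + (1/8 * (n * (p * (t * p - + 8 / 1))) + 1/8 * (n * (s * i - t * (p * p))))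
            eq₁ = solve-∀ ℚ-ring

          -- Densities of columns are at most `1`, so their sum bounds from below the number of
          -- pairs with a nonempty column; at such a pair `Ψ ≤ 1/8`, hence `(Ψ - 1)² ≥ 49/64`.
          mixed-moment : ∀ n → θ * 49/64 ^ n * (# P * # P) ≤ moment P fl fr (over balanced) (n ℕ.* 2)
          mixed-moment n = ≤-trans (≤-trans (≤-by _ (0≤* (0≤^ n (≤! {0ℚ} {49/64})) (0≤- dense)) (eq θ (49/64 ^ n) (# P * # P) (Stot * iU))) (≤-reflexive count))
            (∑-mono∈ P (λ z z∈ → ∑-mono∈ P (λ z′ z′∈ → ≤-trans (pointwise z z′ (0ℚ <? # (Y (x₀ ℤ.+ (z′ ℤ.- z))))) (≤-reflexive (cong (_^ (n ℕ.* 2)) (sym (ker-lr z z∈ z′ z′∈)))))))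
            where
            eq : ∀ t a p s → a * s ≡ t * a * p + a * (s - t * p)
            eq = solve-∀ ℚ-ring
            count : 49/64 ^ n * (Stot * iU) ≡ ∑∑ P (λ z z′ → 49/64 ^ n * (# (Y (x₀ ℤ.+ (z′ ℤ.- z))) * iU))
            count = sym (trans (∑∑-*ˡ P (49/64 ^ n) _) (cong (49/64 ^ n *_) (trans (sym (∑-Ξ (λ ξ → # (Y ξ) * iU))) (∑-*ʳ Ξ iU _))))
            pointwise : ∀ z z′ → Dec (0ℚ < # (Y (x₀ ℤ.+ (z′ ℤ.- z)))) → 49/64 ^ n * (# (Y (x₀ ℤ.+ (z′ ℤ.- z))) * iU) ≤ (Ψ z z′ - 1ℚ) ^ (n ℕ.* 2)
            pointwise z z′ (yes col) = ≤-trans (≤-trans (*-monoˡ (0≤^ n (≤! {0ℚ} {49/64})) (≤-trans (*-monoʳ 0≤iU (#Y≤U (x₀ ℤ.+ (z′ ℤ.- z)))) (≤-reflexive nU*iU))) (≤-reflexive (*-identityʳ (49/64 ^ n)))) (power-away (Ψ z z′) n (≤-trans (Ψ-small z z′ col) Ψ≤1/8))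
            pointwise z z′ (no ¬col) = ≤-trans (≤-reflexive (trans (cong (λ y → 49/64 ^ n * (y * iU)) (ℚ.≤-antisym (≮⇒≥ ¬col) (0≤# (Y (x₀ ℤ.+ (z′ ℤ.- z)))))) (trans (cong (49/64 ^ n *_) (*-zeroˡ iU)) (*-zeroʳ (49/64 ^ n))))) (0≤even (Ψ z z′ - 1ℚ) n)

          even-moment : ∀ n → θ * 49/64 ^ n * (# P * # P) ≤ ∑∑ P (λ z z′ → (K z z′ - 1ℚ) ^ (n ℕ.* 2))
          even-moment n = ≤-trans (mixed-moment n) (half (≤-trans (moment-cs P (over balanced) (over-∈ {λ e → 0ℚ ≤ wt e} balanced (λ ξ u → 0≤c ξ)) (n ℕ.* 2)) (≤-reflexive (cong₂ _+_ (same fl ker-ll) (same fr ker-rr)))))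
            where
            same : ∀ p → (∀ z → z ∈ P → ∀ z′ → z′ ∈ P → ker p p (over balanced) z z′ ≡ Φ (z′ ℤ.- z) - 1ℚ) → moment P p p (over balanced) (n ℕ.* 2) ≡ ∑∑ P (λ z z′ → (K z z′ - 1ℚ) ^ (n ℕ.* 2))
            same p h = ∑-cong∈ P (λ z z∈ → ∑-cong∈ P (λ z′ z′∈ → cong (_^ (n ℕ.* 2)) (trans (h z z∈ z′ z′∈) (cong (_- 1ℚ) (sym (K≡Φ z z∈ z′))))))
            half : ∀ {a b} → a + a ≤ b + b → a ≤ b
            half {a} {b} h = ≤-by (½ * (b + b - (a + a))) (0≤* 0≤½ (0≤- h)) (e a b)
              where
              e : ∀ a b → b ≡ a + ½ * (b + b - (a + a))
              e = solve-∀ ℚ-ring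

          odd-moment : ∀ n → 0ℚ ≤ ∑∑ P (λ z z′ → (K z z′ - 1ℚ) ^ n)
          odd-moment n = ≤-trans (moment-psd P (over balanced) (over-∈ {λ e → 0ℚ ≤ wt e} balanced (λ ξ u → 0≤c ξ)) n)
            (≤-reflexive (∑-cong∈ P (λ z z∈ → ∑-cong∈ P (λ z′ z′∈ → cong (_^ n) (trans (ker-ll z z∈ z′ z′∈) (cong (_- 1ℚ) (sym (K≡Φ z z∈ z′))))))))

          Ξ≤ : ∑ Ξ (λ ξ → c ξ * # (Y ξ)) ≤ inv θ
          Ξ≤ = *-cancelˡ 0<θ (≤-trans (*-monoˡ (<⇒≤ 0<θ) (≤-trans (∑-mono Ξ c*#≤) (≤-reflexive (trans (∑-const Ξ (nU * iS)) (cong (_* (nU * iS)) (trans (∑-Ξ (λ _ → 1ℚ)) (trans (∑∑-const P 1ℚ) (*-identityʳ (# P * # P)))))))))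
            (≤-trans (≤-reflexive (eq θ (# P * # P) (nU * iS))) (≤-trans (*-monoʳ (0≤* (<⇒≤ 0<nU) 0≤iS) dense) (≤-reflexive (trans (eq₂ Stot iU nU iS) (trans (cong₂ _*_ Stot*iS nU*iU) (trans (*-identityˡ 1ℚ) (sym (inv-pos 0<θ)))))))))
            where
            eq : ∀ t p x → t * (p * x) ≡ t * p * x
            eq = solve-∀ ℚ-ring
            eq₂ : ∀ s i n j → s * i * (n * j) ≡ s * j * (n * i)
            eq₂ = solve-∀ ℚ-ring

          -- The total weight of entries at a point is at most `inv θ`. Sifting loses the `r`-th
          -- power of this in density, so `δ′` can be as large as `θ ^ r / 4`.
          concentrate : ∀ q c′ δ′ → 1ℚ ≤ c′ → 0ℚ ≤ δ′ → 2ℚ * 2ℚ * (δ′ * inv θ ^ suc (suc q ℕ.* 16)) ≤ 1ℚ →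
            2ℚ * 2ℚ * (c′ * 17/16 ^ suc (suc q ℕ.* 16)) ≤ 16ℚ ^ suc q * (θ * 49/64 ^ suc q - 1/4 ^ suc q) →
            ∃ λ (b : ℤ → Bool) → let A₁ = filterᵇ b P in
              0ℚ < # A₁ × δ′ * # P ≤ # A₁ × c′ * ∑∑ A₁ (λ z z′ → 𝟙 (not (17/16 ≤ᵇ Φ (z′ ℤ.- z)))) ≤ # A₁ * # A₁
          concentrate q c′ δ′ 1≤c′ 0≤δ′ hδ hpar = translate (sifting P (over plain) r (λ z z′ → not (17/16 ≤ᵇ K z z′)) c′ δ′ (inv θ) (over-∈ {Indicator} plain ind) (≤-trans 0≤1 1≤c′) 0≤δ′ mass (0≤inv (<⇒≤ 0<θ)) 0<P hδ (proj₁ unb) (proj₂ unb))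
            where
            r = suc (suc q ℕ.* 16)
            0≤K : ∀ z z′ → 0ℚ ≤ K z z′
            0≤K z z′ = ≤-trans (0≤∑ Ξ (λ ξ → 0≤∑ U (λ u → 0≤* (0≤c ξ) (0≤* (0≤m ξ (u ℤ.+ z)) (0≤m ξ (u ℤ.+ z′)))))) (≤-reflexive (sym (ker-over fl fl plain z z′)))
              where
              0≤m : ∀ ξ t → 0ℚ ≤ m ξ t
              0≤m ξ t = 0≤∑ (Y ξ) (λ s → 0≤δ (t ℤ.- s))
            unb = unbalance P K q c′ (θ * 49/64 ^ suc q) 0≤K 1≤c′ (even-moment (suc q)) (odd-moment (suc (suc q ℕ.* 2))) hpar
            ind : ∀ ξ u → Indicator (plain ξ u)
            ind ξ u = 0≤c ξ , (λ z → mem (Y ξ) (u ℤ.+ z)) , λ z → sym (mem-multiplicity (Y ξ) (u ℤ.+ z) (multiplicity≤1 ξ (u ℤ.+ z)))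
            mass : ∀ z → ∑ (over plain) (λ e → wt e * fl e z) ≤ inv θ
            mass z = ≤-trans (≤-reflexive (trans (∑-concatMap _ Ξ _) (∑-cong Ξ (λ ξ → trans (∑-map (plain ξ) U _) (∑-*ˡ U (c ξ) _))))) (≤-trans (∑-mono Ξ (λ ξ → *-monoˡ (0≤c ξ) (hit ξ))) Ξ≤)
              where
              eq : ∀ u z s → u ℤ.+ z ℤ.- s ≡ u ℤ.- (s ℤ.- z)
              eq = ℤ.solve-∀
              hit : ∀ ξ → ∑ U (λ u → m ξ (u ℤ.+ z)) ≤ # (Y ξ)
              hit ξ = ≤-trans (≤-reflexive (∑-swap U (Y ξ) _)) (∑-mono (Y ξ) (λ s → ≤-trans (≤-reflexive (∑-cong U (λ u → cong δ (eq u z s)))) (count≤1 {gs} (ℤ.- (+ B)) proper (s ℤ.- z))))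
            translate : (∃ λ (b : ℤ → Bool) → let A₁ = filterᵇ b P in
              0ℚ < # A₁ × δ′ * # P ≤ # A₁ × c′ * ∑ A₁ (λ z → ∑ A₁ (λ z′ → 𝟙 (not (17/16 ≤ᵇ K z z′)))) ≤ # A₁ * # A₁) → _
            translate (b , pos , large , rare) = b , pos , large , ≤-trans (≤-reflexive (cong (c′ *_) (∑-cong∈ (filterᵇ b P) (λ z z∈ → ∑-cong (filterᵇ b P) (λ z′ → cong (λ k → 𝟙 (not (17/16 ≤ᵇ k))) (sym (K≡Φ z (proj₁ (∈-filter⁻ _ {xs = P} z∈)) z′))))))) rare

-- Correlations that persist along a walk

module SmoothCorrelations where

  open Rationals
  open Sums
  open Unbalancing using (∑∑; ∑∑-mono; ∑∑-cong; ∑∑-*ˡ; ∑∑-const; 17/16; 16ℚ)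
  open Tuples using (tuples; #-tuples; length-tuples)
  open AlmostPeriods
  open Characters
  open Transfer
  open Boxes
  open NearRelations
  open Extensions

  total : List ℤ → ℕ
  total [] = 0
  total (x ∷ xs) = ℤ.∣ x ∣ ℕ.+ total xs

  ∈-total : ∀ {xs x} → x ∈ xs → ℤ.∣ x ∣ ℕ.≤ total xs
  ∈-total {x ∷ xs} (here refl) = ℕ.m≤m+n _ _
  ∈-total {y ∷ xs} (there m) = ℕ.≤-trans (∈-total m) (ℕ.m≤n+m _ ℤ.∣ y ∣)

  Span-bound : ∀ {gs B x} → Span gs B x → ℤ.∣ x ∣ ℕ.≤ B ℕ.* total gs
  Span-bound {B = B} (_ , [] , refl) = ℕ.z≤n
  Span-bound {g ∷ gs} {B} (c ∷ cs , p ∷ ps , refl) = ℕ.≤-trans (ℤ.∣i+j∣≤∣i∣+∣j∣ (c ℤ.* g) (dot gs cs))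
    (ℕ.≤-trans (ℕ.+-mono-≤ (ℕ.≤-trans (ℕ.≤-reflexive (ℤ.∣i*j∣≡∣i∣*∣j∣ c g)) (ℕ.*-monoˡ-≤ ℤ.∣ g ∣ p)) (Span-bound {gs} {B} (cs , ps , refl))) (ℕ.≤-reflexive (sym (ℕ.*-distribˡ-+ B ℤ.∣ g ∣ (total gs)))))

  Span-0 : ∀ gs → Span gs 0 ℤ.0ℤ
  Span-0 gs = zeros gs , zeros-fit gs , sym (zeros-dot gs)

  Reach-Span : ∀ {gs L j v} → Reach (box gs ℤ.0ℤ L) j v → Span gs (j ℕ.* (L ℕ.+ L)) v
  Reach-Span {gs} reach-0 = Span-0 gs
  Reach-Span {gs} {L} (reach-+ {j} {v} {t} {t′} r t∈ t′∈) = subst (λ B → Span gs B (v ℤ.+ (t ℤ.- t′))) (ℕ.+-comm (j ℕ.* (L ℕ.+ L)) (L ℕ.+ L))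
    (Span-+ {gs} {j ℕ.* (L ℕ.+ L)} {L ℕ.+ L} (Reach-Span r) (Span-- {gs} {L} {L} (∈-box-Span {gs} {L} t∈) (∈-box-Span {gs} {L} t′∈)))

  1/64 1/128 1/1024 65/64 527/512 : ℚ
  1/64 = + 1 / 64
  1/128 = + 1 / 128
  1/1024 = + 1 / 1024
  65/64 = + 65 / 64
  527/512 = + 527 / 512

  -- `L₁`, `L₂` and `L′` are the sides for the sifted set, for the almost periods and for the next
  -- progression. `H` bounds the coefficients, in the old generators, of differences within the next
  -- progression.
  module Smooth (Ξ : List ℤ) (c : ℤ → ℚ) (0≤c : ∀ ξ → 0ℚ ≤ c ξ) (Y : ℤ → List ℤ) (gs : List ℤ) (L₁ L₂ L′ ℓ m b M K Kc R s n : ℕ) (ε δ′ : ℚ) where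

    Φ : ℤ → ℚ
    Φ v = ∑ Ξ (λ ξ → c ξ * corr (Y ξ) v)

    S : ℤ → Bool
    S v = 17/16 ≤ᵇ Φ v

    H : ℕ
    H = n ℕ.* (L′ ℕ.* R)

    P P₂ Pm Pp : List ℤ
    P = box gs ℤ.0ℤ L₁
    P₂ = box gs ℤ.0ℤ L₂
    Pm = ext gs L₂ L₁
    Pp = ext gs (ℓ ℕ.* (L₂ ℕ.+ L₂)) L₁

    P₂⁺ : ℕ → List ℤ
    P₂⁺ r = ext gs (r ℕ.* H) L₂

    0≤Φ : ∀ v → 0ℚ ≤ Φ v
    0≤Φ v = 0≤∑ Ξ (λ ξ → 0≤* (0≤c ξ) (0≤∑ (Y ξ) (λ s → 0≤∑ (Y ξ) (λ s′ → 0≤δ (v ℤ.+ (s ℤ.- s′))))))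

    P₂⁺-shift : ∀ r {w} → Span gs H w → ∀ (F : ℤ → ℚ) → (∀ x → 0ℚ ≤ F x) → ∑ (P₂⁺ r) (λ x → F (x ℤ.+ w)) ≤ ∑ (P₂⁺ (suc r)) F
    P₂⁺-shift r {w} sp F 0≤F = subst (λ B → ∑ (P₂⁺ r) (λ x → F (x ℤ.+ w)) ≤ ∑ (ext gs B L₂) F) (ℕ.+-comm (r ℕ.* H) H) (∑-ext-shift {gs} (r ℕ.* H) L₂ H sp F 0≤F)

    P₂⁺-mono : ∀ r (F : ℤ → ℚ) → (∀ x → 0ℚ ≤ F x) → ∑ (P₂⁺ r) F ≤ ∑ (P₂⁺ (suc r)) F
    P₂⁺-mono r F 0≤F = ≤-trans (≤-reflexive (∑-cong (P₂⁺ r) (λ x → cong F (sym (ℤ.+-identityʳ x))))) (P₂⁺-shift r (Span-mono {gs} {0} {H} ℕ.z≤n (Span-0 gs)) F 0≤F)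

    module Periods (bA : ℤ → Bool) (0<A : 0ℚ < # (filterᵇ bA P)) (0<ε : 0ℚ < ε) (0<δ′ : 0ℚ < δ′)
      (hm : 16ℚ * ι m ≤ (ε * ι m) * (ε * ι m)) (0<m : 0ℚ < ι m) (0<Pp : 0ℚ < # Pp)
      (largeA : δ′ * # P ≤ # (filterᵇ bA P)) (Pm≤ : # Pm ≤ 2ℚ * # P) (Pp≤ : # Pp ≤ 2ℚ * # P)
      (rare : + 64 / 1 * ∑∑ (filterᵇ bA P) (λ z z′ → 𝟙 (not (S (z′ ℤ.- z)))) ≤ # (filterᵇ bA P) * # (filterᵇ bA P))
      (h₁ : ι ℓ * (2ℚ * ε) ≤ 1/128) (h₂ : ι ℓ * (+ 8 / 1 * inv (2ℚ ^ b)) ≤ 1/128 * δ′) where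

      A : List ℤ
      A = filterᵇ bA P

      A⊂P : ∀ (F : ℤ → ℚ) → (∀ x → 0ℚ ≤ F x) → ∑ A F ≤ ∑ P F
      A⊂P F 0≤F = ∑-filter-≤ bA P 0≤F

      A⊂Pm : ∀ t → t ∈ P₂ → ∀ (F : ℤ → ℚ) → (∀ x → 0ℚ ≤ F x) → ∑ A F ≤ ∑ Pm (λ y → F (y ℤ.+ t))
      A⊂Pm t t∈ F 0≤F = ≤-trans (A⊂P F 0≤F) (≤-trans (≤-reflexive (∑-cong P (λ x → cong F (eq x t))))
        (∑-box-shift {gs} L₁ L₂ (Span-neg {gs} {L₂} (∈-box-Span {gs} {L₂} t∈)) (λ y → F (y ℤ.+ t)) (λ y → 0≤F (y ℤ.+ t))))
        where
        eq : ∀ x t → x ≡ x ℤ.+ (ℤ.- t) ℤ.+ t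
        eq = ℤ.solve-∀

      A⊂Pp : ∀ j v → j ℕ.≤ ℓ → Reach P₂ j v → ∀ (F : ℤ → ℚ) → (∀ x → 0ℚ ≤ F x) → ∑ A (λ y → F (y ℤ.+ v)) ≤ ∑ Pp F
      A⊂Pp j v j≤ r F 0≤F = ≤-trans (A⊂P (λ y → F (y ℤ.+ v)) (λ y → 0≤F (y ℤ.+ v)))
        (∑-box-shift {gs} L₁ (ℓ ℕ.* (L₂ ℕ.+ L₂)) (Span-mono {gs} (ℕ.*-monoˡ-≤ (L₂ ℕ.+ L₂) j≤) (Reach-Span {gs} {L₂} r)) F 0≤F)

      module Sa = Sampling A Pm Pp P₂ S ε m b 0<A 0<ε hm 0<m 0<Pp A⊂Pm

      N : ℚ
      N = # A

      hits : ∀ v → N * ∑ A (λ y → Sa.f (y ℤ.+ v)) ≡ ∑∑ A (λ z z′ → 𝟙 (S (v ℤ.+ (z ℤ.- z′))))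
      hits v = trans (sym (∑-*ˡ A N _)) (∑-cong A (λ y → trans (Sa.N*f (y ℤ.+ v)) (∑-cong A (λ z → cong (λ x → 𝟙 (S x)) (eq y v z)))))
        where
        eq : ∀ y v z → y ℤ.+ v ℤ.- z ≡ v ℤ.+ (y ℤ.- z)
        eq = ℤ.solve-∀

      initial : (1ℚ - 1/64) * (N * N) ≤ N * ∑ A Sa.f
      initial = ≤-trans (≤-by (1/64 * (N * N - + 64 / 1 * X)) (0≤* (≤! {0ℚ} {1/64}) (0≤- rare)) (eq (N * N) X)) (≤-reflexive (sym (trans (sym (∑-*ˡ A N _)) (trans (∑-cong A Sa.N*f) (trans (∑-swap A A _) count)))))
        where
        X = ∑∑ A (λ z z′ → 𝟙 (not (S (z′ ℤ.- z))))
        eq : ∀ n x → n - x ≡ (1ℚ - 1/64) * n + 1/64 * (n - + 64 / 1 * x)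
        eq = solve-∀ ℚ-ring
        flip : ∀ c → 𝟙 c ≡ 1ℚ - 𝟙 (not c)
        flip true = refl
        flip false = refl
        count : ∑∑ A (λ z z′ → 𝟙 (S (z′ ℤ.- z))) ≡ N * N - X
        count = trans (∑∑-cong A (λ z z′ → flip (S (z′ ℤ.- z)))) (trans (∑-cong A (λ z → ∑-- A _ _)) (trans (∑-- A _ _) (cong (_- X) (trans (∑∑-const A 1ℚ) (*-identityʳ (N * N))))))

      module _ (τ : List (List ℤ)) (τ-len : length τ ≡ b) (τ-blocks : ∀ β → β ∈ τ → length β ≡ m) where

        T′ : List ℤ
        T′ = Sa.periods τ

        loss≤ : ι ℓ * Sa.loss τ τ-len τ-blocks ℓ A⊂Pp ≤ 1/64 * N
        loss≤ = ≤-by _ (0≤+ (0≤+ (0≤* (0≤# A) (0≤- h₁)) (0≤* (0≤* (0≤ι ℓ) (0≤* (≤! {0ℚ} {4ℚ}) 0≤i)) (0≤- Pp≤))) (0≤+ (0≤* (0≤# P) (0≤- h₂)) (0≤* (≤! {0ℚ} {1/128}) (0≤- largeA))))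
          (eq (ι ℓ) ε N (# Pp) (inv (2ℚ ^ b)) (# P) δ′)
          where
          0≤i : 0ℚ ≤ inv (2ℚ ^ b)
          0≤i = 0≤inv (0≤^ b 0≤2)
          eq : ∀ l e n pp i p d → 1/64 * n ≡ l * (2ℚ * e * n + 4ℚ * pp * i) + (n * (1/128 - l * (2ℚ * e)) + l * (4ℚ * i) * (2ℚ * p - pp) + (p * (1/128 * d - l * (+ 8 / 1 * i)) + 1/128 * (n - d * p)))
          eq = solve-∀ ℚ-ring

        -- `527/512 = 17/16 * (1 - 1/64 - 1/64)`: one loss for the pairs of `A` outside `S`, one for
        -- the walk.
        correlated : ∀ v → Reach T′ ℓ v → 527/512 * (N * N) ≤ ∑∑ A (λ z z′ → Φ (v ℤ.+ (z ℤ.- z′)))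
        correlated v r = ≤-trans (≤-trans (≤-by _ (0≤* (≤! {0ℚ} {17/16}) (0≤+ (0≤+ (0≤- initial) (0≤* (0≤# A) (0≤- period))) (0≤* (0≤# A) (0≤- loss≤)))) (eq N (∑ A Sa.f) (∑ A (λ y → Sa.f (y ℤ.+ v))) (ι ℓ * Sa.loss τ τ-len τ-blocks ℓ A⊂Pp)))
            (≤-reflexive (trans (cong (17/16 *_) (hits v)) (sym (∑∑-*ˡ A 17/16 _)))))
          (∑∑-mono A (λ z z′ → ≤ᵇ-elim (λ q → 17/16 * 𝟙 q ≤ Φ (v ℤ.+ (z ℤ.- z′))) 17/16 (Φ (v ℤ.+ (z ℤ.- z′))) (λ h → ≤-trans (≤-reflexive (*-identityʳ 17/16)) h) (λ _ → ≤-trans (≤-reflexive (*-zeroʳ 17/16)) (0≤Φ (v ℤ.+ (z ℤ.- z′))))))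
          where
          period : ∑ A Sa.f ≤ ∑ A (λ y → Sa.f (y ℤ.+ v)) + ι ℓ * Sa.loss τ τ-len τ-blocks ℓ A⊂Pp
          period = Sa.almost-period τ τ-len τ-blocks ℓ A⊂Pp ℓ v ℕ.≤-refl r
          eq : ∀ n f g l → 17/16 * (n * g) ≡ 527/512 * (n * n) + 17/16 * (n * f - (1ℚ - 1/64) * (n * n) + n * (g + l - f) + n * (1/64 * n - l))
          eq = solve-∀ ℚ-ring

      -- A factor `½` for good samples, `½` for the enlargement of `P₂`, and `½ * δ′` for each of
      -- the `m * b` sampled points, as `A` has at least this share of `Pm`.
      density : ℚ
      density = ½ * ½ * ((½ * δ′) ^ m) ^ b

      periods-exist : 0ℚ < # Pm → # (P₂⁺ (M ℕ.* K)) ≤ 2ℚ * # P₂ → ∃ λ τ → Σ (length τ ≡ b) λ _ → Σ (∀ β → β ∈ τ → length β ≡ m) λ _ → density * # (P₂⁺ (M ℕ.* K)) ≤ # (Sa.periods τ)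
      periods-exist 0<Pm P₂≤ = use (Sa.many-periods 0<bases)
        where
        nb : ℚ
        nb = # Sa.bases
        nb≡ : nb ≡ (# Pm ^ m) ^ b
        nb≡ = trans (#-tuples (tuples Pm m) b) (cong (_^ b) (#-tuples Pm m))
        0<bases : 0ℚ < nb
        0<bases = subst (0ℚ <_) (sym nb≡) (0<^ b (0<^ m 0<Pm))
        D = ((½ * δ′) ^ m) ^ b
        0≤D : 0ℚ ≤ D
        0≤D = 0≤^ b (0≤^ m (0≤* 0≤½ (<⇒≤ 0<δ′)))
        G≥ : D * nb ≤ # Sa.G
        G≥ = ≤-trans (≤-reflexive (trans (cong (D *_) nb≡) (trans (sym (^-distrib-* _ _ b)) (cong (_^ b) (sym (^-distrib-* (½ * δ′) (# Pm) m))))))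
          (≤-trans (^-mono b (0≤^ m (0≤* (0≤* 0≤½ (<⇒≤ 0<δ′)) (0≤# Pm))) (^-mono m (0≤* (0≤* 0≤½ (<⇒≤ 0<δ′)) (0≤# Pm)) (≤-trans (≤-by (½ * (δ′ * (2ℚ * # P - # Pm))) (0≤* 0≤½ (0≤* (<⇒≤ 0<δ′) (0≤- Pm≤))) (eq δ′ (# P) (# Pm))) largeA)))
            (≤-reflexive (sym (trans (#-tuples Sa.samples b) (cong (_^ b) (#-tuples A m))))))
          where
          eq : ∀ d p q → d * p ≡ ½ * d * q + ½ * (d * (2ℚ * p - q))
          eq = solve-∀ ℚ-ring
        tuple-blocks : ∀ b′ τ → τ ∈ tuples (tuples Pm m) b′ → ∀ β → β ∈ τ → β ∈ tuples Pm m
        tuple-blocks zero τ (here refl) β ()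
        tuple-blocks (suc b′) τ τ∈ β β∈ with L.find (∈-concatMap⁻ (λ x → map (x ∷_) (tuples (tuples Pm m) b′)) {xs = tuples Pm m} τ∈)
          where
          import Data.List.Membership.Propositional as L
          open import Data.List.Membership.Propositional.Properties using (∈-concatMap⁻)
        ... | x , x∈ , m′ with ∈-map⁻ (x ∷_) m′
          where open import Data.List.Membership.Propositional.Properties using (∈-map⁻)
        tuple-blocks (suc b′) τ τ∈ β (here refl) | x , x∈ , m′ | u , u∈ , refl = x∈
        tuple-blocks (suc b′) τ τ∈ β (there β∈) | x , x∈ , m′ | u , u∈ , refl = tuple-blocks b′ u u∈ β β∈
        use : (∃ λ τ → τ ∈ Sa.bases × # P₂ * # Sa.G ≤ 2ℚ * nb * # (Sa.periods τ)) → _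
        use (τ , τ∈ , h) = τ , length-tuples (tuples Pm m) b τ τ∈ , (λ β β∈ → length-tuples Pm m β (tuple-blocks b τ τ∈ β β∈)) ,
          *-cancelˡ 0<bases (≤-by (½ * (2ℚ * nb * # (Sa.periods τ) - # P₂ * # Sa.G) + (½ * (# P₂ * (# Sa.G - D * nb)) + ½ * ½ * (D * nb * (2ℚ * # P₂ - # (P₂⁺ (M ℕ.* K))))))
            (0≤+ (0≤* 0≤½ (0≤- h)) (0≤+ (0≤* 0≤½ (0≤* (0≤# P₂) (0≤- G≥))) (0≤* {½ * ½} (≤! {0ℚ} {½ * ½}) (0≤* (0≤* 0≤D (<⇒≤ 0<bases)) (0≤- P₂≤)))))
            (eq nb (# (Sa.periods τ)) (# P₂) (# Sa.G) D (# (P₂⁺ (M ℕ.* K)))))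
          where
          eq : ∀ n t p g d q → n * t ≡ n * (½ * ½ * d * q) + (½ * (2ℚ * n * t - p * g) + (½ * (p * (g - d * n)) + ½ * ½ * (d * n * (2ℚ * p - q))))
          eq = solve-∀ ℚ-ring

-- A smaller progression that carries the correlation

module LargeSpectrum where

  open Rationals
  open Sums
  open Unbalancing using (∑∑; ∑∑-const)
  open AlmostPeriods using (Reach; reach-0; reach-+)
  open Characters
  open Transfer
  open RieszProducts using (Factor; Near; riesz; riesz-shift; 0≤riesz; 10/9; module Greedy) renaming (1/16 to 1/16′)
  open Boxes
  open NearRelations
  open Extensions
  open SmoothCorrelations using (total; ∈-total; Span-bound; Span-0; Reach-Span; 1/1024; 65/64; 527/512; module Smooth)

  -- `131/128` lies below `(1 - 1/1024) * (527/512 - 1/1024)`; after two further errors of `1/1024`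
  -- more than `65/64` is left.
  transfer-arith : ∀ {w x k f h g u} → 0ℚ ≤ w → 0ℚ ≤ k → k ≤ 1/1024 → 0ℚ ≤ h → f ≤ g → h * (g + 1ℚ) ≤ 1/1024 → u ≤ 1/1024 → u ≤ 1ℚ →
    (1ℚ - u) * (527/512 - k) * w ≤ x + k * w + h * w * (f + k) → 65/64 * w ≤ x
  transfer-arith {w} {x} {k} {f} {h} {g} {u} 0≤w 0≤k k≤ 0≤h f≤ h≤ u≤ u≤1 main =
    ≤-by _ (0≤+ (0≤- (≤-trans low (≤-trans main high))) (0≤* (0≤- closed) 0≤w)) (eq x w (65/64) 131/128 1/1024)
    where
    131/128 : ℚ
    131/128 = + 131 / 128
    closed : 65/64 ≤ 131/128 - 1/1024 - 1/1024
    closed = ≤!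
    k≤1 : k ≤ 1ℚ
    k≤1 = ≤-trans k≤ (≤! {1/1024} {1ℚ})
    eq : ∀ x w a b v → x ≡ a * w + (x + v * w + v * w - b * w + (b - v - v - a) * w)
    eq = solve-∀ ℚ-ring
    sub : ∀ {a b} c → a ≤ b → c - b ≤ c - a
    sub {a} {b} c h = ≤-by (b - a) (0≤- h) (e a b c)
      where
      e : ∀ a b c → c - a ≡ c - b + (b - a)
      e = solve-∀ ℚ-ring
    low : 131/128 * w ≤ (1ℚ - u) * (527/512 - k) * w
    low = *-monoʳ 0≤w (≤-trans (≤! {131/128} {(1ℚ - 1/1024) * (527/512 - 1/1024)}) (*-mono (≤! {0ℚ} {1ℚ - 1/1024}) (0≤- (≤-trans k≤ (≤! {1/1024} {527/512}))) (sub 1ℚ u≤) (sub 527/512 k≤)))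
    hfk : h * (f + k) ≤ 1/1024
    hfk = ≤-trans (*-monoˡ 0≤h (+-mono-≤ f≤ k≤1)) h≤
    high : x + k * w + h * w * (f + k) ≤ x + 1/1024 * w + 1/1024 * w
    high = +-mono-≤ (+-mono-≤ (≤-refl {x}) (*-monoʳ 0≤w k≤)) (≤-trans (≤-reflexive (e h w (f + k))) (*-monoʳ 0≤w hfk))
      where
      e : ∀ h w y → h * w * y ≡ h * y * w
      e = solve-∀ ℚ-ring

  module Finish (Ξ : List ℤ) (c : ℤ → ℚ) (0≤c : ∀ ξ → 0ℚ ≤ c ξ) (Y : ℤ → List ℤ) (gs : List ℤ) (L₁ L₂ L′ ℓ M K Kc R s n : ℕ)
    (A : List ℤ) (A-Span : ∀ z → z ∈ A → Span gs L₁ z) (0<A : 0ℚ < # A)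
    (T : List ℤ) (T∈ : ∀ t → t ∈ T → t ∈ box gs ℤ.0ℤ L₂) (T⊂ : ∀ (F : ℤ → ℚ) → (∀ x → 0ℚ ≤ F x) → ∑ T F ≤ ∑ (box gs ℤ.0ℤ L₂) F) (0<T : 0ℚ < # T)
    (τ η κΦ : ℚ) (0<τ : 0ℚ < τ) (τ≤1 : τ ≤ 1ℚ) (hK : 2ℚ ≤ (1ℚ + 1/1024) ^ K * τ) (hM : 2ℚ ≤ 10/9 ^ M * τ)
    (0≤η : 0ℚ ≤ η) (η≤1 : η ≤ 1ℚ) (hMη : ι M * η ≤ 1/1024) (0<Kc : 0ℚ < ι Kc) (hη : ι n * (ι L′ * (2ℚ * inv (ι Kc))) ≤ η)
    (crowded : (Cells.side Kc 0<Kc ℕ.* Cells.side Kc 0<Kc) ℕ.^ M ℕ.< R ℕ.^ s) (len : length gs ≡ s ℕ.+ n)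
    where

    open Smooth Ξ c 0≤c Y gs L₁ L₂ L′ ℓ 0 0 M K Kc R s n 0ℚ 0ℚ using (Φ; H; P₂⁺; P₂⁺-shift; P₂⁺-mono; 0≤Φ)

    T⊂₀ : ∀ (F : ℤ → ℚ) → (∀ x → 0ℚ ≤ F x) → ∑ T F ≤ ∑ (P₂⁺ 0) F
    T⊂₀ F 0≤F = ≤-trans (T⊂ F 0≤F) (≤-reflexive (cong (λ l → ∑ l F) (sym (ext-0 gs L₂))))

    Lifts : List ℤ → Set
    Lifts gs′ = ∀ B bs → Fit (Bounded B) gs′ bs → ∃ λ as → Fit (Bounded (n ℕ.* (B ℕ.* R))) gs as × dot gs as ≡ dot gs′ bs × (AllZero gs as → AllZero gs′ bs)

    module _ (correlated : ∀ v → Reach T ℓ v → 527/512 * (# A * # A) ≤ ∑∑ A (λ z z′ → Φ (v ℤ.+ (z ℤ.- z′))))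
      (dense : τ * # (P₂⁺ (M ℕ.* K)) ≤ # T) (hΦ : Φ ℤ.0ℤ ≤ κΦ) (hℓ : ½ ^ ℓ * (κΦ + 1ℚ) ≤ 1/1024) where

      -- The orthogonality error is chosen after the columns and small against their total mass `E`;
      -- only the size of `J` pays for that.
      E κ : ℚ
      E = ∑ Ξ (λ ξ → c ξ * (# (Y ξ) * # (Y ξ)))
      κ = 1/1024 * inv (E + 1ℚ)

      0≤E : 0ℚ ≤ E
      0≤E = 0≤∑ Ξ (λ ξ → 0≤* (0≤c ξ) (0≤* (0≤# (Y ξ)) (0≤# (Y ξ))))
      0<E+1 : 0ℚ < E + 1ℚ
      0<E+1 = ℚ.<-≤-trans (ℚ.positive⁻¹ 1ℚ) (≤-by E 0≤E (+-comm E 1ℚ))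
      0<κ : 0ℚ < κ
      0<κ = 0<* (ℚ.positive⁻¹ 1/1024) (0<inv 0<E+1)
      0≤κ*E : 0ℚ ≤ κ * E
      0≤κ*E = 0≤* (<⇒≤ 0<κ) 0≤E
      κ*E≤ : κ * E ≤ 1/1024
      κ*E≤ = ≤-trans (≤-by κ (<⇒≤ 0<κ) (eq κ E)) (≤-reflexive (trans (eq′ 1/1024 (inv (E + 1ℚ)) (E + 1ℚ)) (trans (cong (1/1024 *_) (inv-pos 0<E+1)) (*-identityʳ 1/1024))))
        where
        eq : ∀ k e → k * (e + 1ℚ) ≡ k * e + k
        eq = solve-∀ ℚ-ring
        eq′ : ∀ a i e → a * i * e ≡ a * (e * i)
        eq′ = solve-∀ ℚ-ring

      -- `V` bounds the coefficients of every shift that occurs and `MY` the points of the columns,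
      -- so `Nb` bounds the integers on which near orthogonality is wanted.
      V MY Nb : ℕ
      V = ℓ ℕ.* (L₂ ℕ.+ L₂) ℕ.+ (L₁ ℕ.+ L₁) ℕ.+ H
      MY = total (map (λ ξ → + total (Y ξ)) Ξ)
      Nb = V ℕ.* total gs ℕ.+ (MY ℕ.+ MY)

      Y-bound : ∀ ξ → ξ ∈ Ξ → ∀ y → y ∈ Y ξ → ℤ.∣ y ∣ ℕ.≤ MY
      Y-bound ξ ξ∈ y y∈ = ℕ.≤-trans (∈-total y∈) (∈-total (∈-map⁺ (λ ξ → + total (Y ξ)) ξ∈))
        where open import Data.List.Membership.Propositional.Properties using (∈-map⁺)

      orth = orthogonality κ 0<κ Nb
      J : ℕ
      J = proj₁ orth

      module Sp = Spectral Ξ c 0≤c Y κ (<⇒≤ 0<κ) Nb J (proj₁ (proj₂ orth)) (proj₂ (proj₂ orth))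

      within : ∀ {v} → Span gs V v → Sp.Within v
      within {v} sp ξ ξ∈ s s∈ s′ s′∈ = ℕ.≤-trans (ℤ.∣i+j∣≤∣i∣+∣j∣ v (s ℤ.- s′)) (ℕ.+-mono-≤ (Span-bound {gs} {V} sp)
        (ℕ.≤-trans (ℤ.∣i-j∣≤∣i∣+∣j∣ s s′) (ℕ.+-mono-≤ (Y-bound ξ ξ∈ s s∈) (Y-bound ξ ξ∈ s′ s′∈))))

      within-A : ∀ v → Reach T ℓ v → ∀ z → z ∈ A → ∀ z′ → z′ ∈ A → Sp.Within (v ℤ.+ (z ℤ.- z′))
      within-A v r z z∈ z′ z′∈ = within (Span-mono {gs} (ℕ.m≤m+n (ℓ ℕ.* (L₂ ℕ.+ L₂) ℕ.+ (L₁ ℕ.+ L₁)) H)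
        (Span-+ {gs} {ℓ ℕ.* (L₂ ℕ.+ L₂)} {L₁ ℕ.+ L₁} (Reach-Span {gs} {L₂} (widen r)) (Span-- {gs} {L₁} {L₁} (A-Span z z∈) (A-Span z′ z′∈))))
        where
        widen : ∀ {j v} → Reach T j v → Reach (box gs ℤ.0ℤ L₂) j v
        widen reach-0 = reach-0
        widen (reach-+ r a b) = reach-+ (widen r) (T∈ _ a) (T∈ _ b)

      module Gr = Greedy T P₂⁺ J T⊂₀ P₂⁺-mono τ 1/1024 K M 0<T 0<τ τ≤1 (≤! {0ℚ} {1/1024}) hK hM

      -- The error of `invariant` at `c = 1/1024`.
      γ : ℚ
      γ = ι 576 * (1/1024 * 1/1024)

      Outcome : Set
      Outcome = ∃ λ gs′ → length gs′ ≡ n × Lifts gs′ × 65/64 * (# (box gs′ ℤ.0ℤ L′) * # (box gs′ ℤ.0ℤ L′)) ≤ ∑∑ (box gs′ ℤ.0ℤ L′) (λ w w′ → Φ (ℤ.0ℤ ℤ.+ (w ℤ.- w′)))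

      module _ (Λ : List Factor) (lenΛ : length Λ ℕ.≤ M) (r : ℕ) (reg : Gr.Regular r Λ) (settled : ∀ j → j ∈ below J → Gr.Settled r Λ j) where

        crowded′ : (Cells.side Kc 0<Kc ℕ.* Cells.side Kc 0<Kc) ℕ.^ length Λ ℕ.< R ℕ.^ s
        crowded′ = ℕ.≤-<-trans (ℕ.^-monoʳ-≤ (Cells.side Kc 0<Kc ℕ.* Cells.side Kc 0<Kc) lenΛ) crowded

        module Re = Relations Λ Kc 0<Kc R s crowded′

        finish : Outcome
        finish = go (Re.reduce n gs len)
          where
          go : (∃ λ gs′ → length gs′ ≡ n × (∀ g → g ∈ gs′ → ∀ f → f ∈ Λ → Near (2ℚ * inv (ι Kc)) g f) × Lifts gs′) → Outcome
          go (gs′ , len′ , near , lifts) = gs′ , len′ , lifts , transfer-arith {h = ½ ^ ℓ} {g = κΦ} 0≤B² 0≤κ*E κ*E≤ (0≤^ ℓ 0≤½) hΦ hℓ (≤! {γ} {1/1024}) (≤! {γ} {1ℚ})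
            (Sp.transfer A T (riesz Λ) Bx ℓ 527/512 γ (0≤riesz Λ) (Gr.0<ST Λ) 0<A (≤! {0ℚ} {γ}) (≤! {γ} {1ℚ}) within-A within-B
              (within (Span-mono {gs} {0} {V} ℕ.z≤n (Span-0 gs))) correlated dich)
            where
            Bx : List ℤ
            Bx = box gs′ ℤ.0ℤ L′
            0≤B² : 0ℚ ≤ # Bx * # Bx
            0≤B² = 0≤* (0≤# Bx) (0≤# Bx)
            difference : ∀ {w w′} → w ∈ Bx → w′ ∈ Bx → ∃ λ bs → Fit (Bounded L′) gs′ bs × dot gs′ bs ≡ w ℤ.- w′
            difference w∈ w′∈ with ∈-box⁻ {gs′} w∈ | ∈-box⁻ {gs′} w′∈
            ... | as , fa , refl | bs , fb , refl = proj₁ d , proj₁ (proj₂ d) , proj₁ (proj₂ (proj₂ d))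
              where d = fit-difference {ℤ.0ℤ} fa fb
            diff-Span : ∀ {w w′} → w ∈ Bx → w′ ∈ Bx → Span gs H (w ℤ.- w′)
            diff-Span {w} {w′} w∈ w′∈ = use (difference w∈ w′∈)
              where
              use : (∃ λ bs → Fit (Bounded L′) gs′ bs × dot gs′ bs ≡ w ℤ.- w′) → Span gs H (w ℤ.- w′)
              use (bs , fb , e) = proj₁ (lifts L′ bs fb) , proj₁ (proj₂ (lifts L′ bs fb)) , trans (sym e) (sym (proj₁ (proj₂ (proj₂ (lifts L′ bs fb)))))
            within-B : ∀ z → z ∈ Bx → ∀ z′ → z′ ∈ Bx → Sp.Within (ℤ.0ℤ ℤ.+ (z ℤ.- z′))
            within-B z z∈ z′ z′∈ = within (Span-mono {gs} (ℕ.m≤n+m H (ℓ ℕ.* (L₂ ℕ.+ L₂) ℕ.+ (L₁ ℕ.+ L₁))) (subst (Span gs H) (sym (ℤ.+-identityˡ (z ℤ.- z′))) (diff-Span z∈ z′∈)))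
            near-diff : ∀ {w w′} → w ∈ Bx → w′ ∈ Bx → ∀ f → f ∈ Λ → Near η (w ℤ.- w′) f
            near-diff {w} {w′} w∈ w′∈ f f∈ = use (difference w∈ w′∈)
              where
              0≤a : 0ℚ ≤ 2ℚ * inv (ι Kc)
              0≤a = 0≤* 0≤2 (0≤inv (<⇒≤ 0<Kc))
              use : (∃ λ bs → Fit (Bounded L′) gs′ bs × dot gs′ bs ≡ w ℤ.- w′) → Near η (w ℤ.- w′) f
              use (bs , fb , e) = subst (λ x → Near η x f) e (near-mono {ι (length gs′) * (ι L′ * (2ℚ * inv (ι Kc)))} {η} {dot gs′ bs} {f} (0≤* (0≤ι (length gs′)) (0≤* (0≤ι L′) 0≤a))
                (≤-trans (≤-reflexive (cong (λ l → ι l * (ι L′ * (2ℚ * inv (ι Kc)))) len′)) hη) (near-dot {2ℚ * inv (ι Kc)} {L′} {f} gs′ bs fb 0≤a (λ g g∈ → near g g∈ f f∈)))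
            stable : ∀ {w} → (∀ f → f ∈ Λ → Near η w f) → ∀ x → (1ℚ - 1/1024) * riesz Λ x ≤ riesz Λ (x ℤ.+ w) × (1ℚ - 1/1024) * riesz Λ (x ℤ.+ w) ≤ riesz Λ x
            stable {w} nr x = ≤-trans (*-monoʳ (0≤riesz Λ x) factor≥) (proj₁ sh) , ≤-trans (*-monoʳ (0≤riesz Λ (x ℤ.+ w)) factor≥) (proj₂ sh)
              where
              sh = riesz-shift {η} {w} Λ 0≤η η≤1 nr x
              eq : ∀ a b → 1ℚ - b ≡ 1ℚ - a + (a - b)
              eq = solve-∀ ℚ-ring
              factor≥ : 1ℚ - 1/1024 ≤ (1ℚ - η) ^ length Λ
              factor≥ = ≤-trans (≤-by _ (0≤- (≤-trans (*-monoʳ 0≤η (ι-mono lenΛ)) hMη)) (eq 1/1024 (ι (length Λ) * η))) (bernoulli (length Λ) 0≤η η≤1)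
            character : ∀ j → 1/16′ * (Gr.SP r Λ * Gr.SP r Λ) ≤ energy (riesz Λ) (P₂⁺ r) j → ∀ w → w ∈ Bx → ∀ w′ → w′ ∈ Bx → 1ℚ - γ ≤ χr j (ℤ.0ℤ ℤ.+ (w ℤ.- w′))
            character j big w w∈ w′ w′∈ = subst (λ x → 1ℚ - γ ≤ χr j x) (sym (ℤ.+-identityˡ (w ℤ.- w′)))
              (Gr.invariant r Λ reg (≤! {1/1024} {1ℚ}) (w ℤ.- w′) (P₂⁺-shift r (diff-Span w∈ w′∈)) (stable {w ℤ.- w′} (near-diff w∈ w′∈)) j big)
            energy-B : ∀ j → energy one′ Bx j ≡ ∑∑ Bx (λ w w′ → χr j (ℤ.0ℤ ℤ.+ (w ℤ.- w′)))
            energy-B j = sym (trans (energy-shift-1 Bx j ℤ.0ℤ) (trans (cong (energy one′ Bx j *_) (χr-0 j)) (*-identityʳ (energy one′ Bx j))))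
            -- A frequency that is large on the regular scale is, by `invariant`, almost `1` on all
            -- differences of the new progression, whose energy is then almost maximal.
            dich : ∀ j → j ∈ below J → energy (riesz Λ) T j ≤ ½ * (∑ T (riesz Λ) * ∑ T (riesz Λ)) ⊎ (1ℚ - γ) * (# Bx * # Bx) ≤ energy one′ Bx j
            dich j j∈ = use (settled j j∈)
              where
              use : Gr.Settled r Λ j → energy (riesz Λ) T j ≤ ½ * (∑ T (riesz Λ) * ∑ T (riesz Λ)) ⊎ (1ℚ - γ) * (# Bx * # Bx) ≤ energy one′ Bx j
              use (inj₁ p) = inj₁ p
              use (inj₂ big) = inj₂ (≤-trans (≤-reflexive (trans (*-comm (1ℚ - γ) (# Bx * # Bx)) (sym (∑∑-const Bx (1ℚ - γ))))) (≤-trans (∑-mono∈ Bx (λ w w∈ → ∑-mono∈ Bx (λ w′ w′∈ → character j big w w∈ w′ w′∈))) (≤-reflexive (sym (energy-B j)))))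

      outcome : Outcome
      outcome = use (Gr.start (≤-trans dense (≤-reflexive refl)))
        where
        use : (∃ λ Λ → length Λ ℕ.≤ M × ∃ λ r → r ℕ.< M ℕ.* K × Gr.Regular r Λ × (∀ j → j ∈ below J → Gr.Settled r Λ j)) → Outcome
        use (Λ , lenΛ , r , _ , reg , settled) = finish Λ lenΛ r reg settled

-- The density increment

module NewInstance where

  open Rationals
  open Sums
  open Unbalancing using (∑∑; ∑∑-*ˡ)
  open Transfer using (δ; corr)
  open Boxes
  open Multiplicities
  open Extensions
  open Columns
  open SmoothCorrelations using (1/1024; 65/64)

  mass : (ℤ → ℤ → Bool) → List ℤ → ℚ
  mass A W = ∑ W (λ x → ∑ W (λ y → 𝟙 (A x y)))

  -- The set is quantified anew, because every round translates and shears it.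
  Instance : List ℤ → ℕ → ℚ → Set
  Instance gs L σ = ∃ λ A → SkewFree A × σ * (# (box gs ℤ.0ℤ L) * # (box gs ℤ.0ℤ L)) ≤ mass A (box gs ℤ.0ℤ L)

  η₀ : ℚ
  η₀ = 1/1024

  mass-columns : ∀ A W → mass A W ≡ ∑ W (λ x → # (filterᵇ (A x) W))
  mass-columns A W = ∑-cong W (λ x → sym (#-filter (A x) W))

  -- The two points of one column are moved alike, and the height of the third is arbitrary; so no
  -- condition on `u` arises.
  SkewFree-shift : ∀ {A} x₁ (u : ℤ → ℤ) → SkewFree A → SkewFree (λ x y → A (x₁ ℤ.+ x) (u (x₁ ℤ.+ x) ℤ.+ y))
  SkewFree-shift {A} x₁ u free x y y′ h h≢0 p q r = free (x₁ ℤ.+ x) (u (x₁ ℤ.+ x) ℤ.+ y) (u (x₁ ℤ.+ (x ℤ.+ h)) ℤ.+ y′) h h≢0 p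
    (subst (λ t → T (A (x₁ ℤ.+ x) t)) (sym (ℤ.+-assoc (u (x₁ ℤ.+ x)) y h)) q)
    (subst (λ t → T (A t (u (x₁ ℤ.+ (x ℤ.+ h)) ℤ.+ y′))) (sym (ℤ.+-assoc x₁ x h)) r)

  module Increment (A : ℤ → ℤ → Bool) (free : SkewFree A) (gs : List ℤ) (L L₁ : ℕ)
    (proper : Proper (L ℕ.+ (L₁ ℕ.+ (L₁ ℕ.+ L₁) ℕ.+ (L₁ ℕ.+ (L₁ ℕ.+ L₁)))) gs) (proper₁ : Proper L₁ gs) where

    module Se = Setup A free gs L L₁ proper proper₁
    open Se using (boxL; P; U; Y; ∈-Y; multiplicity≤1)

    column-density : ∀ σ → σ * (# boxL * # boxL) ≤ mass A boxL → 0ℚ ≤ σ → 0ℚ < # (ext gs (L₁ ℕ.+ L₁) L) → 0ℚ < # U → # U * (1ℚ - η₀) ≤ # boxL → # (ext gs (L₁ ℕ.+ L₁) L) * (1ℚ - η₀) ≤ # boxL →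
      ∃ λ x₀ → σ * (1ℚ - η₀) * (1ℚ - η₀) * (# P * # P) ≤ Se.Base.Stot x₀ * Se.Base.iU x₀
    column-density σ dense 0≤σ 0<E 0<U hU hE = use (Se.base-exists (σ * (# boxL * # boxL)) (≤-trans dense (≤-reflexive (mass-columns A boxL))) 0<E)
      where
      E = # (ext gs (L₁ ℕ.+ L₁) L)
      q = 1ℚ - η₀
      0≤q : 0ℚ ≤ q
      0≤q = ≤!
      use : (∃ λ x₀ → # P * # P * (σ * (# boxL * # boxL)) ≤ E * ∑∑ P (λ ζ ζ′ → # (Y (x₀ ℤ.+ (ζ′ ℤ.- ζ))))) → _
      use (x₀ , h) = x₀ , *-cancelˡ (0<* 0<E 0<U) (≤-trans (≤-by _ (0≤* (0≤* (0≤* (0≤# P) (0≤# P)) 0≤σ) (0≤+ (0≤* (0≤* (<⇒≤ 0<E) 0≤q) (0≤- hU)) (0≤* (0≤# boxL) (0≤- hE)))) (eq E (# U) σ q (# P) (# boxL)))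
        (≤-trans h (≤-reflexive (sym (trans (eq₂ E (# U) St (inv (# U))) (trans (cong (E * St *_) (inv-pos 0<U)) (trans (*-identityʳ (E * St)) (cong (E *_) (Se.Base.∑-Ξ x₀ (λ ξ → # (Y ξ)))))))))))
        where
        St = Se.Base.Stot x₀
        eq : ∀ e u s q p l → p * p * (s * (l * l)) ≡ e * u * (s * q * q * (p * p)) + p * p * s * (e * q * (l - u * q) + l * (l - e * q))
        eq = solve-∀ ℚ-ring
        eq₂ : ∀ e u s i → e * u * (s * i) ≡ e * s * (u * i)
        eq₂ = solve-∀ ℚ-ring

    module New (x₀ : ℤ) (gs′ : List ℤ) (L′ H : ℕ) (0<U : 0ℚ < # U) (0<Stot : 0ℚ < Se.Base.Stot x₀) (0<W : 0ℚ < # (box gs′ ℤ.0ℤ L′)) (0<P : 0ℚ < # P)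
      (W-Span : ∀ w → w ∈ box gs′ ℤ.0ℤ L′ → Span gs H w) (0<E : 0ℚ < # (ext gs H L₁)) where

      open Se.Base x₀
      open Analysis 0<U 0<Stot

      W : List ℤ
      W = box gs′ ℤ.0ℤ L′

      dens : ℤ → ℤ → ℚ
      dens ξ u = ∑ W (λ w → m ξ (u ℤ.+ w))

      0≤dens : ∀ ξ u → 0ℚ ≤ dens ξ u
      0≤dens ξ u = 0≤∑ W (λ w → 0≤∑ (Y ξ) (λ s → 0≤δ (u ℤ.+ w ℤ.- s)))

      -- By `regroup` the correlation of a column with `W` is the sum of its densities on the
      -- translates of `W` by these heights. Hence the best height does at least as well as their
      -- average, and the search for it is finite.
      candidates : ℤ → List ℤ
      candidates ξ = concatMap (λ w′ → map (λ s → s ℤ.- w′) (Y ξ)) W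

      u : ℤ → ℤ
      -- The start `0` serves the case of an empty column; as one more competitor it can only raise
      -- the maximum.
      u ξ = proj₁ (argmax ℤ.0ℤ (candidates ξ) (dens ξ))

      regroup : ∀ ξ → ∑∑ W (λ w w′ → corr (Y ξ) (ℤ.0ℤ ℤ.+ (w ℤ.- w′))) ≡ ∑ (candidates ξ) (dens ξ)
      regroup ξ = begin
        ∑∑ W (λ w w′ → corr (Y ξ) (ℤ.0ℤ ℤ.+ (w ℤ.- w′)))
          ≡⟨ ∑-swap W W _ ⟩
        ∑ W (λ w′ → ∑ W (λ w → corr (Y ξ) (ℤ.0ℤ ℤ.+ (w ℤ.- w′))))
          ≡⟨ ∑-cong W (λ w′ → trans (∑-swap W (Y ξ) _) (∑-cong (Y ξ) (λ s → ∑-cong W (λ w → ∑-cong (Y ξ) (λ s′ → cong δ (eq w w′ s s′)))))) ⟩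
        ∑ W (λ w′ → ∑ (Y ξ) (λ s → dens ξ (s ℤ.- w′)))
          ≡⟨ sym (trans (∑-concatMap _ W (dens ξ)) (∑-cong W (λ w′ → ∑-map _ (Y ξ) (dens ξ)))) ⟩
        ∑ (candidates ξ) (dens ξ) ∎
        where
        open ≡-Reasoning
        eq : ∀ w w′ s s′ → + 0 ℤ.+ (w ℤ.- w′) ℤ.+ (s ℤ.- s′) ≡ s ℤ.- w′ ℤ.+ w ℤ.- s′
        eq = ℤ.solve-∀

      best : ∀ ξ → c ξ * ∑∑ W (λ w w′ → corr (Y ξ) (ℤ.0ℤ ℤ.+ (w ℤ.- w′))) ≤ nU * iS * # W * dens ξ (u ξ)
      best ξ = ≤-trans (*-monoˡ (0≤c ξ) (≤-trans (≤-reflexive (regroup ξ)) (≤-trans (∑-mono∈ (candidates ξ) (proj₂ (argmax ℤ.0ℤ (candidates ξ) (dens ξ)))) (≤-reflexive (trans (∑-const (candidates ξ) (dens ξ (u ξ))) (cong (_* dens ξ (u ξ)) size))))))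
        (≤-trans (≤-reflexive (eq (c ξ) (# W) (# (Y ξ)) (dens ξ (u ξ)))) (≤-trans (*-monoʳ (0≤* (0≤# W) (0≤dens ξ (u ξ))) (c*#≤ ξ)) (≤-reflexive (sym (*-assoc (nU * iS) (# W) (dens ξ (u ξ)))))))
        where
        size : # (candidates ξ) ≡ # W * # (Y ξ)
        size = trans (∑-concatMap _ W _) (trans (∑-cong W (λ w′ → ∑-map _ (Y ξ) _)) (∑-const W (# (Y ξ))))
        eq : ∀ c w y d → c * (w * y * d) ≡ c * y * (w * d)
        eq = solve-∀ ℚ-ring

      many : 65/64 * (# W * # W) ≤ ∑∑ W (λ w w′ → Φ (ℤ.0ℤ ℤ.+ (w ℤ.- w′))) → 65/64 * # W * (Stot * iU) ≤ ∑ Ξ (λ ξ → dens ξ (u ξ))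
      many h = *-cancelˡ (0<* (0<* 0<U (0<inv 0<Stot)) 0<W) (≤-trans (≤-reflexive (trans (eq nU iS (# W) 65/64 Stot iU) (trans (cong₂ (λ a b → a * b * (65/64 * (# W * # W))) nU*iU Stot*iS) (eq′ (65/64 * (# W * # W))))))
        (≤-trans h (≤-trans (≤-reflexive expand) (≤-trans (∑-mono Ξ best) (≤-reflexive (∑-*ˡ Ξ (nU * iS * # W) _))))))
        where
        eq : ∀ n s w a t i → n * s * w * (a * w * (t * i)) ≡ n * i * (t * s) * (a * (w * w))
        eq = solve-∀ ℚ-ring
        eq′ : ∀ x → 1ℚ * 1ℚ * x ≡ x
        eq′ = solve-∀ ℚ-ring
        expand : ∑∑ W (λ w w′ → Φ (ℤ.0ℤ ℤ.+ (w ℤ.- w′))) ≡ ∑ Ξ (λ ξ → c ξ * ∑∑ W (λ w w′ → corr (Y ξ) (ℤ.0ℤ ℤ.+ (w ℤ.- w′))))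
        expand = trans (∑-cong W (λ w → ∑-swap W Ξ _)) (trans (∑-swap W Ξ _) (∑-cong Ξ (λ ξ → ∑∑-*ˡ W (c ξ) _)))

      e : ℤ → ℚ
      e x = ∑ W (λ y → 𝟙 (A x (u x ℤ.+ y)))

      0≤e : ∀ x → 0ℚ ≤ e x
      0≤e x = 0≤∑ W (λ y → 0≤𝟙 (A x (u x ℤ.+ y)))

      m≤𝟙 : ∀ x t → m x t ≤ 𝟙 (A x t)
      m≤𝟙 x t = go (A x t) refl
        where
        go : ∀ a → A x t ≡ a → m x t ≤ 𝟙 a
        go true _ = multiplicity≤1 x t
        go false eq = ≤-reflexive (trans (∑-cong∈ (Y x) (λ s s∈ → δ-nonzero (λ z → subst T (trans (cong (A x) (sym (ℤ.i-j≡0⇒i≡j t s z))) eq) (proj₂ (∈-Y {x} s∈))))) (∑-0 (Y x)))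

      dens≤e : ∀ ξ → dens ξ (u ξ) ≤ e ξ
      dens≤e ξ = ∑-mono W (λ w → m≤𝟙 ξ (u ξ ℤ.+ w))

      -- Rewriting each `ζ′` as `ζ″ + w`, for every `w` in `W`, turns the sum over abscissas into
      -- one over translates of `W`; the cost is the extension of the box by `H`.
      localise : # W * ∑ Ξ e ≤ ∑ P (λ ζ → ∑ (ext gs H L₁) (λ ζ″ → ∑ W (λ w → e (x₀ ℤ.- ζ ℤ.+ ζ″ ℤ.+ w))))
      localise = ≤-trans (≤-reflexive (trans (cong (# W *_) (∑-Ξ e)) (trans (sym (∑-*ˡ P (# W) _)) (∑-cong P (λ ζ → sym (∑-const W _)))))) (∑-mono P (λ ζ → ≤-trans (∑-mono∈ W (λ w w∈ → move ζ w w∈)) (≤-reflexive (∑-swap W (ext gs H L₁) _))))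
        where
        eq : ∀ x ζ ζ′ w → x ℤ.+ (ζ′ ℤ.- ζ) ≡ x ℤ.- ζ ℤ.+ (ζ′ ℤ.+ (ℤ.- w)) ℤ.+ w
        eq = ℤ.solve-∀
        move : ∀ ζ w → w ∈ W → ∑ P (λ ζ′ → e (x₀ ℤ.+ (ζ′ ℤ.- ζ))) ≤ ∑ (ext gs H L₁) (λ ζ″ → e (x₀ ℤ.- ζ ℤ.+ ζ″ ℤ.+ w))
        move ζ w w∈ = ≤-trans (≤-reflexive (∑-cong P (λ ζ′ → cong e (eq x₀ ζ ζ′ w)))) (∑-box-shift {gs} L₁ H (Span-neg {gs} {H} (W-Span w w∈)) (λ ζ″ → e (x₀ ℤ.- ζ ℤ.+ ζ″ ℤ.+ w)) (λ ζ″ → 0≤e (x₀ ℤ.- ζ ℤ.+ ζ″ ℤ.+ w)))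

      new-instance : ∀ σ₁ → 0ℚ ≤ σ₁ → σ₁ * (# P * # P) ≤ Stot * iU → # (ext gs H L₁) * (1ℚ - η₀) ≤ # P →
        65/64 * (# W * # W) ≤ ∑∑ W (λ w w′ → Φ (ℤ.0ℤ ℤ.+ (w ℤ.- w′))) → Instance gs′ L′ (65/64 * (1ℚ - η₀) * σ₁)
      new-instance σ₁ 0≤σ₁ hσ hE hΦ = use (≤-avg-∃ (pairs P (ext gs H L₁)) {λ p → ∑ W (λ w → e (x₀ ℤ.- proj₁ p ℤ.+ proj₂ p ℤ.+ w))} (subst (0ℚ <_) (sym size) (0<* 0<P 0<E)) average)
        where
        EH = # (ext gs H L₁)
        q = 1ℚ - η₀
        target = 65/64 * q * σ₁ * (# W * # W)
        size : # (pairs P (ext gs H L₁)) ≡ # P * EH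
        size = trans (∑-pairs P (ext gs H L₁) _) (∑-const P EH)
        eq : ∀ p e a q s w t → w * (a * w * t) ≡ p * e * (a * q * s * (w * w)) + a * (w * w) * (p * s * (p - e * q) + (t - s * (p * p)))
        eq = solve-∀ ℚ-ring
        average : # (pairs P (ext gs H L₁)) * target ≤ ∑ (pairs P (ext gs H L₁)) (λ p → ∑ W (λ w → e (x₀ ℤ.- proj₁ p ℤ.+ proj₂ p ℤ.+ w)))
        average = ≤-trans (≤-reflexive (cong (_* target) size)) (≤-trans (≤-by _ (0≤* (0≤* (≤! {0ℚ} {65/64}) (0≤* (0≤# W) (0≤# W))) (0≤+ (0≤* (0≤* (0≤# P) 0≤σ₁) (0≤- hE)) (0≤- hσ))) (eq (# P) EH 65/64 q σ₁ (# W) (Stot * iU)))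
          (≤-trans (*-monoˡ (0≤# W) (≤-trans (many hΦ) (∑-mono Ξ dens≤e))) (≤-trans localise (≤-reflexive (sym (∑-pairs P (ext gs H L₁) _))))))
        use : (∃ λ p → p ∈ pairs P (ext gs H L₁) × target ≤ ∑ W (λ w → e (x₀ ℤ.- proj₁ p ℤ.+ proj₂ p ℤ.+ w))) → Instance gs′ L′ (65/64 * q * σ₁)
        use ((ζ , ζ″) , _ , h) = (λ x y → A (x₁ ℤ.+ x) (u (x₁ ℤ.+ x) ℤ.+ y)) , SkewFree-shift {A} x₁ u free , h
          where
          x₁ : ℤ
          x₁ = x₀ ℤ.- ζ ℤ.+ ζ″

-- Assembling sampling, large spectrum and new generators

module SmoothingStep where

  open Rationals
  open Sums
  open Unbalancing using (∑∑; 17/16; 16ℚ)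
  open AlmostPeriods using (Reach)
  open Transfer using (corr)
  open RieszProducts using (10/9)
  open Boxes
  open NearRelations
  open Extensions
  open Columns
  open SmoothCorrelations
  open LargeSpectrum
  open NewInstance
  open import Data.List.Membership.Propositional.Properties using (∈-filter⁻)

  abstract
    N₀ : ℕ
    N₀ = 1024

    ιN₀ : ι N₀ * η₀ ≡ 1ℚ
    ιN₀ = cong (_* η₀) (ι-^ 2 10)

    4≤N₀ : 4 ℕ.≤ N₀
    4≤N₀ = ℕ.m≤m+n 4 1020

  1≤N₀ : 1 ℕ.≤ N₀
  1≤N₀ = ℕ.≤-trans (ℕ.s≤s ℕ.z≤n) 4≤N₀

  0<ι′ : ∀ {n} → 1 ℕ.≤ n → 0ℚ < ι n
  0<ι′ {suc n} _ = 0<ι n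

  #box>0 : ∀ gs lo {n} → 1 ℕ.≤ n → 0ℚ < # (box gs lo n)
  #box>0 gs lo {n} h = subst (0ℚ <_) (sym (#-box gs lo n)) (0<^ (length gs) (0<ι′ h))

  box-growth : ∀ gs B n {η} N → 1 ℕ.≤ length gs → 1 ℕ.≤ n → 0ℚ ≤ η → ι N * η ≡ 1ℚ → N ℕ.* (length gs ℕ.* (B ℕ.+ B)) ℕ.≤ n → 1 ℕ.≤ N → # (ext gs B n) * (1ℚ - η) ≤ # (box gs ℤ.0ℤ n)
  box-growth gs B n {η} N 1≤D 1≤n 0≤η Nη le 1≤N = ≤-trans (≤-reflexive (cong (_* (1ℚ - η)) (#-box gs (ℤ.- (+ B)) (n ℕ.+ (B ℕ.+ B)))))
    (≤-trans (growth {n} {B ℕ.+ B} {length gs} {η} (0<ι′ 1≤n) 0≤η cond (ι-mono (ℕ.≤-trans (ℕ.≤-trans (ℕ.≤-reflexive (sym (ℕ.*-identityˡ (B ℕ.+ B)))) (ℕ.*-monoˡ-≤ (B ℕ.+ B) 1≤D)) (ℕ.≤-trans (ℕ.≤-trans (ℕ.≤-reflexive (sym (ℕ.*-identityˡ _))) (ℕ.*-monoˡ-≤ (length gs ℕ.* (B ℕ.+ B)) 1≤N)) le)))) (≤-reflexive (sym (#-box gs ℤ.0ℤ n))))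
    where
    x = ι (length gs) * ι (B ℕ.+ B)
    cond : x ≤ η * ι n
    cond = ≤-trans (≤-reflexive (trans (sym (*-identityˡ x)) (trans (cong (_* x) (trans (sym Nη) (*-comm (ι N) η))) (*-assoc η (ι N) x))))
      (*-monoˡ 0≤η (≤-trans (≤-reflexive (sym (trans (ι-* N (length gs ℕ.* (B ℕ.+ B))) (cong (ι N *_) (ι-* (length gs) (B ℕ.+ B)))))) (ι-mono le)))

  box-double : ∀ gs B n → 1 ℕ.≤ length gs → 1 ℕ.≤ n → 2 ℕ.* (length gs ℕ.* (B ℕ.+ B)) ℕ.≤ n → # (ext gs B n) ≤ 2ℚ * # (box gs ℤ.0ℤ n)
  box-double gs B n 1≤D 1≤n le = ≤-by _ (0≤* 0≤2 (0≤- (box-growth gs B n {½} 2 1≤D 1≤n 0≤½ refl le (ℕ.s≤s ℕ.z≤n)))) (eq (# (ext gs B n)) (# (box gs ℤ.0ℤ n)))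
    where
    eq : ∀ e n → 2ℚ * n ≡ e + 2ℚ * (n - e * (1ℚ - ½))
    eq = solve-∀ ℚ-ring

  0<-left : ∀ {x y} → 0ℚ ≤ y → 0ℚ < x * y → 0ℚ < x
  0<-left {x} {y} 0≤y h with 0ℚ <? x
  ... | yes p = p
  ... | no np = ⊥-elim (<⇒≱ h (≤-trans (*-monoʳ 0≤y (≮⇒≥ np)) (≤-reflexive (*-zeroˡ y))))

  quotient : ∀ a m e h → a * h ≡ 1ℚ → a * m * e ≡ 1ℚ → m * e ≡ h
  quotient a m e h ah ame = trans (sym (*-identityˡ (m * e))) (trans (cong (_* (m * e)) (sym ah)) (trans (eq a m e h) (trans (cong (h *_) ame) (*-identityʳ h))))
    where
    eq : ∀ a m e h → a * h * (m * e) ≡ h * (a * m * e)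
    eq = solve-∀ ℚ-ring

  Lifting : List ℤ → List ℤ → ℕ → ℕ → Set
  Lifting gs gs′ n R = ∀ B bs → Fit (Bounded B) gs′ bs → ∃ λ as → Fit (Bounded (n ℕ.* (B ℕ.* R))) gs as × dot gs as ≡ dot gs′ bs × (AllZero gs as → AllZero gs′ bs)

  -- A relation among the new generators lifts to one among the old, whose coefficients stay in the
  -- range where the old ones are independent.
  lifts-proper : ∀ {gs gs′ n R B B′} → Lifting gs gs′ n R → n ℕ.* (B ℕ.* R) ℕ.≤ B′ → Proper B′ gs → Proper B gs′
  lifts-proper {gs} {gs′} {n} {R} {B} lifts small proper bs fit e = use (lifts B bs fit)
    where
    use : (∃ λ as → Fit (Bounded (n ℕ.* (B ℕ.* R))) gs as × dot gs as ≡ dot gs′ bs × (AllZero gs as → AllZero gs′ bs)) → AllZero gs′ bs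
    use (as , fa , ea , za) = za (Proper-mono {gs} small proper as fa (trans ea e))

  lifts-span : ∀ {gs gs′ n R L} → Lifting gs gs′ n R → ∀ w → w ∈ box gs′ ℤ.0ℤ L → Span gs (n ℕ.* (L ℕ.* R)) w
  lifts-span {gs} {gs′} {n} {R} {L} lifts w w∈ with ∈-box-Span {gs′} {L} w∈
  ... | bs , fb , refl with lifts L bs fb
  ...   | as , fa , ea , _ = as , fa , sym ea

  Φ₀ : List ℤ → (ℤ → ℚ) → (ℤ → List ℤ) → ℤ → ℚ
  Φ₀ Ξ c Y v = ∑ Ξ (λ ξ → c ξ * corr (Y ξ) v)

  Concentrated : (ℤ → ℚ) → List ℤ → ℚ → (ℤ → Bool) → Set
  Concentrated Φ P δ′ bA = 0ℚ < # (filterᵇ bA P) × δ′ * # P ≤ # (filterᵇ bA P) ×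
    + 64 / 1 * ∑∑ (filterᵇ bA P) (λ z z′ → 𝟙 (not (17/16 ≤ᵇ Φ (z′ ℤ.- z)))) ≤ # (filterᵇ bA P) * # (filterᵇ bA P)

  Dense : (ℤ → ℚ) → List ℤ → Set
  Dense Φ W = 65/64 * (# W * # W) ≤ ∑∑ W (λ w w′ → Φ (ℤ.0ℤ ℤ.+ (w ℤ.- w′)))

  Smoothing : List ℤ → ℕ → ℕ → ℕ → ℕ → ℚ → ℚ → Set
  Smoothing gs L₁ L′ n Z δ′ κ = ∀ Ξ c Y → (∀ ξ → 0ℚ ≤ c ξ) → Φ₀ Ξ c Y ℤ.0ℤ ≤ κ → ∀ bA → Concentrated (Φ₀ Ξ c Y) (box gs ℤ.0ℤ L₁) δ′ bA →
    ∃ λ gs′ → length gs′ ≡ n × Lifting gs gs′ n Z × Dense (Φ₀ Ξ c Y) (box gs′ ℤ.0ℤ L′)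

  module Chain (gs : List ℤ) (L₁ L₂ L′ ℓ m b M K Kc Z s n : ℕ) (ε δ′ τ η κ : ℚ)
    (0<ε : 0ℚ < ε) (0<δ′ : 0ℚ < δ′) (0<m : 0ℚ < ι m) (hm : 16ℚ * ι m ≤ (ε * ι m) * (ε * ι m))
    (h₁ : ι ℓ * (2ℚ * ε) ≤ 1/128) (h₂ : ι ℓ * (+ 8 / 1 * inv (2ℚ ^ b)) ≤ 1/128 * δ′)
    (τ≡ : τ ≡ ½ * ½ * ((½ * δ′) ^ m) ^ b) (0<τ : 0ℚ < τ) (τ≤1 : τ ≤ 1ℚ)
    (hK : 2ℚ ≤ (1ℚ + 1/1024) ^ K * τ) (hM : 2ℚ ≤ 10/9 ^ M * τ) (hℓ : ½ ^ ℓ * (κ + 1ℚ) ≤ 1/1024)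
    (0≤η : 0ℚ ≤ η) (η≤1 : η ≤ 1ℚ) (hMη : ι M * η ≤ 1/1024) (0<Kc : 0ℚ < ι Kc) (cells-small : ι n * (ι L′ * (2ℚ * inv (ι Kc))) ≤ η)
    (crowded : (suc (Kc ℕ.+ Kc) ℕ.* suc (Kc ℕ.+ Kc)) ℕ.^ M ℕ.< Z ℕ.^ s) (len : length gs ≡ s ℕ.+ n)
    (1≤L₁ : 1 ℕ.≤ L₁) (1≤L₂ : 1 ℕ.≤ L₂)
    (Pm≤ : # (ext gs L₂ L₁) ≤ 2ℚ * # (box gs ℤ.0ℤ L₁)) (Pp≤ : # (ext gs (ℓ ℕ.* (L₂ ℕ.+ L₂)) L₁) ≤ 2ℚ * # (box gs ℤ.0ℤ L₁))
    (P₂≤ : # (ext gs (M ℕ.* K ℕ.* (n ℕ.* (L′ ℕ.* Z))) L₂) ≤ 2ℚ * # (box gs ℤ.0ℤ L₂))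
    where

    H : ℕ
    H = n ℕ.* (L′ ℕ.* Z)

    0<ext : ∀ B {N} → 1 ℕ.≤ N → 0ℚ < # (ext gs B N)
    0<ext B 1≤N = #box>0 gs (ℤ.- (+ B)) (ℕ.≤-trans 1≤N (ℕ.m≤m+n _ _))

    τ-dense : ∀ {x y} → ½ * ½ * ((½ * δ′) ^ m) ^ b * x ≤ y → τ * x ≤ y
    τ-dense {x} {y} = subst (λ t → t * x ≤ y) (sym τ≡)

    module _ (Ξ : List ℤ) (c : ℤ → ℚ) (Y : ℤ → List ℤ) (0≤c : ∀ ξ → 0ℚ ≤ c ξ) (Φ0≤ : Φ₀ Ξ c Y ℤ.0ℤ ≤ κ) where

      module Sm = Smooth Ξ c 0≤c Y gs L₁ L₂ L′ ℓ m b M K Kc Z s n ε δ′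

      P P₂ : List ℤ
      P = box gs ℤ.0ℤ L₁
      P₂ = box gs ℤ.0ℤ L₂

      Outcome : Set
      Outcome = ∃ λ gs′ → length gs′ ≡ n × Lifting gs gs′ n Z × Dense Sm.Φ (box gs′ ℤ.0ℤ L′)

      finish : ∀ (A T : List ℤ) → (∀ z → z ∈ A → Span gs L₁ z) → 0ℚ < # A → (∀ t → t ∈ T → t ∈ P₂) → (∀ (F : ℤ → ℚ) → (∀ x → 0ℚ ≤ F x) → ∑ T F ≤ ∑ P₂ F) → 0ℚ < # T →
        (∀ v → Reach T ℓ v → 527/512 * (# A * # A) ≤ ∑∑ A (λ z z′ → Sm.Φ (v ℤ.+ (z ℤ.- z′)))) → τ * # (Sm.P₂⁺ (M ℕ.* K)) ≤ # T → Outcome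
      finish A T A-Span 0<A T∈ T⊂ 0<T correlated dense =
        Finish.outcome Ξ c 0≤c Y gs L₁ L₂ L′ ℓ M K Kc Z s n A A-Span 0<A T T∈ T⊂ 0<T τ η κ 0<τ τ≤1 hK hM 0≤η η≤1 hMη 0<Kc cells-small crowded len correlated dense Φ0≤ hℓ

      module _ (bA : ℤ → Bool) (0<A : 0ℚ < # (filterᵇ bA P)) (largeA : δ′ * # P ≤ # (filterᵇ bA P))
        (rare : + 64 / 1 * ∑∑ (filterᵇ bA P) (λ z z′ → 𝟙 (not (17/16 ≤ᵇ Sm.Φ (z′ ℤ.- z)))) ≤ # (filterᵇ bA P) * # (filterᵇ bA P)) where

        module Pe = Sm.Periods bA 0<A 0<ε 0<δ′ hm 0<m (0<ext (ℓ ℕ.* (L₂ ℕ.+ L₂)) 1≤L₁) largeA Pm≤ Pp≤ rare h₁ h₂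

        from-periods : ∀ τ′ → length τ′ ≡ b → (∀ β → β ∈ τ′ → length β ≡ m) → τ * # (Sm.P₂⁺ (M ℕ.* K)) ≤ # (Pe.Sa.periods τ′) → Outcome
        from-periods τ′ τ-len τ-blocks dense =
          finish (filterᵇ bA P) (Pe.Sa.periods τ′) (λ z z∈ → ∈-box-Span {gs} {L₁} (proj₁ (∈-filter⁻ _ {xs = P} z∈))) 0<A
            (λ t t∈ → proj₁ (∈-filter⁻ _ {xs = P₂} t∈)) (λ F 0≤F → ∑-filter-≤ _ P₂ 0≤F) (ℚ.<-≤-trans (0<* {τ} {# (Sm.P₂⁺ (M ℕ.* K))} 0<τ (0<ext (M ℕ.* K ℕ.* H) 1≤L₂)) dense) (Pe.correlated τ′ τ-len τ-blocks) dense

        chain : Outcome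
        chain = (λ r → from-periods (proj₁ r) (proj₁ (proj₂ r)) (proj₁ (proj₂ (proj₂ r))) (τ-dense {# (Sm.P₂⁺ (M ℕ.* K))} {# (Pe.Sa.periods (proj₁ r))} (proj₂ (proj₂ (proj₂ r))))) (Pe.periods-exist (0<ext L₂ 1≤L₁) P₂≤)

    smoothing : Smoothing gs L₁ L′ n Z δ′ κ
    smoothing Ξ c Y 0≤c Φ0≤ bA con = chain Ξ c Y 0≤c Φ0≤ bA (proj₁ con) (proj₁ (proj₂ con)) (proj₂ (proj₂ con))

-- One round of the increment

module IncrementStep where

  open Rationals
  open Sums
  open Unbalancing using (17/16; 16ℚ; 1/4)
  open Boxes
  open Extensions
  open Columns
  open SmoothCorrelations
  open NewInstance
  open SmoothingStep

  module Round (gs : List ℤ) (L L₁ L′ n Z q : ℕ) (θ δ′ : ℚ)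
    (1≤L : 1 ℕ.≤ L) (1≤L₁ : 1 ℕ.≤ L₁) (1≤L′ : 1 ℕ.≤ L′)
    (proper₀ : Proper (L ℕ.+ (L₁ ℕ.+ (L₁ ℕ.+ L₁) ℕ.+ (L₁ ℕ.+ (L₁ ℕ.+ L₁)))) gs) (proper₁ : Proper L₁ gs) (proper : Proper (L ℕ.+ L) gs)
    (small : n ℕ.* ((L′ ℕ.+ L′) ℕ.* Z) ℕ.≤ L ℕ.+ L)
    (hU : # (ext gs (L₁ ℕ.+ (L₁ ℕ.+ L₁)) L) * (1ℚ - η₀) ≤ # (box gs ℤ.0ℤ L)) (hE : # (ext gs (L₁ ℕ.+ L₁) L) * (1ℚ - η₀) ≤ # (box gs ℤ.0ℤ L)) (hEH : # (ext gs (n ℕ.* (L′ ℕ.* Z)) L₁) * (1ℚ - η₀) ≤ # (box gs ℤ.0ℤ L₁))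
    (0<θ : 0ℚ < θ) (0≤δ′ : 0ℚ ≤ δ′) (δ′-cond : 2ℚ * 2ℚ * (δ′ * inv θ ^ suc (suc q ℕ.* 16)) ≤ 1ℚ)
    (hpar : 2ℚ * 2ℚ * (+ 64 / 1 * 17/16 ^ suc (suc q ℕ.* 16)) ≤ 16ℚ ^ suc q * (θ * 49/64 ^ suc q - 1/4 ^ suc q))
    (8≤θP : + 8 / 1 ≤ θ * # (box gs ℤ.0ℤ L₁)) (smoothing : Smoothing gs L₁ L′ n Z δ′ (inv θ))
    where

    H : ℕ
    H = n ℕ.* (L′ ℕ.* Z)

    P : List ℤ
    P = box gs ℤ.0ℤ L₁

    0<ext : ∀ B {N} → 1 ℕ.≤ N → 0ℚ < # (ext gs B N)
    0<ext B 1≤N = #box>0 gs (ℤ.- (+ B)) (ℕ.≤-trans 1≤N (ℕ.m≤m+n _ _))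

    0<P : 0ℚ < # P
    0<P = #box>0 gs ℤ.0ℤ 1≤L₁

    Result : ℚ → Set
    Result σ₁ = ∃ λ gs′ → length gs′ ≡ n × Proper (L′ ℕ.+ L′) gs′ × Instance gs′ L′ (65/64 * (1ℚ - η₀) * σ₁)

    module _ (A : ℤ → ℤ → Bool) (free : SkewFree A) (σ₁ : ℚ) (hθ : θ ≤ σ₁) where

      module In = Increment A free gs L L₁ proper₀ proper₁

      0<U : 0ℚ < # In.Se.U
      0<U = 0<ext (L₁ ℕ.+ (L₁ ℕ.+ L₁)) 1≤L

      0≤σ₁ : 0ℚ ≤ σ₁
      0≤σ₁ = ≤-trans (<⇒≤ 0<θ) hθ

      module _ (x₀ : ℤ) (hσ : σ₁ * (# P * # P) ≤ In.Se.Base.Stot x₀ * In.Se.Base.iU x₀) where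
        module Ba = In.Se.Base x₀

        dense₀ : θ * (# P * # P) ≤ Ba.Stot * Ba.iU
        dense₀ = ≤-trans (*-monoʳ (0≤* (0≤# P) (0≤# P)) hθ) hσ

        0<Stot : 0ℚ < Ba.Stot
        0<Stot = 0<-left {Ba.Stot} {Ba.iU} (0≤inv (<⇒≤ 0<U)) (ℚ.<-≤-trans {0ℚ} {θ * (# P * # P)} {Ba.Stot * Ba.iU} (0<* {θ} {# P * # P} 0<θ (0<* {# P} {# P} 0<P 0<P)) dense₀)

        module An = Ba.Analysis 0<U 0<Stot

        from-dense : ∀ gs′ → length gs′ ≡ n → Lifting gs gs′ n Z → Dense (Φ₀ Ba.Ξ Ba.c In.Se.Y) (box gs′ ℤ.0ℤ L′) → Result σ₁
        from-dense gs′ len′ lifts dense = gs′ , len′ , lifts-proper {gs} {gs′} {n} {Z} lifts small proper ,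
          In.New.new-instance x₀ gs′ L′ H 0<U 0<Stot (#box>0 gs′ ℤ.0ℤ 1≤L′) 0<P (lifts-span {gs} {gs′} {n} {Z} {L′} lifts) (0<ext H 1≤L₁) σ₁ 0≤σ₁ hσ hEH dense

        Φ0≤ : Φ₀ Ba.Ξ Ba.c In.Se.Y ℤ.0ℤ ≤ inv θ
        Φ0≤ = ≤-trans (∑-mono Ba.Ξ (λ ξ → *-monoˡ (An.0≤c ξ) (An.corr-0 ξ))) (An.Ξ≤ θ 0<θ dense₀ 8≤θP 0<P)

        from-concentrated : (∃ λ bA → Concentrated (Φ₀ Ba.Ξ Ba.c In.Se.Y) P δ′ bA) → Result σ₁
        from-concentrated r = (λ o → from-dense (proj₁ o) (proj₁ (proj₂ o)) (proj₁ (proj₂ (proj₂ o))) (proj₂ (proj₂ (proj₂ o))))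
          (smoothing Ba.Ξ Ba.c In.Se.Y An.0≤c Φ0≤ (proj₁ r) (proj₂ r))

        from-base : Result σ₁
        from-base = from-concentrated (An.concentrate θ 0<θ dense₀ 8≤θP 0<P q (+ 64 / 1) δ′ (≤! {1ℚ} {+ 64 / 1}) 0≤δ′ δ′-cond hpar)

    round : ∀ σ → 0ℚ ≤ σ → θ ≤ σ * (1ℚ - η₀) * (1ℚ - η₀) → Instance gs L σ → Result (σ * (1ℚ - η₀) * (1ℚ - η₀))
    round σ 0≤σ hθ I = (λ b → from-base A free (σ * (1ℚ - η₀) * (1ℚ - η₀)) hθ (proj₁ b) (proj₂ b)) (In.column-density A free (σ * (1ℚ - η₀) * (1ℚ - η₀)) hθ σ (proj₂ (proj₂ I)) 0≤σ (0<ext (L₁ ℕ.+ L₁) 1≤L) (0<ext (L₁ ℕ.+ (L₁ ℕ.+ L₁)) 1≤L) hU hE)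
      where
      A = proj₁ I
      free = proj₁ (proj₂ I)

-- Side lengths, densities and cell sizes for one round

module StepConditions where

  open Rationals
  open Sums
  open Unbalancing using (17/16; 16ℚ; 1/4)
  open RieszProducts using (10/9)
  open Boxes
  open NearRelations
  open Extensions
  open Columns
  open SmoothCorrelations
  open LargeSpectrum
  open NewInstance
  open SmoothingStep
  open IncrementStep

  module Lengths (s n ℓ M K Z L′ : ℕ) (1≤n : 1 ℕ.≤ n) (1≤L′ : 1 ℕ.≤ L′) (n≤Z : n ℕ.≤ Z) (1≤Z : 1 ℕ.≤ Z)
    (hZ₁ : (s ℕ.+ n) ℕ.* (N₀ ℕ.* 6) ℕ.≤ Z) (hZ₂ : (s ℕ.+ n) ℕ.* (ℓ ℕ.* 8) ℕ.≤ Z) (hZ₃ : (s ℕ.+ n) ℕ.* (M ℕ.* K ℕ.* 4) ℕ.≤ Z)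
    where

    -- `M * K` shifts by `H = n L′ Z` have to fit into `L₂` in dimension `D`; with `4 D M K ≤ Z` and
    -- `n ≤ Z` this takes `Z³`. One factor `Z` for each further level suffices, so a round costs
    -- `Z⁵` in side length.
    L₂ L₁ L H : ℕ
    L₂ = L′ ℕ.* (Z ℕ.* (Z ℕ.* Z))
    L₁ = L₂ ℕ.* Z
    L = L₁ ℕ.* Z
    H = n ℕ.* (L′ ℕ.* Z)

    D : ℕ
    D = s ℕ.+ n

    1≤Z*Z : 1 ℕ.≤ Z ℕ.* (Z ℕ.* Z)
    1≤Z*Z = ℕ.*-mono-≤ 1≤Z (ℕ.*-mono-≤ 1≤Z 1≤Z)
    1≤L₂ : 1 ℕ.≤ L₂
    1≤L₂ = ℕ.*-mono-≤ 1≤L′ 1≤Z*Z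
    1≤L₁ : 1 ℕ.≤ L₁
    1≤L₁ = ℕ.*-mono-≤ 1≤L₂ 1≤Z
    1≤L : 1 ℕ.≤ L
    1≤L = ℕ.*-mono-≤ 1≤L₁ 1≤Z
    1≤D : 1 ℕ.≤ D
    1≤D = ℕ.≤-trans 1≤n (ℕ.m≤n+m n s)

    scale-up : ∀ {a b x y} → a ℕ.≤ b → x ≡ a ℕ.* y → x ℕ.≤ y ℕ.* b
    scale-up {a} {b} {x} {y} h refl = ℕ.≤-trans (ℕ.≤-reflexive (ℕ.*-comm a y)) (ℕ.*-monoʳ-≤ y h)

    U-cond : N₀ ℕ.* (D ℕ.* (L₁ ℕ.+ (L₁ ℕ.+ L₁) ℕ.+ (L₁ ℕ.+ (L₁ ℕ.+ L₁)))) ℕ.≤ L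
    U-cond = scale-up hZ₁ (eq N₀ D L₁)
      where
      eq : ∀ N d l → N ℕ.* (d ℕ.* (l ℕ.+ (l ℕ.+ l) ℕ.+ (l ℕ.+ (l ℕ.+ l)))) ≡ d ℕ.* (N ℕ.* 6) ℕ.* l
      eq = ℕ.solve-∀

    E-cond : N₀ ℕ.* (D ℕ.* (L₁ ℕ.+ L₁ ℕ.+ (L₁ ℕ.+ L₁))) ℕ.≤ L
    E-cond = ℕ.≤-trans (ℕ.*-monoʳ-≤ N₀ (ℕ.*-monoʳ-≤ D (ℕ.+-mono-≤ (ℕ.+-monoʳ-≤ L₁ (ℕ.m≤m+n L₁ L₁)) (ℕ.+-monoʳ-≤ L₁ (ℕ.m≤m+n L₁ L₁))))) U-cond

    Pm-cond : 2 ℕ.* (D ℕ.* (L₂ ℕ.+ L₂)) ℕ.≤ L₁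
    Pm-cond = scale-up (ℕ.≤-trans (ℕ.*-monoʳ-≤ D (ℕ.≤-trans 4≤N₀ (ℕ.m≤m*n N₀ 6))) hZ₁) (eq D L₂)
      where
      eq : ∀ d l → 2 ℕ.* (d ℕ.* (l ℕ.+ l)) ≡ d ℕ.* 4 ℕ.* l
      eq = ℕ.solve-∀

    Pp-cond : 2 ℕ.* (D ℕ.* (ℓ ℕ.* (L₂ ℕ.+ L₂) ℕ.+ ℓ ℕ.* (L₂ ℕ.+ L₂))) ℕ.≤ L₁
    Pp-cond = scale-up hZ₂ (eq D ℓ L₂)
      where
      eq : ∀ d e l → 2 ℕ.* (d ℕ.* (e ℕ.* (l ℕ.+ l) ℕ.+ e ℕ.* (l ℕ.+ l))) ≡ d ℕ.* (e ℕ.* 8) ℕ.* l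
      eq = ℕ.solve-∀

    P₂-cond : 2 ℕ.* (D ℕ.* (M ℕ.* K ℕ.* H ℕ.+ M ℕ.* K ℕ.* H)) ℕ.≤ L₂
    P₂-cond = ℕ.≤-trans (ℕ.≤-reflexive (eq D (M ℕ.* K) n L′ Z)) (ℕ.≤-trans (ℕ.*-mono-≤ (ℕ.*-mono-≤ hZ₃ n≤Z) (ℕ.≤-refl {L′ ℕ.* Z})) (ℕ.≤-reflexive (eq₂ L′ Z)))
      where
      eq : ∀ d k n l z → 2 ℕ.* (d ℕ.* (k ℕ.* (n ℕ.* (l ℕ.* z)) ℕ.+ k ℕ.* (n ℕ.* (l ℕ.* z)))) ≡ d ℕ.* (k ℕ.* 4) ℕ.* n ℕ.* (l ℕ.* z)
      eq = ℕ.solve-∀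
      eq₂ : ∀ l z → z ℕ.* z ℕ.* (l ℕ.* z) ≡ l ℕ.* (z ℕ.* (z ℕ.* z))
      eq₂ = ℕ.solve-∀

    H-cond : N₀ ℕ.* (D ℕ.* (H ℕ.+ H)) ℕ.≤ L₁
    H-cond = ℕ.≤-trans (ℕ.≤-reflexive (eq N₀ D n L′ Z)) (ℕ.≤-trans (ℕ.*-mono-≤ (ℕ.*-mono-≤ (ℕ.≤-trans (ℕ.*-monoʳ-≤ D (ℕ.*-monoʳ-≤ N₀ {2} {6} (ℕ.m≤m+n 2 4))) hZ₁) n≤Z) (ℕ.≤-refl {L′ ℕ.* Z}))
      (ℕ.≤-trans (ℕ.≤-reflexive (eq₂ L′ Z)) (ℕ.≤-trans (ℕ.≤-reflexive (sym (ℕ.*-identityʳ L₂))) (ℕ.*-monoʳ-≤ L₂ 1≤Z))))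
      where
      eq : ∀ N d n l z → N ℕ.* (d ℕ.* (n ℕ.* (l ℕ.* z) ℕ.+ n ℕ.* (l ℕ.* z))) ≡ d ℕ.* (N ℕ.* 2) ℕ.* n ℕ.* (l ℕ.* z)
      eq = ℕ.solve-∀
      eq₂ : ∀ l z → z ℕ.* z ℕ.* (l ℕ.* z) ≡ l ℕ.* (z ℕ.* (z ℕ.* z))
      eq₂ = ℕ.solve-∀

    LZ²≤L : L′ ℕ.* (Z ℕ.* Z) ℕ.≤ L
    LZ²≤L = ℕ.≤-trans (ℕ.≤-trans (ℕ.≤-reflexive (sym (ℕ.*-identityʳ _))) (ℕ.*-monoʳ-≤ (L′ ℕ.* (Z ℕ.* Z)) 1≤Z*Z)) (ℕ.≤-reflexive (sym (eq₂ Z L′)))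
      where
      eq₂ : ∀ z l → l ℕ.* (z ℕ.* (z ℕ.* z)) ℕ.* z ℕ.* z ≡ l ℕ.* (z ℕ.* z) ℕ.* (z ℕ.* (z ℕ.* z))
      eq₂ = ℕ.solve-∀

    small : n ℕ.* ((L′ ℕ.+ L′) ℕ.* Z) ℕ.≤ L ℕ.+ L
    small = ℕ.≤-trans (ℕ.*-monoˡ-≤ ((L′ ℕ.+ L′) ℕ.* Z) n≤Z) (ℕ.≤-trans (ℕ.≤-reflexive (eq Z L′)) (ℕ.+-mono-≤ LZ²≤L LZ²≤L))
      where
      eq : ∀ z l → z ℕ.* ((l ℕ.+ l) ℕ.* z) ≡ l ℕ.* (z ℕ.* z) ℕ.+ l ℕ.* (z ℕ.* z)
      eq = ℕ.solve-∀

    L′≤L₁ : L′ ℕ.≤ L₁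
    L′≤L₁ = ℕ.≤-trans (ℕ.≤-trans (ℕ.≤-reflexive (sym (ℕ.*-identityʳ L′))) (ℕ.*-monoʳ-≤ L′ 1≤Z*Z)) (ℕ.≤-trans (ℕ.≤-reflexive (sym (ℕ.*-identityʳ L₂))) (ℕ.*-monoʳ-≤ L₂ 1≤Z))

    below-cond : ∀ {N X Y} → 1 ℕ.≤ N → N ℕ.* (D ℕ.* X) ℕ.≤ Y → X ℕ.≤ Y
    below-cond {N} {X} {Y} hN h = ℕ.≤-trans (ℕ.≤-trans (ℕ.≤-reflexive (sym (ℕ.*-identityˡ X))) (ℕ.*-monoˡ-≤ X 1≤D)) (ℕ.≤-trans (ℕ.≤-trans (ℕ.≤-reflexive (sym (ℕ.*-identityˡ (D ℕ.* X)))) (ℕ.*-monoˡ-≤ (D ℕ.* X) hN)) h)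

    U≤ : L₁ ℕ.+ (L₁ ℕ.+ L₁) ℕ.+ (L₁ ℕ.+ (L₁ ℕ.+ L₁)) ℕ.≤ L
    U≤ = below-cond {N₀} 1≤N₀ U-cond

    L₁≤ : L₁ ℕ.≤ L
    L₁≤ = ℕ.≤-trans (ℕ.≤-trans (ℕ.m≤m+n L₁ (L₁ ℕ.+ L₁)) (ℕ.m≤m+n _ (L₁ ℕ.+ (L₁ ℕ.+ L₁)))) U≤

  module Densities (kk q m b : ℕ) (θ δ′ τ : ℚ) (θ≡ : θ ≡ ½ ^ kk) (δ′≡ : δ′ ≡ 1/4 * θ ^ suc (suc q ℕ.* 16)) (τ≡ : τ ≡ ½ * ½ * ((½ * δ′) ^ m) ^ b) where

    0<θ : 0ℚ < θ
    0<θ = subst (0ℚ <_) (sym θ≡) (0<^ kk (ℚ.positive⁻¹ ½))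

    θ≤1 : θ ≤ 1ℚ
    θ≤1 = subst (_≤ 1ℚ) (sym θ≡) (≤1^ kk 0≤½ (≤! {½} {1ℚ}))

    0<δ′ : 0ℚ < δ′
    0<δ′ = subst (0ℚ <_) (sym δ′≡) (0<* (ℚ.positive⁻¹ 1/4) (0<^ (suc (suc q ℕ.* 16)) 0<θ))

    δ′≤1 : δ′ ≤ 1ℚ
    δ′≤1 = subst (_≤ 1ℚ) (sym δ′≡) (≤-trans (*-mono (≤! {0ℚ} {1/4}) 0≤1 (≤! {1/4} {1ℚ}) (≤1^ (suc (suc q ℕ.* 16)) (<⇒≤ 0<θ) θ≤1)) (≤-reflexive (*-identityˡ 1ℚ)))

    0<τ : 0ℚ < τ
    0<τ = subst (0ℚ <_) (sym τ≡) (0<* (ℚ.positive⁻¹ (½ * ½)) (0<^ b (0<^ m (0<* (ℚ.positive⁻¹ ½) 0<δ′))))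

    τ≤1 : τ ≤ 1ℚ
    τ≤1 = subst (_≤ 1ℚ) (sym τ≡) (≤-trans (*-mono (≤! {0ℚ} {½ * ½}) 0≤1 (≤! {½ * ½} {1ℚ}) (≤1^ b (0≤^ m (0≤* 0≤½ (<⇒≤ 0<δ′))) (≤1^ m (0≤* 0≤½ (<⇒≤ 0<δ′)) (≤-trans (*-mono 0≤½ 0≤1 (≤! {½} {1ℚ}) δ′≤1) (≤-reflexive (*-identityˡ 1ℚ)))))) (≤-reflexive (*-identityˡ 1ℚ)))

    δ′-cond : 2ℚ * 2ℚ * (δ′ * inv θ ^ suc (suc q ℕ.* 16)) ≤ 1ℚ
    δ′-cond = subst (λ d → 2ℚ * 2ℚ * (d * inv θ ^ r) ≤ 1ℚ) (sym δ′≡) (≤-reflexive (trans (eq (θ ^ r) (inv θ ^ r)) (trans (sym (^-distrib-* θ (inv θ) r)) (trans (cong (_^ r) (inv-pos 0<θ)) (1^ r)))))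
      where
      r = suc (suc q ℕ.* 16)
      eq : ∀ a b → 2ℚ * 2ℚ * (1/4 * a * b) ≡ a * b
      eq = solve-∀ ℚ-ring

    module _ (gs : List ℤ) (L′ L₁ : ℕ) (big : 2 ℕ.^ kk ℕ.* 8 ℕ.≤ L′) (L′≤L₁ : L′ ℕ.≤ L₁) (1≤L₁ : 1 ℕ.≤ L₁) (1≤gs : 1 ℕ.≤ length gs) where

      8≤θP : + 8 / 1 ≤ θ * # (box gs ℤ.0ℤ L₁)
      8≤θP = ≤-trans (≤-reflexive eight) (*-monoˡ (<⇒≤ 0<θ) (≤-trans (ι-mono (ℕ.≤-trans big L′≤L₁)) (≤-trans (one-factor (length gs) 1≤gs) (≤-reflexive (sym (#-box gs ℤ.0ℤ L₁))))))
        where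
        eight : + 8 / 1 ≡ θ * ι (2 ℕ.^ kk ℕ.* 8)
        eight = sym (trans (cong₂ _*_ θ≡ (trans (ι-* (2 ℕ.^ kk) 8) (cong (_* ι 8) (ι-^ 2 kk)))) (trans (eq (½ ^ kk) (ι 2 ^ kk)) (trans (cong (ι 8 *_) (trans (sym (^-distrib-* ½ (ι 2) kk)) (1^ kk))) (*-identityʳ (ι 8)))))
          where
          eq : ∀ t x → t * (x * ι 8) ≡ ι 8 * (t * x)
          eq = solve-∀ ℚ-ring
        one-factor : ∀ d → 1 ℕ.≤ d → ι L₁ ≤ ι L₁ ^ d
        one-factor (suc d) _ = ≤-trans (≤-reflexive (sym (*-identityʳ (ι L₁)))) (*-monoˡ (0≤ι L₁) (1≤^ d (≤-trans (≤-reflexive (sym (+-identityʳ 1ℚ))) (ι-mono 1≤L₁))))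

  module Cellsize (n L′ M : ℕ) (η : ℚ) (1≤n : 1 ℕ.≤ n) (1≤L′ : 1 ℕ.≤ L′) (1≤M : 1 ℕ.≤ M) (hη : ι (N₀ ℕ.* M) * η ≡ 1ℚ) where

    -- Chosen so that `n * L′` steps of size `2 / Kc`, the closeness within a cell, add up to
    -- `η = 1 / (N₀ * M)`.
    Kc : ℕ
    Kc = n ℕ.* (L′ ℕ.* (N₀ ℕ.* M ℕ.* 2))

    Kc₊ : 1 ℕ.≤ Kc
    Kc₊ = ℕ.*-mono-≤ 1≤n (ℕ.*-mono-≤ 1≤L′ (ℕ.*-mono-≤ {1} {N₀ ℕ.* M} {1} {2} (ℕ.*-mono-≤ 1≤N₀ 1≤M) (ℕ.s≤s ℕ.z≤n)))
    0<Kc : 0ℚ < ι Kc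
    0<Kc = 0<ι′ Kc₊
    cells-small : ι n * (ι L′ * (2ℚ * inv (ι Kc))) ≤ η
    cells-small = ≤-reflexive (trans (sym (*-identityˡ _)) (trans (cong (_* (ι n * (ι L′ * (2ℚ * inv (ι Kc))))) (sym hη)) (trans (eq (ι (N₀ ℕ.* M)) η (ι n) (ι L′) (inv (ι Kc))) (trans (cong (η *_) (trans (cong (_* inv (ι Kc)) Kc≡) (inv-pos 0<Kc))) (*-identityʳ η)))))
      where
      eq : ∀ m e n l i → m * e * (n * (l * (2ℚ * i))) ≡ e * (2ℚ * m * n * l * i)
      eq = solve-∀ ℚ-ring
      eqn : ∀ n l m → n ℕ.* (l ℕ.* (m ℕ.* 2)) ≡ 2 ℕ.* m ℕ.* n ℕ.* l
      eqn = ℕ.solve-∀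
      Kc≡ : 2ℚ * ι (N₀ ℕ.* M) * ι n * ι L′ ≡ ι Kc
      Kc≡ = sym (trans (cong ι (eqn n L′ (N₀ ℕ.* M))) (trans (ι-* (2 ℕ.* (N₀ ℕ.* M) ℕ.* n) L′) (cong (_* ι L′) (trans (ι-* (2 ℕ.* (N₀ ℕ.* M)) n) (cong (_* ι n) (ι-* 2 (N₀ ℕ.* M)))))))
    hMη : ι M * η ≤ 1/1024
    hMη = ≤-reflexive (quotient (ι N₀) (ι M) η 1/1024 ιN₀ (trans (cong (_* η) (sym (ι-* N₀ M))) hη))

  module Combine (gs : List ℤ) (L L₁ L₂ L′ ℓ m b M K Kc Z s n kk q : ℕ) (θ δ′ τ ε η : ℚ)
    (len : length gs ≡ s ℕ.+ n) (proper : Proper (L ℕ.+ L) gs)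
    (1≤n : 1 ℕ.≤ n) (1≤L′ : 1 ℕ.≤ L′) (1≤L₂ : 1 ℕ.≤ L₂) (1≤L₁ : 1 ℕ.≤ L₁) (1≤L : 1 ℕ.≤ L) (L′≤L₁ : L′ ℕ.≤ L₁) (L₁≤ : L₁ ℕ.≤ L)
    (U≤ : L₁ ℕ.+ (L₁ ℕ.+ L₁) ℕ.+ (L₁ ℕ.+ (L₁ ℕ.+ L₁)) ℕ.≤ L) (small : n ℕ.* ((L′ ℕ.+ L′) ℕ.* Z) ℕ.≤ L ℕ.+ L)
    (U-cond : N₀ ℕ.* ((s ℕ.+ n) ℕ.* (L₁ ℕ.+ (L₁ ℕ.+ L₁) ℕ.+ (L₁ ℕ.+ (L₁ ℕ.+ L₁)))) ℕ.≤ L) (E-cond : N₀ ℕ.* ((s ℕ.+ n) ℕ.* (L₁ ℕ.+ L₁ ℕ.+ (L₁ ℕ.+ L₁))) ℕ.≤ L)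
    (Pm-cond : 2 ℕ.* ((s ℕ.+ n) ℕ.* (L₂ ℕ.+ L₂)) ℕ.≤ L₁) (Pp-cond : 2 ℕ.* ((s ℕ.+ n) ℕ.* (ℓ ℕ.* (L₂ ℕ.+ L₂) ℕ.+ ℓ ℕ.* (L₂ ℕ.+ L₂))) ℕ.≤ L₁)
    (P₂-cond : 2 ℕ.* ((s ℕ.+ n) ℕ.* (M ℕ.* K ℕ.* (n ℕ.* (L′ ℕ.* Z)) ℕ.+ M ℕ.* K ℕ.* (n ℕ.* (L′ ℕ.* Z)))) ℕ.≤ L₂) (H-cond : N₀ ℕ.* ((s ℕ.+ n) ℕ.* (n ℕ.* (L′ ℕ.* Z) ℕ.+ n ℕ.* (L′ ℕ.* Z))) ℕ.≤ L₁) (big : 2 ℕ.^ kk ℕ.* 8 ℕ.≤ L′)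
    (θ≡ : θ ≡ ½ ^ kk) (δ′≡ : δ′ ≡ 1/4 * θ ^ suc (suc q ℕ.* 16)) (τ≡ : τ ≡ ½ * ½ * ((½ * δ′) ^ m) ^ b)
    (0<ε : 0ℚ < ε) (0<m : 0ℚ < ι m) (hm : 16ℚ * ι m ≤ (ε * ι m) * (ε * ι m)) (h₁ : ι ℓ * (2ℚ * ε) ≤ 1/128) (h₂ : ι ℓ * (+ 8 / 1 * inv (2ℚ ^ b)) ≤ 1/128 * δ′)
    (hpar : 2ℚ * 2ℚ * (+ 64 / 1 * 17/16 ^ suc (suc q ℕ.* 16)) ≤ 16ℚ ^ suc q * (θ * 49/64 ^ suc q - 1/4 ^ suc q))
    (hK : 2ℚ ≤ (1ℚ + 1/1024) ^ K * τ) (hM : 2ℚ ≤ 10/9 ^ M * τ) (hℓ : ½ ^ ℓ * (inv θ + 1ℚ) ≤ 1/1024)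
    (0≤η : 0ℚ ≤ η) (η≤1 : η ≤ 1ℚ) (hMη : ι M * η ≤ 1/1024) (0<Kc : 0ℚ < ι Kc) (cells-small : ι n * (ι L′ * (2ℚ * inv (ι Kc))) ≤ η)
    (crowded : (suc (Kc ℕ.+ Kc) ℕ.* suc (Kc ℕ.+ Kc)) ℕ.^ M ℕ.< Z ℕ.^ s)
    where

    D H : ℕ
    D = s ℕ.+ n
    H = n ℕ.* (L′ ℕ.* Z)

    open Densities kk q m b θ δ′ τ θ≡ δ′≡ τ≡

    1≤gs : 1 ℕ.≤ length gs
    1≤gs = subst (1 ℕ.≤_) (sym len) (ℕ.≤-trans 1≤n (ℕ.m≤n+m n s))

    with-D : ∀ {N X Y} → N ℕ.* (D ℕ.* X) ℕ.≤ Y → N ℕ.* (length gs ℕ.* X) ℕ.≤ Y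
    with-D {N} {X} {Y} = subst (λ d → N ℕ.* (d ℕ.* X) ℕ.≤ Y) (sym len)

    smooth : Smoothing gs L₁ L′ n Z δ′ (inv θ)
    smooth = Chain.smoothing gs L₁ L₂ L′ ℓ m b M K Kc Z s n ε δ′ τ η (inv θ) 0<ε 0<δ′ 0<m hm h₁ h₂ τ≡ 0<τ τ≤1 hK hM hℓ 0≤η η≤1 hMη 0<Kc cells-small crowded len 1≤L₁ 1≤L₂
      (box-double gs L₂ L₁ 1≤gs 1≤L₁ (with-D {2} Pm-cond)) (box-double gs (ℓ ℕ.* (L₂ ℕ.+ L₂)) L₁ 1≤gs 1≤L₁ (with-D {2} Pp-cond)) (box-double gs (M ℕ.* K ℕ.* H) L₂ 1≤gs 1≤L₂ (with-D {2} P₂-cond))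

    combine : ∀ σ → 0ℚ ≤ σ → θ ≤ σ * (1ℚ - η₀) * (1ℚ - η₀) → Instance gs L σ →
      ∃ λ gs′ → length gs′ ≡ n × Proper (L′ ℕ.+ L′) gs′ × Instance gs′ L′ (65/64 * (1ℚ - η₀) * (σ * (1ℚ - η₀) * (1ℚ - η₀)))
    combine = Round.round gs L L₁ L′ n Z q θ δ′ 1≤L 1≤L₁ 1≤L′ (Proper-mono {gs} (ℕ.+-monoʳ-≤ L U≤) proper) (Proper-mono {gs} (ℕ.≤-trans L₁≤ (ℕ.m≤m+n L L)) proper) proper small
      (growth₀ (L₁ ℕ.+ (L₁ ℕ.+ L₁)) 1≤L U-cond) (growth₀ (L₁ ℕ.+ L₁) 1≤L E-cond) (growth₀ H 1≤L₁ H-cond) 0<θ (<⇒≤ 0<δ′) δ′-cond hpar (8≤θP gs L′ L₁ big L′≤L₁ 1≤L₁ 1≤gs) smooth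
      where
      growth₀ : ∀ B {N} → 1 ℕ.≤ N → N₀ ℕ.* (D ℕ.* (B ℕ.+ B)) ℕ.≤ N → # (ext gs B N) * (1ℚ - η₀) ≤ # (box gs ℤ.0ℤ N)
      growth₀ B {N} 1≤N h = box-growth gs B N {η₀} N₀ 1≤gs 1≤N (≤! {0ℚ} {η₀}) ιN₀ (with-D {N₀} h) 1≤N₀

-- Numerical inequalities between the parameters

module ParameterBounds where

  open Rationals
  open Sums
  open Unbalancing using (17/16; 16ℚ; 1/4)
  open AlmostPeriods using (4ℚ)
  open Columns using (49/64)
  open SmoothCorrelations using (1/128; 1/1024)

  3ℚ 12ℚ 49/4 : ℚ
  3ℚ = + 3 / 1
  12ℚ = + 12 / 1
  49/4 = + 49 / 4

  ½^-2^ : ∀ n → ½ ^ n * 2ℚ ^ n ≡ 1ℚ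
  ½^-2^ n = trans (sym (^-distrib-* ½ 2ℚ n)) (1^ n)

  0<½^ : ∀ n → 0ℚ < ½ ^ n
  0<½^ n = 0<^ n (ℚ.positive⁻¹ ½)

  inv-½^ : ∀ n → inv (½ ^ n) ≡ 2ℚ ^ n
  inv-½^ n = trans (sym (*-identityʳ _)) (trans (cong (inv (½ ^ n) *_) (sym (½^-2^ n))) (trans (eq (inv (½ ^ n)) (½ ^ n) (2ℚ ^ n)) (trans (cong (_* 2ℚ ^ n) (inv-pos (0<½^ n))) (*-identityˡ _))))
    where
    eq : ∀ i h t → i * (h * t) ≡ h * i * t
    eq = solve-∀ ℚ-ring

  inv-2^ : ∀ n → inv (2ℚ ^ n) ≡ ½ ^ n
  inv-2^ n = trans (sym (*-identityʳ _)) (trans (cong (inv (2ℚ ^ n) *_) (sym (½^-2^ n))) (trans (eq (inv (2ℚ ^ n)) (½ ^ n) (2ℚ ^ n)) (trans (cong (_* ½ ^ n) (inv-pos (0<^ n (ℚ.positive⁻¹ 2ℚ)))) (*-identityˡ _))))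
    where
    eq : ∀ i h t → i * (h * t) ≡ t * i * h
    eq = solve-∀ ℚ-ring

  -- Both sides are compared with `4 ^ e`: `16 * 49/64 = 49/4 ≥ 3 * 4`, `16 * 1/4 = 4` and
  -- `(17/16) ^ 16 ≤ 4`. The constant is `273 = 4 * 64 * 17/16 + 1`.
  unbalance-parameter : ∀ θ e → + 273 / 1 ≤ θ * 3ℚ ^ e → 0ℚ ≤ θ → 2ℚ * 2ℚ * (+ 64 / 1 * 17/16 ^ suc (e ℕ.* 16)) ≤ 16ℚ ^ e * (θ * 49/64 ^ e - 1/4 ^ e)
  unbalance-parameter θ e h 0≤θ = ≤-by _ (0≤+ (0≤+ (0≤* (≤! {0ℚ} {+ 272 / 1}) (0≤- small)) (0≤* (0≤- h) (0≤^ e (≤! {0ℚ} {4ℚ})))) (0≤* 0≤θ (0≤- large)))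
    (trans (expand (16ℚ ^ e) θ (49/64 ^ e) (1/4 ^ e)) (trans (cong₂ (λ x y → θ * x - y) (sym (^-distrib-* 16ℚ 49/64 e)) (sym (^-distrib-* 16ℚ 1/4 e))) (trans (eq θ (49/4 ^ e) (4ℚ ^ e) (3ℚ ^ e) ((17/16 ^ 16) ^ e))
      (cong₂ (λ x y → 2ℚ * 2ℚ * (+ 64 / 1 * (17/16 * x)) + (+ 272 / 1 * (4ℚ ^ e - x) + (θ * 3ℚ ^ e - + 273 / 1) * 4ℚ ^ e + θ * (49/4 ^ e - y))) (sym (^-* 17/16 e 16)) (sym (^-distrib-* 3ℚ 4ℚ e))))))
    where
    small : 17/16 ^ (e ℕ.* 16) ≤ 4ℚ ^ e
    small = ≤-trans (≤-reflexive (^-* 17/16 e 16)) (^-mono e (0≤^ 16 (≤! {0ℚ} {17/16})) (≤! {17/16 ^ 16} {4ℚ}))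
    large : 12ℚ ^ e ≤ 49/4 ^ e
    large = ^-mono e (≤! {0ℚ} {12ℚ}) (≤! {12ℚ} {49/4})
    expand : ∀ s t w v → s * (t * w - v) ≡ t * (s * w) - s * v
    expand = solve-∀ ℚ-ring
    eq : ∀ t w f h x → t * w - f ≡ 2ℚ * 2ℚ * (+ 64 / 1 * (17/16 * x)) + (+ 272 / 1 * (f - x) + (t * h - + 273 / 1) * f + t * (w - h * f))
    eq = solve-∀ ℚ-ring

  273≤ : ∀ kk → + 273 / 1 ≤ ½ ^ kk * 3ℚ ^ (kk ℕ.+ 10)
  273≤ kk = ≤-trans (≤! {+ 273 / 1} {3ℚ ^ 10}) (≤-trans (≤-reflexive (sym (*-identityˡ _))) (≤-trans (*-monoʳ (0≤^ 10 (≤! {0ℚ} {3ℚ})) (1≤^ kk (≤! {1ℚ} {½ * 3ℚ})))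
    (≤-reflexive (trans (cong (_* 3ℚ ^ 10) (^-distrib-* ½ 3ℚ kk)) (trans (*-assoc (½ ^ kk) (3ℚ ^ kk) (3ℚ ^ 10)) (cong (½ ^ kk *_) (sym (^-+ 3ℚ kk 10))))))))

  -- `½ ^ kk` cancels `inv (½ ^ kk)`; then `½ ^ 11` meets a sum of two terms that are at most `1`.
  transfer-parameter : ∀ kk → ½ ^ (kk ℕ.+ 11) * (inv (½ ^ kk) + 1ℚ) ≤ 1/1024
  transfer-parameter kk = ≤-trans (≤-reflexive (trans (cong₂ (λ x y → x * (y + 1ℚ)) (^-+ ½ kk 11) (inv-½^ kk)) (trans (eq (½ ^ kk) (2ℚ ^ kk) (½ ^ 11)) (cong (λ x → ½ ^ 11 * (x + ½ ^ kk)) (½^-2^ kk)))))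
    (≤-trans (*-monoˡ (0≤^ 11 0≤½) (+-mono-≤ (≤-refl {1ℚ}) (≤1^ kk 0≤½ (≤! {½} {1ℚ})))) (≤! {½ ^ 11 * (1ℚ + 1ℚ)} {1/1024}))
    where
    eq : ∀ h t c → h * c * (t + 1ℚ) ≡ c * (h * t + h)
    eq = solve-∀ ℚ-ring

  bernoulli⁺ : ∀ {x} n → 0ℚ ≤ x → 1ℚ + ι n * x ≤ (1ℚ + x) ^ n
  bernoulli⁺ {x} zero h = ≤-reflexive (trans (cong (λ y → 1ℚ + y) (*-zeroˡ x)) (+-identityʳ 1ℚ))
  bernoulli⁺ {x} (suc n) h = ≤-trans (≤-by (ι n * (x * x)) (0≤* (0≤ι n) (0≤sq x)) (eq x (ι n))) (*-monoˡ (0≤+ 0≤1 h) (bernoulli⁺ n h))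
    where
    eq : ∀ x m → (1ℚ + x) * (1ℚ + m * x) ≡ 1ℚ + (1ℚ + m) * x + m * (x * x)
    eq = solve-∀ ℚ-ring

  doubling : ∀ {x} n → 0ℚ ≤ x → ι n * x ≡ 1ℚ → 2ℚ ≤ (1ℚ + x) ^ n
  doubling {x} n h e = ≤-trans (≤-reflexive (cong (λ y → 1ℚ + y) (sym e))) (bernoulli⁺ n h)

  -- Of `t + 1` doublings, `t` pay for `½ ^ t` and one is left.
  absorb : ∀ {x} n t → 0ℚ ≤ x → 2ℚ ≤ x ^ n → 2ℚ ≤ x ^ (suc t ℕ.* n) * ½ ^ t
  absorb {x} n t 0≤x h = ≤-trans (≤-trans (≤-reflexive (trans (sym (*-identityʳ 2ℚ)) (trans (cong (2ℚ *_) (sym (½^-2^ t))) (eq (½ ^ t) (2ℚ ^ t))))) (*-monoʳ (0≤^ t 0≤½) (^-mono (suc t) 0≤2 h))) (≤-reflexive (cong (_* ½ ^ t) (sym (^-* x (suc t) n))))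
    where
    eq : ∀ a b → 2ℚ * (a * b) ≡ 2ℚ * b * a
    eq = solve-∀ ℚ-ring

  n≤2^n : ∀ n → n ℕ.≤ 2 ℕ.^ n
  n≤2^n zero = ℕ.z≤n
  n≤2^n (suc n) = ℕ.≤-trans (ℕ.+-mono-≤ (ℕ.m^n>0 2 n) (n≤2^n n)) (ℕ.≤-reflexive (cong (2 ℕ.^ n ℕ.+_) (sym (ℕ.+-identityʳ _))))

  ι≤2^ : ∀ n → ι n ≤ 2ℚ ^ n
  ι≤2^ n = ≤-trans (ι-mono (n≤2^n n)) (≤-reflexive (ι-^ 2 n))

  -- In the exponent `d` matches the density, `ℓ` pays for `ι ℓ ≤ 2 ^ ℓ`, and `12 = 3 + 7 + 2`
  -- covers `8`, `1/128` and `1/4`.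
  amplify-parameter : ∀ ℓ d → ι ℓ * (+ 8 / 1 * inv (2ℚ ^ (d ℕ.+ ℓ ℕ.+ 12))) ≤ 1/128 * (1/4 * ½ ^ d)
  amplify-parameter ℓ d = ≤-trans (*-monoʳ (0≤* (≤! {0ℚ} {+ 8 / 1}) (subst (0ℚ ≤_) (sym (inv-2^ (d ℕ.+ ℓ ℕ.+ 12))) (0≤^ (d ℕ.+ ℓ ℕ.+ 12) 0≤½))) (ι≤2^ ℓ))
    (≤-reflexive (trans (cong (λ x → 2ℚ ^ ℓ * (+ 8 / 1 * x)) (trans (inv-2^ (d ℕ.+ ℓ ℕ.+ 12)) (trans (^-+ ½ (d ℕ.+ ℓ) 12) (cong (_* ½ ^ 12) (^-+ ½ d ℓ))))) (trans (eq (2ℚ ^ ℓ) (½ ^ d) (½ ^ ℓ) (½ ^ 12)) (trans (cong (λ x → x * (½ ^ d * (+ 8 / 1 * ½ ^ 12))) (½^-2^ ℓ)) (eq₂ (½ ^ d))))))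
    where
    eq : ∀ t a b c → t * (+ 8 / 1 * (a * b * c)) ≡ b * t * (a * (+ 8 / 1 * c))
    eq = solve-∀ ℚ-ring
    eq₂ : ∀ a → 1ℚ * (a * (+ 8 / 1 * ½ ^ 12)) ≡ 1/128 * (1/4 * a)
    eq₂ = solve-∀ ℚ-ring

  density-power : ∀ d m b → ½ * ½ * ((½ * (1/4 * ½ ^ d)) ^ m) ^ b ≡ ½ ^ (2 ℕ.+ b ℕ.* (m ℕ.* (3 ℕ.+ d)))
  density-power d m b = trans (cong (λ x → ½ * ½ * (x ^ m) ^ b) (trans (eq₀ (½ ^ d)) (sym (^-+ ½ 3 d))))
    (trans (cong (λ x → ½ * ½ * x) (trans (cong (_^ b) (sym (^-* ½ m (3 ℕ.+ d)))) (sym (^-* ½ b (m ℕ.* (3 ℕ.+ d))))))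
      (sym (^-+ ½ 2 (b ℕ.* (m ℕ.* (3 ℕ.+ d))))))
    where
    eq₀ : ∀ a → ½ * (1/4 * a) ≡ ½ ^ 3 * a
    eq₀ = solve-∀ ℚ-ring

  abstract
    power-of-two : ∀ n → ∃ λ w → ι w ≡ 2ℚ ^ n × 1 ℕ.≤ w
    power-of-two n = 2 ℕ.^ n , ι-^ 2 n , ℕ.m^n>0 2 n

  -- With `ε = ½ ^ 8 / ℓ` and `m = ℓ² m₀` Chebyshev asks for `ε² m ≥ 16`, which `m₀ = 2 ^ 20` meets
  -- with equality.
  m₀ : ℕ
  m₀ = proj₁ (power-of-two 20)

  ιm₀ : ι m₀ * (½ ^ 16) ≡ 16ℚ
  ιm₀ = trans (cong (_* (½ ^ 16)) (trans (proj₁ (proj₂ (power-of-two 20))) (^-+ 2ℚ 4 16))) (trans (eq (2ℚ ^ 4) (2ℚ ^ 16) (½ ^ 16)) (cong (2ℚ ^ 4 *_) (½^-2^ 16)))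
    where
    eq : ∀ a b c → a * b * c ≡ a * (c * b)
    eq = solve-∀ ℚ-ring

  1≤m₀ : 1 ℕ.≤ m₀
  1≤m₀ = proj₂ (proj₂ (power-of-two 20))

  module Sampled (ℓ : ℕ) (1≤ℓ : 1 ℕ.≤ ℓ) where
    m : ℕ
    m = ℓ ℕ.* ℓ ℕ.* m₀

    ε : ℚ
    ε = ½ ^ 8 * inv (ι ℓ)

    0<ιℓ : 0ℚ < ι ℓ
    0<ιℓ = ℚ.<-≤-trans (0<ι 0) (ι-mono 1≤ℓ)

    0<ε : 0ℚ < ε
    0<ε = 0<* {½ ^ 8} (ℚ.positive⁻¹ (½ ^ 8)) (0<inv 0<ιℓ)

    1≤m : 1 ℕ.≤ m
    1≤m = ℕ.*-mono-≤ (ℕ.*-mono-≤ 1≤ℓ 1≤ℓ) 1≤m₀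

    tolerance : ι ℓ * (2ℚ * ε) ≤ 1/128
    tolerance = ≤-reflexive (trans (eq (ι ℓ) (inv (ι ℓ)) (½ ^ 8)) (trans (cong (λ x → x * (2ℚ * ½ ^ 8)) (inv-pos 0<ιℓ)) (*-identityˡ 1/128)))
      where
      eq : ∀ l i h → l * (2ℚ * (h * i)) ≡ l * i * (2ℚ * h)
      eq = solve-∀ ℚ-ring

    enough : 16ℚ * ι m ≤ (ε * ι m) * (ε * ι m)
    enough = ≤-reflexive (sym (trans (cong (λ x → (ε * x) * (ε * ι m)) ιm≡) (trans (eq (ι ℓ) (inv (ι ℓ)) (½ ^ 8) (ι m₀) (ι m)) (trans (cong₂ (λ x y → x * x * (y * ι m)) (inv-pos 0<ιℓ) (trans (cong (ι m₀ *_) (sym (^-+ ½ 8 8))) ιm₀)) (eq₁ (ι m))))))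
      where
      ιm≡ : ι m ≡ ι ℓ * ι ℓ * ι m₀
      ιm≡ = trans (ι-* (ℓ ℕ.* ℓ) m₀) (cong (_* ι m₀) (ι-* ℓ ℓ))
      eq : ∀ l i h w x → (h * i * (l * l * w)) * (h * i * x) ≡ l * i * (l * i) * (w * (h * h) * x)
      eq = solve-∀ ℚ-ring
      eq₁ : ∀ x → 1ℚ * 1ℚ * (16ℚ * x) ≡ 16ℚ * x
      eq₁ = solve-∀ ℚ-ring

-- The schedule of dimensions and side lengths

module Schedules where

  open Rationals
  open Sums
  open Unbalancing using (17/16; 16ℚ; 1/4)
  open RieszProducts using (10/9)
  open Boxes using (Proper)
  open Columns using (49/64)
  open SmoothCorrelations using (1/1024; 65/64)
  open NewInstance
  open SmoothingStep using (N₀; ιN₀; 1≤N₀; 0<ι′)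
  open StepConditions
  open ParameterBounds

  module Parameters (kk : ℕ) where

    -- For `θ = ½ ^ kk`, `r` is the moment exponent, `δ′ = ½ ^ d / 4` and `τ = ½ ^ t`. As `b`, `m`
    -- and `d` are quadratic in `kk`, `t` has degree six.
    q r d ℓ b m t : ℕ
    q = kk ℕ.+ 9
    r = suc (suc q ℕ.* 16)
    d = r ℕ.* kk
    ℓ = kk ℕ.+ 11
    b = d ℕ.+ ℓ ℕ.+ 12
    m = ℓ ℕ.* ℓ ℕ.* m₀
    t = 2 ℕ.+ b ℕ.* (m ℕ.* (3 ℕ.+ d))

    abstract
      -- `(10/9) ^ 7 ≥ 2` and `(1 + 1/1024) ^ 1024 ≥ 2`, each repeated `t + 1` times as in `absorb`.
      M K : ℕ
      M = suc t ℕ.* 7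
      K = suc t ℕ.* N₀

      M≡ : M ≡ suc t ℕ.* 7
      M≡ = refl

      K≡ : K ≡ suc t ℕ.* N₀
      K≡ = refl

    1≤ℓ : 1 ℕ.≤ ℓ
    1≤ℓ = ℕ.≤-trans (ℕ.s≤s ℕ.z≤n) (ℕ.m≤n+m 11 kk)

    1≤M : 1 ℕ.≤ M
    1≤M = subst (1 ℕ.≤_) (sym M≡) (ℕ.s≤s ℕ.z≤n)

    ε η : ℚ
    ε = Sampled.ε ℓ 1≤ℓ
    η = inv (ι (N₀ ℕ.* M))

    1≤NM : 1 ℕ.≤ N₀ ℕ.* M
    1≤NM = ℕ.*-mono-≤ 1≤N₀ 1≤M

    hη : ι (N₀ ℕ.* M) * η ≡ 1ℚ
    hη = inv-pos (0<ι′ 1≤NM)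

    0≤η : 0ℚ ≤ η
    0≤η = 0≤inv (0≤ι (N₀ ℕ.* M))

    η≤1 : η ≤ 1ℚ
    η≤1 = ≤-trans (≤-trans (≤-reflexive (sym (*-identityˡ η))) (*-monoʳ 0≤η (≤-trans (≤-reflexive (sym (+-identityʳ 1ℚ))) (ι-mono 1≤NM)))) (≤-reflexive hη)

    unbalance : 2ℚ * 2ℚ * (+ 64 / 1 * 17/16 ^ r) ≤ 16ℚ ^ suc q * (½ ^ kk * 49/64 ^ suc q - 1/4 ^ suc q)
    unbalance = unbalance-parameter (½ ^ kk) (suc q) (subst (λ e → + 273 / 1 ≤ ½ ^ kk * 3ℚ ^ e) (ℕ.+-suc kk 9) (273≤ kk)) (<⇒≤ (0<½^ kk))

    δ′≡ : 1/4 * ½ ^ d ≡ 1/4 * (½ ^ kk) ^ r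
    δ′≡ = cong (1/4 *_) (^-* ½ r kk)

    τ≡ : ½ ^ t ≡ ½ * ½ * ((½ * (1/4 * ½ ^ d)) ^ m) ^ b
    τ≡ = sym (density-power d m b)

    gain-K : 2ℚ ≤ (1ℚ + 1/1024) ^ K * ½ ^ t
    gain-K = subst (λ K → 2ℚ ≤ (1ℚ + 1/1024) ^ K * ½ ^ t) (sym K≡) $ absorb {1ℚ + 1/1024} N₀ t (≤! {0ℚ} {1ℚ + 1/1024}) (doubling {1/1024} N₀ (≤! {0ℚ} {1/1024}) ιN₀)

    gain-M : 2ℚ ≤ 10/9 ^ M * ½ ^ t
    gain-M = subst (λ M → 2ℚ ≤ 10/9 ^ M * ½ ^ t) (sym M≡) $ absorb {10/9} 7 t (≤! {0ℚ} {10/9}) (≤! {2ℚ} {10/9 ^ 7})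

  square-power : ∀ Z E M x s → 2 ℕ.≤ Z → x ℕ.≤ Z ℕ.^ E → s ≡ suc ((E ℕ.+ E) ℕ.* M) → (x ℕ.* x) ℕ.^ M ℕ.< Z ℕ.^ s
  square-power Z E M x _ 2≤Z h refl = ℕ.≤-<-trans (ℕ.≤-trans (ℕ.^-monoˡ-≤ M (ℕ.*-mono-≤ h h)) (ℕ.≤-reflexive (trans (cong (ℕ._^ M) (sym (ℕ.^-distribˡ-+-* Z E E))) (ℕ.^-*-assoc Z (E ℕ.+ E) M)))) (ℕ.^-monoʳ-< Z 2≤Z (ℕ.n<1+n ((E ℕ.+ E) ℕ.* M)))

  chain-power : ∀ Z D L N a E → .{{ℕ.NonZero Z}} → 1 ℕ.≤ D ℕ.* (L ℕ.* (N ℕ.* 2)) → L ℕ.≤ Z ℕ.^ a → D ℕ.≤ Z → N ℕ.* 6 ℕ.≤ Z → a ℕ.+ 2 ℕ.≤ E → suc (D ℕ.* (L ℕ.* (N ℕ.* 2)) ℕ.+ D ℕ.* (L ℕ.* (N ℕ.* 2))) ℕ.≤ Z ℕ.^ E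
  chain-power Z D L N a E 1≤Kc L≤ D≤ N≤ exponent = ℕ.≤-trans (ℕ.+-monoˡ-≤ (Kc ℕ.+ Kc) 1≤Kc) (ℕ.≤-trans (ℕ.≤-reflexive (eq D L N))
      (ℕ.≤-trans (ℕ.*-mono-≤ L≤ (ℕ.*-mono-≤ D≤ N≤)) (ℕ.≤-trans (ℕ.≤-reflexive (trans (cong (λ x → Z ℕ.^ a ℕ.* (Z ℕ.* x)) (sym (ℕ.*-identityʳ Z))) (sym (ℕ.^-distribˡ-+-* Z a 2)))) (ℕ.^-monoʳ-≤ Z exponent))))
    where
    Kc = D ℕ.* (L ℕ.* (N ℕ.* 2))
    eq : ∀ d l x → d ℕ.* (l ℕ.* (x ℕ.* 2)) ℕ.+ (d ℕ.* (l ℕ.* (x ℕ.* 2)) ℕ.+ d ℕ.* (l ℕ.* (x ℕ.* 2))) ≡ l ℕ.* (d ℕ.* (x ℕ.* 6))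
    eq = ℕ.solve-∀

  module Schedule (kk steps Z : ℕ) where

    open Parameters kk

    -- `Z ^ E` bounds the subdivisions of one axis in every round. A cell needs two axes for each of
    -- `M` frequencies, hence `2 E M` powers of `Z`, and one more for the strict inequality of the
    -- pigeonhole principle.
    E s : ℕ
    E = steps ℕ.* 5 ℕ.+ 3
    s = suc ((E ℕ.+ E) ℕ.* M)

    -- Indexed by the number of rounds still to come, so that the final progression, with one
    -- generator, is at index `0`.
    D L : ℕ → ℕ
    D zero = 1
    D (suc j) = s ℕ.+ D j
    L zero = 2 ℕ.^ kk ℕ.* 8
    L (suc j) = L j ℕ.* (Z ℕ.* (Z ℕ.* Z)) ℕ.* Z ℕ.* Z

    D-mono : ∀ {i j} → i ℕ.≤ j → D i ℕ.≤ D j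
    D-mono {zero} {zero} h = ℕ.≤-refl
    D-mono {zero} {suc j} h = ℕ.≤-trans (D-mono {zero} {j} ℕ.z≤n) (ℕ.m≤n+m (D j) s)
    D-mono {suc i} {suc j} (ℕ.s≤s h) = ℕ.+-monoʳ-≤ s (D-mono h)

    1≤D : ∀ j → 1 ℕ.≤ D j
    1≤D j = D-mono {zero} {j} ℕ.z≤n

    module Descent (h₁ : D steps ℕ.* (N₀ ℕ.* 6) ℕ.≤ Z) (h₂ : D steps ℕ.* (ℓ ℕ.* 8) ℕ.≤ Z) (h₃ : D steps ℕ.* (M ℕ.* K ℕ.* 4) ℕ.≤ Z) (h₄ : N₀ ℕ.* M ℕ.* 6 ℕ.≤ Z) (h₅ : 2 ℕ.^ kk ℕ.* 8 ℕ.≤ Z) where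

      D≤Z : ∀ {j} → j ℕ.≤ steps → D j ℕ.≤ Z
      D≤Z h = ℕ.≤-trans (D-mono h) (ℕ.≤-trans (ℕ.≤-trans (ℕ.≤-reflexive (sym (ℕ.*-identityʳ (D steps)))) (ℕ.*-monoʳ-≤ (D steps) (ℕ.*-mono-≤ {1} {N₀} {1} {6} 1≤N₀ (ℕ.s≤s ℕ.z≤n)))) h₁)

      2≤Z : 2 ℕ.≤ Z
      2≤Z = ℕ.≤-trans (ℕ.≤-trans (ℕ.s≤s (ℕ.s≤s ℕ.z≤n)) (ℕ.*-mono-≤ {1} {2 ℕ.^ kk} {8} {8} (ℕ.m^n>0 2 kk) ℕ.≤-refl)) h₅

      1≤Z : 1 ℕ.≤ Z
      1≤Z = ℕ.≤-trans (ℕ.s≤s ℕ.z≤n) 2≤Z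

      instance
        nonZero : ℕ.NonZero Z
        nonZero = ℕ.>-nonZero 1≤Z

      L≤L : ∀ j → L j ℕ.≤ L (suc j)
      L≤L j = ℕ.≤-trans (ℕ.≤-reflexive (eq₁ (L j))) (ℕ.*-mono-≤ (ℕ.*-mono-≤ (ℕ.*-monoʳ-≤ (L j) (ℕ.*-mono-≤ 1≤Z (ℕ.*-mono-≤ 1≤Z 1≤Z))) 1≤Z) 1≤Z)
        where
        eq₁ : ∀ x → x ≡ x ℕ.* (1 ℕ.* (1 ℕ.* 1)) ℕ.* 1 ℕ.* 1
        eq₁ = ℕ.solve-∀

      L₀≤L : ∀ j → 2 ℕ.^ kk ℕ.* 8 ℕ.≤ L j
      L₀≤L zero = ℕ.≤-refl
      L₀≤L (suc j) = ℕ.≤-trans (L₀≤L j) (L≤L j)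

      1≤L : ∀ j → 1 ℕ.≤ L j
      1≤L j = ℕ.≤-trans (ℕ.*-mono-≤ {1} {2 ℕ.^ kk} {1} {8} (ℕ.m^n>0 2 kk) (ℕ.s≤s ℕ.z≤n)) (L₀≤L j)

      L≤Z^ : ∀ j → L j ℕ.≤ Z ℕ.^ (j ℕ.* 5 ℕ.+ 1)
      L≤Z^ zero = ℕ.≤-trans h₅ (ℕ.≤-reflexive (sym (ℕ.^-identityʳ Z)))
      L≤Z^ (suc j) = ℕ.≤-trans (ℕ.*-monoˡ-≤ Z (ℕ.*-monoˡ-≤ Z (ℕ.*-monoˡ-≤ (Z ℕ.* (Z ℕ.* Z)) (L≤Z^ j)))) (ℕ.≤-reflexive (eq (Z ℕ.^ (j ℕ.* 5 ℕ.+ 1)) Z))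
        where
        eq : ∀ x z → x ℕ.* (z ℕ.* (z ℕ.* z)) ℕ.* z ℕ.* z ≡ z ℕ.* (z ℕ.* (z ℕ.* (z ℕ.* (z ℕ.* x))))
        eq = ℕ.solve-∀

      crowded : ∀ j → suc j ℕ.≤ steps → let Kc = D j ℕ.* (L j ℕ.* (N₀ ℕ.* M ℕ.* 2)) in (suc (Kc ℕ.+ Kc) ℕ.* suc (Kc ℕ.+ Kc)) ℕ.^ M ℕ.< Z ℕ.^ s
      crowded j j< = square-power Z E M (suc (Kc ℕ.+ Kc)) s 2≤Z side≤ refl
        where
        Kc = D j ℕ.* (L j ℕ.* (N₀ ℕ.* M ℕ.* 2))
        1≤Kc : 1 ℕ.≤ Kc
        1≤Kc = ℕ.*-mono-≤ (1≤D j) (ℕ.*-mono-≤ (1≤L j) (ℕ.*-mono-≤ {1} {N₀ ℕ.* M} {1} {2} 1≤NM (ℕ.s≤s ℕ.z≤n)))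
        exponent : j ℕ.* 5 ℕ.+ 1 ℕ.+ 2 ℕ.≤ E
        exponent = ℕ.≤-trans (ℕ.≤-reflexive (ℕ.+-assoc (j ℕ.* 5) 1 2)) (ℕ.+-monoˡ-≤ 3 (ℕ.*-monoˡ-≤ 5 (ℕ.<⇒≤ j<)))
        side≤ : suc (Kc ℕ.+ Kc) ℕ.≤ Z ℕ.^ E
        side≤ = chain-power Z (D j) (L j) (N₀ ℕ.* M) (j ℕ.* 5 ℕ.+ 1) E 1≤Kc (L≤Z^ j) (D≤Z (ℕ.<⇒≤ j<)) h₄ exponent

      module At (j : ℕ) (j< : suc j ℕ.≤ steps) where
        scaled : ∀ {x} → D steps ℕ.* x ℕ.≤ Z → (s ℕ.+ D j) ℕ.* x ℕ.≤ Z
        scaled {x} h = ℕ.≤-trans (ℕ.*-monoˡ-≤ x (D-mono {suc j} {steps} j<)) h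

        module Le = Lengths s (D j) ℓ M K Z (L j) (1≤D j) (1≤L j) (D≤Z (ℕ.<⇒≤ j<)) 1≤Z (scaled h₁) (scaled h₂) (scaled h₃)
        module Ce = Cellsize (D j) (L j) M η (1≤D j) (1≤L j) 1≤M hη

        step : ∀ gs → length gs ≡ D (suc j) → Proper (L (suc j) ℕ.+ L (suc j)) gs → ∀ σ → 0ℚ ≤ σ → ½ ^ kk ≤ σ * (1ℚ - η₀) * (1ℚ - η₀) → Instance gs (L (suc j)) σ →
          ∃ λ gs′ → length gs′ ≡ D j × Proper (L j ℕ.+ L j) gs′ × Instance gs′ (L j) (65/64 * (1ℚ - η₀) * (σ * (1ℚ - η₀) * (1ℚ - η₀)))
        step gs len proper = Combine.combine gs Le.L Le.L₁ Le.L₂ (L j) ℓ m b M K Ce.Kc Z s (D j) kk q (½ ^ kk) (1/4 * ½ ^ d) (½ ^ t) ε η len proper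
          (1≤D j) (1≤L j) Le.1≤L₂ Le.1≤L₁ Le.1≤L Le.L′≤L₁ Le.L₁≤ Le.U≤ Le.small Le.U-cond Le.E-cond Le.Pm-cond Le.Pp-cond Le.P₂-cond Le.H-cond (L₀≤L j)
          refl δ′≡ τ≡ (Sampled.0<ε ℓ 1≤ℓ) (0<ι′ (Sampled.1≤m ℓ 1≤ℓ)) (Sampled.enough ℓ 1≤ℓ) (Sampled.tolerance ℓ 1≤ℓ) (amplify-parameter ℓ d) unbalance gain-K gain-M (transfer-parameter kk)
          0≤η η≤1 Ce.hMη Ce.0<Kc Ce.cells-small (crowded j j<)

-- Iterating the increment

module Descents where

  open Rationals
  open Sums
  open Boxes using (Proper; box)
  open SmoothCorrelations using (65/64)
  open NewInstance
  open SmoothingStep using (#box>0; N₀)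
  open ParameterBounds
  open Schedules

  Instance-mono : ∀ {gs L σ σ′} → σ′ ≤ σ → Instance gs L σ → Instance gs L σ′
  Instance-mono {gs} {L} h (A , free , dense) = A , free , ≤-trans (*-monoʳ (0≤* (0≤# (box gs ℤ.0ℤ L)) (0≤# (box gs ℤ.0ℤ L))) h) dense

  mass≤ : ∀ A W → mass A W ≤ # W * # W
  mass≤ A W = ≤-trans (∑-mono W (λ x → ∑-mono W (λ y → 𝟙≤1 (A x y)))) (≤-reflexive (∑-const W (# W)))

  Instance≤1 : ∀ {gs L σ} → 1 ℕ.≤ L → Instance gs L σ → σ ≤ 1ℚ
  Instance≤1 {gs} {L} {σ} 1≤L (A , _ , dense) = *-cancelˡ (0<* 0<W 0<W) (≤-trans (≤-reflexive (*-comm (# W * # W) σ)) (≤-trans dense (≤-trans (mass≤ A W) (≤-reflexive (sym (*-identityʳ _))))))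
    where
    W = box gs ℤ.0ℤ L
    0<W : 0ℚ < # W
    0<W = #box>0 gs ℤ.0ℤ 1≤L

  129/128 1/128′ : ℚ
  129/128 = + 129 / 128
  1/128′ = + 1 / 128

  -- The gain `65/64` outweighs three boundary losses `1 - η₀`.
  increment : ∀ {σ} → 0ℚ ≤ σ → 129/128 * σ ≤ 65/64 * (1ℚ - η₀) * (σ * (1ℚ - η₀) * (1ℚ - η₀))
  increment {σ} h = ≤-trans (*-monoʳ h (≤! {129/128} {65/64 * (1ℚ - η₀) * (1ℚ - η₀) * (1ℚ - η₀)})) (≤-reflexive (eq σ (65/64) (1ℚ - η₀)))
    where
    eq : ∀ s a q → a * q * q * q * s ≡ a * q * (s * q * q)
    eq = solve-∀ ℚ-ring

  module Iteration (kk steps Z : ℕ) where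

    open Parameters kk
    open Schedule kk steps Z

    module _ (h₁ : D steps ℕ.* (N₀ ℕ.* 6) ℕ.≤ Z) (h₂ : D steps ℕ.* (ℓ ℕ.* 8) ℕ.≤ Z) (h₃ : D steps ℕ.* (M ℕ.* K ℕ.* 4) ℕ.≤ Z) (h₄ : N₀ ℕ.* M ℕ.* 6 ℕ.≤ Z) (h₅ : 2 ℕ.^ kk ℕ.* 8 ℕ.≤ Z) where

      open Descent h₁ h₂ h₃ h₄ h₅

      descend : ∀ j → j ℕ.≤ steps → ∀ gs → length gs ≡ D j → Proper (L j ℕ.+ L j) gs → ∀ σ → 0ℚ ≤ σ → ½ ^ kk ≤ σ * (1ℚ - η₀) * (1ℚ - η₀) → Instance gs (L j) σ → 129/128 ^ j * σ ≤ 1ℚ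
      descend zero _ gs len proper σ 0≤σ hσ I = ≤-trans (≤-reflexive (*-identityˡ σ)) (Instance≤1 {gs} {L zero} (1≤L zero) I)
      descend (suc j) j< gs len proper σ 0≤σ hσ I = continue (At.step j j< gs len proper σ 0≤σ hσ I)
        where
        σ′ = 129/128 * σ
        σ≤σ′ : σ ≤ σ′
        σ≤σ′ = ≤-trans (≤-reflexive (sym (*-identityˡ σ))) (*-monoʳ 0≤σ (≤! {1ℚ} {129/128}))
        hσ′ : ½ ^ kk ≤ σ′ * (1ℚ - η₀) * (1ℚ - η₀)
        hσ′ = ≤-trans hσ (*-monoʳ (≤! {0ℚ} {1ℚ - η₀}) (*-monoʳ (≤! {0ℚ} {1ℚ - η₀}) σ≤σ′))
        eq : ∀ a x s → a * x * s ≡ x * (a * s)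
        eq = solve-∀ ℚ-ring
        continue : (∃ λ gs′ → length gs′ ≡ D j × Proper (L j ℕ.+ L j) gs′ × Instance gs′ (L j) (65/64 * (1ℚ - η₀) * (σ * (1ℚ - η₀) * (1ℚ - η₀)))) → 129/128 ^ suc j * σ ≤ 1ℚ
        continue (gs′ , len′ , proper′ , I′) = ≤-trans (≤-reflexive (eq (129/128) (129/128 ^ j) σ))
          (descend j (ℕ.<⇒≤ j<) gs′ len′ proper′ σ′ (≤-trans 0≤σ σ≤σ′) hσ′ (Instance-mono {gs′} {L j} (increment {σ} 0≤σ) I′))

  -- The density at least doubles in `128` rounds, so `128 * (kk + 1)` of them would lift it from
  -- `½ ^ kk` to `2`.
  exhaustion : ∀ kk steps Z (let open Parameters kk) (let open Schedule kk steps Z) → steps ≡ suc kk ℕ.* 128 → ∀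
    (h₁ : D steps ℕ.* (N₀ ℕ.* 6) ℕ.≤ Z) (h₂ : D steps ℕ.* (ℓ ℕ.* 8) ℕ.≤ Z) (h₃ : D steps ℕ.* (M ℕ.* K ℕ.* 4) ℕ.≤ Z) (h₄ : N₀ ℕ.* M ℕ.* 6 ℕ.≤ Z) (h₅ : 2 ℕ.^ kk ℕ.* 8 ℕ.≤ Z) →
    ∀ gs → length gs ≡ D steps → Proper (L steps ℕ.+ L steps) gs → ∀ σ → 0ℚ ≤ σ → ½ ^ kk ≤ σ * (1ℚ - η₀) * (1ℚ - η₀) → ¬ Instance gs (L steps) σ
  exhaustion kk steps Z steps≡ h₁ h₂ h₃ h₄ h₅ gs len proper σ 0≤σ hσ I = <⇒≱ {1ℚ} {2ℚ} (ℚ.*<* (ℤ.+<+ (ℕ.s≤s (ℕ.s≤s ℕ.z≤n)))) (≤-trans (gain steps≡) (≤-trans (*-monoˡ (0≤^ steps (≤! {0ℚ} {129/128})) θ≤σ)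
      (Iteration.descend kk steps Z h₁ h₂ h₃ h₄ h₅ steps ℕ.≤-refl gs len proper σ 0≤σ hσ I)))
    where
    gain : ∀ {n} → n ≡ suc kk ℕ.* 128 → 2ℚ ≤ 129/128 ^ n * ½ ^ kk
    gain refl = absorb {129/128} 128 kk (≤! {0ℚ} {129/128}) (doubling {1/128′} 128 (≤! {0ℚ} {1/128′}) refl)
    θ≤σ : ½ ^ kk ≤ σ
    θ≤σ = ≤-trans hσ (≤-by _ (0≤* 0≤σ (≤! {0ℚ} {1ℚ - (1ℚ - η₀) * (1ℚ - η₀)})) (eq σ (1ℚ - η₀)))
      where
      eq : ∀ s q → s ≡ s * q * q + s * (1ℚ - q * q)
      eq = solve-∀ ℚ-ring

-- The first progression inside the grid

module Embeddings where

  open Rationals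
  open Sums
  open Boxes
  open Columns using (SkewFree)
  open NewInstance using (mass; Instance; SkewFree-shift)
  open SmoothingStep using (0<ι′)
  open ParameterBounds using (½^-2^; 0<½^)
  open import Data.List.Properties using (length-map)
  open import Data.Product.Properties using (≡-dec)
  open import Data.List.Relation.Unary.Unique.Propositional using (Unique)
  open import Data.List.Relation.Unary.AllPairs using ([]; _∷_)
  open import Data.List.Relation.Unary.All using ([]; _∷_; lookup)
  open import Relation.Nullary.Decidable using (isYes)
  import Data.List.Membership.DecPropositional as DecMembership

  -- With these generators `dot` evaluates digits in base `Q`. Signed digits smaller than `Q` in
  -- modulus satisfy no nontrivial relation, as the lowest one would be divisible by `Q`.
  powers : ℕ → ℕ → List ℤ
  powers Q zero = []
  powers Q (suc d) = + 1 ∷ map (+ Q ℤ.*_) (powers Q d)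

  length-powers : ∀ Q d → length (powers Q d) ≡ d
  length-powers Q zero = refl
  length-powers Q (suc d) = cong suc (trans (length-map _ (powers Q d)) (length-powers Q d))

  dot-scale : ∀ a gs cs → dot (map (a ℤ.*_) gs) cs ≡ a ℤ.* dot gs cs
  dot-scale a [] cs = sym (ℤ.*-zeroʳ a)
  dot-scale a (g ∷ gs) [] = sym (ℤ.*-zeroʳ a)
  dot-scale a (g ∷ gs) (c ∷ cs) = trans (cong (λ y → c ℤ.* (a ℤ.* g) ℤ.+ y) (dot-scale a gs cs)) (eq a c g (dot gs cs))
    where
    eq : ∀ a c g x → c ℤ.* (a ℤ.* g) ℤ.+ a ℤ.* x ≡ a ℤ.* (c ℤ.* g ℤ.+ x)
    eq = ℤ.solve-∀

  Fit-map⁺ : ∀ {P f gs cs} → Fit P gs cs → Fit P (map f gs) cs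
  Fit-map⁺ [] = []
  Fit-map⁺ (p ∷ ps) = p ∷ Fit-map⁺ ps

  Fit-map⁻ : ∀ {P f} gs {cs} → Fit P (map f gs) cs → Fit P gs cs
  Fit-map⁻ [] [] = []
  Fit-map⁻ (g ∷ gs) (p ∷ ps) = p ∷ Fit-map⁻ gs ps

  digit-vanishes : ∀ {Q B} c x → B ℕ.< Q → Bounded B c → c ℤ.* + 1 ℤ.+ + Q ℤ.* x ≡ ℤ.0ℤ → x ≡ ℤ.0ℤ × c ≡ ℤ.0ℤ
  digit-vanishes {Q} {B} c x B<Q bound e = x≡0 , trans c≡ (trans (cong (λ x → ℤ.- (+ Q ℤ.* x)) x≡0) (cong ℤ.-_ (ℤ.*-zeroʳ (+ Q))))
    where
    eq : ∀ c y → c ≡ c ℤ.* + 1 ℤ.+ y ℤ.+ ℤ.- y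
    eq = ℤ.solve-∀
    c≡ : c ≡ ℤ.- (+ Q ℤ.* x)
    c≡ = trans (eq c (+ Q ℤ.* x)) (trans (cong (ℤ._+ ℤ.- (+ Q ℤ.* x)) e) (ℤ.+-identityˡ _))
    abs : Q ℕ.* ℤ.∣ x ∣ ≡ ℤ.∣ c ∣
    abs = sym (trans (cong ℤ.∣_∣ c≡) (trans (ℤ.∣-i∣≡∣i∣ (+ Q ℤ.* x)) (ℤ.∣i*j∣≡∣i∣*∣j∣ (+ Q) x)))
    small : ∀ m → Q ℕ.* m ≡ ℤ.∣ c ∣ → m ≡ 0
    small zero _ = refl
    small (suc m) h = ⊥-elim (ℕ.<⇒≱ B<Q (ℕ.≤-trans (ℕ.≤-trans (ℕ.m≤m*n Q (suc m)) (ℕ.≤-reflexive h)) bound))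
    x≡0 : x ≡ ℤ.0ℤ
    x≡0 = ℤ.∣i∣≡0⇒i≡0 (small ℤ.∣ x ∣ abs)

  powers-proper : ∀ {Q B} d → B ℕ.< Q → Proper B (powers Q d)
  powers-proper zero B<Q [] [] e = []
  powers-proper {Q} (suc d) B<Q (c ∷ cs) (p ∷ ps) e = use (digit-vanishes c (dot (powers Q d) cs) B<Q p (trans (cong (λ y → c ℤ.* + 1 ℤ.+ y) (sym (dot-scale (+ Q) (powers Q d) cs))) e))
    where
    use : dot (powers Q d) cs ≡ ℤ.0ℤ × c ≡ ℤ.0ℤ → Fit (_≡ ℤ.0ℤ) (powers Q (suc d)) (c ∷ cs)
    use (z , c0) = c0 ∷ Fit-map⁺ (powers-proper d B<Q cs (Fit-map⁻ (powers Q d) ps) z)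

  powers-range : ∀ {Q L} d cs → L ℕ.≤ Q → Fit (In ℤ.0ℤ L) (powers Q d) cs → ∃ λ v → dot (powers Q d) cs ≡ + v × v ℕ.< Q ℕ.^ d
  powers-range zero [] L≤Q [] = 0 , refl , ℕ.s≤s ℕ.z≤n
  powers-range {Q} (suc d) (c ∷ cs) L≤Q ((k , refl , k<) ∷ ps) with powers-range d cs L≤Q (Fit-map⁻ (powers Q d) ps)
  ... | v , e , v< = k ℕ.+ Q ℕ.* v , trans (cong (λ x → (ℤ.0ℤ ℤ.+ + k) ℤ.* + 1 ℤ.+ x) (trans (dot-scale (+ Q) (powers Q d) cs) (trans (cong (+ Q ℤ.*_) e) (sym (ℤ.pos-* Q v))))) (eq (+ k) (+ (Q ℕ.* v))) ,
    ℕ.<-≤-trans (ℕ.+-monoˡ-< (Q ℕ.* v) (ℕ.<-≤-trans k< L≤Q)) (ℕ.≤-trans (ℕ.≤-reflexive (sym (ℕ.*-suc Q v))) (ℕ.*-monoʳ-≤ Q v<))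
    where
    eq : ∀ k x → (+ 0 ℤ.+ k) ℤ.* + 1 ℤ.+ x ≡ k ℤ.+ x
    eq = ℤ.solve-∀

  open DecMembership (≡-dec ℤ._≟_ ℤ._≟_) using (_∈?_)

  member : List (ℤ × ℤ) → ℤ → ℤ → Bool
  member xs x y = isYes ((x , y) ∈? xs)

  count-members : ∀ (U xs : List (ℤ × ℤ)) → Unique xs → (∀ p → p ∈ xs → p ∈ U) → # xs ≤ ∑ U (λ p → 𝟙 (isYes (p ∈? xs)))
  count-members U [] _ _ = ≤-reflexive (sym (trans (∑-cong U {g = λ _ → 0ℚ} (λ p → none p)) (∑-0 U)))
    where
    none : ∀ p → 𝟙 (isYes (p ∈? [])) ≡ 0ℚ
    none p with p ∈? []
    ... | no _ = refl
  count-members U (x ∷ xs) (fresh ∷ unique) sub = ≤-trans (+-mono-≤ hit (count-members U xs unique (λ p p∈ → sub p (there p∈)))) (≤-trans (≤-reflexive (sym (∑-+ U _ _))) (∑-mono U split))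
    where
    eq? = ≡-dec ℤ._≟_ ℤ._≟_
    here! : ∀ p → 1ℚ ≤ 𝟙 (isYes (eq? p p))
    here! p with eq? p p
    ... | yes _ = ≤-refl
    ... | no h = ⊥-elim (h refl)
    hit : 1ℚ ≤ ∑ U (λ p → 𝟙 (isYes (eq? p x)))
    hit = ≤-trans (here! x) (term≤∑ (λ p → 0≤𝟙 (isYes (eq? p x))) (sub x (here refl)))
    split : ∀ p → 𝟙 (isYes (eq? p x)) + 𝟙 (isYes (p ∈? xs)) ≤ 𝟙 (isYes (p ∈? (x ∷ xs)))
    split p = go (eq? p x) (p ∈? xs) (p ∈? (x ∷ xs))
      where
      go : (a : Dec (p ≡ x)) (b : Dec (p ∈ xs)) (c : Dec (p ∈ x ∷ xs)) → 𝟙 (isYes a) + 𝟙 (isYes b) ≤ 𝟙 (isYes c)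
      go (yes refl) (yes q) c = ⊥-elim (lookup fresh q refl)
      go (yes e) (no _) (yes _) = ≤-refl
      go (yes e) (no _) (no h) = ⊥-elim (h (here e))
      go (no _) (yes q) (yes _) = ≤-refl
      go (no _) (yes q) (no h) = ⊥-elim (h (there q))
      go (no _) (no _) (yes _) = 0≤1
      go (no _) (no _) (no _) = ≤-refl

  ∈-pairs : ∀ {A B : Set} {xs : List A} {ys : List B} {x y} → x ∈ xs → y ∈ ys → (x , y) ∈ pairs xs ys
  ∈-pairs {xs = xs} {ys} {x} {y} x∈ y∈ = ∈-concat⁺′ (∈-map⁺ (x ,_) y∈) (∈-map⁺ (λ x → map (x ,_) ys) x∈)
    where open import Data.List.Membership.Propositional.Properties using (∈-concat⁺′; ∈-map⁺)

  grid : ℕ → List ℤ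
  grid n = range (+ 1) n

  translates : ℕ → ℕ → List ℤ
  translates T n = range (+ 1 ℤ.- + T) (T ℕ.+ n)

  ∑-translates : ∀ T n x → x ℕ.< T → ∀ (F : ℤ → ℚ) → (∀ z → 0ℚ ≤ F z) → ∑ (grid n) F ≤ ∑ (translates T n) (λ z → F (z ℤ.+ + x))
  ∑-translates T n x x<T F 0≤F = ≤-trans (≤-reflexive (∑-cong (grid n) (λ z → cong F (eq z (+ x)))))
    (∑-range-⊂ {a = ℤ.- (+ x)} (T ℕ.∸ x , x , eq₁ , eq₂) (λ z → F (z ℤ.+ + x)) (λ z → 0≤F (z ℤ.+ + x)))
    where
    x≤T = ℕ.<⇒≤ x<T
    eq : ∀ z x → z ≡ z ℤ.+ (ℤ.- x) ℤ.+ x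
    eq = ℤ.solve-∀
    eq₁′ : ∀ x d → + 1 ℤ.+ (ℤ.- x) ≡ + 1 ℤ.- (d ℤ.+ x) ℤ.+ d
    eq₁′ = ℤ.solve-∀
    eq₁ : + 1 ℤ.+ (ℤ.- (+ x)) ≡ + 1 ℤ.- + T ℤ.+ + (T ℕ.∸ x)
    eq₁ = trans (eq₁′ (+ x) (+ (T ℕ.∸ x))) (cong (λ t → + 1 ℤ.- + t ℤ.+ + (T ℕ.∸ x)) (ℕ.m∸n+n≡m x≤T))
    eq₂ : T ℕ.+ n ≡ T ℕ.∸ x ℕ.+ (n ℕ.+ x)
    eq₂ = trans (cong (ℕ._+ n) (sym (ℕ.m∸n+n≡m x≤T))) (trans (ℕ.+-assoc (T ℕ.∸ x) x n) (cong (λ y → T ℕ.∸ x ℕ.+ y) (ℕ.+-comm x n)))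

  module Embedding (xs : List (ℤ × ℤ)) (unique : Unique xs) (n : ℕ) (sub : ∀ p → p ∈ xs → p ∈ pairs (grid n) (grid n))
    (free : SkewFree (member xs)) (gs : List ℤ) (L T : ℕ) (1≤L : 1 ℕ.≤ L) (1≤n : 1 ℕ.≤ n) (T≤n : T ℕ.≤ n)
    (inside : ∀ w → w ∈ box gs ℤ.0ℤ L → ∃ λ v → w ≡ + v × v ℕ.< T) where

    A = member xs

    W R : List ℤ
    W = box gs ℤ.0ℤ L
    R = translates T n

    at : ℤ → ℤ → ℚ
    at a b = 𝟙 (A a b)

    0≤at : ∀ a b → 0ℚ ≤ at a b
    0≤at a b = 0≤𝟙 (A a b)

    total≥ : # xs ≤ ∑ (grid n) (λ a → ∑ (grid n) (at a))
    total≥ = ≤-trans (count-members (pairs (grid n) (grid n)) xs unique sub) (≤-reflexive (∑-pairs (grid n) (grid n) _))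

    cover : ∀ x y → x ∈ W → y ∈ W → # xs ≤ ∑ R (λ x₀ → ∑ R (λ y₀ → at (x₀ ℤ.+ x) (y₀ ℤ.+ y)))
    cover x y x∈ y∈ = use (inside x x∈) (inside y y∈)
      where
      use : (∃ λ v → x ≡ + v × v ℕ.< T) → (∃ λ v → y ≡ + v × v ℕ.< T) → # xs ≤ ∑ R (λ x₀ → ∑ R (λ y₀ → at (x₀ ℤ.+ x) (y₀ ℤ.+ y)))
      use (v , refl , v<) (w , refl , w<) = ≤-trans total≥ (≤-trans (∑-mono (grid n) (λ a → ∑-translates T n w w< (at a) (0≤at a)))
        (∑-translates T n v v< (λ a → ∑ R (λ y₀ → at a (y₀ ℤ.+ + w))) (λ a → 0≤∑ R (λ y₀ → 0≤at a (y₀ ℤ.+ + w)))))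

    shifted : ℤ × ℤ → ℤ → ℤ → Bool
    shifted (x₀ , y₀) x y = A (x₀ ℤ.+ x) (y₀ ℤ.+ y)

    average : # W * (# W * # xs) ≤ ∑ (pairs R R) (λ p → mass (shifted p) W)
    average = ≤-trans (≤-reflexive (sym (trans (∑-cong W (λ _ → ∑-const W (# xs))) (∑-const W _))))
      (≤-trans (∑-mono∈ W (λ x x∈ → ∑-mono∈ W (λ y y∈ → cover x y x∈ y∈)))
        (≤-reflexive (trans (∑-cong W (λ x → ∑-swap W R _)) (trans (∑-swap W R _) (trans (∑-cong R (λ x₀ → trans (∑-cong W (λ x → ∑-swap W R _)) (∑-swap W R _))) (sym (∑-pairs R R (λ p → mass (shifted p) W))))))))

    -- The average runs over `(T + n)² ≤ (2 n)²` translates, which explains the factor `½ * ½`.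
    instance-exists : ∀ k → n ℕ.* n ℕ.≤ 2 ℕ.^ k ℕ.* length xs → Instance gs L (½ * ½ * ½ ^ k)
    instance-exists k dense = use (≤-avg-∃ (pairs R R) {c = ½ * ½ * ½ ^ k * (# W * # W)} (subst (0ℚ <_) (sym size) (0<* 0<R 0<R)) (≤-trans bound average))
      where
      N = ι n
      r = ι (T ℕ.+ n)
      0<R : 0ℚ < r
      0<R = 0<ι′ (ℕ.≤-trans 1≤n (ℕ.m≤n+m n T))
      size : # (pairs R R) ≡ r * r
      size = trans (∑-pairs R R _) (trans (∑-const R (# R)) (cong₂ _*_ (#-range _ (T ℕ.+ n)) (#-range _ (T ℕ.+ n))))
      r≤2N : r ≤ N + N
      r≤2N = ≤-trans (ι-mono (ℕ.+-monoˡ-≤ n T≤n)) (≤-reflexive (ι-+ n n))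
      dense′ : N * N ≤ 2ℚ ^ k * # xs
      dense′ = ≤-trans (≤-reflexive (sym (ι-* n n))) (≤-trans (ι-mono dense) (≤-reflexive (trans (ι-* (2 ℕ.^ k) (length xs)) (cong₂ _*_ (ι-^ 2 k) (sym (#≡length xs))))))
      rr≤ : r * r ≤ (N + N) * (N + N)
      rr≤ = *-mono (0≤ι (T ℕ.+ n)) (0≤+ (0≤ι n) (0≤ι n)) r≤2N r≤2N
      bound : # (pairs R R) * (½ * ½ * ½ ^ k * (# W * # W)) ≤ # W * (# W * # xs)
      bound = ≤-trans (≤-reflexive (cong (_* (½ * ½ * ½ ^ k * (# W * # W))) size)) (≤-trans (*-monoʳ 0≤c rr≤)
        (≤-trans (≤-reflexive (eq N (½ ^ k) (# W))) (≤-trans (*-monoˡ (0≤* (0≤* (0≤# W) (0≤# W)) (<⇒≤ (0<½^ k))) dense′)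
          (≤-reflexive (trans (eq₂ (# W) (½ ^ k) (2ℚ ^ k) (# xs)) (trans (cong (_* (# W * (# W * # xs))) (½^-2^ k)) (*-identityˡ _)))))))
        where
        0≤c : 0ℚ ≤ ½ * ½ * ½ ^ k * (# W * # W)
        0≤c = 0≤* (0≤* (≤! {0ℚ} {½ * ½}) (<⇒≤ (0<½^ k))) (0≤* (0≤# W) (0≤# W))
        eq : ∀ n h w → (n + n) * (n + n) * (½ * ½ * h * (w * w)) ≡ w * w * h * (n * n)
        eq = solve-∀ ℚ-ring
        eq₂ : ∀ w h t x → w * w * h * (t * x) ≡ h * t * (w * (w * x))
        eq₂ = solve-∀ ℚ-ring
      use : (∃ λ p → p ∈ pairs R R × ½ * ½ * ½ ^ k * (# W * # W) ≤ mass (shifted p) W) → Instance gs L (½ * ½ * ½ ^ k)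
      use ((x₀ , y₀) , _ , h) = shifted (x₀ , y₀) , SkewFree-shift {A} x₀ (λ _ → y₀) free , h

-- Polynomial growth of the parameters

module Growth where

  open Rationals
  open Schedules
  open SmoothingStep using (N₀)
  open ParameterBounds using (n≤2^n; m₀)

  -- A degree with an unspecified constant; restricting to `k ≥ 1` lets lower powers be absorbed
  -- into higher ones.
  record Poly (e : ℕ) (f : ℕ → ℕ) : Set where
    constructor _,ₚ_
    field
      coefficient : ℕ
      bounded : ∀ k → 1 ℕ.≤ k → f k ℕ.≤ coefficient ℕ.* k ℕ.^ e

  Poly-mono : ∀ {e f g} → (∀ k → f k ℕ.≤ g k) → Poly e g → Poly e f
  Poly-mono h (C ,ₚ b) = C ,ₚ λ k 1≤k → ℕ.≤-trans (h k) (b k 1≤k)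

  Poly-raise : ∀ {e f} e′ → e ℕ.≤ e′ → Poly e f → Poly e′ f
  Poly-raise {e} e′ h (C ,ₚ b) = C ,ₚ λ k 1≤k → ℕ.≤-trans (b k 1≤k) (ℕ.*-monoʳ-≤ C (ℕ.^-monoʳ-≤ k {{ℕ.>-nonZero 1≤k}} h))

  Poly-const : ∀ c → Poly 0 (λ _ → c)
  Poly-const c = c ,ₚ λ k _ → ℕ.≤-reflexive (sym (ℕ.*-identityʳ c))

  Poly-id : Poly 1 (λ k → k)
  Poly-id = 1 ,ₚ λ k _ → ℕ.≤-reflexive (sym (trans (ℕ.*-identityˡ _) (ℕ.^-identityʳ k)))

  Poly-+ : ∀ {a b f g} → Poly a f → Poly b g → Poly (a ℕ.⊔ b) (λ k → f k ℕ.+ g k)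
  Poly-+ {a} {b} p q with Poly-raise (a ℕ.⊔ b) (ℕ.m≤m⊔n a b) p | Poly-raise (a ℕ.⊔ b) (ℕ.m≤n⊔m a b) q
  ... | C ,ₚ f≤ | C′ ,ₚ g≤ = (C ℕ.+ C′) ,ₚ λ k 1≤k → ℕ.≤-trans (ℕ.+-mono-≤ (f≤ k 1≤k) (g≤ k 1≤k)) (ℕ.≤-reflexive (sym (ℕ.*-distribʳ-+ (k ℕ.^ (a ℕ.⊔ b)) C C′)))

  Poly-* : ∀ {a b f g} → Poly a f → Poly b g → Poly (a ℕ.+ b) (λ k → f k ℕ.* g k)
  Poly-* {a} {b} (C ,ₚ f≤) (C′ ,ₚ g≤) = (C ℕ.* C′) ,ₚ λ k 1≤k → ℕ.≤-trans (ℕ.*-mono-≤ (f≤ k 1≤k) (g≤ k 1≤k))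
    (ℕ.≤-reflexive (trans (eq C (k ℕ.^ a) C′ (k ℕ.^ b)) (cong (C ℕ.* C′ ℕ.*_) (sym (ℕ.^-distribˡ-+-* k a b)))))
    where
    eq : ∀ c x d y → c ℕ.* x ℕ.* (d ℕ.* y) ≡ c ℕ.* d ℕ.* (x ℕ.* y)
    eq = ℕ.solve-∀

  Poly⇒exponential : ∀ {e f} → Poly e f → ∃ λ C → ∀ k → 1 ℕ.≤ k → f k ℕ.≤ 2 ℕ.^ (C ℕ.* k)
  Poly⇒exponential {e} {f} (C ,ₚ b) = C ℕ.+ e , λ k 1≤k → ℕ.≤-trans (b k 1≤k) (ℕ.≤-trans (ℕ.*-mono-≤ (C≤ k 1≤k) (power k)) (ℕ.≤-reflexive (trans (sym (ℕ.^-distribˡ-+-* 2 (C ℕ.* k) (e ℕ.* k))) (cong (2 ℕ.^_) (sym (ℕ.*-distribʳ-+ k C e))))))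
    where
    C≤ : ∀ k → 1 ℕ.≤ k → C ℕ.≤ 2 ℕ.^ (C ℕ.* k)
    C≤ k 1≤k = ℕ.≤-trans (n≤2^n C) (ℕ.^-monoʳ-≤ 2 (ℕ.≤-trans (ℕ.≤-reflexive (sym (ℕ.*-identityʳ C))) (ℕ.*-monoʳ-≤ C 1≤k)))
    power : ∀ k → k ℕ.^ e ℕ.≤ 2 ℕ.^ (e ℕ.* k)
    power k = ℕ.≤-trans (ℕ.^-monoˡ-≤ e (n≤2^n k)) (ℕ.≤-reflexive (trans (ℕ.^-*-assoc 2 k e) (cong (2 ℕ.^_) (ℕ.*-comm k e))))

  -- Three extra halvings: two for the embedding into the grid, one for `(1 - η₀)²`.
  kk steps ℓ t M K E s : ℕ → ℕ
  kk k = k ℕ.+ 3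
  steps k = suc (kk k) ℕ.* 128
  ℓ k = Parameters.ℓ (kk k)
  t k = Parameters.t (kk k)
  M k = Parameters.M (kk k)
  K k = Parameters.K (kk k)
  E k = steps k ℕ.* 5 ℕ.+ 3
  s k = suc ((E k ℕ.+ E k) ℕ.* M k)

  dimension : ℕ → ℕ
  dimension k = steps k ℕ.* s k ℕ.+ 1

  D≡ : ∀ k Z j → Schedule.D (kk k) (steps k) Z j ≡ j ℕ.* s k ℕ.+ 1
  D≡ k Z zero = refl
  D≡ k Z (suc j) = trans (cong (s k ℕ.+_) (D≡ k Z j)) (sym (ℕ.+-assoc (s k) (j ℕ.* s k) 1))

  Poly-kk : Poly 1 kk
  Poly-kk = Poly-+ Poly-id (Poly-const 3)

  Poly-suc : ∀ {e f} → Poly e f → Poly e (λ k → suc (f k))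
  Poly-suc p = Poly-+ (Poly-const 1) p

  Poly-steps : Poly 1 steps
  Poly-steps = Poly-* (Poly-suc Poly-kk) (Poly-const 128)

  Poly-ℓ : Poly 1 ℓ
  Poly-ℓ = Poly-+ Poly-kk (Poly-const 11)

  Poly-d : Poly 2 (λ k → Parameters.d (kk k))
  Poly-d = Poly-* (Poly-suc (Poly-* (Poly-suc (Poly-+ Poly-kk (Poly-const 9))) (Poly-const 16))) Poly-kk

  Poly-t : Poly 6 t
  Poly-t = Poly-+ (Poly-const 2) (Poly-* (Poly-+ (Poly-+ Poly-d Poly-ℓ) (Poly-const 12)) (Poly-* (Poly-* (Poly-* Poly-ℓ Poly-ℓ) (Poly-const m₀)) (Poly-+ (Poly-const 3) Poly-d)))

  Poly-M : Poly 6 M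
  Poly-M = Poly-mono (λ k → ℕ.≤-reflexive (Parameters.M≡ (kk k))) (Poly-* (Poly-suc Poly-t) (Poly-const 7))

  Poly-K : Poly 6 K
  Poly-K = Poly-mono (λ k → ℕ.≤-reflexive (Parameters.K≡ (kk k))) (Poly-* (Poly-suc Poly-t) (Poly-const N₀))

  Poly-E : Poly 1 E
  Poly-E = Poly-+ (Poly-* Poly-steps (Poly-const 5)) (Poly-const 3)

  Poly-s : Poly 7 s
  Poly-s = Poly-suc (Poly-* (Poly-+ Poly-E Poly-E) Poly-M)

  Poly-dimension : Poly 8 dimension
  Poly-dimension = Poly-+ (Poly-* Poly-steps Poly-s) (Poly-const 1)

  demand : ℕ → ℕ
  demand k = dimension k ℕ.* (N₀ ℕ.* 6) ℕ.+ dimension k ℕ.* (ℓ k ℕ.* 8) ℕ.+ dimension k ℕ.* (M k ℕ.* K k ℕ.* 4) ℕ.+ N₀ ℕ.* M k ℕ.* 6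

  Poly-demand : Poly 20 demand
  Poly-demand = Poly-+ (Poly-+ (Poly-+ (Poly-* Poly-dimension (Poly-const (N₀ ℕ.* 6))) (Poly-* Poly-dimension (Poly-* Poly-ℓ (Poly-const 8)))) (Poly-* Poly-dimension (Poly-* (Poly-* Poly-M Poly-K) (Poly-const 4)))) (Poly-* (Poly-* (Poly-const N₀) Poly-M) (Poly-const 6))

  c₀ : ℕ
  c₀ = proj₁ (Poly⇒exponential Poly-demand)

  -- The polynomial demands fit below `2 ^ (c₀ * k)`; the additional `7 * k` covers
  -- `2 ^ kk k * 8 = 2 ^ (k + 6)`.
  z Z : ℕ → ℕ
  z k = (c₀ ℕ.+ 7) ℕ.* k
  Z k = 2 ℕ.^ z k

  module Bounds (k : ℕ) (1≤k : 1 ℕ.≤ k) where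

    demand≤Z : demand k ℕ.≤ Z k
    demand≤Z = ℕ.≤-trans (proj₂ (Poly⇒exponential Poly-demand) k 1≤k) (ℕ.^-monoʳ-≤ 2 (ℕ.*-monoˡ-≤ k (ℕ.m≤m+n c₀ 7)))

    private
      a b c e : ℕ
      a = dimension k ℕ.* (N₀ ℕ.* 6)
      b = dimension k ℕ.* (ℓ k ℕ.* 8)
      c = dimension k ℕ.* (M k ℕ.* K k ℕ.* 4)
      e = N₀ ℕ.* M k ℕ.* 6
      D = Schedule.D (kk k) (steps k) (Z k) (steps k)

      with-D : ∀ {x} → dimension k ℕ.* x ℕ.≤ Z k → D ℕ.* x ℕ.≤ Z k
      with-D {x} = subst (λ d → d ℕ.* x ℕ.≤ Z k) (sym (D≡ k (Z k) (steps k)))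

      abc≤ : a ℕ.+ b ℕ.+ c ℕ.≤ Z k
      abc≤ = ℕ.≤-trans (ℕ.m≤m+n (a ℕ.+ b ℕ.+ c) e) demand≤Z

      ab≤ : a ℕ.+ b ℕ.≤ Z k
      ab≤ = ℕ.≤-trans (ℕ.m≤m+n (a ℕ.+ b) c) abc≤

    h₁ : D ℕ.* (N₀ ℕ.* 6) ℕ.≤ Z k
    h₁ = with-D {N₀ ℕ.* 6} (ℕ.≤-trans (ℕ.m≤m+n a b) ab≤)

    h₂ : D ℕ.* (ℓ k ℕ.* 8) ℕ.≤ Z k
    h₂ = with-D {ℓ k ℕ.* 8} (ℕ.≤-trans (ℕ.m≤n+m b a) ab≤)

    h₃ : D ℕ.* (M k ℕ.* K k ℕ.* 4) ℕ.≤ Z k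
    h₃ = with-D {M k ℕ.* K k ℕ.* 4} (ℕ.≤-trans (ℕ.m≤n+m c (a ℕ.+ b)) abc≤)

    h₄ : N₀ ℕ.* M k ℕ.* 6 ℕ.≤ Z k
    h₄ = ℕ.≤-trans (ℕ.m≤n+m e (a ℕ.+ b ℕ.+ c)) demand≤Z

    h₅ : 2 ℕ.^ kk k ℕ.* 8 ℕ.≤ Z k
    h₅ = ℕ.≤-trans (ℕ.≤-reflexive (sym (ℕ.^-distribˡ-+-* 2 (kk k) 3))) (ℕ.^-monoʳ-≤ 2 (ℕ.≤-trans (ℕ.≤-reflexive (ℕ.+-assoc k 3 3))
      (ℕ.≤-trans (ℕ.+-monoʳ-≤ k (ℕ.*-monoʳ-≤ 6 1≤k)) (ℕ.*-monoˡ-≤ k (ℕ.m≤n+m 7 c₀)))))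

    open Schedule (kk k) (steps k) (Z k) using (L)
    open Schedule.Descent (kk k) (steps k) (Z k) h₁ h₂ h₃ h₄ h₅ using (1≤L; L≤Z^) public

    -- A base above twice the side, as the signed digits in `Proper (L + L)` require.
    Q : ℕ
    Q = L (steps k) ℕ.* 4

    Q≤ : Q ℕ.≤ 2 ℕ.^ (z k ℕ.* (steps k ℕ.* 5 ℕ.+ 2))
    Q≤ = ℕ.≤-trans (ℕ.*-mono-≤ (L≤Z^ (steps k)) 4≤Z) (ℕ.≤-reflexive (trans (exponents (Z k) (steps k ℕ.* 5)) (ℕ.^-*-assoc 2 (z k) (steps k ℕ.* 5 ℕ.+ 2))))
      where
      4≤Z : 4 ℕ.≤ Z k
      4≤Z = ℕ.≤-trans (ℕ.m≤m+n 4 4) (ℕ.≤-trans (ℕ.*-monoˡ-≤ 8 (ℕ.m^n>0 2 (kk k))) h₅)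
      exponents : ∀ x a → x ℕ.^ (a ℕ.+ 1) ℕ.* x ≡ x ℕ.^ (a ℕ.+ 2)
      exponents x a = trans (ℕ.*-comm (x ℕ.^ (a ℕ.+ 1)) x) (cong (x ℕ.^_) (sym (ℕ.+-suc a 1)))

    size-exponent : ℕ
    size-exponent = z k ℕ.* (steps k ℕ.* 5 ℕ.+ 2) ℕ.* dimension k

    Q^D≤ : Q ℕ.^ dimension k ℕ.≤ 2 ℕ.^ size-exponent
    Q^D≤ = ℕ.≤-trans (ℕ.^-monoˡ-≤ (dimension k) Q≤) (ℕ.≤-reflexive (ℕ.^-*-assoc 2 (z k ℕ.* (steps k ℕ.* 5 ℕ.+ 2)) (dimension k)))

  -- `log Z` is linear in `k`, so is the exponent of `Z` that bounds the base `Q`, and the dimension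
  -- has degree `8`.
  size-bound : Poly 10 (λ k → z k ℕ.* (steps k ℕ.* 5 ℕ.+ 2) ℕ.* dimension k)
  size-bound = Poly-* (Poly-* (Poly-* (Poly-const (c₀ ℕ.+ 7)) Poly-id) (Poly-+ (Poly-* Poly-steps (Poly-const 5)) (Poly-const 2))) Poly-dimension

-- The bound for skew-corner-free sets

module Conclusion where

  open Rationals
  open Sums
  open Boxes
  open Columns using (SkewFree)
  open NewInstance using (η₀)
  open ParameterBounds using (0<½^)
  open Schedules
  open Descents
  open Embeddings
  open Growth
  open import Defs
  open import Data.List.Relation.Unary.All as All using (All; _∷_)
  open import Data.List.Relation.Unary.AllPairs using (_∷_)
  open import Relation.Nullary.Decidable using (isYes; toWitness)
  open import Data.Product.Properties using (≡-dec)
  import Data.List.Membership.DecPropositional as DecMembership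

  open DecMembership (≡-dec ℤ._≟_ ℤ._≟_) using (_∈?_)

  In-grid : ∀ {n x} → ℤ.1ℤ ℤ.≤ x → x ℤ.≤ + n → x ∈ grid n
  In-grid (ℤ.+≤+ {n = suc x} (ℕ.s≤s _)) (ℤ.+≤+ x<n) = ∈-range⁺ (x , refl , x<n)

  grid-pairs : ∀ {n} (A : GridSet n) p → p ∈ elems A → p ∈ pairs (grid n) (grid n)
  grid-pairs {n} A (x , y) p∈ = use (All.lookup (inGrid A) p∈)
    where
    use : InGrid n (x , y) → (x , y) ∈ pairs (grid n) (grid n)
    use ((a , b) , (c , d)) = ∈-pairs (In-grid a b) (In-grid c d)

  free-member : ∀ xs → SkewCornerFree xs → SkewFree (member xs)
  free-member xs free x y y′ h h≢0 p q r = free (x , y , y′ , h , h≢0 , toWitness {a? = (x , y) ∈? xs} p , toWitness {a? = (x , y ℤ.+ h) ∈? xs} q , toWitness {a? = (x ℤ.+ h , y′) ∈? xs} r)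

  -- Adjoining a missing point would put `n² + 1` distinct points into the grid.
  full : ∀ {n} (A : GridSet n) → n ℕ.* n ℕ.≤ length (elems A) → ∀ p → p ∈ pairs (grid n) (grid n) → p ∈ elems A
  full {n} A dense p p∈ = decide (p ∈? elems A)
    where
    U = pairs (grid n) (grid n)
    size : # U ≡ ι (n ℕ.* n)
    size = trans (∑-pairs (grid n) (grid n) _) (trans (∑-const (grid n) (# (grid n))) (trans (cong₂ _*_ (#-range _ n) (#-range _ n)) (sym (ι-* n n))))
    decide : Dec (p ∈ elems A) → p ∈ elems A
    decide (yes h) = h
    decide (no h) = ⊥-elim (ℕ.<⇒≱ (ℕ.s≤s dense) (ι-cancel-≤ (≤-trans (≤-reflexive (sym (#≡length (p ∷ elems A))))
      (≤-trans (count-members U (p ∷ elems A) (All.tabulate (λ q∈ e → h (subst (_∈ elems A) (sym e) q∈)) ∷ unique A) (λ { q (here refl) → p∈ ; q (there q∈) → grid-pairs A q q∈ }))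
        (≤-trans (∑≤# U (λ q → 𝟙≤1 (isYes (q ∈? (p ∷ elems A))))) (≤-reflexive size))))))

  not-full : ∀ {n} (A : GridSet n) → 2 ℕ.≤ n → SkewCornerFree (elems A) → ¬ (n ℕ.* n ℕ.≤ length (elems A))
  not-full {n} A 2≤n free dense = free (+ 1 , + 1 , + 1 , + 1 , (λ ()) , full A dense _ (∈-pairs 1∈ 1∈) , full A dense _ (∈-pairs 1∈ 2∈) , full A dense _ (∈-pairs 2∈ 1∈))
    where
    1∈ : + 1 ∈ grid n
    1∈ = In-grid (ℤ.+≤+ (ℕ.s≤s ℕ.z≤n)) (ℤ.+≤+ (ℕ.≤-trans (ℕ.n≤1+n 1) 2≤n))
    2∈ : + 2 ∈ grid n
    2∈ = In-grid (ℤ.+≤+ (ℕ.s≤s ℕ.z≤n)) (ℤ.+≤+ 2≤n)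

  module _ {n : ℕ} (A : GridSet n) (1≤n : 1 ℕ.≤ n) (free : SkewCornerFree (elems A)) (k : ℕ) (1≤k : 1 ℕ.≤ k) (dense : n ℕ.* n ℕ.≤ 2 ℕ.^ k ℕ.* length (elems A)) where
    open Bounds k 1≤k
    private
      L₀ d : ℕ
      L₀ = Schedule.L (kk k) (steps k) (Z k) (steps k)
      d = dimension k

      gs : List ℤ
      gs = powers Q d

      1≤L₀ : 1 ℕ.≤ L₀
      1≤L₀ = 1≤L (steps k)

      L₀≤Q : L₀ ℕ.≤ Q
      L₀≤Q = ℕ.m≤m*n L₀ 4

      2L₀<Q : L₀ ℕ.+ L₀ ℕ.< Q
      2L₀<Q = ℕ.≤-trans (ℕ.≤-trans (ℕ.≤-reflexive (cong suc (trans (cong (L₀ ℕ.+_) (sym (ℕ.+-identityʳ L₀))) (ℕ.*-comm 2 L₀)))) (ℕ.+-monoˡ-≤ (L₀ ℕ.* 2) 1≤L₀)) (ℕ.≤-trans (ℕ.≤-reflexive (sym (ℕ.*-suc L₀ 2))) (ℕ.*-monoʳ-≤ L₀ (ℕ.n≤1+n 3)))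

      inside : ∀ w → w ∈ box gs ℤ.0ℤ L₀ → ∃ λ v → w ≡ + v × v ℕ.< Q ℕ.^ d
      inside w w∈ = use (∈-box⁻ {gs} w∈)
        where
        use : (∃ λ cs → Fit (In ℤ.0ℤ L₀) gs cs × w ≡ dot gs cs) → ∃ λ v → w ≡ + v × v ℕ.< Q ℕ.^ d
        use (cs , fit , refl) = powers-range d cs L₀≤Q fit

      density : ½ ^ kk k ≤ ½ * ½ * ½ ^ k * (1ℚ - η₀) * (1ℚ - η₀)
      density = ≤-trans (≤-reflexive (trans (^-+ ½ k 3) (eq₁ (½ ^ k)))) (≤-trans (*-monoʳ (<⇒≤ (0<½^ k)) (≤! {½ * ½ * ½} {½ * ½ * ((1ℚ - η₀) * (1ℚ - η₀))})) (≤-reflexive (eq (½ ^ k) (1ℚ - η₀))))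
        where
        eq₁ : ∀ x → x * (½ * (½ * (½ * 1ℚ))) ≡ ½ * ½ * ½ * x
        eq₁ = solve-∀ ℚ-ring
        eq : ∀ x q → ½ * ½ * (q * q) * x ≡ ½ * ½ * x * q * q
        eq = solve-∀ ℚ-ring

    too-large : ¬ (Q ℕ.^ d ℕ.≤ n)
    too-large Q^d≤n = exhaustion (kk k) (steps k) (Z k) refl h₁ h₂ h₃ h₄ h₅ gs (trans (length-powers Q d) (sym (D≡ k (Z k) (steps k)))) (powers-proper d 2L₀<Q)
      (½ * ½ * ½ ^ k) (0≤* (≤! {0ℚ} {½ * ½}) (<⇒≤ (0<½^ k))) density
      (Embedding.instance-exists (elems A) (unique A) n (grid-pairs A) (free-member (elems A) free) gs L₀ (Q ℕ.^ d) 1≤L₀ 1≤n Q^d≤n inside k dense)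

  -- The degree `10` is relaxed to the `12` of the statement, and the successor keeps the constant
  -- positive.
  bound-coefficient : ℕ
  bound-coefficient = suc (Poly.coefficient (Poly-raise 12 (ℕ.m≤m+n 10 2) size-bound))

  -- The exponential bound in integer form. For nonempty `A` take the least `k` with
  -- `n² ≤ 2 ^ k |A|`: then `|A| < 2 ^ (1 - k) n²`, while `k` is at least of order `log^(1/12) n`.
  -- For `k = 1` the number `n` is bounded, and the constant absorbs that case.
  skew-corner-bound : ∀ n → 2 ℕ.≤ n → (A : GridSet n) → SkewCornerFree (elems A) → ∀ k → n ℕ.* n ℕ.≤ 2 ℕ.^ k ℕ.* length (elems A) → n ℕ.≤ 2 ℕ.^ (bound-coefficient ℕ.* k ℕ.^ 12)
  -- For `k = 0` the claim would be `n ≤ 1`, so this case has to be excluded: density `1` means the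
  -- full grid, which contains a skew corner.
  skew-corner-bound n 2≤n A free zero dense = ⊥-elim (not-full A 2≤n free (ℕ.≤-trans dense (ℕ.≤-reflexive (ℕ.*-identityˡ _))))
  skew-corner-bound n 2≤n A free k@(suc _) dense = ℕ.≮⇒≥ (λ large → too-large A (ℕ.≤-trans (ℕ.n≤1+n 1) 2≤n) free k 1≤k dense
    (ℕ.≤-trans (Bounds.Q^D≤ k 1≤k) (ℕ.≤-trans (ℕ.^-monoʳ-≤ 2 exponent) (ℕ.<⇒≤ large))))
    where
    1≤k : 1 ℕ.≤ k
    1≤k = ℕ.s≤s ℕ.z≤n
    exponent : Bounds.size-exponent k 1≤k ℕ.≤ bound-coefficient ℕ.* k ℕ.^ 12
    exponent = ℕ.≤-trans (Poly.bounded (Poly-raise 12 (ℕ.m≤m+n 10 2) size-bound) k 1≤k) (ℕ.*-monoˡ-≤ (k ℕ.^ 12) (ℕ.n≤1+n (Poly.coefficient (Poly-raise 12 (ℕ.m≤m+n 10 2) size-bound))))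

open import Defs
open import Data.Nat using (ℕ; _≤_; _*_; _^_; _≥_)
open import Data.Product using (∃-syntax; _×_)
open import Data.List using (length)
open import Data.Product using (_,_)

theorem1p1 : ∃[ C ] (1 ≤ C × (∀ (n : ℕ) → n ≥ 2 → (A : GridSet n) → SkewCornerFree (elems A) → (k : ℕ) → n * n ≤ 2 ^ k * length (elems A) → n ≤ 2 ^ (C * k ^ 12)))
theorem1p1 = Conclusion.bound-coefficient , ℕ.s≤s ℕ.z≤n , Conclusion.skew-corner-bound
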